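{- Let $B_n$ be the comparability graph of $2^{[n]}$, i.e. the graph with vertex set $2^{[n]}$ in which distinct $x,y$ are adjacent iff $x\subset y$ or $y\subset x$. Let $G$ be a subgraph of $B_n$ with $V(G)=2^{[n]}$ such that $G$ has no independent set of size larger than $\binom{n}{\lfloor n/2\rfloor}$, and with the minimum number of edges among all such subgraphs. Then $|E(G)|=\left(\sqrt{\frac{\pi}{8}}+o(1)\right)2^{n}\sqrt{n}$ as $n\to\infty$.
   Context: $2^{[n]}$ denotes the family of all subsets of $[n]=\{1,\dots,n\}$. -}

module Defs where

open import Data.Bool using (Bool; true; false; if_then_else_)
open import Data.Nat as ℕ using (ℕ; zero; suc; _+_; _*_; _≤_)
open import Data.Nat.Combinatorics using (_C_)
open import Data.Integer as ℤ using (ℤ)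
open import Data.Rational as ℚ using (ℚ)
open import Data.List using (List; []; _∷_; map; _++_; length; filter; concatMap)
open import Data.Vec using (_∷_; [])
open import Data.Fin.Subset using (Subset; _⊂_)
open import Data.Product using (Σ; ∃; _×_; _,_)
open import Data.Sum using (_⊎_)
open import Relation.Binary.PropositionalEquality using (_≡_)
open import Relation.Nullary.Decidable using (does)
open import Data.Bool.Properties using (_≟_)

allSubsets : (n : ℕ) → List (Subset n)
allSubsets zero = [] ∷ []
allSubsets (suc n) = map (true ∷_) (allSubsets n) ++ map (false ∷_) (allSubsets n)

countV : ∀ {n} → (Subset n → Bool) → ℕ
countV {n} P = length (filter (λ x → P x ≟ true) (allSubsets n))

-- A spanning subgraph G of the comparability graph B_n of 2^[n]:
-- vertex set 2^[n], a symmetric edge relation, every edge joins x ⊂ y or y ⊂ x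
-- (strict inclusion, so in particular no loops).
record SpanningSubgraphBn (n : ℕ) : Set where
  field
    edge : Subset n → Subset n → Bool
    edge-sym : ∀ x y → edge x y ≡ edge y x
    edge-sub : ∀ x y → edge x y ≡ true → (x ⊂ y) ⊎ (y ⊂ x)
open SpanningSubgraphBn public

edgeCount : ∀ {n} → SpanningSubgraphBn n → ℕ
edgeCount {n} G =
  length (concatMap (λ x → filter (λ y → edge G x y ≟ true) (allSubsets n))
                    (allSubsets n)) ℕ./ 2

IsIndependent : ∀ {n} → SpanningSubgraphBn n → (Subset n → Bool) → Set
IsIndependent G I = ∀ x y → I x ≡ true → I y ≡ true → edge G x y ≡ false

Admissible : ∀ {n} → SpanningSubgraphBn n → Set
Admissible {n} G = ∀ I → IsIndependent G I → countV I ≤ n C (n ℕ./ 2)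

IsMinimalAdmissible : ∀ {n} → SpanningSubgraphBn n → Set
IsMinimalAdmissible {n} G =
  Admissible G × (∀ (H : SpanningSubgraphBn n) → Admissible H → edgeCount G ≤ edgeCount H)

-- π as a Dedekind cut, via the Leibniz partial sums
-- S m = 4 * Σ_{i=0}^{m} (-1)^i / (2i+1)   (S even ≥ π, S odd ≤ π, both → π)
leibnizTerm : ℕ → ℚ
leibnizTerm i = (ℤ.+ 4) ℚ./ suc (2 * i)

leibniz : ℕ → ℚ
leibniz zero = leibnizTerm 0
leibniz (suc m) = if isEven (suc m)
                  then leibniz m ℚ.+ leibnizTerm (suc m)
                  else leibniz m ℚ.- leibnizTerm (suc m)
  where
    isEven : ℕ → Bool
    isEven zero = true
    isEven (suc zero) = false
    isEven (suc (suc k)) = isEven k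

_<π : ℚ → Set
q <π = ∃ λ m → q ℚ.< leibniz (suc (2 * m))

π<_ : ℚ → Set
π< q = ∃ λ m → leibniz (2 * m) ℚ.< q

ℕ→ℚ : ℕ → ℚ
ℕ→ℚ k = (ℤ.+ k) ℚ./ 1

{-# OPTIONS --safe #-}
-- Lower bound: a greedy independent set (Turán) shows that an admissible graph with E edges satisfies
-- 4ⁿ ≤ α (2E + 2ⁿ), where α is the central binomial coefficient.
--
-- Upper bound: a partition of 2^[n] into α chains gives an admissible graph, the union of the cliques on the
-- chains, and it is sparse when nearly all chains have length close to the average 2ⁿ/α ~ √(πn/2).
-- Such chains are found by splitting [n] into a bounded part and the rest.  The chains of a symmetric
-- chain decomposition of the bounded part serve as columns over the levels of the rest; the levels above the middle
-- are cut into short blocks, in each of which a prescribed proportion of the columns is kept, and a chain leaving its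
-- column at the end of a block resumes later in another column.  Every step needed is a matching of the
-- sets in some levels to sets below them, which exists by Hall's theorem because the normalized matching property
-- reduces Hall's condition to an inequality between densities.  Complementation yields the lower half.
--
-- Asymptotics: expanding cos^(2m+1) turns the Wallis integral into an alternating sum of binomial coefficients,
-- which the comparison with 4 (1 - 1/3 + 1/5 - …) links to the Leibniz partial sums that define π.
module Submission where

open import Defs
open import Data.Bool using (Bool; true; false; if_then_else_; not; _∧_; _∨_)
open import Data.Nat as ℕ hiding (_≟_; _/_; _%_)
open import Data.Nat.Properties as ℕP hiding (_≟_)
open import Data.Nat.DivMod using (_/_; _%_; m≡m%n+[m/n]*n; m%n<n; m/n*n≤m; /-monoˡ-≤; m<n*o⇒m/o<n; m*n/n≡m; [m+kn]%n≡m%n; m<n⇒m%n≡m; m<n⇒m/n≡0; +-distrib-/)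
open import Data.Nat.Divisibility using (divides; m≤n⇒m!∣n!)
open import Data.Nat.Combinatorics using (_C_; nCk+nC[k+1]≡[n+1]C[k+1]; nCk≡nC[n∸k]; k>n⇒nCk≡0)
open import Data.Nat.Tactic.RingSolver using (solve-∀)
open import Data.List using (List; []; _∷_; map; _++_; length; filter; concatMap)
open import Data.Vec as V using (_∷_; [])
open import Data.Fin using (zero; suc)
open import Data.Fin.Subset using (Subset; _⊂_; _⊆_; _∈_; _∉_)
open import Data.Fin.Subset.Properties using (anySubset?)
open import Data.Product using (Σ; ∃; ∃₂; _×_; _,_; proj₁; proj₂)
open import Data.Sum using (_⊎_; inj₁; inj₂)
open import Data.Empty using (⊥; ⊥-elim)
open import Function using (_∘_; id; case_of_)
open import Relation.Binary.PropositionalEquality using (_≡_; _≢_; refl; sym; trans; cong; cong₂; subst; subst₂; module ≡-Reasoning)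
open import Relation.Nullary using (¬_; Dec; yes; no; does)
open import Relation.Nullary.Decidable using (dec-true; dec-false; _×-dec_; _⊎-dec_; ¬?; map′)
import Data.Integer as ℤ
import Data.Integer.Properties as ℤP
open import Data.Rational as ℚ using (ℚ; 0ℚ; 1ℚ) renaming (_+_ to _+ℚ_; _*_ to _*ℚ_; _-_ to _-ℚ_; -_ to ⊝_; _≤_ to _≤ℚ_; _<_ to _<ℚ_)
import Data.Rational.Properties as ℚP
open import Data.Rational.Unnormalised as ℚᵘ using (mkℚᵘ; *≡*; *≤*)
import Data.Rational.Unnormalised.Properties as ℚᵘP
import Tactic.RingSolver as RS
import Tactic.RingSolver.Core.AlmostCommutativeRing as ACR
open import Data.Nat.Coprimality using (Coprime)
open ℕP using () renaming (_≟_ to _≟ℕ_)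

-- The Turán bound is attained only by nearly equal cliques, so having few chains is not enough:
-- their lengths must concentrate. A symmetric chain decomposition already has the right number of
-- chains, but the normalized lengths tend to a Rayleigh law, and the sum of their squares is too
-- large by a factor 4/π. The cure is a numbering. In each supercolumn the cells (block, label) are
-- numbered consecutively, with block sizes nearly proportional to the level sizes, and a chain
-- always drops from number P + `Lb` to number P. So, whatever its label, a chain visits at most one
-- cell more than the quotient of the total number of cells by `Lb`. Each drop also moves to an
-- earlier supercolumn, so the scheme must stop near column 0. There `Z` plain supercolumns, in
-- which nothing jumps, receive the drops: their lower levels are larger than the upper ones, and
-- the difference is the room needed. Chains through these early columns may be long, but they are
-- rare, because the bounded part is chosen after the schedule. The order of choices is: precision
-- `e`, then `E`, `J₁`, `Z`, `Λ`, then `q`, and finally n.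

-- Indicators and finite sums

⟦_⟧ : Bool → ℕ
⟦ true ⟧ = 1
⟦ false ⟧ = 0

⟦⟧≤1 : ∀ b → ⟦ b ⟧ ≤ 1
⟦⟧≤1 true = ≤-refl
⟦⟧≤1 false = z≤n

⟦⟧-mono : ∀ {b c} → (b ≡ true → c ≡ true) → ⟦ b ⟧ ≤ ⟦ c ⟧
⟦⟧-mono {true} h = ≤-reflexive (cong ⟦_⟧ (sym (h refl)))
⟦⟧-mono {false} h = z≤n

⟦∧⟧ : ∀ b c → ⟦ b ∧ c ⟧ ≡ ⟦ b ⟧ * ⟦ c ⟧
⟦∧⟧ true c = sym (*-identityˡ ⟦ c ⟧)
⟦∧⟧ false c = refl

*⟦⟧-cong : ∀ b {m n} → (b ≡ true → m ≡ n) → m * ⟦ b ⟧ ≡ n * ⟦ b ⟧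
*⟦⟧-cong true h = cong (_* 1) (h refl)
*⟦⟧-cong false {m} {n} h = trans (*-zeroʳ m) (sym (*-zeroʳ n))

∧-elim : ∀ {b c} → b ∧ c ≡ true → b ≡ true × c ≡ true
∧-elim {true} {true} _ = refl , refl

∧-intro : ∀ {b c} → b ≡ true → c ≡ true → b ∧ c ≡ true
∧-intro refl refl = refl

does⁻ : ∀ {a} {P : Set a} (d : Dec P) → does d ≡ true → P
does⁻ (yes p) _ = p

does⁺ : ∀ {a} {P : Set a} (d : Dec P) → P → does d ≡ true
does⁺ (yes _) _ = refl
does⁺ (no ¬p) p = ⊥-elim (¬p p)

does-⇔ : ∀ {a b} {P : Set a} {Q : Set b} (d : Dec P) (e : Dec Q) → (P → Q) → (Q → P) → does d ≡ does e
does-⇔ (yes p) e f g = sym (dec-true e (f p))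
does-⇔ (no ¬p) e f g = sym (dec-false e (¬p ∘ g))

∑ : ∀ {A : Set} → List A → (A → ℕ) → ℕ
∑ [] f = 0
∑ (x ∷ xs) f = f x + ∑ xs f

module _ {A : Set} where
  ∑-mono : ∀ (xs : List A) {f g : A → ℕ} → (∀ x → f x ≤ g x) → ∑ xs f ≤ ∑ xs g
  ∑-mono [] h = z≤n
  ∑-mono (x ∷ xs) h = +-mono-≤ (h x) (∑-mono xs h)

  ∑-cong : ∀ (xs : List A) {f g : A → ℕ} → (∀ x → f x ≡ g x) → ∑ xs f ≡ ∑ xs g
  ∑-cong [] h = refl
  ∑-cong (x ∷ xs) h = cong₂ _+_ (h x) (∑-cong xs h)

  ∑-+ : ∀ (xs : List A) (f g : A → ℕ) → ∑ xs (λ x → f x + g x) ≡ ∑ xs f + ∑ xs g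
  ∑-+ [] f g = refl
  ∑-+ (x ∷ xs) f g = trans (cong (f x + g x +_) (∑-+ xs f g)) (interchange (f x) (g x) (∑ xs f) (∑ xs g))
    where
    interchange : ∀ a b c d → a + b + (c + d) ≡ a + c + (b + d)
    interchange = solve-∀

  ∑-*ˡ : ∀ (xs : List A) c (f : A → ℕ) → ∑ xs (λ x → c * f x) ≡ c * ∑ xs f
  ∑-*ˡ [] c f = sym (*-zeroʳ c)
  ∑-*ˡ (x ∷ xs) c f = trans (cong (c * f x +_) (∑-*ˡ xs c f)) (sym (*-distribˡ-+ c (f x) _))

  ∑-*ʳ : ∀ (xs : List A) c (f : A → ℕ) → ∑ xs (λ x → f x * c) ≡ ∑ xs f * c
  ∑-*ʳ xs c f = trans (∑-cong xs (λ x → *-comm (f x) c)) (trans (∑-*ˡ xs c f) (*-comm c _))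

  ∑-0 : ∀ (xs : List A) → ∑ xs (λ _ → 0) ≡ 0
  ∑-0 [] = refl
  ∑-0 (x ∷ xs) = ∑-0 xs

  ∑-const : ∀ (xs : List A) c → ∑ xs (λ _ → c) ≡ length xs * c
  ∑-const [] c = refl
  ∑-const (x ∷ xs) c = cong (c +_) (∑-const xs c)

  ∑-++ : ∀ (xs ys : List A) f → ∑ (xs ++ ys) f ≡ ∑ xs f + ∑ ys f
  ∑-++ [] ys f = refl
  ∑-++ (x ∷ xs) ys f = trans (cong (f x +_) (∑-++ xs ys f)) (sym (+-assoc (f x) _ _))

  length-filter : ∀ (P : A → Bool) xs → length (filter (λ x → P x Data.Bool.≟ true) xs) ≡ ∑ xs (⟦_⟧ ∘ P)
  length-filter P [] = refl
  length-filter P (x ∷ xs) with P x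
  ... | true = cong suc (length-filter P xs)
  ... | false = length-filter P xs

∑-map : ∀ {A B : Set} (h : A → B) (xs : List A) f → ∑ (map h xs) f ≡ ∑ xs (f ∘ h)
∑-map h [] f = refl
∑-map h (x ∷ xs) f = cong (f (h x) +_) (∑-map h xs f)

∑-swap : ∀ {A B : Set} (xs : List A) (ys : List B) (f : A → B → ℕ) →
  ∑ xs (λ x → ∑ ys (f x)) ≡ ∑ ys (λ y → ∑ xs (λ x → f x y))
∑-swap [] ys f = sym (∑-0 ys)
∑-swap (x ∷ xs) ys f = trans (cong (∑ ys (f x) +_) (∑-swap xs ys f)) (sym (∑-+ ys (f x) _))

length-concatMap : ∀ {A B : Set} (h : A → List B) (xs : List A) → length (concatMap h xs) ≡ ∑ xs (length ∘ h)
length-concatMap h [] = refl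
length-concatMap h (x ∷ xs) = trans (LP.length-++ (h x)) (cong (length (h x) +_) (length-concatMap h xs))
  where import Data.List.Properties as LP

∑S : ∀ {n} → (Subset n → ℕ) → ℕ
∑S {n} = ∑ (allSubsets n)

∑S-∷ : ∀ {n} (f : Subset (suc n) → ℕ) → ∑S f ≡ ∑S (f ∘ (true ∷_)) + ∑S (f ∘ (false ∷_))
∑S-∷ {n} f = trans (∑-++ (map (true ∷_) (allSubsets n)) _ f)
  (cong₂ _+_ (∑-map (true ∷_) (allSubsets n) f) (∑-map (false ∷_) (allSubsets n) f))

∑S-++ : ∀ q {n} (f : Subset (q + n) → ℕ) → ∑S f ≡ ∑S {q} (λ x → ∑S {n} (λ y → f (x V.++ y)))
∑S-++ zero f = sym (+-identityʳ _)
∑S-++ (suc q) {n} f = trans (∑S-∷ f) (trans (cong₂ _+_ (∑S-++ q (f ∘ (true ∷_))) (∑S-++ q (f ∘ (false ∷_))))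
  (sym (∑S-∷ {q} (λ x → ∑S {n} (λ y → f (x V.++ y))))))

∑S-1 : ∀ n → ∑S {n} (λ _ → 1) ≡ 2 ^ n
∑S-1 zero = refl
∑S-1 (suc n) = trans (∑S-∷ {n} (λ _ → 1)) (trans (cong₂ _+_ (∑S-1 n) (∑S-1 n)) (cong (2 ^ n +_) (sym (+-identityʳ _))))

infix 4 _≡S?_
_≡S?_ : ∀ {n} (x y : Subset n) → Dec (x ≡ y)
_≡S?_ = VP.≡-dec Data.Bool._≟_
  where import Data.Vec.Properties as VP

∑S-δ : ∀ {n} (z : Subset n) (f : Subset n → ℕ) → ∑S (λ x → ⟦ does (z ≡S? x) ⟧ * f x) ≡ f z
∑S-δ [] f = trans (+-identityʳ _) (*-identityˡ (f []))
∑S-δ {suc n} (b ∷ z) f = trans (∑S-∷ (λ x → ⟦ does (b ∷ z ≡S? x) ⟧ * f x)) (lem b)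
  where
  miss : ∀ (b c : Bool) → b ≢ c → ∑S (λ x → ⟦ does (b ∷ z ≡S? c ∷ x) ⟧ * f (c ∷ x)) ≡ 0
  miss b c ne = trans (∑-cong (allSubsets n) (λ x → cong (λ v → ⟦ v ⟧ * f (c ∷ x))
    (dec-false (b ∷ z ≡S? c ∷ x) λ { refl → ne refl }))) (∑-0 (allSubsets n))
  hit : ∀ b → ∑S (λ x → ⟦ does (b ∷ z ≡S? b ∷ x) ⟧ * f (b ∷ x)) ≡ f (b ∷ z)
  hit b = trans (∑-cong (allSubsets n) (λ x → cong (λ v → ⟦ v ⟧ * f (b ∷ x)) (eqb x))) (∑S-δ z (f ∘ (b ∷_)))
    where
    eqb : ∀ x → does (b ∷ z ≡S? b ∷ x) ≡ does (z ≡S? x)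
    eqb x = does-⇔ (b ∷ z ≡S? b ∷ x) (z ≡S? x) (λ { refl → refl }) (cong (b ∷_))
  lem : ∀ b → ∑S (λ x → ⟦ does (b ∷ z ≡S? true ∷ x) ⟧ * f (true ∷ x)) + ∑S (λ x → ⟦ does (b ∷ z ≡S? false ∷ x) ⟧ * f (false ∷ x)) ≡ f (b ∷ z)
  lem true = trans (cong₂ _+_ (hit true) (miss true false λ ())) (+-identityʳ _)
  lem false = cong₂ _+_ (miss false true λ ()) (hit false)

∑S-δ1 : ∀ {n} (z : Subset n) → ∑S (λ x → ⟦ does (z ≡S? x) ⟧) ≡ 1
∑S-δ1 {n} z = trans (∑-cong (allSubsets n) (λ x → sym (*-identityʳ _))) (∑S-δ z (λ _ → 1))

range : ℕ → List ℕ
range zero = []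
range (suc n) = 0 ∷ map suc (range n)

∑< : ℕ → (ℕ → ℕ) → ℕ
∑< n = ∑ (range n)

∑<-suc : ∀ n f → ∑< (suc n) f ≡ f 0 + ∑< n (f ∘ suc)
∑<-suc n f = cong (f 0 +_) (∑-map suc (range n) f)

∑<-last : ∀ n f → ∑< (suc n) f ≡ ∑< n f + f n
∑<-last zero f = +-identityʳ _
∑<-last (suc n) f = begin
  ∑< (suc (suc n)) f ≡⟨ ∑<-suc (suc n) f ⟩
  f 0 + ∑< (suc n) (f ∘ suc) ≡⟨ cong (f 0 +_) (∑<-last n (f ∘ suc)) ⟩
  f 0 + (∑< n (f ∘ suc) + f (suc n)) ≡⟨ +-assoc (f 0) _ _ ⟨
  f 0 + ∑< n (f ∘ suc) + f (suc n) ≡⟨ cong (_+ f (suc n)) (∑<-suc n f) ⟨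
  ∑< (suc n) f + f (suc n) ∎
  where open ≡-Reasoning

∑<-mono : ∀ n {f g} → (∀ i → i < n → f i ≤ g i) → ∑< n f ≤ ∑< n g
∑<-mono zero h = z≤n
∑<-mono (suc n) {f} {g} h = subst₂ _≤_ (sym (∑<-suc n f)) (sym (∑<-suc n g))
  (+-mono-≤ (h 0 z<s) (∑<-mono n (λ i i<n → h (suc i) (s<s i<n))))

∑<-cong : ∀ n {f g} → (∀ i → i < n → f i ≡ g i) → ∑< n f ≡ ∑< n g
∑<-cong n h = ≤-antisym (∑<-mono n (λ i l → ≤-reflexive (h i l))) (∑<-mono n (λ i l → ≤-reflexive (sym (h i l))))

∑<-split : ∀ m n f → ∑< (m + n) f ≡ ∑< m f + ∑< n (λ i → f (m + i))
∑<-split zero n f = refl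
∑<-split (suc m) n f = begin
  ∑< (suc (m + n)) f ≡⟨ ∑<-suc (m + n) f ⟩
  f 0 + ∑< (m + n) (f ∘ suc) ≡⟨ cong (f 0 +_) (∑<-split m n (f ∘ suc)) ⟩
  f 0 + (∑< m (f ∘ suc) + ∑< n (λ i → f (suc m + i))) ≡⟨ +-assoc (f 0) _ _ ⟨
  f 0 + ∑< m (f ∘ suc) + _ ≡⟨ cong (_+ ∑< n (λ i → f (suc m + i))) (∑<-suc m f) ⟨
  ∑< (suc m) f + ∑< n (λ i → f (suc m + i)) ∎
  where open ≡-Reasoning

∑<-const : ∀ n c → ∑< n (λ _ → c) ≡ n * c
∑<-const n c = trans (∑-const (range n) c) (cong (_* c) (lr n))
  where
  lr : ∀ n → length (range n) ≡ n
  lr zero = refl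
  lr (suc n) = cong suc (trans (LP.length-map suc (range n)) (lr n))
    where import Data.List.Properties as LP

∑<-blocks : ∀ m k f → ∑< (m * k) f ≡ ∑< m (λ i → ∑< k (λ u → f (i * k + u)))
∑<-blocks zero k f = refl
∑<-blocks (suc m) k f = begin
  ∑< (k + m * k) f ≡⟨ ∑<-split k (m * k) f ⟩
  ∑< k f + ∑< (m * k) (λ i → f (k + i)) ≡⟨ cong (∑< k f +_) (∑<-blocks m k (λ i → f (k + i))) ⟩
  ∑< k f + ∑< m (λ i → ∑< k (λ u → f (k + (i * k + u)))) ≡⟨ cong (∑< k f +_) (∑-cong (range m) λ i → ∑-cong (range k) λ u → cong f (sym (+-assoc k (i * k) u))) ⟩
  ∑< k f + ∑< m (λ i → ∑< k (λ u → f (suc i * k + u))) ≡⟨ ∑<-suc m (λ i → ∑< k (λ u → f (i * k + u))) ⟨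
  ∑< (suc m) (λ i → ∑< k (λ u → f (i * k + u))) ∎
  where open ≡-Reasoning

∑<-δ : ∀ n z (f : ℕ → ℕ) → z < n → ∑< n (λ i → ⟦ does (z ≟ℕ i) ⟧ * f i) ≡ f z
∑<-δ (suc n) zero f _ = trans (∑<-suc n (λ i → ⟦ does (0 ≟ℕ i) ⟧ * f i)) (trans (cong₂ _+_ (*-identityˡ (f 0)) (∑-0 (range n))) (+-identityʳ _))
∑<-δ (suc n) (suc z) f (s≤s z<n) = trans (∑<-suc n (λ i → ⟦ does (suc z ≟ℕ i) ⟧ * f i)) (∑<-δ n z (f ∘ suc) z<n)

∑<-δ≤1 : ∀ n z → ∑< n (λ i → ⟦ does (z ≟ℕ i) ⟧) ≤ 1
∑<-δ≤1 zero z = z≤n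
∑<-δ≤1 (suc n) zero = ≤-reflexive (trans (∑<-suc n (λ i → ⟦ does (0 ≟ℕ i) ⟧)) (cong suc (∑-0 (range n))))
∑<-δ≤1 (suc n) (suc z) = ≤-trans (≤-reflexive (∑<-suc n (λ i → ⟦ does (suc z ≟ℕ i) ⟧))) (∑<-δ≤1 n z)

-- Hall's theorem

-- The strict gain at `z` is stored as an indicator of total mass one, which leaves a weak pointwise
-- inequality to check.
∑S-strict : ∀ {n} {f g : Subset n → ℕ} (z : Subset n) → (∀ x → f x ≤ g x) → f z < g z → ∑S f < ∑S g
∑S-strict {n} {f} {g} z f≤g fz<gz = begin
  suc (∑S f) ≡⟨ +-comm 1 _ ⟩
  ∑S f + 1 ≡⟨ cong (∑S f +_) (∑S-δ1 z) ⟨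
  ∑S f + ∑S (λ x → ⟦ does (z ≡S? x) ⟧) ≡⟨ ∑-+ (allSubsets n) f _ ⟨
  ∑S (λ x → f x + ⟦ does (z ≡S? x) ⟧) ≤⟨ ∑-mono (allSubsets n) step ⟩
  ∑S g ∎
  where
  open ≤-Reasoning
  step : ∀ x → f x + ⟦ does (z ≡S? x) ⟧ ≤ g x
  step x with z ≡S? x
  ... | yes refl = subst (_≤ g z) (+-comm 1 (f z)) fz<gz
  ... | no _ = subst (_≤ g x) (sym (+-identityʳ (f x))) (f≤g x)

true≢false : ∀ {b} → b ≡ true → b ≡ false → ⊥
true≢false refl ()

¬true⇒false : ∀ {b} → ¬ (b ≡ true) → b ≡ false
¬true⇒false {true} h = ⊥-elim (h refl)
¬true⇒false {false} h = refl

∨-elim : ∀ {b c} → b ∨ c ≡ true → b ≡ true ⊎ c ≡ true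
∨-elim {true} _ = inj₁ refl
∨-elim {false} h = inj₂ h

∨-introˡ : ∀ {b c} → b ≡ true → b ∨ c ≡ true
∨-introˡ refl = refl

∨-introʳ : ∀ {b c} → c ≡ true → b ∨ c ≡ true
∨-introʳ {true} _ = refl
∨-introʳ {false} h = h

_[_≔_] : ∀ {n} {A : Set} → (Subset n → A) → Subset n → A → Subset n → A
(f [ y ≔ a ]) z = if does (z ≡S? y) then a else f z

≔-hit : ∀ {n} {A : Set} (f : Subset n → A) y {a} → (f [ y ≔ a ]) y ≡ a
≔-hit f y rewrite dec-true (y ≡S? y) refl = refl

≔-miss : ∀ {n} {A : Set} (f : Subset n → A) y {a z} → z ≢ y → (f [ y ≔ a ]) z ≡ f z
≔-miss f y {z = z} ne rewrite dec-false (z ≡S? y) ne = refl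

module Hall {n : ℕ} (E : Subset n → Subset n → Bool) where

  N : (Subset n → Bool) → Subset n → Bool
  N S x = does (anySubset? (λ y → S y ∧ E y x Data.Bool.≟ true))

  N⁻ : ∀ S x → N S x ≡ true → ∃ λ y → S y ≡ true × E y x ≡ true
  N⁻ S x h with does⁻ (anySubset? (λ y → S y ∧ E y x Data.Bool.≟ true)) h
  ... | y , e = y , ∧-elim e

  N⁺ : ∀ S x y → S y ≡ true → E y x ≡ true → N S x ≡ true
  N⁺ S x y s e = does⁺ (anySubset? (λ y → S y ∧ E y x Data.Bool.≟ true)) (y , ∧-intro s e)

  record Matching (P : Subset n → Bool) : Set where
    field
      partner : Subset n → Subset n
      compatible : ∀ y → P y ≡ true → E y (partner y) ≡ true
      injective : ∀ y z → P y ≡ true → P z ≡ true → partner y ≡ partner z → y ≡ z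
  open Matching

  module Augment (D P : Subset n → Bool) (P⊆D : ∀ y → P y ≡ true → D y ≡ true)
    (hall : ∀ S → (∀ y → S y ≡ true → D y ≡ true) → ∑S (⟦_⟧ ∘ S) ≤ ∑S (⟦_⟧ ∘ N S))
    (m : Matching P) (y₀ : Subset n) (Dy₀ : D y₀ ≡ true) (¬Py₀ : P y₀ ≡ false) where

    μ = partner m

    P⁺ : Subset n → Bool
    P⁺ = P [ y₀ ≔ true ]

    P⇒P⁺ : ∀ {y} → P y ≡ true → P⁺ y ≡ true
    P⇒P⁺ {y} p = trans (≔-miss P y₀ λ { refl → true≢false p ¬Py₀ }) p

    P⁺⇒P : ∀ {y} → P⁺ y ≡ true → y ≢ y₀ → P y ≡ true
    P⁺⇒P p ne = trans (sym (≔-miss P y₀ ne)) p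

    -- `ν` is the matching shifted along an alternating path from `y₀` to `y`: it serves `y₀` and
    -- all matched vertices except `y`, using only partners already in use. Storing the shifted
    -- matching instead of the path makes augmentation a single update.
    record Freeing (R : Subset n → Bool) (y : Subset n) : Set where
      field
        ν : Subset n → Subset n
        comp : ∀ z → P⁺ z ≡ true → z ≢ y → E z (ν z) ≡ true
        inj : ∀ z w → P⁺ z ≡ true → P⁺ w ≡ true → z ≢ y → w ≢ y → ν z ≡ ν w → z ≡ w
        image : ∀ z → P⁺ z ≡ true → z ≢ y → ∃ λ w → P w ≡ true × ν z ≡ μ w
        -- A vertex not yet reached still holds its own partner, which can therefore be taken from
        -- it when it is reached.
        outside-fixed : ∀ z → R z ≡ false → ν z ≡ μ z
    open Freeing

    record Reach (R : Subset n → Bool) : Set where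
      field
        start : R y₀ ≡ true
        inside-P⁺ : ∀ y → R y ≡ true → P⁺ y ≡ true
        free : ∀ y → R y ≡ true → Freeing R y
    open Reach

    Free : Subset n → Subset n → Set
    Free y x = E y x ≡ true × ¬ (∃ λ z → P z ∧ does (μ z ≡S? x) ≡ true)

    augmented : ∀ {R y x} → Freeing R y → Free y x → Matching P⁺
    augmented {R} {y} {x} F (e , ¬im) = record { partner = μ' ; compatible = c ; injective = i }
      where
      μ' = ν F [ y ≔ x ]
      c : ∀ z → P⁺ z ≡ true → E z (μ' z) ≡ true
      c z p with z ≡S? y
      ... | yes refl = e
      ... | no ne = comp F z p ne
      notx : ∀ z → P⁺ z ≡ true → z ≢ y → ν F z ≢ x
      notx z p ne eq with image F z p ne
      ... | w , pw , eq' = ¬im (w , ∧-intro pw (does⁺ (μ w ≡S? x) (trans (sym eq') eq)))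
      i : ∀ z w → P⁺ z ≡ true → P⁺ w ≡ true → μ' z ≡ μ' w → z ≡ w
      i z w pz pw eq with z ≡S? y | w ≡S? y
      ... | yes refl | yes refl = refl
      ... | yes refl | no ne = ⊥-elim (notx w pw ne (sym eq))
      ... | no ne | yes refl = ⊥-elim (notx z pz ne eq)
      ... | no ne | no ne' = inj F z w pz pw ne ne' eq

    -- The path to `y` is prolonged: `y` takes over `μ y'`, and `y'` becomes the unserved vertex.
    -- Earlier freeings survive, since being fixed outside a larger set is a weaker demand.
    grown : ∀ {R} → Reach R → ∀ y y' → R y ≡ true → P y' ≡ true → R y' ≡ false → E y (μ y') ≡ true →
      Reach (R [ y' ≔ true ])
    grown {R} r y y' Ry Py' ¬Ry' e = record { start = up _ (start r) ; inside-P⁺ = ins ; free = fr }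
      where
      R' = R [ y' ≔ true ]
      up : ∀ z → R z ≡ true → R' z ≡ true
      up z h = trans (≔-miss R y' λ { refl → true≢false h ¬Ry' }) h
      ins : ∀ z → R' z ≡ true → P⁺ z ≡ true
      ins z h with z ≡S? y'
      ... | yes refl = P⇒P⁺ Py'
      ... | no _ = inside-P⁺ r z h
      down : ∀ z → R' z ≡ false → R z ≡ false
      down z h = ¬true⇒false (λ t → true≢false (up z t) h)
      F = free r y Ry
      y'≢y : y' ≢ y
      y'≢y refl = true≢false Ry ¬Ry'
      νy' : ν F y' ≡ μ y'
      νy' = outside-fixed F y' ¬Ry'
      ν' = ν F [ y ≔ μ y' ]
      c : ∀ z → P⁺ z ≡ true → z ≢ y' → E z (ν' z) ≡ true
      c z p ne with z ≡S? y
      ... | yes refl = e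
      ... | no ne' = comp F z p ne'
      i : ∀ z w → P⁺ z ≡ true → P⁺ w ≡ true → z ≢ y' → w ≢ y' → ν' z ≡ ν' w → z ≡ w
      i z w pz pw nz nw eq with z ≡S? y | w ≡S? y
      ... | yes refl | yes refl = refl
      ... | yes refl | no ne = ⊥-elim (nw (sym (inj F y' w (P⇒P⁺ Py') pw y'≢y ne (trans νy' eq))))
      ... | no ne | yes refl = ⊥-elim (nz (inj F z y' pz (P⇒P⁺ Py') ne y'≢y (trans eq (sym νy'))))
      ... | no ne | no ne' = inj F z w pz pw ne ne' eq
      im : ∀ z → P⁺ z ≡ true → z ≢ y' → ∃ λ w → P w ≡ true × ν' z ≡ μ w
      im z p ne with z ≡S? y
      ... | yes refl = y' , Py' , refl
      ... | no ne' = image F z p ne'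
      of : ∀ z → R' z ≡ false → ν' z ≡ μ z
      of z h = trans (≔-miss (ν F) y λ { refl → true≢false Ry (down z h) }) (outside-fixed F z (down z h))
      fr : ∀ z → R' z ≡ true → Freeing R' z
      fr z h with z ≡S? y'
      ... | yes refl = record { ν = ν' ; comp = c ; inj = i ; image = im ; outside-fixed = of }
      ... | no _ = record { ν = ν G ; comp = comp G ; inj = inj G ; image = image G
                          ; outside-fixed = λ w hw → outside-fixed G w (down w hw) }
        where G = free r z h

    Growable : (Subset n → Bool) → Subset n → Subset n → Set
    Growable R y y' = (P y' ∧ not (R y')) ∧ E y (μ y') ≡ true

    -- When no step is possible, every neighbour of `R` is the partner of a matched vertex of `R`.
    -- Since `y₀` is reached but unmatched, `R` has fewer neighbours than elements, against Hall's
    -- condition.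
    stuck : ∀ {R} → Reach R → (∀ y x → R y ≡ true → ¬ Free y x) → (∀ y y' → R y ≡ true → ¬ Growable R y y') → ⊥
    stuck {R} r ¬free ¬grow = <⇒≱ lt (≤-trans (hall R R⊆D) ub)
      where
      R⊆D : ∀ y → R y ≡ true → D y ≡ true
      R⊆D y h with y ≡S? y₀
      ... | yes refl = Dy₀
      ... | no ne = P⊆D y (P⁺⇒P (inside-P⁺ r y h) ne)
      Q : Subset n → Bool
      Q z = R z ∧ P z
      covered : ∀ x → N R x ≡ true → ∃ λ z → Q z ∧ does (μ z ≡S? x) ≡ true
      covered x h with N⁻ R x h
      ... | y , Ry , e with anySubset? (λ z → P z ∧ does (μ z ≡S? x) Data.Bool.≟ true)
      ...   | no ¬im = ⊥-elim (¬free y x Ry (e , ¬im))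
      ...   | yes (z , w) with ∧-elim {P z} w
      ...     | pz , μz≡x with R z in Rz
      ...       | true = z , ∧-intro (∧-intro Rz pz) μz≡x
      ...       | false = ⊥-elim (¬grow y z Ry (∧-intro (∧-intro pz (cong not Rz))
                    (subst (λ v → E y v ≡ true) (sym (does⁻ (μ z ≡S? x) μz≡x)) e)))
      pointwise : ∀ x → ⟦ N R x ⟧ ≤ ∑S (λ z → ⟦ Q z ⟧ * ⟦ does (μ z ≡S? x) ⟧)
      pointwise x with N R x in eq
      ... | false = z≤n
      ... | true with covered x eq
      ...   | z , h = ≤-trans (s≤s (z≤n {∑S {n} (λ _ → 0)})) (∑S-strict z (λ _ → z≤n)
                (≤-reflexive (trans (cong ⟦_⟧ (sym h)) (⟦∧⟧ (Q z) _))))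
      ub : ∑S (⟦_⟧ ∘ N R) ≤ ∑S (⟦_⟧ ∘ Q)
      ub = begin
        ∑S (⟦_⟧ ∘ N R) ≤⟨ ∑-mono (allSubsets n) pointwise ⟩
        ∑S (λ x → ∑S (λ z → ⟦ Q z ⟧ * ⟦ does (μ z ≡S? x) ⟧)) ≡⟨ ∑-swap (allSubsets n) (allSubsets n) _ ⟩
        ∑S (λ z → ∑S (λ x → ⟦ Q z ⟧ * ⟦ does (μ z ≡S? x) ⟧)) ≡⟨ ∑-cong (allSubsets n) (λ z →
           trans (∑-*ˡ (allSubsets n) ⟦ Q z ⟧ _) (trans (cong (⟦ Q z ⟧ *_) (∑S-δ1 (μ z))) (*-identityʳ _))) ⟩
        ∑S (⟦_⟧ ∘ Q) ∎
        where open ≤-Reasoning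
      lt : ∑S (⟦_⟧ ∘ Q) < ∑S (⟦_⟧ ∘ R)
      lt = ∑S-strict y₀ (λ x → ⟦⟧-mono (λ h → proj₁ (∧-elim h)))
        (subst₂ (λ u v → ⟦ u ∧ v ⟧ < ⟦ u ⟧) (sym (start r)) (sym ¬Py₀) ≤-refl)

    -- Every round without augmentation enlarges `R`, which has at most 2^n elements; the fuel
    -- counts what is left.
    search : ∀ fuel R → Reach R → 2 ^ n < ∑S (⟦_⟧ ∘ R) + fuel → Matching P⁺
    search zero R r lt = ⊥-elim (<⇒≱ (subst (2 ^ n <_) (+-identityʳ _) lt)
      (≤-trans (∑-mono (allSubsets n) (λ x → ⟦⟧≤1 (R x))) (≤-reflexive (∑S-1 n))))
    search (suc fuel) R r lt
      with anySubset? (λ y → anySubset? (λ x → (R y Data.Bool.≟ true) ×-dec ((E y x Data.Bool.≟ true) ×-dec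
             ¬? (anySubset? (λ z → P z ∧ does (μ z ≡S? x) Data.Bool.≟ true)))))
    ... | yes (y , x , Ry , fr) = augmented (free r y Ry) fr
    ... | no ¬fr
      with anySubset? (λ y → anySubset? (λ y' → (R y Data.Bool.≟ true) ×-dec ((P y' ∧ not (R y')) ∧ E y (μ y') Data.Bool.≟ true)))
    ...   | no ¬gr = ⊥-elim (stuck r (λ y x Ry f → ¬fr (y , x , Ry , f)) (λ y y' Ry g → ¬gr (y , y' , Ry , g)))
    ...   | yes (y , y' , Ry , g) = search fuel (R [ y' ≔ true ])
            (grown r y y' Ry (proj₁ (∧-elim (proj₁ (∧-elim g)))) ¬Ry' (proj₂ (∧-elim {P y' ∧ not (R y')} g)))
            (≤-trans lt (≤-trans (≤-reflexive (+-suc _ fuel)) (+-monoˡ-≤ fuel bigger)))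
      where
      not-elim : ∀ {b} → not b ≡ true → b ≡ false
      not-elim {false} _ = refl
      ¬Ry' : R y' ≡ false
      ¬Ry' = not-elim (proj₂ (∧-elim {P y'} (proj₁ (∧-elim g))))
      bigger : ∑S (⟦_⟧ ∘ R) < ∑S (⟦_⟧ ∘ (R [ y' ≔ true ]))
      bigger = ∑S-strict y' le (subst₂ (λ u v → ⟦ u ⟧ < ⟦ v ⟧) (sym ¬Ry') (sym (≔-hit R y')) ≤-refl)
        where
        le : ∀ x → ⟦ R x ⟧ ≤ ⟦ (R [ y' ≔ true ]) x ⟧
        le x with x ≡S? y'
        ... | yes refl = ⟦⟧≤1 (R x)
        ... | no _ = ≤-refl

    extended : Matching P⁺
    extended = search (suc (2 ^ n)) R₀ reach₀ (m≤n+m (suc (2 ^ n)) _)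
      where
      R₀ : Subset n → Bool
      R₀ = (λ _ → false) [ y₀ ≔ true ]
      only : ∀ y → R₀ y ≡ true → y ≡ y₀
      only y h with y ≡S? y₀
      ... | yes eq = eq
      reach₀ : Reach R₀
      reach₀ = record
        { start = ≔-hit (λ _ → false) y₀
        ; inside-P⁺ = λ y h → subst (λ v → P⁺ v ≡ true) (sym (only y h)) (≔-hit P y₀)
        ; free = λ y h → record
          { ν = μ
          ; comp = λ z p ne → compatible m z (P⁺⇒P p λ eq → ne (trans eq (sym (only y h))))
          ; inj = λ z w p p' ne ne' → injective m z w (P⁺⇒P p λ eq → ne (trans eq (sym (only y h)))) (P⁺⇒P p' λ eq → ne' (trans eq (sym (only y h))))
          ; image = λ z p ne → z , P⁺⇒P p (λ eq → ne (trans eq (sym (only y h)))) , refl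
          ; outside-fixed = λ _ _ → refl } }

  hall-matching : ∀ (D : Subset n → Bool) →
    (∀ S → (∀ y → S y ≡ true → D y ≡ true) → ∑S (⟦_⟧ ∘ S) ≤ ∑S (⟦_⟧ ∘ N S)) → Matching D
  hall-matching D hall = finish (build (allSubsets n))
    where
    open import Data.List.Membership.Propositional using () renaming (_∈_ to _∈L_)
    open import Data.List.Membership.Propositional.Properties using (∈-++⁺ˡ; ∈-++⁺ʳ; ∈-map⁺)
    open import Data.List.Relation.Unary.Any using (here; there)
    every : ∀ {n} (x : Subset n) → x ∈L allSubsets n
    every [] = here refl
    every (true ∷ x) = ∈-++⁺ˡ (∈-map⁺ (true ∷_) (every x))
    every {suc n} (false ∷ x) = ∈-++⁺ʳ (map (true ∷_) (allSubsets n)) (∈-map⁺ (false ∷_) (every x))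
    Partial : List (Subset n) → Set
    Partial xs = Σ (Subset n → Bool) λ P → Matching P × (∀ y → P y ≡ true → D y ≡ true) × (∀ y → y ∈L xs → D y ≡ true → P y ≡ true)
    build : ∀ xs → Partial xs
    build [] = (λ _ → false) , record { partner = id ; compatible = λ _ () ; injective = λ _ _ () } , (λ _ ()) , (λ _ ())
    build (x ∷ xs) with build xs
    ... | P , m , P⊆D , cov with D x in Dx | P x in Px
    ...   | false | _ = P , m , P⊆D , λ { y (here refl) d → ⊥-elim (true≢false d Dx) ; y (there i) d → cov y i d }
    ...   | true | true = P , m , P⊆D , λ { y (here refl) d → Px ; y (there i) d → cov y i d }
    ...   | true | false = P⁺ , extended , sub , λ { y (here refl) d → ≔-hit P x ; y (there i) d → P⇒P⁺ (cov y i d) }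
      where
      open Augment D P P⊆D hall m x Dx Px
      sub : ∀ y → P⁺ y ≡ true → D y ≡ true
      sub y h with y ≡S? x
      ... | yes refl = Dx
      ... | no _ = P⊆D y h
    finish : Partial (allSubsets n) → Matching D
    finish (P , m , _ , cov) = record
      { partner = partner m
      ; compatible = λ y d → compatible m y (cov y (every y) d)
      ; injective = λ y z d d' → injective m y z (cov y (every y) d) (cov z (every z) d') }

-- Levels, shadows and densities

-- Inclusion as an inductive relation, so that proofs recurse on coordinates; it is converted to `⊂`
-- only for the edges of the final graph.
data _≼_ : ∀ {n} → Subset n → Subset n → Set where
  [] : [] ≼ []
  keep : ∀ {n b} {x y : Subset n} → x ≼ y → (b ∷ x) ≼ (b ∷ y)
  add : ∀ {n} {x y : Subset n} → x ≼ y → (false ∷ x) ≼ (true ∷ y)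

size : ∀ {n} → Subset n → ℕ
size [] = 0
size (true ∷ x) = suc (size x)
size (false ∷ x) = size x

≼-refl : ∀ {n} {x : Subset n} → x ≼ x
≼-refl {x = []} = []
≼-refl {x = b ∷ x} = keep ≼-refl

≼-trans : ∀ {n} {x y z : Subset n} → x ≼ y → y ≼ z → x ≼ z
≼-trans [] [] = []
≼-trans (keep p) (keep q) = keep (≼-trans p q)
≼-trans (keep p) (add q) = add (≼-trans p q)
≼-trans (add p) (keep q) = add (≼-trans p q)

infix 4 _≼?_
_≼?_ : ∀ {n} (x y : Subset n) → Dec (x ≼ y)
[] ≼? [] = yes []
(true ∷ x) ≼? (true ∷ y) = map′ keep (λ { (keep p) → p }) (x ≼? y)
(true ∷ x) ≼? (false ∷ y) = no λ ()
(false ∷ x) ≼? (true ∷ y) = map′ add (λ { (add p) → p }) (x ≼? y)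
(false ∷ x) ≼? (false ∷ y) = map′ keep (λ { (keep p) → p }) (x ≼? y)

size≤n : ∀ {n} (x : Subset n) → size x ≤ n
size≤n [] = z≤n
size≤n (true ∷ x) = s≤s (size≤n x)
size≤n (false ∷ x) = m≤n⇒m≤1+n (size≤n x)

size-mono : ∀ {n} {x y : Subset n} → x ≼ y → size x ≤ size y
size-mono [] = z≤n
size-mono (keep {b = true} p) = s≤s (size-mono p)
size-mono (keep {b = false} p) = size-mono p
size-mono (add p) = m≤n⇒m≤1+n (size-mono p)

≼-size-≡ : ∀ {n} {x y : Subset n} → x ≼ y → size x ≡ size y → x ≡ y
≼-size-≡ [] _ = refl
≼-size-≡ (keep {b = true} p) e = cong (true ∷_) (≼-size-≡ p (suc-injective e))
≼-size-≡ (keep {b = false} p) e = cong (false ∷_) (≼-size-≡ p e)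
≼-size-≡ (add p) e = ⊥-elim (<-irrefl e (s≤s (size-mono p)))

≼-++ : ∀ {q n} {x₁ y₁ : Subset q} {x₂ y₂ : Subset n} → x₁ ≼ y₁ → x₂ ≼ y₂ → (x₁ V.++ x₂) ≼ (y₁ V.++ y₂)
≼-++ [] r = r
≼-++ (keep p) r = keep (≼-++ p r)
≼-++ (add p) r = add (≼-++ p r)

size-++ : ∀ {q n} (x₁ : Subset q) (x₂ : Subset n) → size (x₁ V.++ x₂) ≡ size x₁ + size x₂
size-++ [] x₂ = refl
size-++ (true ∷ x₁) x₂ = cong suc (size-++ x₁ x₂)
size-++ (false ∷ x₁) x₂ = size-++ x₁ x₂

-- Double counting of covering pairs: y has |y| lower covers and x has n - |x| upper covers. The
-- induction separates the pairs in which the added element is the head coordinate.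
shadow : ∀ n (f g : Subset n → ℕ) → (∀ x y → x ≼ y → size y ≡ suc (size x) → f y ≤ g x) →
  ∑S (λ y → size y * f y) ≤ ∑S (λ x → (n ∸ size x) * g x)
shadow zero f g h = z≤n
shadow (suc n) f g h = begin
  ∑S (λ y → size y * f y) ≡⟨ ∑S-∷ (λ y → size y * f y) ⟩
  ∑S (λ y → f (true ∷ y) + size y * f (true ∷ y)) + ∑S (λ y → size y * f (false ∷ y))
    ≡⟨ cong (_+ ∑S (λ y → size y * f (false ∷ y))) (∑-+ (allSubsets n) (λ y → f (true ∷ y)) _) ⟩
  ∑S (λ y → f (true ∷ y)) + ∑S (λ y → size y * f (true ∷ y)) + ∑S (λ y → size y * f (false ∷ y))
    ≤⟨ +-mono-≤ (+-mono-≤ (∑-mono (allSubsets n) (λ y → h (false ∷ y) (true ∷ y) (add ≼-refl) refl))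
         (shadow n (f ∘ (true ∷_)) (g ∘ (true ∷_)) (λ x y p e → h (true ∷ x) (true ∷ y) (keep p) (cong suc e))))
         (shadow n (f ∘ (false ∷_)) (g ∘ (false ∷_)) (λ x y p e → h (false ∷ x) (false ∷ y) (keep p) e)) ⟩
  A + B + C ≡⟨ rearrange A B C ⟩
  B + (A + C) ≡⟨ cong (B +_) (trans (sym (∑-+ (allSubsets n) _ _)) (∑-cong (allSubsets n) λ x →
      cong (_* g (false ∷ x)) (sym (+-∸-assoc 1 (size≤n x))))) ⟩
  B + ∑S (λ x → (suc n ∸ size x) * g (false ∷ x)) ≡⟨ ∑S-∷ (λ x → (suc n ∸ size x) * g x) ⟨
  ∑S (λ x → (suc n ∸ size x) * g x) ∎
  where
  open ≤-Reasoning
  A = ∑S (λ x → g (false ∷ x))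
  B = ∑S (λ x → (n ∸ size x) * g (true ∷ x))
  C = ∑S (λ x → (n ∸ size x) * g (false ∷ x))
  rearrange : ∀ a b c → a + b + c ≡ b + (a + c)
  rearrange = solve-∀

cnt : ∀ {n} → (Subset n → Bool) → ℕ → ℕ
cnt S k = ∑S λ x → ⟦ S x ∧ does (size x ≟ℕ k) ⟧

∑-cnt : ∀ {n} (S : Subset n → Bool) → ∑S (⟦_⟧ ∘ S) ≡ ∑< (suc n) (cnt S)
∑-cnt {n} S = begin
  ∑S (⟦_⟧ ∘ S) ≡⟨ ∑-cong (allSubsets n) (λ x → ∑<-δ (suc n) (size x) (λ _ → ⟦ S x ⟧) (s≤s (size≤n x))) ⟨
  ∑S (λ x → ∑< (suc n) (λ k → ⟦ does (size x ≟ℕ k) ⟧ * ⟦ S x ⟧)) ≡⟨ ∑-cong (allSubsets n) (λ x → ∑-cong (range (suc n)) (λ k →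
      trans (*-comm ⟦ does (size x ≟ℕ k) ⟧ _) (sym (⟦∧⟧ (S x) _)))) ⟩
  ∑S (λ x → ∑< (suc n) (λ k → ⟦ S x ∧ does (size x ≟ℕ k) ⟧)) ≡⟨ ∑-swap (allSubsets n) (range (suc n)) _ ⟩
  ∑< (suc n) (cnt S) ∎
  where open ≡-Reasoning

cnt≡0 : ∀ {n} (S : Subset n → Bool) k → (∀ x → S x ≡ true → size x ≢ k) → cnt S k ≡ 0
cnt≡0 {n} S k h = trans (∑-cong (allSubsets n) λ x → cong ⟦_⟧ (¬true⇒false λ e →
  h x (proj₁ (∧-elim e)) (does⁻ (size x ≟ℕ k) (proj₂ (∧-elim {S x} e))))) (∑-0 (allSubsets n))

cnt-mono : ∀ {n} (S T : Subset n → Bool) k → (∀ x → size x ≡ k → S x ≡ true → T x ≡ true) → cnt S k ≤ cnt T k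
cnt-mono {n} S T k h = ∑-mono (allSubsets n) λ x → ⟦⟧-mono λ e →
  let e₁ , e₂ = ∧-elim {S x} e in ∧-intro (h x (does⁻ (size x ≟ℕ k) e₂) e₁) e₂

shadow-cnt : ∀ {n} (S T : Subset n → Bool) k →
  (∀ x y → x ≼ y → size y ≡ suc k → size x ≡ k → S y ≡ true → T x ≡ true) →
  suc k * cnt S (suc k) ≤ (n ∸ k) * cnt T k
shadow-cnt {n} S T k h = begin
  suc k * cnt S (suc k) ≡⟨ ∑-*ˡ (allSubsets n) (suc k) _ ⟨
  ∑S (λ y → suc k * ⟦ S y ∧ does (size y ≟ℕ suc k) ⟧) ≡⟨ ∑-cong (allSubsets n) (λ y → onlevel S (suc k) y (λ j → j)) ⟩
  ∑S (λ y → size y * ⟦ S y ∧ does (size y ≟ℕ suc k) ⟧) ≤⟨ shadow n _ _ (λ x y p e → ⟦⟧-mono (λ s →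
     let s₁ , s₂ = ∧-elim {S y} s ; sy = does⁻ (size y ≟ℕ suc k) s₂ ; sx = suc-injective (trans (sym e) sy) in
     ∧-intro (h x y p sy sx s₁) (does⁺ (size x ≟ℕ k) sx))) ⟩
  ∑S (λ x → (n ∸ size x) * ⟦ T x ∧ does (size x ≟ℕ k) ⟧) ≡⟨ ∑-cong (allSubsets n) (λ x → onlevel T k x (n ∸_)) ⟨
  ∑S (λ x → (n ∸ k) * ⟦ T x ∧ does (size x ≟ℕ k) ⟧) ≡⟨ ∑-*ˡ (allSubsets n) (n ∸ k) _ ⟩
  (n ∸ k) * cnt T k ∎
  where
  open ≤-Reasoning
  onlevel : ∀ (S : Subset n → Bool) k y (w : ℕ → ℕ) →
    w k * ⟦ S y ∧ does (size y ≟ℕ k) ⟧ ≡ w (size y) * ⟦ S y ∧ does (size y ≟ℕ k) ⟧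
  onlevel S k y w = *⟦⟧-cong (S y ∧ does (size y ≟ℕ k)) λ e →
    cong w (sym (does⁻ (size y ≟ℕ k) (proj₂ (∧-elim {S y} e))))

∸-! : ∀ {n k} → k < n → (n ∸ k) * (n ∸ suc k) ! ≡ (n ∸ k) !
∸-! {n} {k} k<n = subst (λ v → v * (n ∸ suc k) ! ≡ v !) (sym (+-∸-assoc 1 k<n)) refl

-- The weight k!(n-k)! counts the maximal chains of 2^[n] through a given k-set, so that
-- `chains S k` compares densities of different levels without division.
chains : ∀ {n} → (Subset n → Bool) → ℕ → ℕ
chains {n} S k = cnt S k * (k ! * (n ∸ k) !)

-- The normalized matching property: multiplying the shadow inequality by k! (n-k-1)! turns both
-- counts into numbers of maximal chains.
chains-shadow₁ : ∀ {n} (S T : Subset n → Bool) k →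
  (∀ x y → x ≼ y → size y ≡ suc k → size x ≡ k → S y ≡ true → T x ≡ true) →
  chains S (suc k) ≤ chains T k
chains-shadow₁ {n} S T k h with k <? n
... | no k≮n rewrite cnt≡0 S (suc k) (λ x _ e → k≮n (subst (_≤ n) e (size≤n x))) = z≤n
... | yes k<n = begin
  cnt S (suc k) * (suc k * k ! * r !) ≡⟨ lem₁ (cnt S (suc k)) (suc k) (k !) (r !) ⟩
  suc k * cnt S (suc k) * (k ! * r !) ≤⟨ *-monoˡ-≤ (k ! * r !) (shadow-cnt S T k h) ⟩
  (n ∸ k) * cnt T k * (k ! * r !) ≡⟨ lem₂ (n ∸ k) (cnt T k) (k !) (r !) ⟩
  cnt T k * (k ! * ((n ∸ k) * r !)) ≡⟨ cong (λ v → cnt T k * (k ! * v)) fact ⟩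
  cnt T k * (k ! * (n ∸ k) !) ∎
  where
  open ≤-Reasoning
  r = n ∸ suc k
  fact : (n ∸ k) * r ! ≡ (n ∸ k) !
  fact = ∸-! k<n
  lem₁ : ∀ c s a b → c * (s * a * b) ≡ s * c * (a * b)
  lem₁ = solve-∀
  lem₂ : ∀ m c a b → m * c * (a * b) ≡ c * (a * (m * b))
  lem₂ = solve-∀

-- One level at a time, with the sets lying below some member of `S` as the intermediate family `U`.
chains-shadow : ∀ {n} (S T : Subset n → Bool) k d →
  (∀ x y → x ≼ y → size y ≡ d + k → size x ≡ k → S y ≡ true → T x ≡ true) →
  chains S (d + k) ≤ chains T k
chains-shadow {n} S T k zero h = *-monoˡ-≤ _ (cnt-mono S T k λ x e → h x x ≼-refl e e)
chains-shadow {n} S T k (suc d) h =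
  ≤-trans (chains-shadow₁ S U (d + k) (λ x y p ey _ s → U⁺ x y s ey p))
          (chains-shadow U T k d λ x z p ez ex u →
             let y , s , ey , q = U⁻ z u in h x y (≼-trans p q) ey ex s)
  where
  U? : ∀ x → Dec (∃ λ y → S y ≡ true × size y ≡ suc (d + k) × x ≼ y)
  U? x = anySubset? (λ y → (S y Data.Bool.≟ true) ×-dec ((size y ≟ℕ suc (d + k)) ×-dec (x ≼? y)))
  U : Subset n → Bool
  U x = does (U? x)
  U⁺ : ∀ x y → S y ≡ true → size y ≡ suc (d + k) → x ≼ y → U x ≡ true
  U⁺ x y a b c = does⁺ (U? x) (y , a , b , c)
  U⁻ : ∀ x → U x ≡ true → ∃ λ y → S y ≡ true × size y ≡ suc (d + k) × x ≼ y
  U⁻ x = does⁻ (U? x)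

-- Used close to the middle, where the schedule does not act and chains simply lose one element per
-- step.
record LowerCover (n : ℕ) : Set where
  field
    lower : Subset n → Subset n
    lower-≼ : ∀ y → n < 2 * size y → lower y ≼ y
    lower-size : ∀ y → n < 2 * size y → suc (size (lower y)) ≡ size y
    lower-inj : ∀ y z → n < 2 * size y → n < 2 * size z → lower y ≡ lower z → y ≡ z

abstract
  -- Above the middle a set has at least as many lower covers as any set one level below has upper
  -- covers, so Hall's condition already holds level by level.
  lowerCover : ∀ n → LowerCover n
  lowerCover n = record
    { lower = partner
    ; lower-≼ = λ y l → proj₁ (cov y l)
    ; lower-size = λ y l → proj₂ (cov y l)
    ; lower-inj = λ y z l l' → injective y z (does⁺ (D? y) l) (does⁺ (D? z) l') }
    where
    D? : ∀ (y : Subset n) → Dec (n < 2 * size y)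
    D? y = n <? 2 * size y
    D : Subset n → Bool
    D y = does (D? y)
    E? : ∀ (y x : Subset n) → Dec (x ≼ y × suc (size x) ≡ size y)
    E? y x = (x ≼? y) ×-dec (suc (size x) ≟ℕ size y)
    open Hall (λ y x → does (E? y x))
    level : ∀ S → (∀ y → S y ≡ true → D y ≡ true) → ∀ k → cnt S (suc k) ≤ cnt (N S) k
    level S S⊆D k with n <? 2 * suc k
    ... | no n≮ = subst (_≤ cnt (N S) k) (sym (cnt≡0 S (suc k) λ x s e →
            n≮ (subst (λ v → n < 2 * v) e (does⁻ (D? x) (S⊆D x s))))) z≤n
    ... | yes n< = *-cancelˡ-≤ (suc k) (≤-trans
            (shadow-cnt S (N S) k λ x y p ey ex s → N⁺ S x y s (does⁺ (E? y x) (p , trans (cong suc ex) (sym ey))))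
            (*-monoˡ-≤ _ (≤-trans (∸-monoˡ-≤ k (≤-pred n<)) (≤-reflexive (arith k)))))
      where
      arith : ∀ k → (k + suc (k + 0)) ∸ k ≡ suc k
      arith k = trans (m+n∸m≡n k _) (cong suc (+-identityʳ k))
    hall : ∀ S → (∀ y → S y ≡ true → D y ≡ true) → ∑S (⟦_⟧ ∘ S) ≤ ∑S (⟦_⟧ ∘ N S)
    hall S S⊆D = begin
      ∑S (⟦_⟧ ∘ S) ≡⟨ ∑-cnt S ⟩
      ∑< (suc n) (cnt S) ≡⟨ ∑<-suc n (cnt S) ⟩
      cnt S 0 + ∑< n (cnt S ∘ suc) ≡⟨ cong (_+ ∑< n (cnt S ∘ suc)) (cnt≡0 S 0 λ x s e → n≮0 (subst (λ v → n < 2 * v) e (does⁻ (D? x) (S⊆D x s)))) ⟩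
      ∑< n (cnt S ∘ suc) ≤⟨ ∑-mono (range n) (level S S⊆D) ⟩
      ∑< n (cnt (N S)) ≤⟨ m≤m+n _ _ ⟩
      ∑< n (cnt (N S)) + cnt (N S) n ≡⟨ ∑<-last n (cnt (N S)) ⟨
      ∑< (suc n) (cnt (N S)) ≡⟨ ∑-cnt (N S) ⟨
      ∑S (⟦_⟧ ∘ N S) ∎
      where open ≤-Reasoning
    open Matching (hall-matching D hall)
    cov : ∀ y → n < 2 * size y → partner y ≼ y × suc (size (partner y)) ≡ size y
    cov y l = does⁻ (E? y (partner y)) (compatible y (does⁺ (D? y) l))

-- Binomial coefficients as level sizes

absorption : ∀ n k → suc k * (n C suc k) ≡ (n ∸ k) * (n C k)
absorption zero zero = refl
absorption zero (suc k) = trans (cong (suc (suc k) *_) (k>n⇒nCk≡0 {0} {suc (suc k)} z<s)) (*-zeroʳ (suc (suc k)))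
absorption (suc n) zero = begin
  1 * (suc n C 1) ≡⟨ cong (1 *_) (sym (nCk+nC[k+1]≡[n+1]C[k+1] n 0)) ⟩
  1 * (1 + n C 1) ≡⟨ *-distribˡ-+ 1 1 (n C 1) ⟩
  1 + 1 * (n C 1) ≡⟨ cong (1 +_) (absorption n 0) ⟩
  suc n * 1 ∎
  where open ≡-Reasoning
absorption (suc n) (suc k) = begin
  suc (suc k) * (suc n C suc (suc k)) ≡⟨ cong (suc (suc k) *_) (sym (nCk+nC[k+1]≡[n+1]C[k+1] n (suc k))) ⟩
  suc (suc k) * (c + n C suc (suc k)) ≡⟨ *-distribˡ-+ (suc (suc k)) c _ ⟩
  suc (suc k) * c + suc (suc k) * (n C suc (suc k)) ≡⟨ cong (suc (suc k) * c +_) (absorption n (suc k)) ⟩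
  suc (suc k) * c + (n ∸ suc k) * c ≡⟨ middle ⟩
  suc k * c + (n ∸ k) * c ≡⟨ cong (_+ (n ∸ k) * c) (absorption n k) ⟩
  (n ∸ k) * (n C k) + (n ∸ k) * c ≡⟨ *-distribˡ-+ (n ∸ k) (n C k) c ⟨
  (n ∸ k) * (n C k + c) ≡⟨ cong ((n ∸ k) *_) (nCk+nC[k+1]≡[n+1]C[k+1] n k) ⟩
  (n ∸ k) * (suc n C suc k) ∎
  where
  open ≡-Reasoning
  c = n C suc k
  shift : ∀ k r c → suc (suc k) * c + r * c ≡ suc k * c + suc r * c
  shift = solve-∀
  middle : suc (suc k) * c + (n ∸ suc k) * c ≡ suc k * c + (n ∸ k) * c
  middle with k <? n
  ... | yes k<n = trans (shift k (n ∸ suc k) c) (cong (λ v → suc k * c + v * c) (sym (+-∸-assoc 1 k<n)))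
  ... | no k≮n = cong₂ _+_ (trans (vanish (suc (suc k))) (sym (vanish (suc k)))) (trans (vanish (n ∸ suc k)) (sym (vanish (n ∸ k))))
    where
    vanish : ∀ m → m * c ≡ 0
    vanish m = trans (cong (m *_) (k>n⇒nCk≡0 (≰⇒> k≮n))) (*-zeroʳ m)

level-count : ∀ n k → ∑S {n} (λ x → ⟦ does (size x ≟ℕ k) ⟧) ≡ n C k
level-count zero zero = refl
level-count zero (suc k) = sym (k>n⇒nCk≡0 {0} {suc k} z<s)
level-count (suc n) zero = trans (∑S-∷ {n} (λ x → ⟦ does (size x ≟ℕ 0) ⟧)) (cong₂ _+_ (∑-0 (allSubsets n)) (level-count n 0))
level-count (suc n) (suc k) = trans (∑S-∷ {n} (λ x → ⟦ does (size x ≟ℕ suc k) ⟧))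
  (trans (cong₂ _+_ (level-count n k) (level-count n (suc k))) (nCk+nC[k+1]≡[n+1]C[k+1] n k))

binomial-factorials : ∀ n k → k ≤ n → (n C k) * (k ! * (n ∸ k) !) ≡ n !
binomial-factorials n zero _ = trans (+-identityʳ _) (+-identityʳ _)
binomial-factorials n (suc k) k<n = begin
  (n C suc k) * (suc k * k ! * r !) ≡⟨ lem₁ (n C suc k) (suc k) (k !) (r !) ⟩
  suc k * (n C suc k) * (k ! * r !) ≡⟨ cong (_* (k ! * r !)) (absorption n k) ⟩
  (n ∸ k) * (n C k) * (k ! * r !) ≡⟨ lem₂ (n ∸ k) (n C k) (k !) (r !) ⟩
  (n C k) * (k ! * ((n ∸ k) * r !)) ≡⟨ cong (λ v → (n C k) * (k ! * v)) fact ⟩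
  (n C k) * (k ! * (n ∸ k) !) ≡⟨ binomial-factorials n k (<⇒≤ k<n) ⟩
  n ! ∎
  where
  open ≡-Reasoning
  r = n ∸ suc k
  fact : (n ∸ k) * r ! ≡ (n ∸ k) !
  fact = ∸-! k<n
  lem₁ : ∀ c s a b → c * (s * a * b) ≡ s * c * (a * b)
  lem₁ = solve-∀
  lem₂ : ∀ m c a b → m * c * (a * b) ≡ c * (a * (m * b))
  lem₂ = solve-∀

-- Symmetric chains

∑S-unique : ∀ {n} (F : Subset n → Bool) → (∀ y z → F y ≡ true → F z ≡ true → y ≡ z) → ∑S (⟦_⟧ ∘ F) ≤ 1
∑S-unique {n} F uniq with anySubset? (λ y → F y Data.Bool.≟ true)
... | no none = ≤-trans (≤-reflexive (trans (∑-cong (allSubsets n) λ x → cong ⟦_⟧ (¬true⇒false λ h → none (x , h))) (∑-0 (allSubsets n)))) z≤n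
... | yes (z , Fz) = ≤-trans (∑-mono (allSubsets n) λ y → ⟦⟧-mono λ h → does⁺ (z ≡S? y) (uniq z y Fz h)) (≤-reflexive (∑S-δ1 z))

∑S-pos : ∀ {n} (f : Subset n → ℕ) z → f z ≤ ∑S f
∑S-pos {n} f z = ≤-trans (≤-reflexive (sym (∑S-δ z f))) (∑-mono (allSubsets n) λ x →
  ≤-trans (*-monoˡ-≤ (f x) (⟦⟧≤1 (does (z ≡S? x)))) (≤-reflexive (*-identityˡ (f x))))

-- Writing f (φ y) as a sum over its value x and exchanging the sums leaves the fibres of `φ`, which
-- have at most one element in `P`.
∑S-inject : ∀ {m n} (φ : Subset m → Subset n) (P : Subset m → Bool) (Q : Subset n → Bool) (f : Subset n → ℕ) →
  (∀ y → P y ≡ true → Q (φ y) ≡ true) →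
  (∀ y z → P y ≡ true → P z ≡ true → φ y ≡ φ z → y ≡ z) →
  ∑S (λ y → ⟦ P y ⟧ * f (φ y)) ≤ ∑S (λ x → ⟦ Q x ⟧ * f x)
∑S-inject {m} {n} φ P Q f P⇒Q inj = begin
  ∑S (λ y → ⟦ P y ⟧ * f (φ y)) ≡⟨ ∑-cong (allSubsets m) (λ y → trans (cong (⟦ P y ⟧ *_) (sym (∑S-δ (φ y) f)))
      (trans (sym (∑-*ˡ (allSubsets n) ⟦ P y ⟧ _)) (∑-cong (allSubsets n) λ x → trans (sym (*-assoc ⟦ P y ⟧ _ (f x))) (cong (_* f x) (sym (⟦∧⟧ (P y) _)))))) ⟩
  ∑S (λ y → ∑S (λ x → ⟦ P y ∧ does (φ y ≡S? x) ⟧ * f x)) ≡⟨ ∑-swap (allSubsets m) (allSubsets n) _ ⟩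
  ∑S (λ x → ∑S (λ y → ⟦ P y ∧ does (φ y ≡S? x) ⟧ * f x)) ≡⟨ ∑-cong (allSubsets n) (λ x → ∑-*ʳ (allSubsets m) (f x) _) ⟩
  ∑S (λ x → ∑S (λ y → ⟦ P y ∧ does (φ y ≡S? x) ⟧) * f x) ≤⟨ ∑-mono (allSubsets n) (λ x → *-monoˡ-≤ (f x) (fibre x)) ⟩
  ∑S (λ x → ⟦ Q x ⟧ * f x) ∎
  where
  open ≤-Reasoning
  hits : ∀ x → Subset m → Bool
  hits x y = P y ∧ does (φ y ≡S? x)
  hits⁻ : ∀ x y → hits x y ≡ true → P y ≡ true × φ y ≡ x
  hits⁻ x y h = let a , b = ∧-elim {P y} h in a , does⁻ (φ y ≡S? x) b
  fibre : ∀ x → ∑S (λ y → ⟦ hits x y ⟧) ≤ ⟦ Q x ⟧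
  fibre x with Q x in Qx
  ... | true = ∑S-unique (hits x) λ y z hy hz →
          inj y z (proj₁ (hits⁻ x y hy)) (proj₁ (hits⁻ x z hz)) (trans (proj₂ (hits⁻ x y hy)) (sym (proj₂ (hits⁻ x z hz))))
  ... | false = ≤-reflexive (trans (∑-cong (allSubsets m) λ y → cong ⟦_⟧ (¬true⇒false λ h →
          true≢false (subst (λ v → Q v ≡ true) (proj₂ (hits⁻ x y h)) (P⇒Q y (proj₁ (hits⁻ x y h)))) Qx)) (∑-0 (allSubsets m)))

-- pos and prev describe a symmetric chain decomposition: chains are built by adding the head
-- coordinate last, pos x is the rank of x in its chain and prev x the element below it.
pos : ∀ {q} → Subset q → ℕ
pos [] = 0
pos (true ∷ x) = suc (pos x)
-- An old chain x₀, x₁, x₂, ... yields the chains false ∷ x₀, true ∷ x₀, true ∷ x₁, ... and false ∷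
-- x₁, false ∷ x₂, .... Truncation gives false ∷ x₀ its rank 0.
pos (false ∷ x) = pos x ∸ 1

prev : ∀ {q} → Subset q → Subset q
prev [] = []
prev (false ∷ x) = false ∷ prev x
prev (true ∷ x) with pos x
... | zero = false ∷ x
... | suc _ = true ∷ prev x

pos≤q : ∀ {q} (x : Subset q) → pos x ≤ q
pos≤q [] = z≤n
pos≤q (true ∷ x) = s≤s (pos≤q x)
pos≤q (false ∷ x) = ≤-trans (m∸n≤m (pos x) 1) (m≤n⇒m≤1+n (pos≤q x))

prev-≼ : ∀ {q} (x : Subset q) → prev x ≼ x
prev-≼ [] = []
prev-≼ (false ∷ x) = keep (prev-≼ x)
prev-≼ (true ∷ x) with pos x
... | zero = add ≼-refl
... | suc _ = keep (prev-≼ x)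

pos-prev : ∀ {q} (x : Subset q) i → pos x ≡ suc i → pos (prev x) ≡ i
pos-prev (true ∷ x) i e with pos x in p
pos-prev (true ∷ x) .0 refl | zero rewrite p = refl
pos-prev (true ∷ x) .(suc k) refl | suc k = cong suc (pos-prev x k p)
pos-prev (false ∷ x) i e with pos x in p
pos-prev (false ∷ x) i refl | suc .(suc i) = cong (_∸ 1) (pos-prev x (suc i) p)

-- Positive ranks exclude chain bottoms, where `prev` is a mere default. In the mixed cases an
-- equality would force true ∷ y with y at rank 0 and y = prev x, while prev x still has positive
-- rank.
prev-inj : ∀ {q} (x y : Subset q) → 0 < pos x → 0 < pos y → prev x ≡ prev y → x ≡ y
prev-inj (false ∷ x) (false ∷ y) px py e = cong (false ∷_) (prev-inj x y (≤-trans px (m∸n≤m (pos x) 1)) (≤-trans py (m∸n≤m (pos y) 1)) (VP.∷-injectiveʳ e))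
  where import Data.Vec.Properties as VP
prev-inj (true ∷ x) (true ∷ y) px py e with pos x in ex | pos y in ey
prev-inj (true ∷ x) (true ∷ .x) px py refl | zero | zero = refl
... | suc _ | suc _ = cong (true ∷_) (prev-inj x y (subst (0 <_) (sym ex) z<s) (subst (0 <_) (sym ey) z<s) (VP.∷-injectiveʳ e))
  where import Data.Vec.Properties as VP
prev-inj (false ∷ x) (true ∷ y) px py e with pos y in ey | pos x in ex
prev-inj (false ∷ x) (true ∷ .(prev x)) px py refl | zero | suc (suc k) = ⊥-elim (0≢1+n (trans (sym ey) (pos-prev x (suc k) ex)))
prev-inj (true ∷ x) (false ∷ y) px py e with pos x in ex | pos y in ey
prev-inj (true ∷ .(prev y)) (false ∷ y) px py refl | zero | suc (suc k) = ⊥-elim (0≢1+n (trans (sym ex) (pos-prev y (suc k) ey)))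

prev^ : ∀ {q} → ℕ → Subset q → Subset q
prev^ zero x = x
prev^ (suc d) x = prev^ d (prev x)

prev^-≼ : ∀ {q} d (x : Subset q) → prev^ d x ≼ x
prev^-≼ zero x = ≼-refl
prev^-≼ (suc d) x = ≼-trans (prev^-≼ d (prev x)) (prev-≼ x)

pos-prev^ : ∀ {q} d (x : Subset q) i → pos x ≡ d + i → pos (prev^ d x) ≡ i
pos-prev^ zero x i e = e
pos-prev^ (suc d) x i e = pos-prev^ d (prev x) i (pos-prev x (d + i) e)

prev^-inj : ∀ {q} d (x y : Subset q) → d ≤ pos x → d ≤ pos y → prev^ d x ≡ prev^ d y → x ≡ y
prev^-inj zero x y _ _ e = e
prev^-inj (suc d) x y dx dy e with pos x in ex | pos y in ey
prev^-inj (suc d) x y (s≤s dx) (s≤s dy) e | suc k | suc l =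
  prev-inj x y (subst (0 <_) (sym ex) z<s) (subst (0 <_) (sym ey) z<s)
    (prev^-inj d (prev x) (prev y) (subst (d ≤_) (sym (pos-prev x k ex)) dx) (subst (d ≤_) (sym (pos-prev y l ey)) dy) e)

at : ∀ {q} → ℕ → Subset q → Bool
at i x = does (pos x ≟ℕ i)

∑-prev^ : ∀ {q} d i (f : Subset q → ℕ) → ∑S (λ y → ⟦ at (d + i) y ⟧ * f (prev^ d y)) ≤ ∑S (λ x → ⟦ at i x ⟧ * f x)
∑-prev^ d i f = ∑S-inject (prev^ d) (at (d + i)) (at i) f
  (λ y h → does⁺ (pos (prev^ d y) ≟ℕ i) (pos-prev^ d y i (p y h)))
  (λ y z hy hz → prev^-inj d y z (≤-trans (m≤m+n d i) (≤-reflexive (sym (p y hy)))) (≤-trans (m≤m+n d i) (≤-reflexive (sym (p z hz)))))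
  where
  p : ∀ y → at (d + i) y ≡ true → pos y ≡ d + i
  p y = does⁻ (pos y ≟ℕ d + i)

-- Rank j occurs once in each chain with more than j elements, and by symmetry these are the chains
-- that meet size ⌈(q+j)/2⌉. The recursion of `pos` turns this into Pascal's rule.
pos-count : ∀ q j → ∑S {q} (λ x → ⟦ at j x ⟧) ≡ q C ⌈ q + j /2⌉
pos-count zero zero = refl
pos-count zero (suc j) = sym (k>n⇒nCk≡0 {0} {⌈ suc j /2⌉} z<s)
pos-count (suc q) zero = trans (∑S-∷ {q} (λ x → ⟦ at 0 x ⟧)) (trans (cong₂ _+_ (∑-0 (allSubsets q)) zeros) centre)
  where
  zeros : ∑S {q} (λ x → ⟦ does ((pos x ∸ 1) ≟ℕ 0) ⟧) ≡ q C ⌈ q /2⌉ + q C suc ⌊ q /2⌋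
  zeros = trans (∑-cong (allSubsets q) λ x → split (pos x)) (trans (∑-+ (allSubsets q) _ _)
    (cong₂ _+_ (trans (pos-count q 0) (cong (λ v → q C ⌈ v /2⌉) (+-identityʳ q)))
               (trans (pos-count q 1) (cong (λ v → q C ⌈ v /2⌉) (+-comm q 1)))))
    where
    split : ∀ p → ⟦ does ((p ∸ 1) ≟ℕ 0) ⟧ ≡ ⟦ does (p ≟ℕ 0) ⟧ + ⟦ does (p ≟ℕ 1) ⟧
    split zero = refl
    split (suc zero) = refl
    split (suc (suc p)) = refl
  ⌈⌉-cases : ∀ q → ⌈ q /2⌉ ≡ ⌊ q /2⌋ ⊎ ⌈ q /2⌉ ≡ suc ⌊ q /2⌋
  ⌈⌉-cases zero = inj₁ refl
  ⌈⌉-cases (suc zero) = inj₂ refl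
  ⌈⌉-cases (suc (suc q)) with ⌈⌉-cases q
  ... | inj₁ e = inj₁ (cong suc e)
  ... | inj₂ e = inj₂ (cong suc e)
  centre : q C ⌈ q /2⌉ + q C suc ⌊ q /2⌋ ≡ suc q C ⌈ suc q + 0 /2⌉
  centre rewrite +-identityʳ q with ⌈⌉-cases q
  ... | inj₁ e = trans (cong (λ v → q C v + q C suc ⌊ q /2⌋) e) (nCk+nC[k+1]≡[n+1]C[k+1] q ⌊ q /2⌋)
  ... | inj₂ e = trans (cong (_+ q C suc ⌊ q /2⌋) (trans (nCk≡nC[n∸k] (⌈n/2⌉≤n q)) (cong (q C_)
          (trans (cong (_∸ ⌈ q /2⌉) (sym (⌊n/2⌋+⌈n/2⌉≡n q))) (m+n∸n≡m ⌊ q /2⌋ ⌈ q /2⌉)))))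
          (nCk+nC[k+1]≡[n+1]C[k+1] q ⌊ q /2⌋)
pos-count (suc q) (suc j) = trans (∑S-∷ {q} (λ x → ⟦ at (suc j) x ⟧)) (trans (cong₂ _+_
  (pos-count q j)
  (trans (∑-cong (allSubsets q) λ x → cong ⟦_⟧ (shift (pos x))) (trans (pos-count q (suc (suc j))) (cong (λ v → q C ⌈ v /2⌉) (trans (+-suc q (suc j)) (cong suc (+-suc q j)))))))
  (trans (nCk+nC[k+1]≡[n+1]C[k+1] q ⌈ q + j /2⌉) (cong (λ v → suc q C ⌈ v /2⌉) (sym (cong suc (+-suc q j))))))
  where
  shift : ∀ p → does ((p ∸ 1) ≟ℕ suc j) ≡ does (p ≟ℕ suc (suc j))
  shift zero = refl
  shift (suc p) = refl

-- Matching the columns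

max< : ℕ → (ℕ → ℕ) → ℕ
max< zero f = 0
max< (suc n) f = f 0 ⊔ max< n (f ∘ suc)

≤-max< : ∀ n f i → i < n → f i ≤ max< n f
≤-max< (suc n) f zero _ = m≤m⊔n (f 0) _
≤-max< (suc n) f (suc i) (s≤s i<n) = ≤-trans (≤-max< n (f ∘ suc) i i<n) (m≤n⊔m (f 0) _)

max<-≤ : ∀ n f c → (∀ i → i < n → f i ≤ c) → max< n f ≤ c
max<-≤ zero f c h = z≤n
max<-≤ (suc n) f c h = ⊔-lub (h 0 z<s) (max<-≤ n (f ∘ suc) c λ i i<n → h (suc i) (s<s i<n))

min< : ℕ → (ℕ → ℕ) → ℕ
min< zero f = f 0
min< (suc n) f = f 0 ⊓ min< n (f ∘ suc)

min<-≤ : ∀ n f i → i ≤ n → min< n f ≤ f i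
min<-≤ zero f zero _ = ≤-refl
min<-≤ (suc n) f zero _ = m⊓n≤m (f 0) _
min<-≤ (suc n) f (suc i) (s≤s i≤n) = ≤-trans (m⊓n≤n (f 0) _) (min<-≤ n (f ∘ suc) i i≤n)

≤-min< : ∀ n f c → (∀ i → i ≤ n → c ≤ f i) → c ≤ min< n f
≤-min< zero f c h = h 0 z≤n
≤-min< (suc n) f c h = ⊓-glb (h 0 z≤n) (≤-min< n (f ∘ suc) c λ i i≤n → h (suc i) (s≤s i≤n))

-- The maximum of `f` separates demands from supplies, so only the total weights a c ≤ b d matter
-- and a and b may differ.
balance : ∀ a b c d (f g : ℕ → ℕ) → (∀ i j → i < a → j < b → f i ≤ g j) → a * c ≤ b * d →
  ∑< a (λ i → f i * c) ≤ ∑< b (λ j → g j * d)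
balance a b c d f g f≤g ac≤bd = begin
  ∑< a (λ i → f i * c) ≤⟨ ∑<-mono a (λ i i<a → *-monoˡ-≤ c (≤-max< a f i i<a)) ⟩
  ∑< a (λ _ → μ * c) ≡⟨ ∑<-const a (μ * c) ⟩
  a * (μ * c) ≡⟨ lem a μ c ⟩
  μ * (a * c) ≤⟨ *-monoʳ-≤ μ ac≤bd ⟩
  μ * (b * d) ≡⟨ lem b μ d ⟨
  b * (μ * d) ≡⟨ ∑<-const b (μ * d) ⟨
  ∑< b (λ _ → μ * d) ≤⟨ ∑<-mono b (λ j j<b → *-monoˡ-≤ d (max<-≤ a f (g j) λ i i<a → f≤g i j i<a j<b)) ⟩
  ∑< b (λ j → g j * d) ∎
  where
  open ≤-Reasoning
  μ = max< a f
  lem : ∀ a m c → a * (m * c) ≡ m * (a * c)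
  lem = solve-∀

-- The inverse of the consecutive numbering of cells: it recovers the block and the index within the
-- block.
locate : (k : ℕ → ℕ) → ℕ → ℕ → ℕ × ℕ
locate k zero P = 0 , P
locate k (suc J) P with P <? k 0
... | yes _ = 0 , P
... | no _ = let j , i = locate (k ∘ suc) J (P ∸ k 0) in suc j , i

locate-spec : ∀ k J P → P < ∑< J k → let j , i = locate k J P in j < J × i < k j × ∑< j k + i ≡ P
locate-spec k (suc J) P P< with P <? k 0
... | yes l = z<s , l , refl
... | no ≮ = let a , b , c = locate-spec (k ∘ suc) J (P ∸ k 0) bound ; j , i = locate (k ∘ suc) J (P ∸ k 0) in
  s<s a , b , trans (cong (_+ i) (∑<-suc j k)) (trans (+-assoc (k 0) _ i) (trans (cong (k 0 +_) c) (m+[n∸m]≡n (≮⇒≥ ≮))))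
  where
  bound : P ∸ k 0 < ∑< J (k ∘ suc)
  bound = +-cancelˡ-< (k 0) _ _ (subst₂ _<_ (sym (m+[n∸m]≡n (≮⇒≥ ≮))) (∑<-suc J k) P<)

∑<-locate : ∀ k J (f : ℕ → ℕ → ℕ) →
  ∑< (∑< J k) (λ P → f (proj₁ (locate k J P)) (proj₂ (locate k J P))) ≡ ∑< J (λ j → ∑< (k j) (f j))
∑<-locate k zero f = refl
∑<-locate k (suc J) f = begin
  ∑< (∑< (suc J) k) F ≡⟨ cong (λ v → ∑< v F) (∑<-suc J k) ⟩
  ∑< (k 0 + ∑< J (k ∘ suc)) F ≡⟨ ∑<-split (k 0) (∑< J (k ∘ suc)) F ⟩
  ∑< (k 0) F + ∑< (∑< J (k ∘ suc)) (λ P → F (k 0 + P)) ≡⟨ cong₂ _+_ (∑<-cong (k 0) here) (∑-cong (range (∑< J (k ∘ suc))) there) ⟩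
  ∑< (k 0) (f 0) + ∑< (∑< J (k ∘ suc)) (λ P → f (suc (proj₁ (locate (k ∘ suc) J P))) (proj₂ (locate (k ∘ suc) J P)))
    ≡⟨ cong (∑< (k 0) (f 0) +_) (∑<-locate (k ∘ suc) J (f ∘ suc)) ⟩
  ∑< (k 0) (f 0) + ∑< J (λ j → ∑< (k (suc j)) (f (suc j))) ≡⟨ ∑<-suc J (λ j → ∑< (k j) (f j)) ⟨
  ∑< (suc J) (λ j → ∑< (k j) (f j)) ∎
  where
  open ≡-Reasoning
  F : ℕ → ℕ
  F P = f (proj₁ (locate k (suc J) P)) (proj₂ (locate k (suc J) P))
  here : ∀ P → P < k 0 → F P ≡ f 0 P
  here P l with P <? k 0
  ... | yes _ = refl
  ... | no ≮ = ⊥-elim (≮ l)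
  there : ∀ P → F (k 0 + P) ≡ f (suc (proj₁ (locate (k ∘ suc) J P))) (proj₂ (locate (k ∘ suc) J P))
  there P with k 0 + P <? k 0
  ... | yes l = ⊥-elim (m+n≮m (k 0) P l)
  ... | no _ rewrite m+n∸m≡n (k 0) P = refl

∑<-≤-index : ∀ {k l} (f : ℕ → ℕ) → k ≤ l → ∑< k f ≤ ∑< l f
∑<-≤-index {k} {l} f k≤l = ≤-trans (m≤m+n _ _) (≤-reflexive (trans (sym (∑<-split k (l ∸ k) f)) (cong (λ v → ∑< v f) (m+[n∸m]≡n k≤l))))

∑<-strict⁻ : ∀ {j r} (k : ℕ → ℕ) → ∑< r k < ∑< j k → r < j
∑<-strict⁻ k lt = ≰⇒> λ j≤r → <⇒≱ lt (∑<-≤-index k j≤r)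

/-block : ∀ a M κ .{{_ : NonZero M}} → κ < M → (a * M + κ) / M ≡ a
/-block a M κ κ<M = trans (+-distrib-/ (a * M) κ (subst (_< M)
    (sym (cong₂ _+_ (m*n%n≡0 a M) (m<n⇒m%n≡m κ<M))) κ<M))
  (trans (cong₂ _+_ (m*n/n≡m a M) (m<n⇒m/n≡0 κ<M)) (+-identityʳ a))
  where open import Data.Nat.DivMod using (m*n%n≡0)

%-block : ∀ a M κ .{{_ : NonZero M}} → κ < M → (a * M + κ) % M ≡ κ
%-block a M κ κ<M = trans (cong (_% M) (+-comm (a * M) κ)) (trans ([m+kn]%n≡m%n κ a M) (m<n⇒m%n≡m κ<M))

monotone⇒≥ : ∀ (w : ℕ → ℕ) → (∀ t → w (suc t) ≤ w t) → ∀ {s t} → s ≤ t → w t ≤ w s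
monotone⇒≥ w mono {s} {t} s≤t = subst (λ v → w v ≤ w s) (m∸n+n≡m s≤t) (go (t ∸ s))
  where
  go : ∀ d → w (d + s) ≤ w s
  go zero = ≤-refl
  go (suc d) = ≤-trans (mono (d + s)) (go d)

-- A supply of density at least z on a level of weight w₀, serving a level of smaller weight w₁,
-- keeps z on the difference.
surplus : ∀ {X s z w₀ w₁} → s ≤ X → z ≤ X → w₁ ≤ w₀ → s * w₁ + z * (w₀ ∸ w₁) ≤ X * w₀
surplus {X} {s} {z} {w₀} {w₁} s≤X z≤X w₁≤w₀ = begin
  s * w₁ + z * (w₀ ∸ w₁) ≤⟨ +-mono-≤ (*-monoˡ-≤ w₁ s≤X) (*-monoˡ-≤ (w₀ ∸ w₁) z≤X) ⟩
  X * w₁ + X * (w₀ ∸ w₁) ≡⟨ *-distribˡ-+ X w₁ _ ⟨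
  X * (w₁ + (w₀ ∸ w₁)) ≡⟨ cong (X *_) (m+[n∸m]≡n w₁≤w₀) ⟩
  X * w₀ ∎
  where open ≤-Reasoning

-- A block of a column: level o+1 draws on level o, and since the weights w decrease an amount z * w 0 stays unused.
block-surplus : ∀ B (X s w : ℕ → ℕ) z → (∀ t → w (suc t) ≤ w t) →
  (∀ o → o < B → s (suc o) ≤ X o) → (∀ o → o ≤ B → z ≤ X o) →
  ∑< B (λ o → s (suc o) * w (suc o)) + z * w 0 ≤ ∑< (suc B) (λ o → X o * w o)
block-surplus zero X s w z mono s≤ z≤ = ≤-trans (*-monoˡ-≤ (w 0) (z≤ 0 z≤n)) (≤-reflexive (sym (+-identityʳ _)))
block-surplus (suc B) X s w z mono s≤ z≤ = begin
  ∑< (suc B) (λ o → s (suc o) * w (suc o)) + z * w 0 ≡⟨ cong₂ _+_ (∑<-suc B _) (trans (cong (z *_) (sym (m+[n∸m]≡n (mono 0)))) (*-distribˡ-+ z (w 1) _)) ⟩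
  s 1 * w 1 + R + (z * w 1 + z * (w 0 ∸ w 1)) ≡⟨ lem (s 1 * w 1) R (z * w 1) _ ⟩
  (s 1 * w 1 + z * (w 0 ∸ w 1)) + (R + z * w 1) ≤⟨ +-mono-≤ (surplus (s≤ 0 z<s) (z≤ 0 z≤n) (mono 0))
     (block-surplus B (X ∘ suc) (s ∘ suc) (w ∘ suc) z (mono ∘ suc) (λ o l → s≤ (suc o) (s<s l)) (λ o l → z≤ (suc o) (s≤s l))) ⟩
  X 0 * w 0 + ∑< (suc B) (λ o → X (suc o) * w (suc o)) ≡⟨ ∑<-suc (suc B) (λ o → X o * w o) ⟨
  ∑< (suc (suc B)) (λ o → X o * w o) ∎
  where
  open ≤-Reasoning
  R = ∑< B (λ o → s (suc (suc o)) * w (suc (suc o)))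
  lem : ∀ a r c d → a + r + (c + d) ≡ (a + d) + (r + c)
  lem = solve-∀

∑<-telescope : ∀ n (w : ℕ → ℕ) → (∀ t → w (suc t) ≤ w t) → ∑< n (λ t → w t ∸ w (suc t)) ≡ w 0 ∸ w n
∑<-telescope zero w mono = sym (n∸n≡0 (w 0))
∑<-telescope (suc n) w mono = begin
  ∑< (suc n) (λ t → w t ∸ w (suc t)) ≡⟨ ∑<-suc n _ ⟩
  (w 0 ∸ w 1) + ∑< n (λ t → w (suc t) ∸ w (suc (suc t))) ≡⟨ cong ((w 0 ∸ w 1) +_) (∑<-telescope n (w ∘ suc) (mono ∘ suc)) ⟩
  (w 0 ∸ w 1) + (w 1 ∸ w (suc n)) ≡⟨ m∸n+n∸o≡m∸o ⟩
  w 0 ∸ w (suc n) ∎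
  where
  open ≡-Reasoning
  m∸n+n∸o≡m∸o : (w 0 ∸ w 1) + (w 1 ∸ w (suc n)) ≡ w 0 ∸ w (suc n)
  m∸n+n∸o≡m∸o = trans (sym (+-∸-assoc (w 0 ∸ w 1) (monotone⇒≥ w mono {1} {suc n} (s≤s z≤n)))) (cong (_∸ w (suc n)) (m∸n+n≡m (mono 0)))

-- Parameters of the schedule.  Columns are grouped in supercolumns of M; block r consists of the levels
-- with t / B = r.  Block r is shared by k r of the Lb labels, each owning m r columns of every supercolumn.
-- The labels are handed out cyclically: the cell (r , κ) receives number `position r κ`, and
-- a chain continues from the cell numbered P to the cell numbered P + Lb of the next supercolumn.
record Schedule : Set where
  field
    B₁ M₁ J₁ Z Lb : ℕ
    k m : ℕ → ℕ
    k₀ : k 0 ≡ Lb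
    k≤Lb : ∀ j → j ≤ J₁ → k j ≤ Lb
    k>0 : ∀ j → 0 < k j
    km : ∀ j → k j * m j ≡ suc M₁
  B M : ℕ
  B = suc B₁
  M = suc M₁
  m>0 : ∀ j → NonZero (m j)
  m>0 j with m j | km j
  ... | zero | e = ⊥-elim (0≢1+n (trans (sym (*-zeroʳ (k j))) e))
  ... | suc _ | _ = _
  K : ℕ → ℕ
  K j = ∑< j k
  position : ℕ → ℕ → ℕ
  position r κ = K r + _/_ κ (m r) {{m>0 r}}

  -- The bottom levels of the blocks 1, ..., `J₁` outside the plain supercolumns: there a chain
  -- leaves its column.
  Jumping : ℕ → ℕ → Set
  Jumping i t = Z * M ≤ i × t % B ≡ 0 × 0 < t / B × t / B ≤ J₁

  -- A jump may land on any level of its target block. Hence the neighbourhood is at least as dense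
  -- as the jumping set on all of these levels at once, and the minimum `z` over the block is
  -- bounded below.
  data Jump (i t i' t' : ℕ) : Set where
    entry : i < suc Z * M → i' < Z * M → suc (t' / B) ≡ t / B → Jump i t i' t'
    cycle : suc Z * M ≤ i → suc (i' / M) ≡ i / M → t' / B < t / B →
      position (t' / B) (i' % M) + Lb ≡ position (t / B) (i % M) → Jump i t i' t'

  jumping? : ∀ i t → Dec (Jumping i t)
  jumping? i t = (Z * M ≤? i) ×-dec ((t % B ≟ℕ 0) ×-dec ((0 <? t / B) ×-dec (t / B ≤? J₁)))

  jump? : ∀ i t i' t' → Dec (Jump i t i' t')
  jump? i t i' t' = map′
    (λ { (inj₁ (a , b , c)) → entry a b c ; (inj₂ (a , b , c , d)) → cycle a b c d })
    (λ { (entry a b c) → inj₁ (a , b , c) ; (cycle a b c d) → inj₂ (a , b , c , d) })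
    (((i <? suc Z * M) ×-dec ((i' <? Z * M) ×-dec (suc (t' / B) ≟ℕ t / B))) ⊎-dec
     ((suc Z * M ≤? i) ×-dec ((suc (i' / M) ≟ℕ i / M) ×-dec ((t' / B <? t / B) ×-dec
       (position (t' / B) (i' % M) + Lb ≟ℕ position (t / B) (i % M))))))

-- The weight lost across block r, taken over `Z` plain columns, pays for one column entering from
-- above.
Gap : Schedule → (ℕ → ℕ) → Set
Gap sch w = ∀ r → r < J₁ → w (suc r * B) ≤ Z * (w (r * B) ∸ w (suc r * B))
  where open Schedule sch

-- A cell has M / k j columns of weight w (j B); the condition says that cells of higher blocks are
-- no heavier.
Ratio : Schedule → (ℕ → ℕ) → Set
Ratio sch w = ∀ r j → r < j → j ≤ J₁ → k r * w (j * B) ≤ k j * w (r * B)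
  where open Schedule sch

-- Hall's condition reduced to densities: `s` is the density of the set to be matched and `X` that
-- of its neighbourhood in column i at level t, and `w` converts densities into counts.
module Grid (sch : Schedule) (s X : ℕ → ℕ → ℕ) (w : ℕ → ℕ) (mono : ∀ t → w (suc t) ≤ w t)
  (gap : Gap sch w) (ratio : Ratio sch w)
  (vertical : ∀ i t → ¬ Schedule.Jumping sch i (suc t) → s i (suc t) ≤ X i t)
  (jumping : ∀ i t i' t' → Schedule.Jumping sch i t → Schedule.Jump sch i t i' t' → s i t ≤ X i' t') where

  open Schedule sch

  v : ℕ → ℕ
  v r = w (r * B)

  z : ℕ → ℕ → ℕ
  z i r = min< B₁ (λ o → X i (r * B + o))

  z-≤ : ∀ i r o → o ≤ B₁ → z i r ≤ X i (r * B + o)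
  z-≤ i r o o≤ = min<-≤ B₁ (λ o → X i (r * B + o)) o o≤

  jump-z : ∀ i j i' r → Z * M ≤ i → 0 < j → j ≤ J₁ → (∀ o → o ≤ B₁ → Jump i (j * B) i' (r * B + o)) → s i (j * B) ≤ z i' r
  jump-z i j i' r Z≤ 0<j j≤ jmp = ≤-min< B₁ _ _ λ o o≤ → jumping i (j * B) i' (r * B + o)
    (Z≤ , m*n%n≡0 j B , subst (0 <_) (sym (m*n/n≡m j B)) 0<j , subst (_≤ J₁) (sym (m*n/n≡m j B)) j≤) (jmp o o≤)
    where open import Data.Nat.DivMod using (m*n%n≡0)

  module Columns (T : ℕ) where
    TT = J₁ * B + T

    demand supply jumped : ℕ → ℕ
    demand i = ∑< TT (λ t → s i (suc t) * w (suc t))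
    supply i = ∑< TT (λ t → X i t * w t)
    jumped i = ∑< J₁ (λ r → s i (suc r * B) * v (suc r))

    -- Here each level is served by the heavier level below it, and the weight differences inside
    -- block r add up to v r - v (r+1).
    plain-column : ∀ i → i < Z * M → demand i + ∑< J₁ (λ r → z i r * (v r ∸ v (suc r))) ≤ supply i
    plain-column i i<ZM = begin
      demand i + ∑< J₁ (λ r → z i r * (v r ∸ v (suc r))) ≡⟨ cong (demand i +_) (∑-cong (range J₁) per-block) ⟩
      demand i + ∑< J₁ (λ r → ∑< B (λ o → ζ (r * B + o) (z i r))) ≤⟨ +-monoʳ-≤ (demand i) (∑-mono (range J₁) λ r →
          ∑<-mono B (λ o o<B → *-monoˡ-≤ (w (r * B + o) ∸ w (suc (r * B + o))) (z-≤ i r o (≤-pred o<B)))) ⟩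
      demand i + ∑< J₁ (λ r → ∑< B (λ o → ζ (r * B + o) (X i (r * B + o)))) ≡⟨ cong (demand i +_) (∑<-blocks J₁ B (λ t → ζ t (X i t))) ⟨
      demand i + ∑< (J₁ * B) (λ t → ζ t (X i t)) ≤⟨ +-monoʳ-≤ (demand i) (∑<-≤-index (λ t → ζ t (X i t)) (m≤m+n (J₁ * B) T)) ⟩
      demand i + ∑< TT (λ t → ζ t (X i t)) ≡⟨ ∑-+ (range TT) _ _ ⟨
      ∑< TT (λ t → s i (suc t) * w (suc t) + ζ t (X i t)) ≤⟨ ∑-mono (range TT) (λ t →
          surplus (vertical i t (λ jp → <⇒≱ i<ZM (proj₁ jp))) ≤-refl (mono t)) ⟩
      supply i ∎
      where
      open ≤-Reasoning
      ζ : ℕ → ℕ → ℕ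
      ζ t y = y * (w t ∸ w (suc t))
      per-block : ∀ r → z i r * (v r ∸ v (suc r)) ≡ ∑< B (λ o → ζ (r * B + o) (z i r))
      per-block r = trans (cong (z i r *_) (sym
          (trans (∑-cong (range B) λ o → cong (λ a → w (r * B + o) ∸ w a) (sym (+-suc (r * B) o)))
          (trans (∑<-telescope B (λ o → w (r * B + o)) (λ t → subst (λ a → w a ≤ w (r * B + t)) (sym (+-suc (r * B) t)) (mono (r * B + t))))
           (cong₂ (λ a b → w a ∸ w b) (+-identityʳ (r * B)) (+-comm (r * B) B))))))
        (sym (∑-*ˡ (range B) (z i r) (λ o → w (r * B + o) ∸ w (suc (r * B + o)))))

    -- The demand of level (r+1) B leaves the column, so block r has one more level of supply than
    -- of vertical demand. Decreasing weights let the spare level count with v r, the largest weight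
    -- of the block.
    blocked-column : ∀ i → Z * M ≤ i → demand i + ∑< J₁ (λ r → z i r * v r) ≤ supply i + jumped i
    blocked-column i ZM≤i = begin
      demand i + ∑< J₁ (λ r → z i r * v r) ≡⟨ cong (_+ ∑< J₁ (λ r → z i r * v r)) (trans (∑<-split (J₁ * B) T d) (cong (_+ ∑< T (λ t → d (J₁ * B + t)))
          (trans (∑<-blocks J₁ B d) (trans (∑-cong (range J₁) (λ r → ∑<-last B₁ (λ o → d (r * B + o)))) (∑-+ (range J₁) _ _))))) ⟩
      (V + ∑< J₁ (λ r → d (r * B + B₁))) + F + ∑< J₁ (λ r → z i r * v r) ≡⟨ cong (λ a → V + a + F + ∑< J₁ (λ r → z i r * v r))
          (∑-cong (range J₁) λ r → cong (λ t → s i t * w t) (trans (sym (+-suc (r * B) B₁)) (+-comm (r * B) B))) ⟩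
      (V + jumped i) + F + ∑< J₁ (λ r → z i r * v r) ≡⟨ lem V (jumped i) F _ ⟩
      (V + ∑< J₁ (λ r → z i r * v r)) + F + jumped i ≡⟨ cong (λ a → a + F + jumped i) (∑-+ (range J₁) _ _) ⟨
      ∑< J₁ (λ r → ∑< B₁ (λ o → d (r * B + o)) + z i r * v r) + F + jumped i ≤⟨ +-monoˡ-≤ (jumped i) (+-mono-≤ (∑<-mono J₁ per-block) far) ⟩
      ∑< J₁ (λ r → ∑< B (λ o → u (r * B + o))) + ∑< T (λ t → u (J₁ * B + t)) + jumped i
        ≡⟨ cong (_+ jumped i) (trans (cong (_+ ∑< T (λ t → u (J₁ * B + t))) (sym (∑<-blocks J₁ B u))) (sym (∑<-split (J₁ * B) T u))) ⟩
      supply i + jumped i ∎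
      where
      open ≤-Reasoning
      d u : ℕ → ℕ
      d t = s i (suc t) * w (suc t)
      u t = X i t * w t
      V = ∑< J₁ (λ r → ∑< B₁ (λ o → d (r * B + o)))
      F = ∑< T (λ t → d (J₁ * B + t))
      lem : ∀ a b c e → a + b + c + e ≡ a + e + c + b
      lem = solve-∀
      per-block : ∀ r → r < J₁ → ∑< B₁ (λ o → d (r * B + o)) + z i r * v r ≤ ∑< B (λ o → u (r * B + o))
      per-block r r<J = subst₂ _≤_
        (cong₂ _+_ (∑-cong (range B₁) λ o → cong (λ t → s i t * w t) (+-suc (r * B) o)) (cong (λ a → z i r * w a) (+-identityʳ (r * B)))) refl
        (block-surplus B₁ (λ o → X i (r * B + o)) (λ o → s i (r * B + o)) (λ o → w (r * B + o)) (z i r)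
          (λ t → subst (λ a → w a ≤ w (r * B + t)) (sym (+-suc (r * B) t)) (mono (r * B + t)))
          (λ o o<B → subst (λ a → s i a ≤ X i (r * B + o)) (sym (+-suc (r * B) o)) (vertical i (r * B + o) λ jp →
             0≢1+n (trans (sym (proj₁ (proj₂ jp))) (trans (cong (_% B) (sym (+-suc (r * B) o))) (%-block r B (suc o) (s<s o<B))))))
          (z-≤ i r))
      far : F ≤ ∑< T (λ t → u (J₁ * B + t))
      far = ∑-mono (range T) λ t → *-mono-≤ (vertical i (J₁ * B + t) (not-jumping t)) (mono (J₁ * B + t))
        where
        not-jumping : ∀ t → ¬ Jumping i (suc (J₁ * B + t))
        not-jumping t (_ , e , _ , l) = <⇒≱ (s<s (m≤m+n (J₁ * B) t))
          (≤-trans (≤-reflexive (trans (m≡m%n+[m/n]*n (suc (J₁ * B + t)) B) (cong (λ (a : ℕ) → a + (suc (J₁ * B + t) / B) * B) e))) (*-monoˡ-≤ B l))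

  -- The column with offset κ is served by the column with the same offset in each of the `Z` plain
  -- supercolumns, so that different entering columns do not compete.
  entries : ∀ κ r → κ < M → r < J₁ → s (Z * M + κ) (suc r * B) * v (suc r) ≤ ∑< Z (λ ς → z (ς * M + κ) r * (v r ∸ v (suc r)))
  entries κ r κ<M r<J = begin
    σ * v (suc r) ≤⟨ *-monoʳ-≤ σ (gap r r<J) ⟩
    σ * (Z * (v r ∸ v (suc r))) ≡⟨ lem σ Z _ ⟩
    Z * (σ * (v r ∸ v (suc r))) ≡⟨ ∑<-const Z _ ⟨
    ∑< Z (λ _ → σ * (v r ∸ v (suc r))) ≤⟨ ∑<-mono Z (λ ς ς<Z → *-monoˡ-≤ (v r ∸ v (suc r)) (from ς ς<Z)) ⟩
    ∑< Z (λ ς → z (ς * M + κ) r * (v r ∸ v (suc r))) ∎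
    where
    open ≤-Reasoning
    σ = s (Z * M + κ) (suc r * B)
    lem : ∀ a b c → a * (b * c) ≡ b * (a * c)
    lem = solve-∀
    from : ∀ ς → ς < Z → σ ≤ z (ς * M + κ) r
    from ς ς<Z = jump-z (Z * M + κ) (suc r) (ς * M + κ) r (m≤m+n _ κ) z<s r<J λ o o≤ → entry
      (subst (Z * M + κ <_) (+-comm (Z * M) M) (+-monoʳ-< (Z * M) κ<M))
      (<-≤-trans (+-monoʳ-< (ς * M) κ<M) (≤-trans (≤-reflexive (+-comm (ς * M) M)) (*-monoˡ-≤ M ς<Z)))
      (trans (cong suc (/-block r B o (s≤s o≤))) (sym (m*n/n≡m (suc r) B)))

  module Cycles (A : ℕ) where
    D U : ℕ → ℕ → ℕ
    D j idx = ∑< (m j) (λ u → s (suc (Z + A) * M + (idx * m j + u)) (j * B) * v j)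
    U r idx = ∑< (m r) (λ u → z ((Z + A) * M + (idx * m r + u)) r * v r)

    inside : ∀ j idx u → idx < k j → u < m j → idx * m j + u < M
    inside j idx u i<k u<m = <-≤-trans (+-monoʳ-< (idx * m j) u<m) (≤-trans (≤-reflexive (+-comm (idx * m j) (m j)))
      (≤-trans (*-monoˡ-≤ (m j) i<k) (≤-reflexive (km j))))

    -- No block has more than `Lb` cells, so lowering the number by `Lb` leads to an earlier block.
    -- By `ratio` the cell reached is at least as heavy, and `balance` compares the two.
    D≤U : ∀ j idx' r idx → 0 < j → j ≤ J₁ → idx' < k j → idx < k r → K r + idx + Lb ≡ K j + idx' → D j idx' ≤ U r idx
    D≤U j idx' r idx 0<j j≤J i'<k i<k eq = balance (m j) (m r) (v j) (v r) _ _ dominates masses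
      where
      open ≤-Reasoning
      r<j : r < j
      r<j = ∑<-strict⁻ k (+-cancelʳ-< Lb (K r) (K j) (begin-strict
        K r + Lb ≤⟨ +-monoˡ-≤ Lb (m≤m+n (K r) idx) ⟩
        K r + idx + Lb ≡⟨ eq ⟩
        K j + idx' <⟨ +-monoʳ-< (K j) i'<k ⟩
        K j + k j ≤⟨ +-monoʳ-≤ (K j) (k≤Lb j j≤J) ⟩
        K j + Lb ∎))
      masses : m j * v j ≤ m r * v r
      masses = *-cancelˡ-≤ M (begin
        M * (m j * v j) ≡⟨ cong (_* (m j * v j)) (km r) ⟨
        k r * m r * (m j * v j) ≡⟨ lem (k r) (m r) (m j) (v j) ⟩
        (m r * m j) * (k r * v j) ≤⟨ *-monoʳ-≤ (m r * m j) (ratio r j r<j j≤J) ⟩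
        (m r * m j) * (k j * v r) ≡⟨ lem' (m r) (m j) (k j) (v r) ⟩
        k j * m j * (m r * v r) ≡⟨ cong (_* (m r * v r)) (km j) ⟩
        M * (m r * v r) ∎)
        where
        lem : ∀ a b c d → a * b * (c * d) ≡ b * c * (a * d)
        lem = solve-∀
        lem' : ∀ a b c d → a * b * (c * d) ≡ c * b * (a * d)
        lem' = solve-∀
      dominates : ∀ u' u → u' < m j → u < m r → s (suc (Z + A) * M + (idx' * m j + u')) (j * B) ≤ z ((Z + A) * M + (idx * m r + u)) r
      dominates u' u u'<m u<m = jump-z _ j _ r (≤-trans (*-monoˡ-≤ M (≤-trans (m≤m+n Z A) (n≤1+n _))) (m≤m+n _ _)) 0<j j≤J λ o o≤ →
        let tj = m*n/n≡m j B ; tr = /-block r B o (s≤s o≤)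
            ij = inside j idx' u' i'<k u'<m ; ir = inside r idx u i<k u<m in
        cycle (≤-trans (*-monoˡ-≤ M (s≤s (m≤m+n Z A))) (m≤m+n _ _))
          (trans (cong suc (/-block (Z + A) M _ ir)) (sym (/-block (suc (Z + A)) M _ ij)))
          (subst₂ _<_ (sym tr) (sym tj) r<j)
          (trans (cong₂ (λ a b → position a b + Lb) tr (%-block (Z + A) M _ ir))
            (trans (cong (λ a → K r + a + Lb) (/-block idx (m r) u {{m>0 r}} u<m))
            (trans eq (sym (trans (cong₂ position tj (%-block (suc (Z + A)) M _ ij)) (cong (K j +_) (/-block idx' (m j) u' {{m>0 j}} u'<m)))))))

    -- As k 0 = `Lb`, the cells of the blocks from 1 on carry the numbers from `Lb` on. Subtracting
    -- `Lb` lands in blocks 0, ..., J₁ - 1, because k J₁ ≤ `Lb` (`fewer`).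
    cycles : ∑< M (λ κ → ∑< J₁ (λ r → s (suc (Z + A) * M + κ) (suc r * B) * v (suc r)))
           ≤ ∑< M (λ κ → ∑< J₁ (λ r → z ((Z + A) * M + κ) r * v r))
    cycles = begin
      ∑< M (λ κ → ∑< J₁ (λ r → s (suc (Z + A) * M + κ) (suc r * B) * v (suc r))) ≡⟨ ∑-swap (range M) (range J₁) _ ⟩
      ∑< J₁ (λ r → ∑< M (λ κ → s (suc (Z + A) * M + κ) (suc r * B) * v (suc r))) ≡⟨ ∑-cong (range J₁) (λ r → regroup (suc r) _) ⟩
      ∑< J₁ (λ r → ∑< (k (suc r)) (D (suc r))) ≡⟨ ∑<-locate (k ∘ suc) J₁ (D ∘ suc) ⟨
      ∑< (∑< J₁ (k ∘ suc)) (λ P → D (suc (proj₁ (locate (k ∘ suc) J₁ P))) (proj₂ (locate (k ∘ suc) J₁ P))) ≤⟨ ∑<-mono (∑< J₁ (k ∘ suc)) pointwise ⟩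
      ∑< (∑< J₁ (k ∘ suc)) (λ P → U (proj₁ (locate k J₁ P)) (proj₂ (locate k J₁ P))) ≤⟨ ∑<-≤-index _ fewer ⟩
      ∑< (K J₁) (λ P → U (proj₁ (locate k J₁ P)) (proj₂ (locate k J₁ P))) ≡⟨ ∑<-locate k J₁ U ⟩
      ∑< J₁ (λ r → ∑< (k r) (U r)) ≡⟨ ∑-cong (range J₁) (λ r → regroup r _) ⟨
      ∑< J₁ (λ r → ∑< M (λ κ → z ((Z + A) * M + κ) r * v r)) ≡⟨ ∑-swap (range J₁) (range M) _ ⟩
      ∑< M (λ κ → ∑< J₁ (λ r → z ((Z + A) * M + κ) r * v r)) ∎
      where
      open ≤-Reasoning
      regroup : ∀ r f → ∑< M f ≡ ∑< (k r) (λ idx → ∑< (m r) (λ u → f (idx * m r + u)))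
      regroup r f = trans (cong (λ a → ∑< a f) (sym (km r))) (∑<-blocks (k r) (m r) f)
      fewer : ∑< J₁ (k ∘ suc) ≤ K J₁
      fewer = +-cancelˡ-≤ (k 0) _ _ (≤-trans (≤-reflexive (trans (sym (∑<-suc J₁ k)) (∑<-last J₁ k)))
        (≤-trans (+-monoʳ-≤ (K J₁) (≤-trans (k≤Lb J₁ ≤-refl) (≤-reflexive (sym k₀)))) (≤-reflexive (+-comm (K J₁) (k 0)))))
      pointwise : ∀ P → P < ∑< J₁ (k ∘ suc) → D (suc (proj₁ (locate (k ∘ suc) J₁ P))) (proj₂ (locate (k ∘ suc) J₁ P))
                ≤ U (proj₁ (locate k J₁ P)) (proj₂ (locate k J₁ P))
      pointwise P P< with locate (k ∘ suc) J₁ P | locate-spec (k ∘ suc) J₁ P P< | locate k J₁ P | locate-spec k J₁ P (<-≤-trans P< fewer)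
      ... | j , idx' | j<J , i'<k , e' | r , idx | r<J , i<k , e =
        D≤U (suc j) idx' r idx z<s j<J i'<k i<k (trans (cong (_+ Lb) e) (trans (+-comm P Lb) (sym (trans (cong (_+ idx') (∑<-suc j k))
          (trans (+-assoc (k 0) _ idx') (cong₂ _+_ k₀ e'))))))

  -- All spare mass is added to both sides. The plain surplus `G` covers the jumps `EJ` from the
  -- first blocked supercolumn; the surplus of each blocked supercolumn covers the jumps from the
  -- next one; the last surplus `E` is left over.
  grid : ∀ T Y → let open Columns T in ∑< ((Z + suc Y) * M) demand ≤ ∑< ((Z + suc Y) * M) supply
  grid T Y = +-cancelʳ-≤ (G + (E + CZ)) _ _ (begin
    ∑< ((Z + suc Y) * M) demand + (G + (E + CZ)) ≡⟨ cong (_+ (G + (E + CZ))) (split demand) ⟩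
    DT + DP + (G + (E + CZ)) ≡⟨ lem₁ DT DP G E CZ ⟩
    (DT + G) + (DP + (E + CZ)) ≤⟨ +-mono-≤ plain blocked ⟩
    ST + (SP + (EJ + CJ)) ≤⟨ +-monoʳ-≤ ST (+-monoʳ-≤ SP (+-mono-≤ E≤G C≤)) ⟩
    ST + (SP + (G + (E + CZ))) ≡⟨ +-assoc ST SP _ ⟨
    ST + SP + (G + (E + CZ)) ≡⟨ cong (_+ (G + (E + CZ))) (split supply) ⟨
    ∑< ((Z + suc Y) * M) supply + (G + (E + CZ)) ∎)
    where
    open Columns T
    open ≤-Reasoning
    zz gg : ℕ → ℕ
    gg i = ∑< J₁ (λ r → z i r * (v r ∸ v (suc r)))
    zz i = ∑< J₁ (λ r → z i r * v r)
    high : (ℕ → ℕ) → ℕ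
    high f = ∑< (suc Y) (λ A → ∑< M (λ κ → f ((Z + A) * M + κ)))
    split : ∀ f → ∑< ((Z + suc Y) * M) f ≡ ∑< (Z * M) f + high f
    split f = trans (∑<-blocks (Z + suc Y) M f) (trans (∑<-split Z (suc Y) (λ a → ∑< M (λ κ → f (a * M + κ))))
      (cong (_+ high f) (sym (∑<-blocks Z M f))))
    DT = ∑< (Z * M) demand
    DP = high demand
    ST = ∑< (Z * M) supply
    SP = high supply
    G = ∑< (Z * M) gg
    E = ∑< M (λ κ → zz ((Z + Y) * M + κ))
    CZ = ∑< Y (λ A → ∑< M (λ κ → zz ((Z + A) * M + κ)))
    EJ = ∑< M (λ κ → jumped (Z * M + κ))
    CJ = ∑< Y (λ A → ∑< M (λ κ → jumped (suc (Z + A) * M + κ)))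
    lem₁ : ∀ a b c d e → a + b + (c + (d + e)) ≡ (a + c) + (b + (d + e))
    lem₁ = solve-∀
    plain : DT + G ≤ ST
    plain = ≤-trans (≤-reflexive (sym (∑-+ (range (Z * M)) demand gg))) (∑<-mono (Z * M) plain-column)
    blocked : DP + (E + CZ) ≤ SP + (EJ + CJ)
    blocked = begin
      DP + (E + CZ) ≡⟨ cong (DP +_) (trans (+-comm E CZ) (sym (∑<-last Y (λ A → ∑< M (λ κ → zz ((Z + A) * M + κ)))))) ⟩
      DP + high zz ≡⟨ merge demand zz ⟩
      high (λ i → demand i + zz i) ≤⟨ ∑-mono (range (suc Y)) (λ A → ∑-mono (range M) λ κ →
          blocked-column ((Z + A) * M + κ) (≤-trans (*-monoˡ-≤ M (m≤m+n Z A)) (m≤m+n _ κ))) ⟩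
      high (λ i → supply i + jumped i) ≡⟨ merge supply jumped ⟨
      SP + high jumped ≡⟨ cong (SP +_) (trans (∑<-suc Y (λ A → ∑< M (λ κ → jumped ((Z + A) * M + κ)))) (cong₂ _+_
          (cong (λ a → ∑< M (λ κ → jumped (a * M + κ))) (+-identityʳ Z))
          (∑-cong (range Y) λ A → cong (λ a → ∑< M (λ κ → jumped (a * M + κ))) (+-suc Z A)))) ⟩
      SP + (EJ + CJ) ∎
      where
      merge : ∀ f g → high f + high g ≡ high (λ i → f i + g i)
      merge f g = sym (trans (∑-cong (range (suc Y)) λ A → ∑-+ (range M) (λ κ → f ((Z + A) * M + κ)) (λ κ → g ((Z + A) * M + κ)))
        (∑-+ (range (suc Y)) (λ A → ∑< M (λ κ → f ((Z + A) * M + κ))) (λ A → ∑< M (λ κ → g ((Z + A) * M + κ)))))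
    E≤G : EJ ≤ G
    E≤G = begin
      EJ ≤⟨ ∑<-mono M (λ κ κ<M → ∑<-mono J₁ (λ r r<J → entries κ r κ<M r<J)) ⟩
      ∑< M (λ κ → ∑< J₁ (λ r → ∑< Z (λ ς → z (ς * M + κ) r * (v r ∸ v (suc r))))) ≡⟨ ∑-cong (range M) (λ κ → ∑-swap (range J₁) (range Z) _) ⟩
      ∑< M (λ κ → ∑< Z (λ ς → gg (ς * M + κ))) ≡⟨ ∑-swap (range M) (range Z) _ ⟩
      ∑< Z (λ ς → ∑< M (λ κ → gg (ς * M + κ))) ≡⟨ ∑<-blocks Z M gg ⟨
      G ∎
    C≤ : CJ ≤ E + CZ
    C≤ = ≤-trans (∑-mono (range Y) (λ A → Cycles.cycles A)) (m≤n+m CZ E)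

-- Hall's condition in a product of two cubes

left : ∀ q {n} → Subset (q + n) → Subset q
left zero y = []
left (suc q) (b ∷ y) = b ∷ left q y

right : ∀ q {n} → Subset (q + n) → Subset n
right zero y = y
right (suc q) (b ∷ y) = right q y

left-++ : ∀ {q n} (x : Subset q) (y : Subset n) → left q (x V.++ y) ≡ x
left-++ [] y = refl
left-++ (b ∷ x) y = cong (b ∷_) (left-++ x y)

right-++ : ∀ {q n} (x : Subset q) (y : Subset n) → right q (x V.++ y) ≡ y
right-++ [] y = refl
right-++ (b ∷ x) y = right-++ x y

left++right : ∀ q {n} (y : Subset (q + n)) → left q y V.++ right q y ≡ y
left++right zero y = refl
left++right (suc q) (b ∷ y) = cong (b ∷_) (left++right q y)

∑-cnt≥ : ∀ {n} (S : Subset n → Bool) m → n < m → ∑S (⟦_⟧ ∘ S) ≡ ∑< m (cnt S)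
∑-cnt≥ {n} S m n<m = begin
  ∑S (⟦_⟧ ∘ S) ≡⟨ ∑-cnt S ⟩
  ∑< (suc n) (cnt S) ≡⟨ +-identityʳ _ ⟨
  ∑< (suc n) (cnt S) + 0 ≡⟨ cong (∑< (suc n) (cnt S) +_) (trans (∑-cong (range (m ∸ suc n)) λ i →
      cnt≡0 S (suc n + i) λ x _ e → <⇒≱ (s≤s (m≤m+n n i)) (subst (_≤ n) e (size≤n x))) (∑-0 (range (m ∸ suc n)))) ⟨
  ∑< (suc n) (cnt S) + ∑< (m ∸ suc n) (λ i → cnt S (suc n + i)) ≡⟨ ∑<-split (suc n) (m ∸ suc n) (cnt S) ⟨
  ∑< (suc n + (m ∸ suc n)) (cnt S) ≡⟨ cong (λ v → ∑< v (cnt S)) (m+[n∸m]≡n n<m) ⟩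
  ∑< m (cnt S) ∎
  where open ≡-Reasoning

cnt-chains : ∀ {n} (S : Subset n → Bool) b → n ! * cnt S b ≡ chains S b * (n C b)
cnt-chains {n} S b with b ≤? n
... | yes b≤n = trans (cong (_* cnt S b) (sym (binomial-factorials n b b≤n))) (lem (n C b) _ (cnt S b))
  where
  lem : ∀ c f t → c * f * t ≡ t * f * c
  lem = solve-∀
... | no b≰n = trans (cong (n ! *_) (cnt≡0 S b λ x _ e → b≰n (subst (_≤ n) e (size≤n x))))
    (trans (*-zeroʳ (n !)) (sym (trans (cong (chains S b *_) (k>n⇒nCk≡0 (≰⇒> b≰n))) (*-zeroʳ (chains S b)))))

∑-pos : ∀ {q} I → q < I → (g : Subset q → ℕ) → ∑S g ≡ ∑< I (λ i → ∑S (λ x → ⟦ at i x ⟧ * g x))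
∑-pos {q} I q<I g = trans (∑-cong (allSubsets q) λ x → sym (∑<-δ I (pos x) (λ _ → g x) (≤-<-trans (pos≤q x) q<I)))
  (∑-swap (allSubsets q) (range I) _)

binomial-decreasing : ∀ n b → n ∸ b ≤ suc b → n C suc b ≤ n C b
binomial-decreasing n b h = *-cancelˡ-≤ (suc b) (≤-trans (≤-reflexive (absorption n b)) (*-monoˡ-≤ (n C b) h))

module Upper (q n b₀ : ℕ) (sch : Schedule) (centred : n ∸ b₀ ≤ suc b₀)
  (gap : Gap sch (λ t → n C (b₀ + t))) (ratio : Ratio sch (λ t → n C (b₀ + t))) where

  open Schedule sch

  column height : Subset (q + n) → ℕ
  column y = pos (left q y)
  height y = size (right q y)

  -- A column consists of all left parts of one rank. A jump follows the symmetric chain of the left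
  -- part down to the rank of the new column while the right part shrinks, so inclusion is preserved
  -- in both factors.
  data Edge (y x : Subset (q + n)) : Set where
    vertical : left q x ≡ left q y → right q x ≼ right q y → height y ≡ suc (height x) →
      ¬ Jumping (column y) (height y ∸ b₀) → Edge y x
    jump : left q x ≡ prev^ (column y ∸ column x) (left q y) → right q x ≼ right q y → b₀ ≤ height x →
      Jumping (column y) (height y ∸ b₀) → Jump (column y) (height y ∸ b₀) (column x) (height x ∸ b₀) → Edge y x

  edge? : ∀ y x → Dec (Edge y x)
  edge? y x = map′
    (λ { (inj₁ (a , b , c , d)) → vertical a b c d ; (inj₂ (a , b , c , d , e)) → jump a b c d e })
    (λ { (vertical a b c d) → inj₁ (a , b , c , d) ; (jump a b c d e) → inj₂ (a , b , c , d , e) })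
    (((left q x ≡S? left q y) ×-dec ((right q x ≼? right q y) ×-dec ((height y ≟ℕ suc (height x)) ×-dec
       ¬? (jumping? (column y) (height y ∸ b₀))))) ⊎-dec
     ((left q x ≡S? prev^ (column y ∸ column x) (left q y)) ×-dec ((right q x ≼? right q y) ×-dec ((b₀ ≤? height x) ×-dec
       (jumping? (column y) (height y ∸ b₀) ×-dec jump? (column y) (height y ∸ b₀) (column x) (height x ∸ b₀))))))

  D : Subset (q + n) → Bool
  D y = does (b₀ <? height y)

  open Hall (λ y x → does (edge? y x))

  section : (Subset (q + n) → Bool) → Subset q → Subset n → Bool
  section S x₁ x₂ = S (x₁ V.++ x₂)

  -- Densities of the right sections, summed over the left parts of rank i. Jumps transport this
  -- quantity without loss: `prev^` is injective on the left and the normalized matching property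
  -- acts on the right.
  mass : (Subset (q + n) → Bool) → ℕ → ℕ → ℕ
  mass S i t = ∑S (λ x₁ → ⟦ at i x₁ ⟧ * chains (section S x₁) (b₀ + t))

  w : ℕ → ℕ
  w t = n C (b₀ + t)

  w-mono : ∀ t → w (suc t) ≤ w t
  w-mono t = subst (λ v → n C v ≤ w t) (sym (+-suc b₀ t)) (binomial-decreasing n (b₀ + t)
    (≤-trans (∸-monoʳ-≤ n (m≤m+n b₀ t)) (≤-trans centred (s≤s (m≤m+n b₀ t)))))

  jump-≤ : ∀ i t i' t' → Jumping i t → Jump i t i' t' → i' ≤ i × t' ≤ t
  jump-≤ i t i' t' (ZM≤i , _) (entry _ i'< e) = <⇒≤ (<-≤-trans i'< ZM≤i) , ≮⇒≥ λ t<t' →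
    <⇒≱ (≤-reflexive e) (/-monoˡ-≤ B (<⇒≤ t<t'))
  jump-≤ i t i' t' _ (cycle _ e l _) = ≮⇒≥ (λ i<i' → <⇒≱ (≤-reflexive e) (/-monoˡ-≤ M (<⇒≤ i<i'))) ,
    ≮⇒≥ (λ t<t' → <⇒≱ l (/-monoˡ-≤ B (<⇒≤ t<t')))

  module HallCondition (S : Subset (q + n) → Bool) (S⊆D : ∀ y → S y ≡ true → D y ≡ true) where

    edge⁺ : ∀ x y → S y ≡ true → Edge y x → N S x ≡ true
    edge⁺ x y s e = N⁺ S x y s (does⁺ (edge? y x) e)

    col-++ : ∀ (x₁ : Subset q) (x₂ : Subset n) → column (x₁ V.++ x₂) ≡ pos x₁
    col-++ x₁ x₂ = cong pos (left-++ x₁ x₂)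

    height-++ : ∀ (x₁ : Subset q) {x₂ : Subset n} {h} → size x₂ ≡ h → height (x₁ V.++ x₂) ≡ h
    height-++ x₁ {x₂} e = trans (cong size (right-++ x₁ x₂)) e

    vertical-≤ : ∀ i t → ¬ Jumping i (suc t) → mass S i (suc t) ≤ mass (N S) i t
    vertical-≤ i t ¬jmp = ∑-mono (allSubsets q) per
      where
      per : ∀ x₁ → ⟦ at i x₁ ⟧ * chains (section S x₁) (b₀ + suc t) ≤ ⟦ at i x₁ ⟧ * chains (section (N S) x₁) (b₀ + t)
      per x₁ with at i x₁ in ai
      ... | false = z≤n
      ... | true = +-monoˡ-≤ 0 (subst (λ v → chains (section S x₁) v ≤ chains (section (N S) x₁) (b₀ + t)) (sym (+-suc b₀ t))
          (chains-shadow₁ (section S x₁) (section (N S) x₁) (b₀ + t) λ x y p ey ex sy →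
            edge⁺ (x₁ V.++ x) (x₁ V.++ y) sy (vertical
              (trans (left-++ x₁ x) (sym (left-++ x₁ y)))
              (subst₂ _≼_ (sym (right-++ x₁ x)) (sym (right-++ x₁ y)) p)
              (trans (height-++ x₁ ey) (cong suc (sym (height-++ x₁ ex))))
              (λ jmp → ¬jmp (subst₂ Jumping (trans (col-++ x₁ y) (does⁻ (pos x₁ ≟ℕ i) ai))
                 (trans (cong (_∸ b₀) (trans (height-++ x₁ ey) (sym (+-suc b₀ t)))) (m+n∸m≡n b₀ (suc t))) jmp)))))

    jump-mass : ∀ i t i' t' → Jumping i t → Jump i t i' t' → mass S i t ≤ mass (N S) i' t'
    jump-mass i t i' t' jg jp = subst₂ (λ a b → mass S a b ≤ mass (N S) i' t') (m∸n+n≡m i'≤i) (m∸n+n≡m t'≤t) go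
      where
      i'≤i = proj₁ (jump-≤ i t i' t' jg jp)
      t'≤t = proj₂ (jump-≤ i t i' t' jg jp)
      d = i ∸ i'
      e = t ∸ t'
      go : mass S (d + i') (e + t') ≤ mass (N S) i' t'
      go = ≤-trans (∑-mono (allSubsets q) per) (∑-prev^ d i' (λ x₁ → chains (section (N S) x₁) (b₀ + t')))
        where
        per : ∀ y₁ → ⟦ at (d + i') y₁ ⟧ * chains (section S y₁) (b₀ + (e + t')) ≤ ⟦ at (d + i') y₁ ⟧ * chains (section (N S) (prev^ d y₁)) (b₀ + t')
        per y₁ with at (d + i') y₁ in ai
        ... | false = z≤n
        ... | true = +-monoˡ-≤ 0 (subst (λ v → chains (section S y₁) v ≤ chains (section (N S) (prev^ d y₁)) (b₀ + t'))
              (swap e b₀ t')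
              (chains-shadow (section S y₁) (section (N S) (prev^ d y₁)) (b₀ + t') e λ x y p ey ex sy →
                let py = does⁻ (pos y₁ ≟ℕ d + i') ai
                    cy : column (y₁ V.++ y) ≡ i
                    cy = trans (col-++ y₁ y) (trans py (m∸n+n≡m i'≤i))
                    cx : column (prev^ d y₁ V.++ x) ≡ i'
                    cx = trans (col-++ (prev^ d y₁) x) (pos-prev^ d y₁ i' py)
                    hx : height (prev^ d y₁ V.++ x) ≡ b₀ + t'
                    hx = height-++ (prev^ d y₁) ex
                    hy : height (y₁ V.++ y) ∸ b₀ ≡ t
                    hy = trans (cong (_∸ b₀) (trans (height-++ y₁ ey) (swap e b₀ t')))
                      (trans (m+n∸m≡n b₀ (e + t')) (m∸n+n≡m t'≤t))
                in edge⁺ (prev^ d y₁ V.++ x) (y₁ V.++ y) sy (jump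
                  (trans (left-++ (prev^ d y₁) x) (cong₂ (λ a b → prev^ a b) (sym (cong₂ _∸_ cy cx)) (sym (left-++ y₁ y))))
                  (subst₂ _≼_ (sym (right-++ (prev^ d y₁) x)) (sym (right-++ y₁ y)) p)
                  (≤-trans (m≤m+n b₀ t') (≤-reflexive (sym hx)))
                  (subst₂ Jumping (sym cy) (sym hy) jg)
                  (subst₂ (λ a b → Jump a b (column (prev^ d y₁ V.++ x)) (height (prev^ d y₁ V.++ x) ∸ b₀)) (sym cy) (sym hy)
                    (subst₂ (Jump i t) (sym cx) (sym (trans (cong (_∸ b₀) hx) (m+n∸m≡n b₀ t'))) jp)))))
          where
          swap : ∀ e b t → e + (b + t) ≡ b + (e + t)
          swap = solve-∀

    Y T TT I : ℕ
    -- Both bounds only need to cover everything: ranks are at most q and heights at most n.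
    Y = q
    T = suc n
    TT = J₁ * B + T
    I = (Z + suc Y) * M

    q<I : q < I
    q<I = ≤-trans (m≤n+m (suc q) Z) (m≤m*n (Z + suc q) M)

    module G = Grid sch (mass S) (mass (N S)) w w-mono gap ratio vertical-≤ jump-mass
    open G.Columns T using (demand; supply)

    total : ∀ R → n ! * ∑S (⟦_⟧ ∘ R) ≡ ∑S (λ x₁ → ∑< b₀ (λ b → n ! * cnt (section R x₁) b)) + ∑< I (λ i → ∑< TT (λ t → mass R i t * w t))
    total R = begin
      n ! * ∑S (⟦_⟧ ∘ R) ≡⟨ cong (n ! *_) (∑S-++ q (⟦_⟧ ∘ R)) ⟩
      n ! * ∑S (λ x₁ → ∑S (⟦_⟧ ∘ section R x₁)) ≡⟨ ∑-*ˡ (allSubsets q) (n !) _ ⟨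
      ∑S (λ x₁ → n ! * ∑S (⟦_⟧ ∘ section R x₁)) ≡⟨ ∑-cong (allSubsets q) (λ x₁ → trans (cong (n ! *_) (∑-cnt≥ (section R x₁) (b₀ + TT) big)) (trans (sym (∑-*ˡ (range (b₀ + TT)) (n !) _))
          (trans (∑<-split b₀ TT (λ b → n ! * cnt (section R x₁) b)) (cong (∑< b₀ (λ b → n ! * cnt (section R x₁) b) +_) (∑-cong (range TT) λ t → cnt-chains (section R x₁) (b₀ + t)))))) ⟩
      ∑S (λ x₁ → ∑< b₀ (λ b → n ! * cnt (section R x₁) b) + h x₁) ≡⟨ ∑-+ (allSubsets q) _ _ ⟩
      low + ∑S h ≡⟨ cong (low +_) (trans (∑-pos I q<I h) (∑-cong (range I) λ i → begin
         ∑S (λ x → ⟦ at i x ⟧ * h x) ≡⟨ ∑-cong (allSubsets q) (λ x → sym (∑-*ˡ (range TT) ⟦ at i x ⟧ _)) ⟩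
         ∑S (λ x → ∑< TT (λ t → ⟦ at i x ⟧ * (chains (section R x) (b₀ + t) * w t))) ≡⟨ ∑-swap (allSubsets q) (range TT) _ ⟩
         ∑< TT (λ t → ∑S (λ x → ⟦ at i x ⟧ * (chains (section R x) (b₀ + t) * w t))) ≡⟨ ∑-cong (range TT) (λ t → trans (∑-cong (allSubsets q) λ x → sym (*-assoc ⟦ at i x ⟧ (chains (section R x) (b₀ + t)) (w t))) (∑-*ʳ (allSubsets q) (w t) _)) ⟩
         ∑< TT (λ t → mass R i t * w t) ∎)) ⟩
      low + ∑< I (λ i → ∑< TT (λ t → mass R i t * w t)) ∎
      where
      open ≡-Reasoning
      h : Subset q → ℕ
      h x₁ = ∑< TT (λ t → chains (section R x₁) (b₀ + t) * w t)
      low = ∑S (λ x₁ → ∑< b₀ (λ b → n ! * cnt (section R x₁) b))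
      big : n < b₀ + TT
      big = ≤-trans (m≤n+m T (J₁ * B)) (m≤n+m TT b₀)

    empty : ∀ x₁ b → b ≤ b₀ → cnt (section S x₁) b ≡ 0
    empty x₁ b b≤ = cnt≡0 (section S x₁) b λ x s e → <⇒≱ (does⁻ (b₀ <? height (x₁ V.++ x)) (S⊆D (x₁ V.++ x) s))
      (≤-trans (≤-reflexive (height-++ x₁ e)) b≤)

    hall : ∑S (⟦_⟧ ∘ S) ≤ ∑S (⟦_⟧ ∘ N S)
    hall = *-cancelˡ-≤ (n !) {{n !≢0}} (begin
      n ! * ∑S (⟦_⟧ ∘ S) ≡⟨ total S ⟩
      ∑S (λ x₁ → ∑< b₀ (λ b → n ! * cnt (section S x₁) b)) + ∑< I (λ i → ∑< TT (λ t → mass S i t * w t))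
        ≡⟨ cong (_+ ∑< I (λ i → ∑< TT (λ t → mass S i t * w t))) (trans (∑-cong (allSubsets q) λ x₁ → trans (∑<-cong b₀ (λ b b< →
             trans (cong (n ! *_) (empty x₁ b (<⇒≤ b<))) (*-zeroʳ (n !)))) (∑-0 (range b₀))) (∑-0 (allSubsets q))) ⟩
      ∑< I (λ i → ∑< TT (λ t → mass S i t * w t)) ≤⟨ ∑-mono (range I) shift ⟩
      ∑< I demand ≤⟨ G.grid T Y ⟩
      ∑< I supply ≤⟨ m≤n+m _ _ ⟩
      ∑S (λ x₁ → ∑< b₀ (λ b → n ! * cnt (section (N S) x₁) b)) + ∑< I supply ≡⟨ total (N S) ⟨
      n ! * ∑S (⟦_⟧ ∘ N S) ∎)
      where
      open ≤-Reasoning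
      zero-mass : ∀ i → mass S i 0 ≡ 0
      zero-mass i = trans (∑-cong (allSubsets q) λ x₁ → trans (cong (λ v → ⟦ at i x₁ ⟧ * (v * ((b₀ + 0) ! * (n ∸ (b₀ + 0)) !)))
        (empty x₁ (b₀ + 0) (≤-reflexive (+-identityʳ b₀)))) (*-zeroʳ ⟦ at i x₁ ⟧)) (∑-0 (allSubsets q))
      -- `demand` starts one level higher, which loses nothing: no element of `S` has height `b₀`.
      shift : ∀ i → ∑< TT (λ t → mass S i t * w t) ≤ demand i
      shift i = ≤-trans (∑<-≤-index (λ t → mass S i t * w t) (n≤1+n TT)) (≤-reflexive (trans (∑<-suc TT (λ t → mass S i t * w t))
        (cong (_+ demand i) (cong (_* w 0) (zero-mass i)))))

  abstract
    upper-matching : Matching D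
    upper-matching = hall-matching D (λ S S⊆D → HallCondition.hall S S⊆D)

-- Chain partitions and their clique unions

-- Injectivity of `below` makes its orbits disjoint chains, each ending on level h. Levels may be
-- skipped, so position in a chain is measured by depth instead of size.
record ChainSystem (n h : ℕ) : Set where
  field
    below : Subset n → Subset n
    below-≼ : ∀ y → h < size y → below y ≼ y
    below-< : ∀ y → h < size y → size (below y) < size y
    below-≥ : ∀ y → h < size y → h ≤ size (below y)
    below-inj : ∀ y z → h < size y → h < size z → below y ≡ below z → y ≡ z

  walk : ℕ → Subset n → Subset n × ℕ
  walk zero y = y , 0
  walk (suc f) y with h <? size y
  ... | no _ = y , 0
  ... | yes _ = let r , d = walk f (below y) in r , suc d

  root : Subset n → Subset n
  root y = proj₁ (walk n y)

  depth : Subset n → ℕ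
  depth y = proj₂ (walk n y)

  data Chain : Subset n → Subset n → ℕ → Set where
    bottom : ∀ {y} → size y ≡ h → Chain y y 0
    step : ∀ {y r d} → h < size y → Chain (below y) r d → Chain y r (suc d)

  walk-chain : ∀ f y → h ≤ size y → size y ≤ f + h → Chain y (proj₁ (walk f y)) (proj₂ (walk f y))
  walk-chain zero y h≤ ≤f = bottom (≤-antisym ≤f h≤)
  walk-chain (suc f) y h≤ ≤f with h <? size y
  ... | no ≮ = bottom (≤-antisym (≮⇒≥ ≮) h≤)
  ... | yes l = step l (walk-chain f (below y) (below-≥ y l) (≤-pred (≤-trans (below-< y l) ≤f)))

  chain : ∀ y → h ≤ size y → Chain y (root y) (depth y)
  chain y h≤ = walk-chain n y h≤ (≤-trans (size≤n y) (m≤m+n n h))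

  chain-unique : ∀ {y r r' d d'} → Chain y r d → Chain y r' d' → r ≡ r' × d ≡ d'
  chain-unique (bottom e) (bottom _) = refl , refl
  chain-unique (bottom e) (step l _) = ⊥-elim (<-irrefl (sym e) l)
  chain-unique (step l _) (bottom e) = ⊥-elim (<-irrefl (sym e) l)
  chain-unique (step _ c) (step _ c') with chain-unique c c'
  ... | refl , refl = refl , refl

  chain-inj : ∀ {y z r d} → Chain y r d → Chain z r d → y ≡ z
  chain-inj (bottom _) (bottom _) = refl
  chain-inj (step l c) (step l' c') = below-inj _ _ l l' (chain-inj c c')

  chain-size : ∀ {y r d} → Chain y r d → d + h ≤ size y
  chain-size (bottom e) = ≤-reflexive (sym e)
  chain-size (step l c) = ≤-trans (s≤s (chain-size c)) (below-< _ l)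

  chain-root : ∀ {y r d} → Chain y r d → size r ≡ h × r ≼ y
  chain-root (bottom e) = e , ≼-refl
  chain-root (step l c) = let e , p = chain-root c in e , ≼-trans p (below-≼ _ l)

  chain-≼ : ∀ {y z r} d e → Chain y r d → Chain z r (e + d) → y ≼ z
  chain-≼ d zero c c' with chain-inj c c'
  ... | refl = ≼-refl
  chain-≼ d (suc e) c (step l c') = ≼-trans (chain-≼ d e c c') (below-≼ _ l)

  same-root : ∀ y z → h ≤ size y → h ≤ size z → root y ≡ root z → y ≼ z ⊎ z ≼ y
  same-root y z hy hz e with ≤-total (depth y) (depth z)
  ... | inj₁ l = inj₁ (chain-≼ (depth y) (depth z ∸ depth y) (chain y hy)
          (subst₂ (Chain z) (sym e) (sym (m∸n+n≡m l)) (chain z hz)))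
  ... | inj₂ l = inj₂ (chain-≼ (depth z) (depth y ∸ depth z) (chain z hz)
          (subst₂ (Chain y) e (sym (m∸n+n≡m l)) (chain y hy)))

  up : Subset n → Bool
  up x = does (h ≤? size x)

  up⁻ : ∀ x → up x ≡ true → h ≤ size x
  up⁻ x = does⁻ (h ≤? size x)

  linked : Subset n → Subset n → Bool
  linked x r = up x ∧ does (root x ≡S? r)

  -- The sum of the squared chain lengths, which controls the edges of the clique union.
  pairs : ℕ
  pairs = ∑S λ r → ∑S (λ x → ⟦ linked x r ⟧) * ∑S (λ x → ⟦ linked x r ⟧)

  linked⁻ : ∀ x r → linked x r ≡ true → h ≤ size x × root x ≡ r
  linked⁻ x r e = let a , b = ∧-elim {up x} e in up⁻ x a , does⁻ (root x ≡S? r) b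

  shallow : ∀ r m (Q : Subset n → Bool) → (∀ x → Q x ≡ true → h ≤ size x × root x ≡ r × depth x < m) → ∑S (⟦_⟧ ∘ Q) ≤ m
  shallow r m Q hyp = begin
    ∑S (⟦_⟧ ∘ Q) ≤⟨ ∑-mono (allSubsets n) split ⟩
    ∑S (λ x → ∑< m (λ d → ⟦ Q x ∧ does (depth x ≟ℕ d) ⟧)) ≡⟨ ∑-swap (allSubsets n) (range m) _ ⟩
    ∑< m (λ d → ∑S (λ x → ⟦ Q x ∧ does (depth x ≟ℕ d) ⟧)) ≤⟨ ∑-mono (range m) (λ d → ∑S-unique (λ x → Q x ∧ does (depth x ≟ℕ d)) (uniq d)) ⟩
    ∑< m (λ _ → 1) ≡⟨ ∑<-const m 1 ⟩
    m * 1 ≡⟨ *-identityʳ m ⟩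
    m ∎
    where
    open ≤-Reasoning
    split : ∀ x → ⟦ Q x ⟧ ≤ ∑< m (λ d → ⟦ Q x ∧ does (depth x ≟ℕ d) ⟧)
    split x with Q x in Qx
    ... | false = z≤n
    ... | true = ≤-reflexive (sym (trans (∑-cong (range m) λ d → sym (*-identityʳ _)) (∑<-δ m (depth x) (λ _ → 1) (proj₂ (proj₂ (hyp x Qx))))))
    uniq : ∀ d y z → Q y ∧ does (depth y ≟ℕ d) ≡ true → Q z ∧ does (depth z ≟ℕ d) ≡ true → y ≡ z
    uniq d y z ey ez =
      let qy , dy = ∧-elim {Q y} ey ; qz , dz = ∧-elim {Q z} ez
          hy , ry , _ = hyp y qy ; hz , rz , _ = hyp z qz
      in chain-inj (subst₂ (Chain y) ry (does⁻ (depth y ≟ℕ d) dy) (chain y hy))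
                   (subst₂ (Chain z) rz (does⁻ (depth z ≟ℕ d) dz) (chain z hz))

  -- Below level `L`, a chain has at most g elements if its root is good and at most G in any case.
  -- A pair reaching level `L` is charged to its larger element x, whose chain has at most |x| - h +
  -- 1 elements of size up to |x|.
  module Bound (bad : Subset n → Bool) (g G L : ℕ)
    (good-depth : ∀ x → h ≤ size x → size x < L → bad (root x) ≡ false → depth x < g)
    (any-depth : ∀ x → h ≤ size x → size x < L → depth x < G) where

    near far : Subset n → Bool
    near x = does (size x <? L)
    far x = does (L ≤? size x)

    nearby : Subset n → ℕ
    nearby r = ∑S (λ x → ⟦ linked x r ∧ near x ⟧)

    nearby² : ∀ r → nearby r * nearby r ≤ ⟦ does (size r ≟ℕ h) ⟧ * (g * g) + ⟦ bad r ⟧ * (G * G)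
    nearby² r with bad r in br
    ... | true = ≤-trans (*-mono-≤ G-bound G-bound) (≤-trans (≤-reflexive (sym (*-identityˡ (G * G)))) (m≤n+m (1 * (G * G)) (⟦ does (size r ≟ℕ h) ⟧ * (g * g))))
      where
      G-bound : nearby r ≤ G
      G-bound = shallow r G (λ x → linked x r ∧ near x) λ x e →
        let a , b = ∧-elim {linked x r} e ; c , d = linked⁻ x r a in c , d , any-depth x c (does⁻ (size x <? L) b)
    ... | false with does (size r ≟ℕ h) in sr
    ...   | true = ≤-trans (*-mono-≤ g-bound g-bound) (≤-trans (≤-reflexive (sym (*-identityˡ (g * g)))) (m≤m+n (1 * (g * g)) 0))
      where
      g-bound : nearby r ≤ g
      g-bound = shallow r g (λ x → linked x r ∧ near x) λ x e →
        let a , b = ∧-elim {linked x r} e ; c , d = linked⁻ x r a in c , d ,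
          good-depth x c (does⁻ (size x <? L) b) (trans (cong bad d) br)
    ...   | false = ≤-trans (*-mono-≤ none none) z≤n
      where
      none : nearby r ≤ 0
      none = shallow r 0 (λ x → linked x r ∧ near x) λ x e →
        let a , b = ∧-elim {linked x r} e ; c , d = linked⁻ x r a in
        ⊥-elim (true≢false (does⁺ (size r ≟ℕ h) (trans (cong size (sym d)) (proj₁ (chain-root (chain x c))))) sr)

    tail : ℕ
    tail = ∑S (λ x → ⟦ far x ⟧ * suc (size x ∸ h))

    far-part : ∑S (λ r → ∑S (λ x → ∑S (λ y → ⟦ linked x r ∧ (linked y r ∧ (far x ∧ does (size y ≤? size x))) ⟧))) ≤ tail
    far-part = begin
      ∑S (λ r → ∑S (λ x → ∑S (λ y → ⟦ linked x r ∧ (linked y r ∧ (far x ∧ does (size y ≤? size x))) ⟧)))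
        ≤⟨ ∑-mono (allSubsets n) (λ r → ∑-mono (allSubsets n) λ x → per r x) ⟩
      ∑S (λ r → ∑S (λ x → ⟦ does (root x ≡S? r) ⟧ * (⟦ far x ⟧ * suc (size x ∸ h)))) ≡⟨ ∑-swap (allSubsets n) (allSubsets n) _ ⟩
      ∑S (λ x → ∑S (λ r → ⟦ does (root x ≡S? r) ⟧ * (⟦ far x ⟧ * suc (size x ∸ h)))) ≡⟨ ∑-cong (allSubsets n) (λ x →
          ∑S-δ (root x) (λ _ → ⟦ far x ⟧ * suc (size x ∸ h))) ⟩
      tail ∎
      where
      open ≤-Reasoning
      F : Subset n → Subset n → Subset n → Bool
      F r x y = linked x r ∧ (linked y r ∧ (far x ∧ does (size y ≤? size x)))
      F⁻ : ∀ r x y → F r x y ≡ true → (h ≤ size x × root x ≡ r) × (h ≤ size y × root y ≡ r) × far x ≡ true × size y ≤ size x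
      F⁻ r x y e = let a , b = ∧-elim {linked x r} e ; c , d = ∧-elim {linked y r} b ; f , i = ∧-elim {far x} d in
        linked⁻ x r a , linked⁻ y r c , f , does⁻ (size y ≤? size x) i
      per : ∀ r x → ∑S (λ y → ⟦ F r x y ⟧) ≤ ⟦ does (root x ≡S? r) ⟧ * (⟦ far x ⟧ * suc (size x ∸ h))
      per r x = shallow r _ (F r x) λ y e → let (hx , rx) , (hy , ry) , fx , le = F⁻ r x y e in hy , ry ,
        subst (depth y <_) (sym (trans (cong₂ (λ a b → ⟦ a ⟧ * (⟦ b ⟧ * suc (size x ∸ h))) (does⁺ (root x ≡S? r) rx) fx)
          (trans (*-identityˡ _) (*-identityˡ _))))
          (s≤s (≤-trans (≤-trans (≤-reflexive (sym (m+n∸n≡m (depth y) h))) (∸-monoˡ-≤ h (chain-size (chain y hy)))) (∸-monoˡ-≤ h le)))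

    pairs-bound : pairs ≤ (n C h) * (g * g) + ∑S (⟦_⟧ ∘ bad) * (G * G) + 2 * tail
    pairs-bound = begin
      pairs ≡⟨ ∑-cong (allSubsets n) (λ r → square (λ x → linked x r)) ⟩
      ∑S (λ r → ∑S (λ x → ∑S (λ y → ⟦ linked x r ⟧ * ⟦ linked y r ⟧))) ≤⟨ ∑-mono (allSubsets n) (λ r → ∑-mono (allSubsets n) λ x → ∑-mono (allSubsets n) λ y → cases r x y) ⟩
      ∑S (λ r → ∑S (λ x → ∑S (λ y → ⟦ nr x r ⟧ * ⟦ nr y r ⟧ + (⟦ F r x y ⟧ + ⟦ F r y x ⟧)))) ≡⟨ ∑-cong (allSubsets n) (λ r → trans (∑-cong (allSubsets n) λ x → trans (∑-+ (allSubsets n) _ _) (cong (∑S (λ y → ⟦ nr x r ⟧ * ⟦ nr y r ⟧) +_) (∑-+ (allSubsets n) _ _)))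
          (trans (∑-+ (allSubsets n) _ _) (cong₂ _+_ (sym (square (λ x → nr x r))) (∑-+ (allSubsets n) _ _)))) ⟩
      ∑S (λ r → nearby r * nearby r + (∑S (λ x → ∑S (λ y → ⟦ F r x y ⟧)) + ∑S (λ x → ∑S (λ y → ⟦ F r y x ⟧)))) ≡⟨ trans (∑-+ (allSubsets n) _ _) (cong (∑S (λ r → nearby r * nearby r) +_)
          (trans (∑-+ (allSubsets n) _ _) (cong (FF +_) (∑-cong (allSubsets n) λ r → ∑-swap (allSubsets n) (allSubsets n) _)))) ⟩
      ∑S (λ r → nearby r * nearby r) + (FF + FF) ≤⟨ +-mono-≤ (∑-mono (allSubsets n) nearby²) (+-mono-≤ far-part far-part) ⟩
      ∑S (λ r → ⟦ does (size r ≟ℕ h) ⟧ * (g * g) + ⟦ bad r ⟧ * (G * G)) + (tail + tail) ≡⟨ cong₂ _+_ (trans (∑-+ (allSubsets n) _ _)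
          (cong₂ _+_ (trans (∑-*ʳ (allSubsets n) (g * g) _) (cong (_* (g * g)) (level-count n h))) (∑-*ʳ (allSubsets n) (G * G) _)))
          (cong (tail +_) (sym (+-identityʳ tail))) ⟩
      (n C h) * (g * g) + ∑S (⟦_⟧ ∘ bad) * (G * G) + 2 * tail ∎
      where
      open ≤-Reasoning
      nr : Subset n → Subset n → Bool
      nr x r = linked x r ∧ near x
      F : Subset n → Subset n → Subset n → Bool
      F r x y = linked x r ∧ (linked y r ∧ (far x ∧ does (size y ≤? size x)))
      FF = ∑S (λ r → ∑S (λ x → ∑S (λ y → ⟦ F r x y ⟧)))
      square : ∀ (a : Subset n → Bool) → ∑S (⟦_⟧ ∘ a) * ∑S (⟦_⟧ ∘ a) ≡ ∑S (λ x → ∑S (λ y → ⟦ a x ⟧ * ⟦ a y ⟧))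
      square a = sym (trans (∑-cong (allSubsets n) λ x → ∑-*ˡ (allSubsets n) ⟦ a x ⟧ _) (∑-*ʳ (allSubsets n) _ _))
      cases : ∀ r x y → ⟦ linked x r ⟧ * ⟦ linked y r ⟧ ≤ ⟦ nr x r ⟧ * ⟦ nr y r ⟧ + (⟦ F r x y ⟧ + ⟦ F r y x ⟧)
      cases r x y with linked x r | linked y r
      ... | false | _ = z≤n
      ... | true | false = z≤n
      ... | true | true with ≤-total (size x) (size y)
      ...   | inj₁ x≤y = case size y <? L of λ
              { (yes l) → subst₂ (λ u v → 1 ≤ ⟦ u ⟧ * ⟦ v ⟧ + (⟦ far x ∧ does (size y ≤? size x) ⟧ + ⟦ far y ∧ does (size x ≤? size y) ⟧))
                  (sym (does⁺ (size x <? L) (≤-<-trans x≤y l))) (sym (does⁺ (size y <? L) l)) (s≤s z≤n)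
              ; (no l) → ≤-trans (≤-reflexive (cong ⟦_⟧ (sym (∧-intro (does⁺ (L ≤? size y) (≮⇒≥ l)) (does⁺ (size x ≤? size y) x≤y)))))
                  (≤-trans (m≤n+m _ ⟦ far x ∧ does (size y ≤? size x) ⟧) (m≤n+m _ (⟦ near x ⟧ * ⟦ near y ⟧))) }
      ...   | inj₂ y≤x = case size x <? L of λ
              { (yes l) → subst₂ (λ u v → 1 ≤ ⟦ u ⟧ * ⟦ v ⟧ + (⟦ far x ∧ does (size y ≤? size x) ⟧ + ⟦ far y ∧ does (size x ≤? size y) ⟧))
                  (sym (does⁺ (size x <? L) l)) (sym (does⁺ (size y <? L) (≤-<-trans y≤x l))) (s≤s z≤n)
              ; (no l) → ≤-trans (≤-reflexive (cong ⟦_⟧ (sym (∧-intro (does⁺ (L ≤? size x) (≮⇒≥ l)) (does⁺ (size y ≤? size x) y≤x)))))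
                  (≤-trans (m≤m+n _ ⟦ far y ∧ does (size x ≤? size y) ⟧) (m≤n+m _ (⟦ near x ⟧ * ⟦ near y ⟧))) }

-- The chain system above the middle

size-split : ∀ q {n} (y : Subset (q + n)) → size y ≡ size (left q y) + size (right q y)
size-split q y = trans (cong size (sym (left++right q y))) (size-++ (left q y) (right q y))

≼-split : ∀ q {n} {x y : Subset (q + n)} → left q x ≼ left q y → right q x ≼ right q y → x ≼ y
≼-split q {x = x} {y} a b = subst₂ _≼_ (left++right q x) (left++right q y) (≼-++ a b)

module UpperHalf (q n h : ℕ) (sch : Schedule) (h-mid : q + n ≤ suc (2 * h))
  (gap : Gap sch (λ t → n C (h + q + t))) (ratio : Ratio sch (λ t → n C (h + q + t))) where

  open Schedule sch

  -- Raised by q so that a set of size above `b₀` has height above h even if its left part is full.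
  -- The right part then lies above its own middle and can be lowered alone (`tall`).
  b₀ : ℕ
  b₀ = h + q

  centred : n ∸ b₀ ≤ suc b₀
  centred = m≤n+o⇒m∸n≤o n b₀ (≤-trans (m≤n+m n q) (≤-trans h-mid
    (≤-trans (≤-reflexive (double h)) (+-mono-≤ (m≤m+n h q) (s≤s (m≤m+n h q))))))
    where
    double : ∀ h → suc (h + (h + 0)) ≡ h + suc h
    double = solve-∀

  module U = Upper q n b₀ sch centred gap ratio
  open U using (column; height; Edge; vertical; jump)
  open Hall.Matching U.upper-matching

  open LowerCover (lowerCover (q + n)) using (lower; lower-≼; lower-size; lower-inj)
  module R = LowerCover (lowerCover n)

  above-mid : ∀ {m} → h < m → q + n < 2 * m
  above-mid {m} h<m = ≤-trans (s≤s h-mid) (≤-trans (≤-reflexive (lem h)) (*-monoʳ-≤ 2 h<m))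
    where
    lem : ∀ h → suc (suc (h + (h + 0))) ≡ suc h + (suc h + 0)
    lem = solve-∀

  tall : ∀ y → b₀ < size y → n < 2 * height y
  tall y l = <-≤-trans (s≤s (≤-trans (m≤n+m n q) h-mid)) (≤-trans (≤-reflexive (lem h)) (*-monoʳ-≤ 2 h<height))
    where
    lem : ∀ h → suc (suc (h + (h + 0))) ≡ suc h + (suc h + 0)
    lem = solve-∀
    h<height : h < height y
    h<height = +-cancelʳ-< q h (height y) (<-≤-trans l (≤-trans (≤-reflexive (trans (size-split q y) (+-comm (size (left q y)) _)))
      (+-monoʳ-≤ (height y) (size≤n (left q y)))))

  -- The images of the three zones are disjoint: size less than `b₀`; size at least `b₀` but height
  -- less than `b₀`; height at least `b₀`. Injectivity can thus be checked in each zone.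
  below : Subset (q + n) → Subset (q + n)
  below y with b₀ <? size y | b₀ <? height y
  ... | no _ | _ = lower y
  ... | yes _ | no _ = left q y V.++ R.lower (right q y)
  ... | yes _ | yes _ = partner y

  partner-edge : ∀ y → b₀ < height y → Edge y (partner y)
  partner-edge y l = does⁻ (U.edge? y (partner y)) (compatible y (does⁺ (b₀ <? height y) l))

  edge-≼ : ∀ {y x} → Edge y x → x ≼ y
  edge-≼ {y} {x} (vertical a b _ _) = ≼-split q (subst (_≼ left q y) (sym a) ≼-refl) b
  edge-≼ {y} {x} (jump a b _ _ _) = ≼-split q (subst (_≼ left q y) (sym a) (prev^-≼ (column y ∸ column x) (left q y))) b

  edge-< : ∀ {y x} → Edge y x → height x < height y
  edge-< (vertical _ _ e _) = ≤-reflexive (sym e)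
  edge-< {y} {x} (jump _ _ b≤ jg jp) = ≰⇒> λ y≤x → no-rise jp (∸-monoˡ-≤ b₀ y≤x)
    where
    no-rise : ∀ {i t i' t'} → Jump i t i' t' → t ≤ t' → ⊥
    no-rise (entry _ _ e) t≤ = <⇒≱ (≤-reflexive e) (/-monoˡ-≤ B t≤)
    no-rise (cycle _ _ l _) t≤ = <⇒≱ l (/-monoˡ-≤ B t≤)

  edge-≥ : ∀ {y x} → b₀ < height y → Edge y x → b₀ ≤ height x
  edge-≥ l (vertical _ _ e _) = ≤-pred (≤-trans l (≤-reflexive e))
  edge-≥ l (jump _ _ b≤ _ _) = b≤

  height≤size : ∀ y → height y ≤ size y
  height≤size y = ≤-trans (m≤n+m _ (size (left q y))) (≤-reflexive (sym (size-split q y)))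

  edge-size : ∀ {y x} → Edge y x → size x < size y
  edge-size {y} {x} e = ≤∧≢⇒< (size-mono (edge-≼ e)) λ eq →
    <-irrefl (cong height (≼-size-≡ (edge-≼ e) eq)) (edge-< e)

  side-size : ∀ y → b₀ < size y → suc (size (left q y V.++ R.lower (right q y))) ≡ size y
  side-size y l = trans (cong suc (size-++ (left q y) _)) (trans (sym (+-suc (size (left q y)) _))
    (trans (cong (size (left q y) +_) (R.lower-size (right q y) (tall y l))) (sym (size-split q y))))

  system : ChainSystem (q + n) h
  system = record { below = below ; below-≼ = b≼ ; below-< = b< ; below-≥ = b≥ ; below-inj = binj }
    where
    b≼ : ∀ y → h < size y → below y ≼ y
    b≼ y l with b₀ <? size y | b₀ <? height y
    ... | no _ | _ = lower-≼ y (above-mid l)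
    ... | yes a | no _ = ≼-split q (subst (_≼ left q y) (sym (left-++ (left q y) _)) ≼-refl)
            (subst (_≼ right q y) (sym (right-++ (left q y) _)) (R.lower-≼ (right q y) (tall y a)))
    ... | yes _ | yes b = edge-≼ (partner-edge y b)
    b< : ∀ y → h < size y → size (below y) < size y
    b< y l with b₀ <? size y | b₀ <? height y
    ... | no _ | _ = ≤-reflexive (lower-size y (above-mid l))
    ... | yes a | no _ = ≤-reflexive (side-size y a)
    ... | yes _ | yes b = edge-size (partner-edge y b)
    b≥ : ∀ y → h < size y → h ≤ size (below y)
    b≥ y l with b₀ <? size y | b₀ <? height y
    ... | no _ | _ = ≤-pred (≤-trans l (≤-reflexive (sym (lower-size y (above-mid l)))))
    ... | yes a | no _ = ≤-pred (≤-trans l (≤-reflexive (sym (side-size y a))))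
    ... | yes _ | yes b = ≤-trans (m≤m+n h q) (≤-trans (edge-≥ b (partner-edge y b)) (height≤size _))
    low-size : ∀ y → h < size y → ¬ b₀ < size y → size (lower y) < b₀
    low-size y l a = <-≤-trans (≤-reflexive (lower-size y (above-mid l))) (≮⇒≥ a)
    mid-size : ∀ y → b₀ < size y → b₀ ≤ size (left q y V.++ R.lower (right q y))
    mid-size y a = ≤-pred (≤-trans a (≤-reflexive (sym (side-size y a))))
    mid-height : ∀ y → b₀ < size y → ¬ b₀ < height y → height (left q y V.++ R.lower (right q y)) < b₀
    mid-height y a b = <-≤-trans (≤-reflexive (trans (cong (suc ∘ size) (right-++ (left q y) _)) (R.lower-size (right q y) (tall y a)))) (≮⇒≥ b)
    high-size : ∀ y → b₀ < height y → b₀ ≤ size (partner y)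
    high-size y b = ≤-trans (edge-≥ b (partner-edge y b)) (height≤size _)
    binj : ∀ y z → h < size y → h < size z → below y ≡ below z → y ≡ z
    binj y z ly lz e with b₀ <? size y | b₀ <? height y | b₀ <? size z | b₀ <? height z
    ... | no _ | _ | no _ | _ = lower-inj y z (above-mid ly) (above-mid lz) e
    ... | no a | _ | yes a' | no b' = ⊥-elim (<⇒≱ (low-size y ly a) (subst (b₀ ≤_) (cong size (sym e)) (mid-size z a')))
    ... | no a | _ | yes a' | yes b' = ⊥-elim (<⇒≱ (low-size y ly a) (subst (b₀ ≤_) (cong size (sym e)) (high-size z b')))
    ... | yes a | no b | no a' | _ = ⊥-elim (<⇒≱ (low-size z lz a') (subst (b₀ ≤_) (cong size e) (mid-size y a)))
    ... | yes a | yes b | no a' | _ = ⊥-elim (<⇒≱ (low-size z lz a') (subst (b₀ ≤_) (cong size e) (high-size y b)))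
    ... | yes a | no b | yes a' | yes b' = ⊥-elim (<⇒≱ (mid-height y a b) (subst (b₀ ≤_) (cong height (sym e)) (edge-≥ b' (partner-edge z b'))))
    ... | yes a | yes b | yes a' | no b' = ⊥-elim (<⇒≱ (mid-height z a' b') (subst (b₀ ≤_) (cong height e) (edge-≥ b (partner-edge y b))))
    ... | yes a | yes b | yes a' | yes b' = injective y z (does⁺ (b₀ <? height y) b) (does⁺ (b₀ <? height z) b') e
    ... | yes a | no b | yes a' | no b' = trans (sym (left++right q y)) (trans (cong₂ V._++_ lefts
             (R.lower-inj (right q y) (right q z) (tall y a) (tall z a') rights)) (left++right q z))
      where
      lefts : left q y ≡ left q z
      lefts = trans (sym (left-++ (left q y) _)) (trans (cong (left q) e) (left-++ (left q z) _))
      rights : R.lower (right q y) ≡ R.lower (right q z)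
      rights = trans (sym (right-++ (left q y) _)) (trans (cong (right q) e) (right-++ (left q z) _))

  open ChainSystem system hiding (below)

  -- The places where a chain may leave the scheduled levels in an early column. Only chains
  -- avoiding them obey the short length bound.
  anchor : Subset (q + n) → Bool
  anchor w = does (height w ≟ℕ b₀) ∧ does (column w <? suc Z * M)

  bad? : ∀ r → Dec (∃ λ w → anchor w ∧ does (root w ≡S? r) ≡ true)
  bad? r = anySubset? (λ w → anchor w ∧ does (root w ≡S? r) Data.Bool.≟ true)

  bad : Subset (q + n) → Bool
  bad r = does (bad? r)

  early : ℕ
  early = ∑S {q} (λ x → ⟦ does (pos x <? suc Z * M) ⟧)

  few-bad : ∑S (⟦_⟧ ∘ bad) ≤ early * (n C b₀)
  few-bad = begin
    ∑S (⟦_⟧ ∘ bad) ≤⟨ ∑-mono (allSubsets (q + n)) pointwise ⟩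
    ∑S (λ r → ∑S (λ w → ⟦ anchor w ∧ does (root w ≡S? r) ⟧)) ≡⟨ ∑-swap (allSubsets (q + n)) (allSubsets (q + n)) _ ⟩
    ∑S (λ w → ∑S (λ r → ⟦ anchor w ∧ does (root w ≡S? r) ⟧)) ≡⟨ ∑-cong (allSubsets (q + n)) (λ w → trans (∑-cong (allSubsets (q + n)) λ r → ⟦∧⟧ (anchor w) _)
        (trans (∑-*ˡ (allSubsets (q + n)) ⟦ anchor w ⟧ _) (trans (cong (⟦ anchor w ⟧ *_) (∑S-δ1 (root w))) (*-identityʳ _)))) ⟩
    ∑S (λ w → ⟦ anchor w ⟧) ≡⟨ ∑S-++ q (⟦_⟧ ∘ anchor) ⟩
    ∑S {q} (λ x → ∑S {n} (λ y → ⟦ anchor (x V.++ y) ⟧)) ≡⟨ ∑-cong (allSubsets q) (λ x → trans (∑-cong (allSubsets n) λ y →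
        trans (⟦∧⟧ (does (height (x V.++ y) ≟ℕ b₀)) _) (cong₂ (λ a b → ⟦ does (size a ≟ℕ b₀) ⟧ * ⟦ does (pos b <? suc Z * M) ⟧) (right-++ x y) (left-++ x y)))
        (∑-*ʳ (allSubsets n) ⟦ does (pos x <? suc Z * M) ⟧ _)) ⟩
    ∑S {q} (λ x → ∑S {n} (λ y → ⟦ does (size y ≟ℕ b₀) ⟧) * ⟦ does (pos x <? suc Z * M) ⟧) ≡⟨ trans (∑-*ˡ (allSubsets q) (∑S {n} (λ y → ⟦ does (size y ≟ℕ b₀) ⟧)) (λ x → ⟦ does (pos x <? suc Z * M) ⟧)) (trans (cong (_* early) (level-count n b₀)) (*-comm (n C b₀) early)) ⟩
    early * (n C b₀) ∎
    where
    open ≤-Reasoning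
    pointwise : ∀ r → ⟦ bad r ⟧ ≤ ∑S (λ w → ⟦ anchor w ∧ does (root w ≡S? r) ⟧)
    pointwise r with bad? r
    ... | no _ = z≤n
    ... | yes (w , e) = ≤-trans (≤-reflexive (cong ⟦_⟧ (sym e))) (∑S-pos (λ w → ⟦ anchor w ∧ does (root w ≡S? r) ⟧) w)

  J : ℕ
  J = suc J₁

  rounds : .{{NonZero Lb}} → ℕ
  rounds = K J / Lb

  module Depth {{_ : NonZero Lb}} where
    t : Subset (q + n) → ℕ
    t x = height x ∸ b₀

    -- A potential above the depth: 2q for the levels without schedule, B for every full `Lb` in the
    -- number of the cell, and the offset within the block.
    ρ : Subset (q + n) → ℕ
    ρ x = 2 * q + (B * (position (t x / B) (column x % M) / Lb) + t x % B)

    next : ∀ t → ¬ (suc t % B ≡ 0 × 0 < suc t / B) → suc t / B ≡ t / B × suc t % B ≡ suc (t % B)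
    next t ¬start with suc (t % B) <? B
    ... | yes l = trans (cong (_/ B) eq) (/-block (t / B) B _ l) , trans (cong (_% B) eq) (%-block (t / B) B _ l)
      where
      eq : suc t ≡ t / B * B + suc (t % B)
      eq = trans (cong suc (trans (m≡m%n+[m/n]*n t B) (+-comm (t % B) _))) (sym (+-suc _ (t % B)))
    ... | no ≮ = ⊥-elim (¬start (trans (cong (_% B) eq) (%-block (suc (t / B)) B 0 z<s) ,
            subst (0 <_) (sym (trans (cong (_/ B) eq) (/-block (suc (t / B)) B 0 z<s))) z<s))
      where
      eq : suc t ≡ suc (t / B) * B + 0
      eq = trans (cong suc (m≡m%n+[m/n]*n t B)) (trans (cong (_+ t / B * B) (≤-antisym (m%n<n t B) (≮⇒≥ ≮))) (sym (+-identityʳ _)))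

    -- A vertical edge lowers the offset by one. A cycle lowers the number by `Lb`, hence the
    -- quotient by one, and the B lost outweighs any new offset. Columns do not decrease upwards, so
    -- an entry cannot occur here.
    edge-ρ : ∀ {y x} → height y < b₀ + J * B → b₀ < height y → suc Z * M ≤ column x → Edge y x →
      suc Z * M ≤ column y × ρ x < ρ y
    edge-ρ {y} {x} near high early≤ (vertical a _ e ¬jg) = subst (suc Z * M ≤_) same early≤ ,
      ≤-reflexive (trans (sym (trans (cong (2 * q +_) (+-suc _ (t x % B))) (+-suc (2 * q) _)))
        (cong (2 * q +_) (cong₂ _+_ (cong (B *_) (cong (_/ Lb) (cong₂ position (sym (trans (cong (_/ B) ty) quotient)) (cong (_% M) same))))
          (sym (trans (cong (_% B) ty) remainder)))))
      where
      same : column x ≡ column y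
      same = cong pos a
      ty : t y ≡ suc (t x)
      ty = trans (cong (_∸ b₀) e) (+-∸-assoc 1 (≤-pred (≤-trans high (≤-reflexive e))))
      small : t y / B ≤ J₁
      small = ≤-pred (m<n*o⇒m/o<n (≤-trans (≤-reflexive (sym (+-∸-assoc 1 (<⇒≤ high)))) (≤-trans (∸-monoˡ-≤ b₀ near) (≤-reflexive (m+n∸m≡n b₀ (J * B))))))
      ¬start : ¬ (suc (t x) % B ≡ 0 × 0 < suc (t x) / B)
      ¬start (z , p) = ¬jg (≤-trans (m≤n+m (Z * M) M) (subst (suc Z * M ≤_) same early≤) , trans (cong (_% B) ty) z , subst (λ v → 0 < v / B) (sym ty) p , small)
      quotient = proj₁ (next (t x) ¬start)
      remainder = proj₂ (next (t x) ¬start)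
    edge-ρ {y} {x} near high early≤ (jump _ _ _ jg jp) = late , +-monoʳ-< (2 * q) (descend jp)
      where
      late : suc Z * M ≤ column y
      late = ≤-trans early≤ (proj₁ (U.jump-≤ _ _ _ _ jg jp))
      px = position (t x / B) (column x % M)
      py = position (t y / B) (column y % M)
      descend : Jump (column y) (t y) (column x) (t x) → B * (px / Lb) + t x % B < B * (py / Lb) + t y % B
      descend (entry l _ _) = ⊥-elim (<⇒≱ l late)
      descend (cycle _ _ _ e) = <-≤-trans (+-monoʳ-< (B * (px / Lb)) (m%n<n (t x) B)) (≤-trans (≤-reflexive (begin
        B * (px / Lb) + B ≡⟨ +-comm (B * (px / Lb)) B ⟩
        B + B * (px / Lb) ≡⟨ *-suc B (px / Lb) ⟨
        B * suc (px / Lb) ≡⟨ cong (B *_) (sym (trans (cong (_/ Lb) (trans (sym e) (+-comm px Lb))) (m+n/m≡1+n/m Lb px))) ⟩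
        B * (py / Lb) ∎)) (m≤m+n _ (t y % B)))
        where
        open ≡-Reasoning
        m+n/m≡1+n/m : ∀ m n .{{_ : NonZero m}} → (m + n) / m ≡ suc (n / m)
        m+n/m≡1+n/m m n = trans (m/n≡1+[m∸n]/n (m≤m+n m n)) (cong (λ v → suc (v / m)) (m+n∸m≡n m n))
          where open import Data.Nat.DivMod using (m/n≡1+[m∸n]/n)

    shallow-base : ∀ x → h ≤ size x → height x ≤ b₀ → depth x ≤ 2 * q
    shallow-base x hx hb = +-cancelʳ-≤ h _ _ (≤-trans (chain-size (chain x hx)) (≤-trans (≤-reflexive (size-split q x))
      (≤-trans (+-mono-≤ (size≤n (left q x)) hb) (≤-reflexive (lem q h)))))
      where
      lem : ∀ q h → q + (h + q) ≡ 2 * q + h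
      lem = solve-∀

    below-high : ∀ y → b₀ < height y → below y ≡ partner y
    below-high y l with b₀ <? size y | b₀ <? height y
    ... | no a | _ = ⊥-elim (a (<-≤-trans l (height≤size y)))
    ... | yes _ | no b = ⊥-elim (b l)
    ... | yes _ | yes _ = refl

    -- Induction up the chain from its element of height `b₀`. In an early column that element would
    -- be an anchor and the root bad; lateness then persists upwards.
    depth-ρ : ∀ {x r d} → Chain x r d → b₀ ≤ height x → height x < b₀ + J * B → bad r ≡ false →
      suc Z * M ≤ column x × d ≤ ρ x
    depth-ρ {x} {r} {d} c low near good with b₀ <? height x
    ... | no ≮ = ≮⇒≥ (λ early< → true≢false (does⁺ (bad? r) (x , ∧-intro
              (∧-intro (does⁺ (height x ≟ℕ b₀) (≤-antisym (≮⇒≥ ≮) low)) (does⁺ (column x <? suc Z * M) early<))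
              (does⁺ (root x ≡S? r) (proj₁ same)))) good) ,
            ≤-trans (subst (_≤ 2 * q) (proj₂ same) (shallow-base x hx (≮⇒≥ ≮))) (m≤m+n (2 * q) _)
      where
      hx : h ≤ size x
      hx = ≤-trans (m≤m+n h q) (≤-trans low (height≤size x))
      same : root x ≡ r × depth x ≡ d
      same = chain-unique (chain x hx) c
    depth-ρ {x} (bottom e) low near good | yes l = ⊥-elim (<⇒≱ (<-≤-trans l (height≤size x)) (≤-trans (≤-reflexive e) (m≤m+n h q)))
    depth-ρ {x} {r} {suc d} (step _ c) low near good | yes l =
      let c' = subst (λ v → Chain v r d) (below-high x l) c
          col , dep = depth-ρ c' (edge-≥ l (partner-edge x l)) (<-trans (edge-< (partner-edge x l)) near) good
          col' , drop-ρ = edge-ρ near l col (partner-edge x l)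
      in col' , ≤-<-trans dep drop-ρ

    g G : ℕ
    g = 2 * q + B * suc rounds
    G = suc (q + J * B)

    ρ<g : ∀ x → b₀ ≤ height x → height x < b₀ + J * B → ρ x < g
    ρ<g x low near = +-monoʳ-< (2 * q) (<-≤-trans (+-monoʳ-< (B * (p / Lb)) (m%n<n (t x) B)) (≤-trans (≤-reflexive (trans (+-comm _ B) (sym (*-suc B (p / Lb)))))
      (*-monoʳ-≤ B (s≤s (/-monoˡ-≤ Lb (<⇒≤ p<K))))))
      where
      r = t x / B
      κ = column x % M
      p = position r κ
      small : r ≤ J₁
      small = ≤-pred (m<n*o⇒m/o<n (≤-trans (≤-reflexive (sym (+-∸-assoc 1 low))) (≤-trans (∸-monoˡ-≤ b₀ near) (≤-reflexive (m+n∸m≡n b₀ (J * B))))))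
      p<K : p < K J
      p<K = <-≤-trans (+-monoʳ-< (K r) (m<n*o⇒m/o<n {{m>0 r}} (<-≤-trans (m%n<n (column x) M) (≤-reflexive (sym (km r))))))
        (≤-trans (≤-reflexive (sym (∑<-last r k))) (∑<-≤-index k (s≤s small)))

    good-depth : ∀ x → h ≤ size x → size x < b₀ + J * B → bad (root x) ≡ false → depth x < g
    good-depth x hx near good with b₀ ≤? height x
    ... | yes low = let near' = ≤-<-trans (height≤size x) near in
            ≤-<-trans (proj₂ (depth-ρ (chain x hx) low near' good)) (ρ<g x low near')
    ... | no high = ≤-<-trans (shallow-base x hx (<⇒≤ (≰⇒> high))) (m<m+n (2 * q) z<s)

    any-depth : ∀ x → h ≤ size x → size x < b₀ + J * B → depth x < G
    any-depth x hx near = s≤s (+-cancelʳ-≤ h _ _ (≤-trans (chain-size (chain x hx)) (≤-trans (<⇒≤ near) (≤-reflexive (lem h q (J * B))))))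
      where
      lem : ∀ h q j → h + q + j ≡ q + j + h
      lem = solve-∀

    open Bound bad g G (b₀ + J * B) good-depth any-depth public using (pairs-bound; tail)

-- Complementation and the clique union

comp : ∀ {n} → Subset n → Subset n
comp [] = []
comp (b ∷ x) = not b ∷ comp x

comp² : ∀ {n} (x : Subset n) → comp (comp x) ≡ x
comp² [] = refl
comp² (true ∷ x) = cong (true ∷_) (comp² x)
comp² (false ∷ x) = cong (false ∷_) (comp² x)

comp-≼ : ∀ {n} {x y : Subset n} → x ≼ y → comp y ≼ comp x
comp-≼ [] = []
comp-≼ (keep p) = keep (comp-≼ p)
comp-≼ (add p) = add (comp-≼ p)

size-comp : ∀ {n} (x : Subset n) → size (comp x) ≡ n ∸ size x
size-comp [] = refl
size-comp (true ∷ x) = size-comp x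
size-comp (false ∷ x) = trans (cong suc (size-comp x)) (sym (+-∸-assoc 1 (size≤n x)))

comp-inj : ∀ {n} {x y : Subset n} → comp x ≡ comp y → x ≡ y
comp-inj {x = x} {y} e = trans (sym (comp² x)) (trans (cong comp e) (comp² y))

≼⇒⊆ : ∀ {n} {x y : Subset n} → x ≼ y → x ⊆ y
≼⇒⊆ (keep p) V.here = V.here
≼⇒⊆ (keep p) (V.there i) = V.there (≼⇒⊆ p i)
≼⇒⊆ (add p) (V.there i) = V.there (≼⇒⊆ p i)

≼⇒⊂ : ∀ {n} {x y : Subset n} → x ≼ y → x ≢ y → x ⊂ y
≼⇒⊂ p ne = ≼⇒⊆ p , witness p ne
  where
  witness : ∀ {n} {x y : Subset n} → x ≼ y → x ≢ y → ∃ λ i → i ∈ y × i ∉ x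
  witness [] ne = ⊥-elim (ne refl)
  witness (keep {b = b} p) ne = let i , a , c = witness p (ne ∘ cong (b ∷_)) in
    suc i , V.there a , λ { (V.there q) → c q }
  witness (add p) ne = zero , V.here , λ ()

2*-≤-squares : ∀ u d → 2 * (u * d) ≤ u * u + d * d
2*-≤-squares u d with ≤-total u d
... | inj₁ l = subst (λ d → 2 * (u * d) ≤ u * u + d * d) (m+[n∸m]≡n l) (ordered u (d ∸ u))
  where
  lem : ∀ u k → u * u + (u + k) * (u + k) ≡ 2 * (u * (u + k)) + k * k
  lem = solve-∀
  ordered : ∀ u k → 2 * (u * (u + k)) ≤ u * u + (u + k) * (u + k)
  ordered u k = ≤-trans (m≤m+n _ (k * k)) (≤-reflexive (sym (lem u k)))
... | inj₂ l = subst (λ u → 2 * (u * d) ≤ u * u + d * d) (m+[n∸m]≡n l) (ordered d (u ∸ d))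
  where
  lem : ∀ d k → (d + k) * (d + k) + d * d ≡ 2 * ((d + k) * d) + k * k
  lem = solve-∀
  ordered : ∀ d k → 2 * ((d + k) * d) ≤ (d + k) * (d + k) + d * d
  ordered d k = ≤-trans (m≤m+n _ (k * k)) (≤-reflexive (sym (lem d k)))

square-+-≤ : ∀ u d → (u + d) * (u + d) ≤ 2 * (u * u) + 2 * (d * d)
square-+-≤ u d = begin
  (u + d) * (u + d) ≡⟨ lem₁ u d ⟩
  u * u + d * d + 2 * (u * d) ≤⟨ +-monoʳ-≤ (u * u + d * d) (2*-≤-squares u d) ⟩
  u * u + d * d + (u * u + d * d) ≡⟨ lem₂ (u * u) (d * d) ⟩
  2 * (u * u) + 2 * (d * d) ∎
  where
  open ≤-Reasoning
  lem₁ : ∀ u d → (u + d) * (u + d) ≡ u * u + d * d + 2 * (u * d)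
  lem₁ = solve-∀
  lem₂ : ∀ a b → a + b + (a + b) ≡ 2 * a + 2 * b
  lem₂ = solve-∀

edgeCount-∑ : ∀ {n} (G : SpanningSubgraphBn n) →
  edgeCount G ≡ ∑S (λ x → ∑S (λ y → ⟦ edge G x y ⟧)) / 2
edgeCount-∑ {n} G = cong (_/ 2) (trans (length-concatMap _ (allSubsets n)) (∑-cong (allSubsets n) λ x → length-filter (edge G x) (allSubsets n)))

module ChainGraph (n : ℕ) (upper : ChainSystem n (n / 2)) (lower : ChainSystem n (n ∸ n / 2)) where
  module A = ChainSystem upper
  module B = ChainSystem lower

  mid : ℕ
  mid = n / 2

  mid≤n : mid ≤ n
  mid≤n = ≤-trans (m≤m*n mid 2) (m/n*n≤m n 2)

  -- The middle element of the chain through x, where an upper chain and the complement of a chain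
  -- of the other system are glued.
  R : Subset n → Subset n
  R x with mid ≤? size x
  ... | yes _ = A.root x
  ... | no _ = comp (B.root (comp x))

  low : ∀ x → ¬ mid ≤ size x → n ∸ mid ≤ size (comp x)
  low x l = ≤-trans (∸-monoʳ-≤ n (<⇒≤ (≰⇒> l))) (≤-reflexive (sym (size-comp x)))

  low-≼ : ∀ x → ¬ mid ≤ size x → x ≼ comp (B.root (comp x))
  low-≼ x l = subst (_≼ comp (B.root (comp x))) (comp² x) (comp-≼ (proj₂ (B.chain-root (B.chain (comp x) (low x l)))))

  size-R : ∀ x → size (R x) ≡ mid
  size-R x with mid ≤? size x
  ... | yes l = proj₁ (A.chain-root (A.chain x l))
  ... | no l = trans (size-comp (B.root (comp x))) (trans (cong (n ∸_) (proj₁ (B.chain-root (B.chain (comp x) (low x l))))) (m∸[m∸n]≡n mid≤n))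

  comparable : ∀ x y → R x ≡ R y → x ≼ y ⊎ y ≼ x
  comparable x y e with mid ≤? size x | mid ≤? size y
  ... | yes a | yes b = A.same-root x y a b e
  ... | yes a | no b = inj₂ (≼-trans (low-≼ y b) (subst (_≼ x) e (proj₂ (A.chain-root (A.chain x a)))))
  ... | no a | yes b = inj₁ (≼-trans (low-≼ x a) (subst (_≼ y) (sym e) (proj₂ (A.chain-root (A.chain y b)))))
  ... | no a | no b with B.same-root (comp x) (comp y) (low x a) (low y b) (comp-inj e)
  ...   | inj₁ p = inj₂ (subst₂ _≼_ (comp² y) (comp² x) (comp-≼ p))
  ...   | inj₂ p = inj₁ (subst₂ _≼_ (comp² x) (comp² y) (comp-≼ p))

  adjacent : Subset n → Subset n → Bool
  adjacent x y = not (does (x ≡S? y)) ∧ does (R x ≡S? R y)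

  adjacent⁻ : ∀ x y → adjacent x y ≡ true → x ≢ y × R x ≡ R y
  adjacent⁻ x y h with x ≡S? y
  ... | no ne = ne , does⁻ (R x ≡S? R y) h

  graph : SpanningSubgraphBn n
  graph = record
    { edge = adjacent
    ; edge-sym = λ x y → cong₂ (λ a b → not a ∧ b) (does-⇔ (x ≡S? y) (y ≡S? x) sym sym) (does-⇔ (R x ≡S? R y) (R y ≡S? R x) sym sym)
    ; edge-sub = sub }
    where
    sub : ∀ x y → adjacent x y ≡ true → (x ⊂ y) ⊎ (y ⊂ x)
    sub x y h with adjacent⁻ x y h
    ... | ne , e with comparable x y e
    ...   | inj₁ p = inj₁ (≼⇒⊂ p ne)
    ...   | inj₂ p = inj₂ (≼⇒⊂ p (ne ∘ sym))

  -- An independent set meets each clique at most once, so `R` embeds it into the middle level.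
  admissible : Admissible graph
  admissible I ind = begin
    countV I ≡⟨ length-filter I (allSubsets n) ⟩
    ∑S (⟦_⟧ ∘ I) ≡⟨ ∑-cong (allSubsets n) (λ x → sym (*-identityʳ _)) ⟩
    ∑S (λ x → ⟦ I x ⟧ * 1) ≤⟨ ∑S-inject R I (λ r → does (size r ≟ℕ mid)) (λ _ → 1) (λ x _ → does⁺ (size (R x) ≟ℕ mid) (size-R x)) inj ⟩
    ∑S {n} (λ r → ⟦ does (size r ≟ℕ mid) ⟧ * 1) ≡⟨ ∑-cong (allSubsets n) (λ x → *-identityʳ ⟦ does (size x ≟ℕ mid) ⟧) ⟩
    ∑S {n} (λ r → ⟦ does (size r ≟ℕ mid) ⟧) ≡⟨ level-count n mid ⟩
    n C (n / 2) ∎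
    where
    open ≤-Reasoning
    inj : ∀ x y → I x ≡ true → I y ≡ true → R x ≡ R y → x ≡ y
    inj x y ix iy e with x ≡S? y
    ... | yes eq = eq
    ... | no ne = ⊥-elim (true≢false (cong₂ (λ a b → not a ∧ b) (dec-false (x ≡S? y) ne) (does⁺ (R x ≡S? R y) e)) (ind x y ix iy))

  -- (a + b)² ≤ 2a² + 2b² separates the halves of a chain. It is asymptotically lossless because the
  -- halves have nearly equal length, and halving the ordered pairs removes the factor 2.
  edges-bound : edgeCount graph ≤ A.pairs + B.pairs
  edges-bound = begin
    edgeCount graph ≡⟨ edgeCount-∑ graph ⟩
    ∑S (λ x → ∑S (λ y → ⟦ adjacent x y ⟧)) / 2 ≤⟨ /-monoˡ-≤ 2 (≤-trans total (≤-reflexive (lem A.pairs B.pairs))) ⟩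
    (A.pairs + B.pairs) * 2 / 2 ≡⟨ m*n/n≡m (A.pairs + B.pairs) 2 ⟩
    A.pairs + B.pairs ∎
    where
    open ≤-Reasoning
    lem : ∀ a b → 2 * a + 2 * b ≡ (a + b) * 2
    lem = solve-∀
    in-fibre : Subset n → Subset n → Bool
    in-fibre r x = does (R x ≡S? r)
    a b : Subset n → ℕ
    a r = ∑S (λ x → ⟦ A.linked x r ⟧)
    b r = ∑S (λ x → ⟦ B.linked x (comp r) ⟧)
    fibre : ∀ r → ∑S (λ x → ⟦ in-fibre r x ⟧) ≤ a r + b r
    fibre r = ≤-trans (∑-mono (allSubsets n) per) (≤-trans (≤-reflexive (∑-+ (allSubsets n) _ _)) (+-monoʳ-≤ (a r)
      (≤-trans (≤-trans (≤-reflexive (∑-cong (allSubsets n) λ x → sym (*-identityʳ _))) (∑S-inject comp (λ x → B.linked (comp x) (comp r)) (λ y → B.linked y (comp r)) (λ _ → 1) (λ _ h → h) (λ y z _ _ → comp-inj)))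
        (≤-reflexive (∑-cong (allSubsets n) λ x → *-identityʳ _)))))
      where
      per : ∀ x → ⟦ in-fibre r x ⟧ ≤ ⟦ A.linked x r ⟧ + ⟦ B.linked (comp x) (comp r) ⟧
      per x with mid ≤? size x
      ... | yes l = ≤-trans (⟦⟧-mono (λ h → ∧-intro (does⁺ (mid ≤? size x) l) h)) (m≤m+n _ _)
      ... | no l = ≤-trans (⟦⟧-mono (λ h → ∧-intro (does⁺ (n ∸ mid ≤? size (comp x)) (low x l))
              (does⁺ (B.root (comp x) ≡S? comp r) (comp-inj (trans (does⁻ (comp (B.root (comp x)) ≡S? r) h) (sym (comp² r)))))))
              (m≤n+m _ ⟦ A.linked x r ⟧)
    total : ∑S (λ x → ∑S (λ y → ⟦ adjacent x y ⟧)) ≤ 2 * A.pairs + 2 * B.pairs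
    total = begin
      ∑S (λ x → ∑S (λ y → ⟦ adjacent x y ⟧)) ≤⟨ ∑-mono (allSubsets n) (λ x → ∑-mono (allSubsets n) λ y → ≤-trans (⟦⟧-mono (λ h → does⁺ (R x ≡S? R y) (proj₂ (adjacent⁻ x y h))))
          (≤-reflexive (sym (∑S-δ (R x) (λ r → ⟦ does (r ≡S? R y) ⟧))))) ⟩
      ∑S (λ x → ∑S (λ y → ∑S (λ r → ⟦ in-fibre r x ⟧ * ⟦ does (r ≡S? R y) ⟧))) ≡⟨ ∑-cong (allSubsets n) (λ x → ∑-swap (allSubsets n) (allSubsets n) _) ⟩
      ∑S (λ x → ∑S (λ r → ∑S (λ y → ⟦ in-fibre r x ⟧ * ⟦ does (r ≡S? R y) ⟧))) ≡⟨ ∑-swap (allSubsets n) (allSubsets n) _ ⟩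
      ∑S (λ r → ∑S (λ x → ∑S (λ y → ⟦ in-fibre r x ⟧ * ⟦ does (r ≡S? R y) ⟧))) ≡⟨ ∑-cong (allSubsets n) (λ r → trans (∑-cong (allSubsets n) λ x → trans (∑-*ˡ (allSubsets n) ⟦ in-fibre r x ⟧ _)
          (cong (⟦ in-fibre r x ⟧ *_) (∑-cong (allSubsets n) λ y → cong ⟦_⟧ (does-⇔ (r ≡S? R y) (R y ≡S? r) sym sym)))) (∑-*ʳ (allSubsets n) _ _)) ⟩
      ∑S (λ r → ∑S (λ x → ⟦ in-fibre r x ⟧) * ∑S (λ x → ⟦ in-fibre r x ⟧)) ≤⟨ ∑-mono (allSubsets n) (λ r → ≤-trans (*-mono-≤ (fibre r) (fibre r)) (square-+-≤ (a r) (b r))) ⟩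
      ∑S (λ r → 2 * (a r * a r) + 2 * (b r * b r)) ≡⟨ trans (∑-+ (allSubsets n) _ _) (cong₂ _+_ (∑-*ˡ (allSubsets n) 2 _) (∑-*ˡ (allSubsets n) 2 _)) ⟩
      2 * A.pairs + 2 * ∑S (λ r → b r * b r) ≤⟨ +-monoʳ-≤ (2 * A.pairs) (*-monoʳ-≤ 2 (≤-trans (≤-reflexive (∑-cong (allSubsets n) λ r → sym (*-identityˡ (b r * b r))))
          (≤-trans (∑S-inject comp (λ _ → true) (λ _ → true) (λ r → ∑S (λ x → ⟦ B.linked x r ⟧) * ∑S (λ x → ⟦ B.linked x r ⟧)) (λ _ _ → refl) (λ y z _ _ → comp-inj))
          (≤-reflexive (∑-cong (allSubsets n) λ r → *-identityˡ _))))) ⟩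
      2 * A.pairs + 2 * B.pairs ∎

-- Binomial estimates

-- Says that m is ⌊n/2⌋ or ⌈n/2⌉ without fixing the parity of n.
record Central (n m : ℕ) : Set where
  constructor central
  field
    not-low : n ≤ suc (2 * m)
    not-high : 2 * m ≤ suc n

binomial-increasing : ∀ n k → suc k ≤ n ∸ k → n C k ≤ n C suc k
binomial-increasing n k h = *-cancelˡ-≤ (suc k) (≤-trans (*-monoˡ-≤ (n C k) h) (≤-reflexive (sym (absorption n k))))

binomial-antitone : ∀ n {a b} → n ∸ a ≤ suc a → a ≤ b → n C b ≤ n C a
binomial-antitone n {a} {b} ha a≤b = subst (λ v → n C v ≤ n C a) (m∸n+n≡m a≤b) (go (b ∸ a))
  where
  go : ∀ d → n C (d + a) ≤ n C a
  go zero = ≤-refl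
  go (suc d) = ≤-trans (binomial-decreasing n (d + a) (≤-trans (∸-monoʳ-≤ n (m≤n+m a d)) (≤-trans ha (s≤s (m≤n+m a d))))) (go d)

past-centre : ∀ n {m b} → n ≤ suc (2 * m) → m ≤ b → n ∸ b ≤ suc b
past-centre n {m} {b} h m≤b = m≤n+o⇒m∸n≤o n b (≤-trans h (≤-trans (s≤s (*-monoʳ-≤ 2 m≤b)) (≤-reflexive (lem b))))
  where
  lem : ∀ b → suc (b + (b + 0)) ≡ b + suc b
  lem = solve-∀

binomial-max : ∀ n {m} → Central n m → ∀ k → n C k ≤ n C m
binomial-max n {m} (central lo hi) k with ≤-total m k
... | inj₁ m≤k = binomial-antitone n (past-centre n lo ≤-refl) m≤k
... | inj₂ k≤m = go m (m ∸ k) (m∸n+n≡m k≤m) hi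
  where
  go : ∀ m d → d + k ≡ m → 2 * m ≤ suc n → n C k ≤ n C m
  go m zero refl _ = ≤-refl
  go .(suc (d + k)) (suc d) refl h = ≤-trans (go (d + k) d refl (≤-trans (*-monoʳ-≤ 2 (n≤1+n (d + k))) h))
    (binomial-increasing n (d + k) (m+n≤o⇒m≤o∸n (suc (d + k)) (≤-pred (≤-trans (≤-reflexive (lem (d + k))) h))))
    where
    lem : ∀ a → suc (suc a + a) ≡ 2 * suc a
    lem = solve-∀

binomial-central : ∀ n {m m'} → Central n m → Central n m' → n C m ≡ n C m'
binomial-central n {m} {m'} c c' = ≤-antisym (binomial-max n c' m) (binomial-max n c m')

half-central : ∀ n → Central n (n / 2)
half-central n = central (≤-trans (≤-reflexive (m≡m%n+[m/n]*n n 2)) (≤-trans (+-monoˡ-≤ _ (≤-pred (m%n<n n 2))) (≤-reflexive (cong suc (*-comm (n / 2) 2)))))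
  (≤-trans (≤-reflexive (*-comm 2 (n / 2))) (m≤n⇒m≤1+n (m/n*n≤m n 2)))

other-half-central : ∀ n → Central n (n ∸ n / 2)
other-half-central n = central (+-cancelˡ-≤ (2 * m) _ _ (≤-trans (+-monoˡ-≤ n 2m≤n) (≤-trans (≤-reflexive (cong (n +_) (sym (+-identityʳ n)))) (≤-trans (n≤1+n _)
    (≤-reflexive (trans (cong (λ v → suc (2 * v)) (sym (m+[n∸m]≡n m≤n))) (lem₁ m (n ∸ m))))))))
  (+-cancelˡ-≤ (2 * m) _ _ (≤-trans (≤-reflexive (trans (sym (*-distribˡ-+ 2 m (n ∸ m))) (cong (2 *_) (m+[n∸m]≡n m≤n))))
    (≤-trans (+-monoʳ-≤ n (≤-trans (≤-reflexive (+-identityʳ n)) (Central.not-low (half-central n)))) (≤-reflexive (lem₂ n (2 * m))))))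
  where
  m = n / 2
  2m≤n : 2 * m ≤ n
  2m≤n = ≤-trans (≤-reflexive (*-comm 2 m)) (m/n*n≤m n 2)
  m≤n : m ≤ n
  m≤n = ≤-trans (m≤n*m m 2) 2m≤n
  lem₁ : ∀ m d → suc (2 * (m + d)) ≡ 2 * m + suc (2 * d)
  lem₁ = solve-∀
  lem₂ : ∀ n a → n + suc a ≡ a + suc n
  lem₂ = solve-∀

odd-symmetric : ∀ m → suc (2 * m) C suc m ≡ suc (2 * m) C m
odd-symmetric m = *-cancelˡ-≡ _ _ (suc m) (trans (absorption (suc (2 * m)) m) (cong (_* (suc (2 * m) C m)) (trans (cong (_∸ m) (lem m)) (m+n∸n≡m (suc m) m))))
  where
  lem : ∀ m → suc (m + (m + 0)) ≡ suc m + m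
  lem = solve-∀

odd-central : ∀ m → suc m * (suc (2 * m) C m) ≡ suc (2 * m) * (2 * m C m)
odd-central m = begin
  suc m * (suc (2 * m) C m) ≡⟨ cong (suc m *_) (odd-symmetric m) ⟨
  suc m * (suc (2 * m) C suc m) ≡⟨ cong (suc m *_) (nCk+nC[k+1]≡[n+1]C[k+1] (2 * m) m) ⟨
  suc m * (c + 2 * m C suc m) ≡⟨ *-distribˡ-+ (suc m) c _ ⟩
  suc m * c + suc m * (2 * m C suc m) ≡⟨ cong (suc m * c +_) (trans (absorption (2 * m) m) (cong (_* c) (trans (cong (_∸ m) (cong (m +_) (+-identityʳ m))) (m+n∸n≡m m m)))) ⟩
  suc m * c + m * c ≡⟨ lem m c ⟩
  suc (2 * m) * c ∎
  where
  open ≡-Reasoning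
  c = 2 * m C m
  lem : ∀ m c → suc m * c + m * c ≡ suc (2 * m) * c
  lem = solve-∀

even-central : ∀ m → 2 * suc m C suc m ≡ 2 * (suc (2 * m) C m)
even-central m = begin
  2 * suc m C suc m ≡⟨ cong (_C suc m) (lem m) ⟩
  suc (suc (2 * m)) C suc m ≡⟨ nCk+nC[k+1]≡[n+1]C[k+1] (suc (2 * m)) m ⟨
  o + suc (2 * m) C suc m ≡⟨ cong (o +_) (trans (odd-symmetric m) (sym (+-identityʳ o))) ⟩
  2 * o ∎
  where
  open ≡-Reasoning
  o = suc (2 * m) C m
  lem : ∀ m → 2 * suc m ≡ suc (suc (2 * m))
  lem = solve-∀

-- The exact ratio of consecutive central coefficients reduces the induction step to (2m+1)(2m+3) ≤
-- (2m+2)².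
even-central-bound : ∀ m → suc (2 * m) * ((2 * m C m) * (2 * m C m)) ≤ 4 ^ (2 * m)
even-central-bound zero = ≤-refl
even-central-bound (suc m) = *-cancelˡ-≤ (suc m * suc m) (begin
  suc m * suc m * (suc (2 * suc m) * (c' * c')) ≡⟨ lem₁ (suc m) (suc (2 * suc m)) c' ⟩
  suc (2 * suc m) * ((suc m * c') * (suc m * c')) ≡⟨ cong (λ v → suc (2 * suc m) * (v * v)) step ⟩
  suc (2 * suc m) * ((2 * (suc (2 * m) * c)) * (2 * (suc (2 * m) * c))) ≡⟨ lem₂ (suc (2 * suc m)) (suc (2 * m)) c ⟩
  (4 * (suc (2 * suc m) * suc (2 * m))) * (suc (2 * m) * (c * c)) ≤⟨ *-mono-≤ (≤-trans (m≤m+n _ 4) (≤-reflexive (lem₃ m))) (even-central-bound m) ⟩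
  (16 * (suc m * suc m)) * 4 ^ (2 * m) ≡⟨ lem₄ (suc m * suc m) (4 ^ (2 * m)) ⟩
  suc m * suc m * (4 * (4 * 4 ^ (2 * m))) ≡⟨ cong (λ v → suc m * suc m * 4 ^ v) (lem₅ m) ⟨
  suc m * suc m * 4 ^ (2 * suc m) ∎)
  where
  open ≤-Reasoning
  c = 2 * m C m
  c' = 2 * suc m C suc m
  step : suc m * c' ≡ 2 * (suc (2 * m) * c)
  step = trans (cong (suc m *_) (even-central m)) (trans (lem (suc m) (suc (2 * m) C m)) (cong (2 *_) (odd-central m)))
    where
    lem : ∀ a b → a * (2 * b) ≡ 2 * (a * b)
    lem = solve-∀
  lem₁ : ∀ a b c → a * a * (b * (c * c)) ≡ b * ((a * c) * (a * c))
  lem₁ = solve-∀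
  lem₂ : ∀ a b c → a * ((2 * (b * c)) * (2 * (b * c))) ≡ (4 * (a * b)) * (b * (c * c))
  lem₂ = solve-∀
  lem₃ : ∀ m → 4 * (suc (2 * suc m) * suc (2 * m)) + 4 ≡ 16 * (suc m * suc m)
  lem₃ = solve-∀
  lem₄ : ∀ a b → (16 * a) * b ≡ a * (4 * (4 * b))
  lem₄ = solve-∀
  lem₅ : ∀ m → 2 * suc m ≡ suc (suc (2 * m))
  lem₅ = solve-∀

even-or-odd : ∀ n → ∃ λ m → n ≡ 2 * m ⊎ n ≡ suc (2 * m)
even-or-odd zero = 0 , inj₁ refl
even-or-odd (suc n) with even-or-odd n
... | m , inj₁ e = m , inj₂ (cong suc e)
... | m , inj₂ e = suc m , inj₁ (trans (cong suc e) (lem m))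
  where
  lem : ∀ m → suc (suc (2 * m)) ≡ 2 * suc m
  lem = solve-∀

-- For odd n the next even central coefficient is exactly twice as large, and the even bound applies
-- to it.
central-bound : ∀ n k → n * ((n C k) * (n C k)) ≤ 4 ^ n
central-bound n k with even-or-odd n
... | m , inj₁ refl = ≤-trans (*-mono-≤ (n≤1+n (2 * m)) (*-mono-≤ mx mx)) (even-central-bound m)
  where
  mx : 2 * m C k ≤ 2 * m C m
  mx = binomial-max (2 * m) {m} (central (n≤1+n _) (n≤1+n _)) k
... | m , inj₂ refl = *-cancelˡ-≤ 4 (begin
  4 * (suc (2 * m) * ((suc (2 * m) C k) * (suc (2 * m) C k))) ≤⟨ *-monoʳ-≤ 4 (*-mono-≤ (≤-trans (m≤n+m (suc (2 * m)) 2) (≤-reflexive (lem₀ m))) (*-mono-≤ mx mx)) ⟩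
  4 * (suc (2 * suc m) * (o * o)) ≡⟨ lem₁ (suc (2 * suc m)) o ⟩
  suc (2 * suc m) * ((2 * o) * (2 * o)) ≡⟨ cong (λ v → suc (2 * suc m) * (v * v)) (even-central m) ⟨
  suc (2 * suc m) * ((2 * suc m C suc m) * (2 * suc m C suc m)) ≤⟨ even-central-bound (suc m) ⟩
  4 ^ (2 * suc m) ≡⟨ cong (4 ^_) (lem₂ m) ⟨
  4 * 4 ^ suc (2 * m) ∎)
  where
  open ≤-Reasoning
  o = suc (2 * m) C m
  mx : suc (2 * m) C k ≤ o
  mx = binomial-max (suc (2 * m)) {m} (central ≤-refl (≤-trans (n≤1+n _) (n≤1+n _))) k
  lem₁ : ∀ a o → 4 * (a * (o * o)) ≡ a * ((2 * o) * (2 * o))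
  lem₁ = solve-∀
  lem₂ : ∀ m → suc (suc (2 * m)) ≡ 2 * suc m
  lem₂ = solve-∀
  lem₀ : ∀ m → suc (suc (suc (2 * m))) ≡ suc (2 * suc m)
  lem₀ m = cong suc (lem₂ m)

binomial-doubling : ∀ q n {m} → Central n m → ∀ k → (q + n) C k ≤ 2 ^ q * (n C m)
binomial-doubling zero n c k = ≤-trans (binomial-max n c k) (≤-reflexive (sym (+-identityʳ _)))
binomial-doubling (suc q) n {m} c zero = ≤-trans (binomial-doubling q n c zero) (*-monoˡ-≤ (n C m) (m≤m+n (2 ^ q) _))
binomial-doubling (suc q) n {m} c (suc k) = ≤-trans (≤-reflexive (sym (nCk+nC[k+1]≡[n+1]C[k+1] (q + n) k)))
  (≤-trans (+-mono-≤ (binomial-doubling q n c k) (binomial-doubling q n c (suc k))) (≤-reflexive (lem (2 ^ q) (n C m))))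
  where
  lem : ∀ a b → a * b + a * b ≡ 2 * a * b
  lem = solve-∀

square-cancel : ∀ {a b} → a * a ≤ b * b → a ≤ b
square-cancel {a} {b} h = ≮⇒≥ λ b<a → <⇒≱ (*-mono-< b<a b<a) h

isqrt : ∀ n → ∃ λ t → t * t ≤ n × n < suc t * suc t
isqrt zero = 0 , z≤n , s≤s z≤n
isqrt (suc n) with isqrt n
... | t , lo , hi with suc t * suc t ≤? suc n
...   | yes l = suc t , l , ≤-<-trans hi (*-mono-< (n<1+n (suc t)) (n<1+n (suc t)))
...   | no ≰ = t , m≤n⇒m≤1+n lo , ≰⇒> ≰

-- One step past the centre multiplies a binomial coefficient by at least (x - y) / x when it lies within (y-1)/2 of the centre.
near-centre : ∀ n m S → 2 * m ≤ n → let x = suc m ; y = suc (2 * S) in ∀ k → k ≤ S →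
  (n C m) * (x ∸ k * y) ≤ (n C (m + k)) * x
near-centre n m S 2m≤n zero _ = ≤-reflexive (cong (λ v → (n C v) * suc m) (sym (+-identityʳ m)))
near-centre n m S 2m≤n (suc k) k<S = *-cancelˡ-≤ x (begin
  x * ((n C m) * (x ∸ (y + k * y))) ≡⟨ lem₁ x (n C m) _ ⟩
  (n C m) * ((x ∸ (y + k * y)) * x) ≤⟨ *-monoʳ-≤ (n C m) (shrink x y (k * y)) ⟩
  (n C m) * ((x ∸ k * y) * (x ∸ y)) ≡⟨ *-assoc (n C m) _ _ ⟨
  (n C m) * (x ∸ k * y) * (x ∸ y) ≤⟨ *-monoˡ-≤ (x ∸ y) (near-centre n m S 2m≤n k (<⇒≤ k<S)) ⟩
  (n C b) * x * (x ∸ y) ≡⟨ lem₂ (n C b) x (x ∸ y) ⟩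
  x * ((x ∸ y) * (n C b)) ≤⟨ *-monoʳ-≤ x one ⟩
  x * (x * (n C suc b)) ≡⟨ cong (x *_) (trans (*-comm x _) (cong (λ v → (n C v) * x) (sym (+-suc m k)))) ⟩
  x * ((n C (m + suc k)) * x) ∎)
  where
  open ≤-Reasoning
  x = suc m
  y = suc (2 * S)
  b = m + k
  lem₁ : ∀ x c d → x * (c * d) ≡ c * (d * x)
  lem₁ = solve-∀
  lem₂ : ∀ c x d → c * x * d ≡ x * (d * c)
  lem₂ = solve-∀
  shrink : ∀ x y z → (x ∸ (y + z)) * x ≤ (x ∸ z) * (x ∸ y)
  shrink x y z with y + z ≤? x
  ... | no ≰ = ≤-trans (≤-reflexive (cong (_* x) (m≤n⇒m∸n≡0 (<⇒≤ (≰⇒> ≰))))) z≤n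
  ... | yes l with m≤n⇒∃[o]m+o≡n l
  ...   | w , refl = subst₂ _≤_ (cong (_* (y + z + w)) (sym (m+n∸m≡n (y + z) w))) (cong₂ _*_ (sym (trans (cong (_∸ z) (lemz y z w)) (m+n∸m≡n z (y + w))))
            (sym (trans (cong (_∸ y) (+-assoc y z w)) (m+n∸m≡n y (z + w))))) (≤-trans (m≤m+n _ (y * z)) (≤-reflexive (lem y z w)))
    where
    lemz : ∀ y z w → y + z + w ≡ z + (y + w)
    lemz = solve-∀
    lem : ∀ y z w → w * (y + z + w) + y * z ≡ (y + w) * (z + w)
    lem = solve-∀
  ratio-step : (x ∸ y) * suc b ≤ x * (n ∸ b)
  ratio-step with y ≤? x
  ... | no ≰ = ≤-trans (≤-reflexive (cong (_* suc b) (m≤n⇒m∸n≡0 (<⇒≤ (≰⇒> ≰))))) z≤n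
  ... | yes l with m≤n⇒∃[o]m+o≡n l
  ...   | w , e = begin
    (x ∸ y) * suc b ≡⟨ cong (_* suc b) (trans (cong (_∸ y) (sym e)) (m+n∸m≡n y w)) ⟩
    w * suc (m + k) ≤⟨ *-monoʳ-≤ w (s≤s (+-monoʳ-≤ m (<⇒≤ k<S))) ⟩
    w * (x + S) ≤⟨ widen ⟩
    x * (w + S) ≤⟨ *-monoʳ-≤ x (m+n≤o⇒m≤o∸n (w + S) (≤-trans (+-monoʳ-≤ (w + S) (+-monoʳ-≤ m (<⇒≤ k<S))) (≤-trans (≤-reflexive (trans (lem₄ w S m) (cong (_+ m) (suc-injective e)))) (≤-trans (≤-reflexive (cong (m +_) (sym (+-identityʳ m)))) 2m≤n)))) ⟩
    x * (n ∸ b) ∎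
    where
    lem₄ : ∀ w S m → w + S + (m + S) ≡ (2 * S + w) + m
    lem₄ = solve-∀
    widen : w * (x + S) ≤ x * (w + S)
    widen = subst (λ x → w * (x + S) ≤ x * (w + S)) e (≤-trans (m≤m+n _ ((1 + 2 * S) * S)) (≤-reflexive (lem₅ S w)))
      where
      lem₅ : ∀ S w → w * (suc (2 * S) + w + S) + (1 + 2 * S) * S ≡ (suc (2 * S) + w) * (w + S)
      lem₅ = solve-∀
  one : (x ∸ y) * (n C b) ≤ x * (n C suc b)
  one = *-cancelˡ-≤ (suc b) (begin
    suc b * ((x ∸ y) * (n C b)) ≡⟨ lem₃ (suc b) (x ∸ y) (n C b) ⟩
    ((x ∸ y) * suc b) * (n C b) ≤⟨ *-monoˡ-≤ (n C b) ratio-step ⟩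
    (x * (n ∸ b)) * (n C b) ≡⟨ *-assoc x (n ∸ b) (n C b) ⟩
    x * ((n ∸ b) * (n C b)) ≡⟨ cong (x *_) (absorption n b) ⟨
    x * (suc b * (n C suc b)) ≡⟨ lem₆ x (suc b) (n C suc b) ⟩
    suc b * (x * (n C suc b)) ∎)
    where
    lem₃ : ∀ b d c → b * (d * c) ≡ (d * b) * c
    lem₃ = solve-∀
    lem₆ : ∀ x b c → x * (b * c) ≡ b * (x * c)
    lem₆ = solve-∀

-- At distance at least c past the centre b, each step shrinks the binomial coefficient by a factor b / (b + c).
decay : ∀ n b c → n ≤ 2 * b → 0 < b → ∀ s k → c ≤ s → (n C (b + s + k)) * (b + k * c) ≤ (n C (b + s)) * b
decay n b c n≤2b 0<b s zero c≤s = ≤-reflexive (cong₂ (λ u v → (n C u) * v) (+-identityʳ (b + s)) (+-identityʳ b))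
decay n b c n≤2b 0<b s (suc k) c≤s = *-cancelˡ-≤ b {{>-nonZero 0<b}} (begin
  b * (V' * (b + suc k * c)) ≡⟨ lem₁ b V' (b + suc k * c) ⟩
  V' * ((b + suc k * c) * b) ≤⟨ *-monoʳ-≤ V' (≤-trans (m≤m+n _ (k * c * c)) (≤-reflexive (lem₂ b k c))) ⟩
  V' * ((b + c) * (b + k * c)) ≡⟨ *-assoc V' (b + c) (b + k * c) ⟨
  V' * (b + c) * (b + k * c) ≤⟨ *-monoˡ-≤ (b + k * c) one ⟩
  V * b * (b + k * c) ≡⟨ lem₃ V b (b + k * c) ⟩
  b * (V * (b + k * c)) ≤⟨ *-monoʳ-≤ b (decay n b c n≤2b 0<b s k c≤s) ⟩
  b * ((n C (b + s)) * b) ∎)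
  where
  open ≤-Reasoning
  i = b + s + k
  V = n C i
  V' = n C (b + s + suc k)
  lem₁ : ∀ b v d → b * (v * d) ≡ v * (d * b)
  lem₁ = solve-∀
  lem₂ : ∀ b k c → (b + suc k * c) * b + k * c * c ≡ (b + c) * (b + k * c)
  lem₂ = solve-∀
  lem₃ : ∀ v b d → v * b * d ≡ b * (v * d)
  lem₃ = solve-∀
  one : V' * (b + c) ≤ V * b
  one = *-cancelˡ-≤ (suc i) (begin
    suc i * (V' * (b + c)) ≡⟨ cong (λ v → suc i * ((n C v) * (b + c))) (+-suc (b + s) k) ⟩
    suc i * ((n C suc i) * (b + c)) ≡⟨ *-assoc (suc i) (n C suc i) (b + c) ⟨
    suc i * (n C suc i) * (b + c) ≡⟨ cong (_* (b + c)) (absorption n i) ⟩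
    (n ∸ i) * V * (b + c) ≤⟨ *-mono-≤ (*-monoˡ-≤ V n∸i≤b) (≤-trans (+-monoʳ-≤ b c≤s) (≤-trans (m≤m+n (b + s) k) (n≤1+n i))) ⟩
    b * V * suc i ≡⟨ lem₄ b V (suc i) ⟩
    suc i * (V * b) ∎)
    where
    lem₄ : ∀ b v i → b * v * i ≡ i * (v * b)
    lem₄ = solve-∀
    n∸i≤b : n ∸ i ≤ b
    n∸i≤b = m≤n+o⇒m∸n≤o n i (≤-trans n≤2b (≤-trans (≤-reflexive (cong (b +_) (+-identityʳ b))) (+-monoˡ-≤ b (≤-trans (m≤m+n b s) (m≤m+n (b + s) k)))))

four-power : ∀ b → 4 ^ b ≡ 2 ^ b * 2 ^ b
four-power zero = refl
four-power (suc b) = trans (cong (4 *_) (four-power b)) (lem (2 ^ b))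
  where
  lem : ∀ p → 4 * (p * p) ≡ 2 * p * (2 * p)
  lem = solve-∀

square-≤-^ : ∀ a b t n → t * t ≤ n → n * (a * a) ≤ 4 ^ b → a * t ≤ 2 ^ b
square-≤-^ a b t n t²≤n h = square-cancel (begin
  a * t * (a * t) ≡⟨ lem a t ⟩
  t * t * (a * a) ≤⟨ *-monoˡ-≤ (a * a) t²≤n ⟩
  n * (a * a) ≤⟨ h ⟩
  4 ^ b ≡⟨ four-power b ⟩
  2 ^ b * 2 ^ b ∎)
  where
  open ≤-Reasoning
  lem : ∀ a t → a * t * (a * t) ≡ t * t * (a * a)
  lem = solve-∀

∑-levels : ∀ n (I : ℕ → Bool) (f : ℕ → ℕ) → ∑S {n} (λ x → ⟦ I (size x) ⟧ * f (size x)) ≡ ∑< (suc n) (λ l → ⟦ I l ⟧ * f l * (n C l))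
∑-levels n I f = begin
  ∑S {n} (λ x → F (size x)) ≡⟨ ∑-cong (allSubsets n) (λ x → ∑<-δ (suc n) (size x) F (s≤s (size≤n x))) ⟨
  ∑S {n} (λ x → ∑< (suc n) (λ l → ⟦ does (size x ≟ℕ l) ⟧ * F l)) ≡⟨ ∑-swap (allSubsets n) (range (suc n)) _ ⟩
  ∑< (suc n) (λ l → ∑S {n} (λ x → ⟦ does (size x ≟ℕ l) ⟧ * F l)) ≡⟨ ∑-cong (range (suc n)) (λ l → trans (∑-*ʳ (allSubsets n) (F l) _) (trans (cong (_* F l) (level-count n l)) (*-comm (n C l) (F l)))) ⟩
  ∑< (suc n) (λ l → F l * (n C l)) ∎
  where
  open ≡-Reasoning
  F : ℕ → ℕ
  F l = ⟦ I l ⟧ * f l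

∑-binomials : ∀ n → ∑< (suc n) (n C_) ≡ 2 ^ n
∑-binomials n = trans (∑-cong (range (suc n)) λ l → sym (*-identityˡ (n C l))) (trans (sym (∑-levels n (λ _ → true) (λ _ → 1))) (∑S-1 n))

∑-binomials-≤ : ∀ n a m → ∑< m (λ i → n C (a + i)) ≤ 2 ^ n
∑-binomials-≤ n a m = ≤-trans (m≤n+m _ (∑< a (n C_))) (≤-trans (≤-reflexive (sym (∑<-split a m (n C_)))) (≤-trans (∑<-≤-index (n C_) (m≤m+n (a + m) (suc n)))
  (≤-trans (≤-reflexive (trans (cong (λ v → ∑< v (n C_)) (+-comm (a + m) (suc n))) (∑<-split (suc n) (a + m) (n C_))))
  (≤-reflexive (trans (cong₂ _+_ (∑-binomials n) (trans (∑-cong (range (a + m)) λ i → k>n⇒nCk≡0 (s≤s (m≤m+n n i))) (∑-0 (range (a + m))))) (+-identityʳ _))))))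

-- Complementation maps the levels above b into those up to b.
∑-upper-binomials : ∀ n b m → n ≤ suc (2 * b) → 2 * ∑< m (λ i → n C (suc b + i)) ≤ 2 ^ n
∑-upper-binomials n b m n≤ = begin
  2 * U ≤⟨ +-monoʳ-≤ U (≤-trans (≤-reflexive (+-identityʳ U)) U≤) ⟩
  U + ∑< (suc b) (n C_) ≡⟨ +-comm U _ ⟩
  ∑< (suc b) (n C_) + U ≡⟨ ∑<-split (suc b) m (n C_) ⟨
  ∑< (suc b + m) (n C_) ≤⟨ ∑-binomials-≤ n 0 (suc b + m) ⟩
  2 ^ n ∎
  where
  open ≤-Reasoning
  U = ∑< m (λ i → n C (suc b + i))
  hi lo : Subset n → Bool
  hi x = does (b <? size x)
  lo x = does (size x ≤? b)
  upper : ∀ k → ∑< k (λ i → n C (suc b + i)) ≤ ∑S (⟦_⟧ ∘ hi)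
  upper k = begin
    ∑< k (λ i → n C (suc b + i)) ≡⟨ ∑-cong (range k) (λ i → level-count n (suc b + i)) ⟨
    ∑< k (λ i → ∑S {n} (λ x → ⟦ does (size x ≟ℕ suc b + i) ⟧)) ≡⟨ ∑-swap (range k) (allSubsets n) _ ⟩
    ∑S {n} (λ x → ∑< k (λ i → ⟦ does (size x ≟ℕ suc b + i) ⟧)) ≤⟨ ∑-mono (allSubsets n) per ⟩
    ∑S (⟦_⟧ ∘ hi) ∎
    where
    per : ∀ x → ∑< k (λ i → ⟦ does (size x ≟ℕ suc b + i) ⟧) ≤ ⟦ hi x ⟧
    per x = case b <? size x of λ
      { (yes l) → ≤-trans (≤-trans (≤-reflexive (∑-cong (range k) λ i → cong ⟦_⟧ (does-⇔ (size x ≟ℕ suc b + i) (size x ∸ suc b ≟ℕ i)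
            (λ e → trans (cong (_∸ suc b) e) (m+n∸m≡n (suc b) i)) (λ e → trans (sym (m+[n∸m]≡n l)) (cong (suc b +_) e)))))
            (∑<-δ≤1 k (size x ∸ suc b))) (≤-reflexive (cong ⟦_⟧ (sym (does⁺ (b <? size x) l))))
      ; (no ≮) → ≤-trans (≤-reflexive (trans (∑-cong (range k) λ i → cong ⟦_⟧ (dec-false (size x ≟ℕ suc b + i)
            λ e → ≮ (≤-trans (m≤m+n (suc b) i) (≤-reflexive (sym e))))) (∑-0 (range k)))) z≤n }
  lower : ∑S (⟦_⟧ ∘ lo) ≤ ∑< (suc b) (n C_)
  lower = begin
    ∑S (⟦_⟧ ∘ lo) ≤⟨ ∑-mono (allSubsets n) per ⟩
    ∑S {n} (λ x → ∑< (suc b) (λ i → ⟦ does (size x ≟ℕ i) ⟧)) ≡⟨ ∑-swap (allSubsets n) (range (suc b)) _ ⟩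
    ∑< (suc b) (λ i → ∑S {n} (λ x → ⟦ does (size x ≟ℕ i) ⟧)) ≡⟨ ∑-cong (range (suc b)) (level-count n) ⟩
    ∑< (suc b) (n C_) ∎
    where
    per : ∀ x → ⟦ lo x ⟧ ≤ ∑< (suc b) (λ i → ⟦ does (size x ≟ℕ i) ⟧)
    per x = case size x ≤? b of λ
      { (yes l) → ≤-trans (⟦⟧≤1 (lo x)) (≤-reflexive (sym (trans (∑-cong (range (suc b)) λ i → sym (*-identityʳ ⟦ does (size x ≟ℕ i) ⟧)) (∑<-δ (suc b) (size x) (λ _ → 1) (s≤s l)))))
      ; (no ≰) → ≤-trans (≤-reflexive (cong ⟦_⟧ (dec-false (size x ≤? b) ≰))) z≤n }
  U≤ : U ≤ ∑< (suc b) (n C_)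
  U≤ = begin
    U ≤⟨ upper m ⟩
    ∑S (⟦_⟧ ∘ hi) ≡⟨ ∑-cong (allSubsets n) (λ x → sym (*-identityʳ ⟦ hi x ⟧)) ⟩
    ∑S (λ x → ⟦ hi x ⟧ * 1) ≤⟨ ∑S-inject comp hi lo (λ _ → 1) flip (λ y z _ _ → comp-inj) ⟩
    ∑S (λ x → ⟦ lo x ⟧ * 1) ≡⟨ ∑-cong (allSubsets n) (λ x → *-identityʳ ⟦ lo x ⟧) ⟩
    ∑S (⟦_⟧ ∘ lo) ≤⟨ lower ⟩
    ∑< (suc b) (n C_) ∎
    where
    flip : ∀ y → hi y ≡ true → lo (comp y) ≡ true
    flip y h = does⁺ (size (comp y) ≤? b) (≤-trans (≤-reflexive (size-comp y)) (m≤n+o⇒m∸n≤o n (size y)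
      (≤-trans n≤ (≤-trans (≤-reflexive (cong (λ v → suc (b + v)) (+-identityʳ b))) (+-monoˡ-≤ b (does⁻ (b <? size y) h))))))

-- By `absorption`, (2l-n) C(n,l) = l C(n,l) - (l+1) C(n,l+1), so the sum telescopes.
weighted-tail : ∀ n L d → (∀ l → L ≤ l → n ≤ 2 * l) → ∑< d (λ i → (2 * (L + i) ∸ n) * (n C (L + i))) ≤ L * (n C L)
weighted-tail n L zero h = z≤n
weighted-tail n L (suc d) h = begin
  ∑< (suc d) (λ i → (2 * (L + i) ∸ n) * (n C (L + i))) ≡⟨ ∑<-suc d _ ⟩
  (2 * (L + 0) ∸ n) * (n C (L + 0)) + ∑< d (λ i → (2 * (L + suc i) ∸ n) * (n C (L + suc i)))
    ≡⟨ cong₂ _+_ (cong (λ v → (2 * v ∸ n) * (n C v)) (+-identityʳ L)) (∑-cong (range d) λ i → cong (λ v → (2 * v ∸ n) * (n C v)) (+-suc L i)) ⟩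
  (2 * L ∸ n) * (n C L) + ∑< d (λ i → (2 * (suc L + i) ∸ n) * (n C (suc L + i))) ≤⟨ +-monoʳ-≤ _ (weighted-tail n (suc L) d (λ l l≤ → h l (<⇒≤ l≤))) ⟩
  (2 * L ∸ n) * (n C L) + suc L * (n C suc L) ≡⟨ cong ((2 * L ∸ n) * (n C L) +_) (absorption n L) ⟩
  (2 * L ∸ n) * (n C L) + (n ∸ L) * (n C L) ≤⟨ final ⟩
  L * (n C L) ∎
  where
  open ≤-Reasoning
  final : (2 * L ∸ n) * (n C L) + (n ∸ L) * (n C L) ≤ L * (n C L)
  final with L ≤? n
  ... | yes l = ≤-reflexive (trans (sym (*-distribʳ-+ (n C L) (2 * L ∸ n) (n ∸ L))) (cong (_* (n C L)) (+-cancelˡ-≡ n _ _ (trans (sym (+-assoc n (2 * L ∸ n) (n ∸ L)))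
      (trans (cong (_+ (n ∸ L)) (m+[n∸m]≡n (h L ≤-refl))) (trans (lem L (n ∸ L)) (cong (_+ L) (m+[n∸m]≡n l))))))))
    where
    lem : ∀ L d → L + (L + 0) + d ≡ L + d + L
    lem = solve-∀
  ... | no ≰ = ≤-reflexive (trans (cong₂ _+_ (vanish (2 * L ∸ n)) (vanish (n ∸ L))) (sym (vanish L)))
    where
    vanish : ∀ a → a * (n C L) ≡ 0
    vanish a = trans (cong (a *_) (k>n⇒nCk≡0 (≰⇒> ≰))) (*-zeroʳ a)

-- Parameters and edge count of one half

-- The edges are to be optimal up to a factor 1 + 1/e, and E = 100 e is the working precision. With
-- t = ⌊√n⌋, blocks have length 2c, about t / E, and the J₁ + 1 blocks span at least 128 e t levels.
-- Only n', c and t vary with n, so `q-large` can be met after the schedule is fixed.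
record Sizes (e E J₁ Z Λ q n' c t : ℕ) : Set where
  field
    e>0 : 0 < e
    q>0 : 0 < q
    E-def : E ≡ 100 * e
    J-large : 256 * e * E ≤ suc J₁
    Z-def : Z ≡ 128 * (E * E)
    Λ-def : Λ ≡ suc J₁ * suc J₁ * suc Z
    q-large : 128 * e * (suc J₁ * suc J₁) * ∑S {q} (λ x → ⟦ does (pos x <? suc Z * suc Λ !) ⟧) ≤ 2 ^ q
    t-low : t * t ≤ q + n'
    t-high : q + n' < suc t * suc t
    c>0 : 0 < c
    c-low : 2 * c * E ≤ t
    c-high : t ≤ 4 * E * c
    t-large : E * suc q ≤ t
    n'-large : q ≤ n'
    centre-large : suc E * (suc (2 * q) * suc (2 * suc (2 * q))) ≤ suc (n' / 2)

module Half {e E J₁ Z Λ q n' c t : ℕ} (sizes : Sizes e E J₁ Z Λ q n' c t) (h : ℕ) (centre : Central (q + n') h) where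
  open Sizes sizes
  open ≤-Reasoning

  n b₀ B B₁ Lb J S : ℕ
  J = suc J₁
  S = suc (2 * q)
  n = q + n'
  b₀ = h + q
  B₁ = pred (2 * c)
  B = suc B₁
  Lb = suc Λ

  B≡ : B ≡ 2 * c
  B≡ = suc-pred (2 * c) {{>-nonZero (≤-trans c>0 (m≤m+n c _))}}

  E>0 : 0 < E
  E>0 = subst (0 <_) (sym E-def) (≤-trans e>0 (m≤n*m e 100))

  t>0 : 0 < t
  t>0 = ≤-trans (*-mono-≤ E>0 (s≤s {0} {q} z≤n)) t-large

  q<t : suc q ≤ t
  q<t = ≤-trans (m≤n*m (suc q) E {{>-nonZero E>0}}) t-large

  h-mid : n ≤ suc (2 * h)
  h-mid = Central.not-low centre

  n≤4t² : n ≤ 4 * (t * t)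
  n≤4t² = ≤-trans (<⇒≤ t-high) (≤-trans (*-mono-≤ double double) (≤-reflexive (lem t)))
    where
    double : suc t ≤ 2 * t
    double = subst (_≤ 2 * t) (+-comm t 1) (+-monoʳ-≤ t (≤-trans t>0 (≤-reflexive (sym (+-identityʳ t)))))
    lem : ∀ t → 2 * t * (2 * t) ≡ 4 * (t * t)
    lem = solve-∀

  V v : ℕ → ℕ
  V b = n' C b
  v r = V (b₀ + r * B)

  α : ℕ
  α = n C h

  α-max : ∀ k → n C k ≤ α
  α-max = binomial-max n centre

  α>0 : 0 < α
  α>0 = α-max 0

  n'≤2b₀ : n' ≤ 2 * b₀
  n'≤2b₀ = +-cancelˡ-≤ q _ _ (≤-trans h-mid (≤-trans (+-mono-≤ q>0 (*-monoʳ-≤ 2 (m≤m+n h q))) ≤-refl))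

  -- `b₀` is within 2q + 1 of the middle of [n'], where the binomial coefficients are flat up to
  -- 1/E. So the chains are hardly more numerous than the sets of height `b₀`.
  α≤ : α * E ≤ suc E * (2 ^ q * V b₀)
  α≤ = *-cancelˡ-≤ x (begin
    x * (α * E) ≤⟨ *-monoʳ-≤ x (*-monoˡ-≤ E (binomial-doubling q n' (half-central n') h)) ⟩
    x * (2 ^ q * μ * E) ≡⟨ lem₁ x (2 ^ q) μ E ⟩
    2 ^ q * (μ * (E * x)) ≤⟨ *-monoʳ-≤ (2 ^ q) (*-monoʳ-≤ μ margin) ⟩
    2 ^ q * (μ * (suc E * (x ∸ k * y))) ≡⟨ lem₂ (2 ^ q) μ (suc E) (x ∸ k * y) ⟩
    2 ^ q * suc E * (μ * (x ∸ k * y)) ≤⟨ *-monoʳ-≤ (2 ^ q * suc E) (near-centre n' m S 2m≤n' k k≤S) ⟩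
    2 ^ q * suc E * (V (m + k) * x) ≡⟨ cong (λ u → 2 ^ q * suc E * (V u * x)) (m+[n∸m]≡n m≤b₀) ⟩
    2 ^ q * suc E * (V b₀ * x) ≡⟨ lem₃ (2 ^ q) (suc E) (V b₀) x ⟩
    x * (suc E * (2 ^ q * V b₀)) ∎)
    where
    m = n' / 2
    x = suc m
    y = suc (2 * S)
    k = b₀ ∸ m
    μ = V m
    2m≤n' : 2 * m ≤ n'
    2m≤n' = ≤-trans (≤-reflexive (*-comm 2 m)) (m/n*n≤m n' 2)
    m≤b₀ : m ≤ b₀
    m≤b₀ = *-cancelˡ-≤ 2 (≤-trans 2m≤n' n'≤2b₀)
    k≤S : k ≤ S
    k≤S = m≤n+o⇒m∸n≤o b₀ m (*-cancelˡ-≤ 2 (begin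
      2 * (h + q) ≡⟨ *-distribˡ-+ 2 h q ⟩
      2 * h + 2 * q ≤⟨ +-monoˡ-≤ (2 * q) (Central.not-high centre) ⟩
      suc (q + n') + 2 * q ≤⟨ +-monoˡ-≤ (2 * q) (s≤s (+-monoʳ-≤ q (Central.not-low (half-central n')))) ⟩
      suc (q + suc (2 * m)) + 2 * q ≤⟨ m≤m+n _ q ⟩
      suc (q + suc (2 * m)) + 2 * q + q ≡⟨ lem q m ⟩
      2 * (m + suc (2 * q)) ∎))
      where
      lem : ∀ q m → suc (q + suc (2 * m)) + 2 * q + q ≡ 2 * (m + suc (2 * q))
      lem = solve-∀
    margin : E * x ≤ suc E * (x ∸ k * y)
    margin = begin
      E * x ≡⟨ m+n∸m≡n x (E * x) ⟨
      suc E * x ∸ x ≤⟨ ∸-monoʳ-≤ (suc E * x) (≤-trans (*-monoʳ-≤ (suc E) (*-monoˡ-≤ y k≤S)) centre-large) ⟩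
      suc E * x ∸ suc E * (k * y) ≡⟨ *-distribˡ-∸ (suc E) x (k * y) ⟨
      suc E * (x ∸ k * y) ∎
    lem₁ : ∀ x p m e → x * (p * m * e) ≡ p * (m * (e * x))
    lem₁ = solve-∀
    lem₂ : ∀ p m e d → p * (m * (e * d)) ≡ p * e * (m * d)
    lem₂ = solve-∀
    lem₃ : ∀ p e b x → p * e * (b * x) ≡ x * (e * (p * b))
    lem₃ = solve-∀

  v₀ : ℕ
  v₀ = V b₀

  v₀>0 : 0 < v₀
  v₀>0 = n≢0⇒n>0 λ z → <⇒≱ (*-mono-< α>0 E>0) (≤-trans α≤ (≤-reflexive
    (trans (cong (λ u → suc E * (2 ^ q * u)) z) (trans (cong (suc E *_) (*-zeroʳ (2 ^ q))) (*-zeroʳ (suc E))))))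

  v0≡ : v 0 ≡ v₀
  v0≡ = cong V (+-identityʳ b₀)

  V-anti : ∀ {a b} → b₀ ≤ a → a ≤ b → V b ≤ V a
  V-anti {a} {b} b₀≤a a≤b = binomial-antitone n' (m≤n+o⇒m∸n≤o n' a (≤-trans n'≤2b₀ (≤-trans (+-mono-≤ b₀≤a (≤-trans (≤-reflexive (+-identityʳ b₀)) (m≤n⇒m≤1+n b₀≤a))) ≤-refl))) a≤b

  v-anti : ∀ {r j} → r ≤ j → v j ≤ v r
  v-anti r≤j = V-anti (m≤m+n b₀ _) (+-monoʳ-≤ b₀ (*-monoˡ-≤ B r≤j))

  -- Origin of the 128 in `Z`: b₀ ≤ 2n ≤ 8t² and t ≤ 4 E c.
  b₀≤ : b₀ ≤ Z * (c * c)
  b₀≤ = begin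
    h + q ≤⟨ +-mono-≤ h≤n (m≤m+n q n') ⟩
    n + n ≤⟨ +-mono-≤ n≤4t² n≤4t² ⟩
    4 * (t * t) + 4 * (t * t) ≤⟨ +-mono-≤ t²≤ t²≤ ⟩
    4 * (4 * E * c * (4 * E * c)) + 4 * (4 * E * c * (4 * E * c)) ≡⟨ lem E c ⟩
    128 * (E * E) * (c * c) ≡⟨ cong (_* (c * c)) Z-def ⟨
    Z * (c * c) ∎
    where
    t²≤ : 4 * (t * t) ≤ 4 * (4 * E * c * (4 * E * c))
    t²≤ = *-monoʳ-≤ 4 (*-mono-≤ c-high c-high)
    h≤n : h ≤ n
    h≤n = *-cancelˡ-≤ 2 (≤-trans (Central.not-high centre) (≤-trans (+-monoˡ-≤ n (≤-trans q>0 (m≤m+n q n'))) (≤-reflexive (cong (n +_) (sym (+-identityʳ n))))))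
    lem : ∀ E c → 4 * (4 * E * c * (4 * E * c)) + 4 * (4 * E * c * (4 * E * c)) ≡ 128 * (E * E) * (c * c)
    lem = solve-∀

  -- The first c levels of the block bring it to distance c from `b₀`, even for r = 0. In the
  -- remaining c steps `decay` then gives the factor b₀ / (b₀ + c²). Hence the block length 2c.
  gap-step : ∀ r → v (suc r) ≤ Z * (v r ∸ v (suc r))
  gap-step r = *-cancelˡ-≤ (c * c) {{m*n≢0 c c {{>-nonZero c>0}} {{>-nonZero c>0}}}} (begin
    c * c * v (suc r) ≤⟨ +-cancelˡ-≤ (b₀ * v (suc r)) _ _ shrunk ⟩
    b₀ * (v r ∸ v (suc r)) ≤⟨ *-monoˡ-≤ (v r ∸ v (suc r)) b₀≤ ⟩
    Z * (c * c) * (v r ∸ v (suc r)) ≡⟨ lem₁ Z (c * c) _ ⟩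
    c * c * (Z * (v r ∸ v (suc r))) ∎)
    where
    lem₁ : ∀ z c d → z * c * d ≡ c * (z * d)
    lem₁ = solve-∀
    lem₂ : ∀ b v c → b * v + c * v ≡ v * (b + c)
    lem₂ = solve-∀
    index : b₀ + (r * B + c) + c ≡ b₀ + suc r * B
    index = trans (lem₃ b₀ (r * B) c) (cong (λ u → b₀ + (u + r * B)) (sym B≡))
      where
      lem₃ : ∀ b x c → b + (x + c) + c ≡ b + (2 * c + x)
      lem₃ = solve-∀
    shrunk : b₀ * v (suc r) + c * c * v (suc r) ≤ b₀ * v (suc r) + b₀ * (v r ∸ v (suc r))
    shrunk = begin
      b₀ * v (suc r) + c * c * v (suc r) ≡⟨ lem₂ b₀ (v (suc r)) (c * c) ⟩
      v (suc r) * (b₀ + c * c) ≡⟨ cong (λ u → V u * (b₀ + c * c)) index ⟨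
      V (b₀ + (r * B + c) + c) * (b₀ + c * c) ≤⟨ decay n' b₀ c n'≤2b₀ (≤-trans q>0 (m≤n+m q h)) (r * B + c) c (m≤n+m c (r * B)) ⟩
      V (b₀ + (r * B + c)) * b₀ ≤⟨ *-monoˡ-≤ b₀ (V-anti (m≤m+n b₀ _) (+-monoʳ-≤ b₀ (m≤m+n (r * B) c))) ⟩
      v r * b₀ ≡⟨ *-comm (v r) b₀ ⟩
      b₀ * v r ≡⟨ cong (b₀ *_) (m+[n∸m]≡n (v-anti (n≤1+n r))) ⟨
      b₀ * (v (suc r) + (v r ∸ v (suc r))) ≡⟨ *-distribˡ-+ b₀ _ _ ⟩
      b₀ * v (suc r) + b₀ * (v r ∸ v (suc r)) ∎

  instance
    v₀-nonZero : NonZero v₀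
    v₀-nonZero = >-nonZero v₀>0

  share : ℕ → ℕ
  share j = Λ * v j / v₀

  -- Proportional to the level sizes, k j ≈ Λ v j / v₀. Rounding down could violate `Ratio` by one
  -- unit; the increasing correction j + 1 repairs this. The minimum with `Lb` changes nothing up to
  -- J₁ and keeps later values admissible.
  k : ℕ → ℕ
  k j = (share j + suc j) ⊓ Lb

  share-0 : share 0 ≡ Λ
  share-0 = trans (cong (λ u → Λ * u / v₀) v0≡) (m*n/n≡m Λ v₀)

  -- Block 0 of `gap-step` gives (Z+1) v j ≤ Z v₀ for j ≥ 1, so the share is at most J² Z. The J²
  -- left of Λ = J² (Z+1) makes room for the correction.
  share-≤ : ∀ j → j ≤ J₁ → share j + suc j ≤ Lb
  share-≤ zero _ = ≤-reflexive (trans (cong (_+ 1) share-0) (+-comm Λ 1))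
  share-≤ (suc j) j≤ = ≤-trans (≤-reflexive (+-suc (share (suc j)) (suc j))) (s≤s (begin
    share (suc j) + suc j ≤⟨ +-mono-≤ (≤-pred (m<n*o⇒m/o<n {o = v₀} bound)) (≤-trans (m≤n⇒m≤1+n j≤) (m≤m*n J J)) ⟩
    J * J * Z + J * J ≡⟨ trans (+-comm _ (J * J)) (sym (*-suc (J * J) Z)) ⟩
    J * J * suc Z ≡⟨ Λ-def ⟨
    Λ ∎))
    where
    next : suc Z * v (suc j) ≤ Z * v₀
    next = begin
      v (suc j) + Z * v (suc j) ≤⟨ +-mono-≤ (v-anti (s≤s (z≤n {j}))) (*-monoʳ-≤ Z (v-anti (s≤s (z≤n {j})))) ⟩
      v 1 + Z * v 1 ≤⟨ +-monoˡ-≤ (Z * v 1) (gap-step 0) ⟩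
      Z * (v 0 ∸ v 1) + Z * v 1 ≡⟨ *-distribˡ-+ Z (v 0 ∸ v 1) (v 1) ⟨
      Z * (v 0 ∸ v 1 + v 1) ≡⟨ cong (Z *_) (trans (m∸n+n≡m (v-anti {0} {1} z≤n)) v0≡) ⟩
      Z * v₀ ∎
    bound : Λ * v (suc j) < suc (J * J * Z) * v₀
    bound = begin-strict
      Λ * v (suc j) ≡⟨ cong (_* v (suc j)) Λ-def ⟩
      J * J * suc Z * v (suc j) ≡⟨ *-assoc (J * J) (suc Z) _ ⟩
      J * J * (suc Z * v (suc j)) ≤⟨ *-monoʳ-≤ (J * J) next ⟩
      J * J * (Z * v₀) ≡⟨ *-assoc (J * J) Z v₀ ⟨
      J * J * Z * v₀ <⟨ m<n+m (J * J * Z * v₀) v₀>0 ⟩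
      suc (J * J * Z) * v₀ ∎

  k-exact : ∀ j → j ≤ J₁ → k j ≡ share j + suc j
  k-exact j j≤ = m≤n⇒m⊓n≡m (share-≤ j j≤)

  k-positive : ∀ j → 0 < k j
  k-positive j = ⊓-glb (≤-trans (s≤s z≤n) (m≤n+m (suc j) (share j))) (s≤s z≤n)

  share-low : ∀ j → share j * v₀ ≤ Λ * v j
  share-low j = m/n*n≤m (Λ * v j) v₀

  share-high : ∀ j → Λ * v j ≤ suc (share j) * v₀
  share-high j = ≤-trans (≤-reflexive (m≡m%n+[m/n]*n (Λ * v j) v₀)) (+-monoˡ-≤ (share j * v₀) (<⇒≤ (m%n<n (Λ * v j) v₀)))

  ratio : ∀ r j → r < j → j ≤ J₁ → k r * v j ≤ k j * v r
  ratio r j r<j j≤ = *-cancelˡ-≤ v₀ (begin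
    v₀ * (k r * v j) ≡⟨ cong (λ u → v₀ * (u * v j)) (k-exact r (≤-trans (<⇒≤ r<j) j≤)) ⟩
    v₀ * ((share r + suc r) * v j) ≡⟨ lem₁ v₀ (share r) (suc r) (v j) ⟩
    share r * v₀ * v j + suc r * v₀ * v j ≤⟨ +-mono-≤ (*-monoˡ-≤ (v j) (share-low r)) (*-mono-≤ (*-monoˡ-≤ v₀ r<j) (v-anti (<⇒≤ r<j))) ⟩
    Λ * v r * v j + j * v₀ * v r ≡⟨ cong (_+ j * v₀ * v r) (lem₂ Λ (v r) (v j)) ⟩
    Λ * v j * v r + j * v₀ * v r ≤⟨ +-monoˡ-≤ (j * v₀ * v r) (*-monoˡ-≤ (v r) (share-high j)) ⟩
    suc (share j) * v₀ * v r + j * v₀ * v r ≡⟨ lem₃ (share j) j v₀ (v r) ⟩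
    v₀ * ((share j + suc j) * v r) ≡⟨ cong (λ u → v₀ * (u * v r)) (k-exact j j≤) ⟨
    v₀ * (k j * v r) ∎)
    where
    lem₁ : ∀ v s r w → v * ((s + r) * w) ≡ s * v * w + r * v * w
    lem₁ = solve-∀
    lem₂ : ∀ a b c → a * b * c ≡ a * c * b
    lem₂ = solve-∀
    lem₃ : ∀ s j v w → suc s * v * w + j * v * w ≡ v * ((s + suc j) * w)
    lem₃ = solve-∀

  divisor : ∀ a b → 0 < a → a ≤ b → ∃ λ m → a * m ≡ b !
  divisor (suc a) b _ a<b with m≤n⇒m!∣n! a<b
  ... | divides w e = a ! * w , trans (lem (suc a) (a !) w) (sym e)
    where
    lem : ∀ a f w → a * (f * w) ≡ w * (a * f)
    lem = solve-∀

  M! : suc (pred (Lb !)) ≡ Lb !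
  M! = suc-pred (Lb !) {{Lb !≢0}}

  schedule : Schedule
  schedule = record
    -- A supercolumn has `Lb` ! columns, so that every k j ≤ `Lb` divides it evenly.
    { B₁ = B₁ ; M₁ = pred (Lb !) ; J₁ = J₁ ; Z = Z ; Lb = Lb ; k = k
    ; m = λ j → proj₁ (divisor (k j) Lb (k-positive j) (m⊓n≤n (share j + suc j) Lb))
    ; k₀ = trans (k-exact 0 z≤n) (trans (cong (_+ 1) share-0) (+-comm Λ 1))
    ; k≤Lb = λ j _ → m⊓n≤n (share j + suc j) Lb
    ; k>0 = k-positive
    ; km = λ j → trans (proj₂ (divisor (k j) Lb (k-positive j) (m⊓n≤n (share j + suc j) Lb))) (sym M!) }

  gap : Gap schedule (λ t → V (b₀ + t))
  gap r _ = gap-step r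

  module H = UpperHalf q n' h schedule h-mid gap ratio
  module D = H.Depth
  open ChainSystem H.system using (pairs)

  -- There are about Σ v j / v₀ rounds. Each v (r+1) is at most the size of every one of the B
  -- levels ending at its own, and these levels together are at most half of 2^[n']; 6 B v₀ collects
  -- block 0 and the roundings.
  rounds-bound : 2 * (v₀ * (B * suc H.rounds)) ≤ 6 * B * v₀ + 2 ^ n'
  rounds-bound = begin
    2 * (v₀ * (B * suc H.rounds)) ≡⟨ lem₁ v₀ B H.rounds ⟩
    2 * (B * (v₀ * H.rounds)) + 2 * (B * v₀) ≤⟨ +-monoˡ-≤ (2 * (B * v₀)) (*-monoʳ-≤ 2 (*-monoʳ-≤ B few)) ⟩
    2 * (B * (2 * v₀ + ∑< J₁ (v ∘ suc))) + 2 * (B * v₀) ≡⟨ lem₂ B v₀ (∑< J₁ (v ∘ suc)) ⟩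
    6 * B * v₀ + 2 * (B * ∑< J₁ (v ∘ suc)) ≤⟨ +-monoʳ-≤ (6 * B * v₀) (≤-trans (*-monoʳ-≤ 2 blocks) (∑-upper-binomials n' b₀ (J₁ * B) (m≤n⇒m≤1+n n'≤2b₀))) ⟩
    6 * B * v₀ + 2 ^ n' ∎
    where
    lem₁ : ∀ v b r → 2 * (v * (b * suc r)) ≡ 2 * (b * (v * r)) + 2 * (b * v)
    lem₁ = solve-∀
    lem₂ : ∀ b v s → 2 * (b * (2 * v + s)) + 2 * (b * v) ≡ 6 * b * v + 2 * (b * s)
    lem₂ = solve-∀
    blocks : B * ∑< J₁ (v ∘ suc) ≤ ∑< (J₁ * B) (λ i → V (suc b₀ + i))
    blocks = begin
      B * ∑< J₁ (v ∘ suc) ≡⟨ ∑-*ˡ (range J₁) B (v ∘ suc) ⟨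
      ∑< J₁ (λ r → B * v (suc r)) ≤⟨ ∑-mono (range J₁) (λ r → ≤-trans (≤-reflexive (sym (∑<-const B (v (suc r))))) (∑<-mono B λ o o<B →
          V-anti (≤-trans (m≤m+n b₀ _) (≤-trans (n≤1+n _) ≤-refl)) (≤-trans (≤-reflexive (sym (+-suc b₀ (r * B + o)))) (+-monoʳ-≤ b₀ (≤-trans (≤-reflexive (sym (+-suc (r * B) o))) (≤-trans (+-monoʳ-≤ (r * B) o<B) (≤-reflexive (+-comm (r * B) B)))))))) ⟩
      ∑< J₁ (λ r → ∑< B (λ o → V (suc b₀ + (r * B + o)))) ≡⟨ ∑<-blocks J₁ B (λ i → V (suc b₀ + i)) ⟨
      ∑< (J₁ * B) (λ i → V (suc b₀ + i)) ∎
    Λ>0 : NonZero Λ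
    Λ>0 = >-nonZero (subst (0 <_) (sym Λ-def) (s≤s z≤n))
    labels : v₀ * ∑< J k ≤ Λ * ∑< J v + v₀ * (J * J)
    labels = begin
      v₀ * ∑< J k ≡⟨ ∑-*ˡ (range J) v₀ k ⟨
      ∑< J (λ j → v₀ * k j) ≤⟨ ∑<-mono J (λ j j<J → begin
          v₀ * k j ≡⟨ cong (v₀ *_) (k-exact j (≤-pred j<J)) ⟩
          v₀ * (share j + suc j) ≡⟨ *-distribˡ-+ v₀ (share j) (suc j) ⟩
          v₀ * share j + v₀ * suc j ≤⟨ +-mono-≤ (≤-trans (≤-reflexive (*-comm v₀ (share j))) (share-low j)) (*-monoʳ-≤ v₀ j<J) ⟩
          Λ * v j + v₀ * J ∎) ⟩
      ∑< J (λ j → Λ * v j + v₀ * J) ≡⟨ ∑-+ (range J) (λ j → Λ * v j) (λ _ → v₀ * J) ⟩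
      ∑< J (λ j → Λ * v j) + ∑< J (λ _ → v₀ * J) ≡⟨ cong₂ _+_ (∑-*ˡ (range J) Λ v) (trans (∑<-const J (v₀ * J)) (lem J v₀)) ⟩
      Λ * ∑< J v + v₀ * (J * J) ∎
      where
      lem : ∀ j v → j * (v * j) ≡ v * (j * j)
      lem = solve-∀
    few : v₀ * H.rounds ≤ 2 * v₀ + ∑< J₁ (v ∘ suc)
    few = *-cancelˡ-≤ Λ {{Λ>0}} (begin
      Λ * (v₀ * H.rounds) ≤⟨ *-monoˡ-≤ (v₀ * H.rounds) (n≤1+n Λ) ⟩
      Lb * (v₀ * H.rounds) ≡⟨ lem₃ Lb v₀ H.rounds ⟩
      v₀ * (H.rounds * Lb) ≤⟨ *-monoʳ-≤ v₀ (m/n*n≤m (∑< J k) Lb) ⟩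
      v₀ * ∑< J k ≤⟨ labels ⟩
      Λ * ∑< J v + v₀ * (J * J) ≤⟨ +-monoʳ-≤ (Λ * ∑< J v) (*-monoʳ-≤ v₀ (≤-trans (m≤m*n (J * J) (suc Z)) (≤-reflexive (sym Λ-def)))) ⟩
      Λ * ∑< J v + v₀ * Λ ≡⟨ cong (λ u → Λ * u + v₀ * Λ) (trans (∑<-suc J₁ v) (cong (_+ ∑< J₁ (v ∘ suc)) v0≡)) ⟩
      Λ * (v₀ + ∑< J₁ (v ∘ suc)) + v₀ * Λ ≡⟨ lem₄ Λ v₀ (∑< J₁ (v ∘ suc)) ⟩
      Λ * (2 * v₀ + ∑< J₁ (v ∘ suc)) ∎)
      where
      lem₃ : ∀ l v r → l * (v * r) ≡ v * (r * l)
      lem₃ = solve-∀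
      lem₄ : ∀ l v s → l * (v + s) + v * l ≡ l * (2 * v + s)
      lem₄ = solve-∀

  W : ℕ
  W = 2 ^ q * v₀

  αt≤ : α * t ≤ 2 ^ n
  αt≤ = square-≤-^ α n t n t-low (central-bound n h)

  Wt≤ : W * t ≤ 2 * 2 ^ n
  Wt≤ = begin
    2 ^ q * v₀ * t ≡⟨ *-assoc (2 ^ q) v₀ t ⟩
    2 ^ q * (v₀ * t) ≤⟨ *-monoʳ-≤ (2 ^ q) (square-cancel (begin
      v₀ * t * (v₀ * t) ≡⟨ lem₁ v₀ t ⟩
      t * t * (v₀ * v₀) ≤⟨ *-monoˡ-≤ (v₀ * v₀) (≤-trans t-low (≤-trans (+-monoˡ-≤ n' n'-large) (≤-reflexive (cong (n' +_) (sym (+-identityʳ n')))))) ⟩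
      2 * n' * (v₀ * v₀) ≤⟨ *-monoˡ-≤ (v₀ * v₀) (*-monoˡ-≤ n' (m≤n+m 2 2)) ⟩
      4 * n' * (v₀ * v₀) ≡⟨ *-assoc 4 n' (v₀ * v₀) ⟩
      4 * (n' * (v₀ * v₀)) ≤⟨ *-monoʳ-≤ 4 (central-bound n' b₀) ⟩
      4 * 4 ^ n' ≡⟨ cong (4 *_) (four-power n') ⟩
      4 * (2 ^ n' * 2 ^ n') ≡⟨ lem₂ (2 ^ n') ⟩
      2 * 2 ^ n' * (2 * 2 ^ n') ∎)) ⟩
    2 ^ q * (2 * 2 ^ n') ≡⟨ lem₃ (2 ^ q) (2 ^ n') ⟩
    2 * (2 ^ q * 2 ^ n') ≡⟨ cong (2 *_) (^-distribˡ-+-* 2 q n') ⟨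
    2 * 2 ^ n ∎
    where
    lem₁ : ∀ v t → v * t * (v * t) ≡ t * t * (v * v)
    lem₁ = solve-∀
    lem₂ : ∀ p → 4 * (p * p) ≡ 2 * p * (2 * p)
    lem₂ = solve-∀
    lem₃ : ∀ a b → a * (2 * b) ≡ 2 * (a * b)
    lem₃ = solve-∀

  BE≤t : B * E ≤ t
  BE≤t = ≤-trans (≤-reflexive (cong (_* E) B≡)) c-low

  -- Compares `g` with half of the average chain length 2^n / α: the excess is at most a factor 1 +
  -- 22 / E.
  g-bound : 2 * (α * D.g) * E ≤ (E + 22) * 2 ^ n
  g-bound = *-cancelʳ-≤ _ _ E {{>-nonZero E>0}} (begin
    2 * (α * D.g) * E * E ≡⟨ lem₁ α D.g E ⟩
    (α * E) * (2 * D.g) * E ≤⟨ *-monoˡ-≤ E (*-monoˡ-≤ (2 * D.g) α≤) ⟩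
    suc E * (2 ^ q * v₀) * (2 * D.g) * E ≡⟨ lem₂ (suc E) (2 ^ q) v₀ (2 * q) (B * suc H.rounds) E ⟩
    suc E * (2 ^ q * ((2 * v₀ * (2 * q) + 2 * (v₀ * (B * suc H.rounds))) * E)) ≤⟨ *-monoʳ-≤ (suc E) (*-monoʳ-≤ (2 ^ q) (*-monoˡ-≤ E (+-monoʳ-≤ (2 * v₀ * (2 * q)) rounds-bound))) ⟩
    suc E * (2 ^ q * ((2 * v₀ * (2 * q) + (6 * B * v₀ + 2 ^ n')) * E)) ≡⟨ lem₃ (suc E) (2 ^ q) v₀ q B (2 ^ n') E ⟩
    suc E * (2 ^ q * v₀ * (4 * (E * q) + 6 * (B * E)) + 2 ^ q * 2 ^ n' * E) ≤⟨ *-monoʳ-≤ (suc E) (+-monoˡ-≤ (2 ^ q * 2 ^ n' * E) (*-monoʳ-≤ (2 ^ q * v₀) (+-mono-≤ (*-monoʳ-≤ 4 Eq≤t) (*-monoʳ-≤ 6 BE≤t)))) ⟩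
    suc E * (2 ^ q * v₀ * (4 * t + 6 * t) + 2 ^ q * 2 ^ n' * E) ≡⟨ cong₂ (λ a b → suc E * (a + b * E)) (lem₄ (2 ^ q * v₀) t) (sym (^-distribˡ-+-* 2 q n')) ⟩
    suc E * (10 * (W * t) + 2 ^ n * E) ≤⟨ *-monoʳ-≤ (suc E) (+-monoˡ-≤ (2 ^ n * E) (*-monoʳ-≤ 10 Wt≤)) ⟩
    suc E * (10 * (2 * 2 ^ n) + 2 ^ n * E) ≡⟨ lem₅ E (2 ^ n) ⟩
    2 ^ n * (E * E + 21 * E + 20) ≤⟨ *-monoʳ-≤ (2 ^ n) (+-monoʳ-≤ (E * E + 21 * E) 20≤E) ⟩
    2 ^ n * (E * E + 21 * E + E) ≡⟨ lem₆ (2 ^ n) E ⟩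
    (E + 22) * 2 ^ n * E ∎)
    where
    Eq≤t : E * q ≤ t
    Eq≤t = ≤-trans (*-monoʳ-≤ E (n≤1+n q)) t-large
    20≤E : 20 ≤ E
    20≤E = ≤-trans (m≤m+n 20 80) (≤-trans (*-monoʳ-≤ 100 e>0) (≤-reflexive (sym E-def)))
    lem₁ : ∀ a g e → 2 * (a * g) * e * e ≡ (a * e) * (2 * g) * e
    lem₁ = solve-∀
    lem₂ : ∀ s p v q b e → s * (p * v) * (2 * (q + b)) * e ≡ s * (p * ((2 * v * q + 2 * (v * b)) * e))
    lem₂ = solve-∀
    lem₃ : ∀ s p v q b r e → s * (p * ((2 * v * (2 * q) + (6 * b * v + r)) * e)) ≡ s * (p * v * (4 * (e * q) + 6 * (b * e)) + p * r * e)
    lem₃ = solve-∀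
    lem₄ : ∀ w t → w * (4 * t + 6 * t) ≡ 10 * (w * t)
    lem₄ = solve-∀
    lem₅ : ∀ e p → suc e * (10 * (2 * p) + p * e) ≡ p * (e * e + 21 * e + 20)
    lem₅ = solve-∀
    lem₆ : ∀ p e → p * (e * e + 21 * e + e) ≡ (e + 22) * p * e
    lem₆ = solve-∀

  -- The constant 100 in E is chosen for `margin`: in 2e (1 + 22/E)² the excess over 2e is 0.88 +
  -- 0.0968 / e, below 1.
  main-term : 8 * e * (α * (α * (D.g * D.g))) ≤ suc (2 * e) * 4 ^ n
  main-term = *-cancelʳ-≤ _ _ (E * E) {{m*n≢0 E E {{>-nonZero E>0}} {{>-nonZero E>0}}}} (begin
    8 * e * (α * (α * (D.g * D.g))) * (E * E) ≡⟨ lem₁ e α D.g E ⟩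
    2 * e * ((2 * (α * D.g) * E) * (2 * (α * D.g) * E)) ≤⟨ *-monoʳ-≤ (2 * e) (*-mono-≤ g-bound g-bound) ⟩
    2 * e * ((E + 22) * 2 ^ n * ((E + 22) * 2 ^ n)) ≡⟨ trans (lem₂ e E (2 ^ n)) (cong (2 * e * ((E + 22) * (E + 22)) *_) (sym (four-power n))) ⟩
    2 * e * ((E + 22) * (E + 22)) * 4 ^ n ≤⟨ *-monoˡ-≤ (4 ^ n) (subst (λ E → 2 * e * ((E + 22) * (E + 22)) ≤ suc (2 * e) * (E * E)) (sym E-def) (margin e e>0)) ⟩
    suc (2 * e) * (E * E) * 4 ^ n ≡⟨ lem₃ (suc (2 * e)) (E * E) (4 ^ n) ⟩
    suc (2 * e) * 4 ^ n * (E * E) ∎)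
    where
    lem₁ : ∀ e a g E → 8 * e * (a * (a * (g * g))) * (E * E) ≡ 2 * e * ((2 * (a * g) * E) * (2 * (a * g) * E))
    lem₁ = solve-∀
    lem₂ : ∀ e E p → 2 * e * ((E + 22) * p * ((E + 22) * p)) ≡ 2 * e * ((E + 22) * (E + 22)) * (p * p)
    lem₂ = solve-∀
    lem₃ : ∀ a b c → a * b * c ≡ a * c * b
    lem₃ = solve-∀
    margin : ∀ e → 0 < e → 2 * e * ((100 * e + 22) * (100 * e + 22)) ≤ suc (2 * e) * (100 * e * (100 * e))
    margin (suc d) _ = ≤-trans (m≤m+n _ (1200 * (d * d) + 1432 * d + 232)) (≤-reflexive (lem d))
      where
      lem : ∀ d → 2 * suc d * ((100 * suc d + 22) * (100 * suc d + 22)) + (1200 * (d * d) + 1432 * d + 232) ≡ suc (2 * suc d) * (100 * suc d * (100 * suc d))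
      lem = solve-∀

  bad-count : ℕ
  bad-count = ∑S (⟦_⟧ ∘ H.bad)

  -- Bad chains may be as long as 2 J t, which costs J²; `q-large` makes the share of early columns
  -- small enough to pay for it.
  bad-term : 16 * e * (α * (bad-count * (D.G * D.G))) ≤ 4 ^ n
  bad-term = *-cancelʳ-≤ _ _ (2 ^ q) {{m^n≢0 2 q}} (begin
    16 * e * (α * (bad-count * (D.G * D.G))) * 2 ^ q ≤⟨ *-monoˡ-≤ (2 ^ q) (*-monoʳ-≤ (16 * e) (*-monoʳ-≤ α (*-mono-≤ H.few-bad (*-mono-≤ G≤ G≤)))) ⟩
    16 * e * (α * (H.early * v₀ * (2 * (J * t) * (2 * (J * t))))) * 2 ^ q ≡⟨ lem₁ e α H.early v₀ J t (2 ^ q) ⟩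
    64 * e * (J * J) * H.early * ((α * t) * (2 ^ q * v₀ * t)) ≤⟨ *-monoʳ-≤ (64 * e * (J * J) * H.early) (*-mono-≤ αt≤ Wt≤) ⟩
    64 * e * (J * J) * H.early * (2 ^ n * (2 * 2 ^ n)) ≡⟨ trans (lem₂ e (J * J) H.early (2 ^ n)) (cong (128 * e * (J * J) * H.early *_) (sym (four-power n))) ⟩
    128 * e * (J * J) * H.early * 4 ^ n ≤⟨ *-monoˡ-≤ (4 ^ n) (≤-trans (≤-reflexive (cong (λ m → 128 * e * (J * J) * ∑S {q} (λ x → ⟦ does (pos x <? suc Z * m) ⟧)) M!)) q-large) ⟩
    2 ^ q * 4 ^ n ≡⟨ *-comm (2 ^ q) (4 ^ n) ⟩
    4 ^ n * 2 ^ q ∎)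
    where
    G≤ : D.G ≤ 2 * (J * t)
    G≤ = begin
      suc q + J * B ≤⟨ +-mono-≤ (≤-trans q<t (m≤n*m t J)) (*-monoʳ-≤ J (≤-trans (m≤m*n B E {{>-nonZero E>0}}) BE≤t)) ⟩
      J * t + J * t ≡⟨ cong (J * t +_) (+-identityʳ (J * t)) ⟨
      2 * (J * t) ∎
    lem₁ : ∀ e a r v j t p → 16 * e * (a * (r * v * (2 * (j * t) * (2 * (j * t))))) * p ≡ 64 * e * (j * j) * r * ((a * t) * (p * v * t))
    lem₁ = solve-∀
    lem₂ : ∀ e j r p → 64 * e * j * r * (p * (2 * p)) ≡ 128 * e * j * r * (p * p)
    lem₂ = solve-∀

  L : ℕ
  L = b₀ + J * B

  -- Beyond `L` the weight l - h + 1 is at most 2l - n, the weight for which the tail telescopes.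
  tail-bound : D.tail ≤ n * (n C L)
  tail-bound = begin
    D.tail ≡⟨ ∑-levels n (λ l → does (L ≤? l)) (λ l → suc (l ∸ h)) ⟩
    ∑< (suc n) F ≤⟨ ∑<-≤-index F (m≤n+m (suc n) L) ⟩
    ∑< (L + suc n) F ≡⟨ trans (∑<-split L (suc n) F) (cong (_+ ∑< (suc n) (λ i → F (L + i))) (trans (∑<-cong L below-L) (∑-0 (range L)))) ⟩
    ∑< (suc n) (λ i → F (L + i)) ≤⟨ ∑-mono (range (suc n)) (λ i → *-monoˡ-≤ (n C (L + i)) (≤-trans (*-monoˡ-≤ (suc (L + i ∸ h)) (⟦⟧≤1 (does (L ≤? L + i)))) (≤-trans (≤-reflexive (*-identityˡ _)) (steep (L + i) (m≤m+n L i))))) ⟩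
    ∑< (suc n) (λ i → (2 * (L + i) ∸ n) * (n C (L + i))) ≤⟨ weighted-tail n L (suc n) (λ l L≤l → ≤-trans h-mid (≤-trans (≤-trans (n≤1+n _) (≤-reflexive (lem h))) (*-monoʳ-≤ 2 (≤-trans (≤-trans (n≤1+n _) (h+2≤L)) L≤l)))) ⟩
    L * (n C L) ≤⟨ cap ⟩
    n * (n C L) ∎
    where
    F : ℕ → ℕ
    F l = ⟦ does (L ≤? l) ⟧ * suc (l ∸ h) * (n C l)
    below-L : ∀ l → l < L → F l ≡ 0
    below-L l l<L = cong (λ b → ⟦ b ⟧ * suc (l ∸ h) * (n C l)) (dec-false (L ≤? l) (<⇒≱ l<L))
    lem : ∀ h → suc (suc (h + (h + 0))) ≡ suc h + (suc h + 0)
    lem = solve-∀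
    h+2≤L : suc (suc h) ≤ L
    h+2≤L = begin
      suc (suc h) ≡⟨ +-comm 2 h ⟩
      h + 2 ≤⟨ +-mono-≤ (m≤m+n h q) (≤-trans (≤-trans (*-monoʳ-≤ 2 c>0) (≤-reflexive (sym B≡))) (m≤n*m B J)) ⟩
      h + q + J * B ∎
    steep : ∀ l → L ≤ l → suc (l ∸ h) ≤ 2 * l ∸ n
    steep l L≤l = m+n≤o⇒m≤o∸n (suc (l ∸ h)) (+-cancelʳ-≤ h _ _ (begin
      suc (l ∸ h) + n + h ≡⟨ lem₁ (l ∸ h) n h ⟩
      suc (l ∸ h + h) + n ≡⟨ cong (λ u → suc u + n) (m∸n+n≡m (≤-trans (≤-trans (n≤1+n h) (n≤1+n (suc h))) (≤-trans h+2≤L L≤l))) ⟩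
      suc l + n ≤⟨ +-monoʳ-≤ (suc l) h-mid ⟩
      suc l + suc (2 * h) ≡⟨ lem₂ l h ⟩
      l + suc (suc h) + h ≤⟨ +-monoˡ-≤ h (+-monoʳ-≤ l (≤-trans h+2≤L L≤l)) ⟩
      l + l + h ≡⟨ cong (λ u → l + u + h) (+-identityʳ l) ⟨
      2 * l + h ∎))
      where
      lem₁ : ∀ a n h → suc a + n + h ≡ suc (a + h) + n
      lem₁ = solve-∀
      lem₂ : ∀ l h → suc l + suc (2 * h) ≡ l + suc (suc h) + h
      lem₂ = solve-∀
    cap : L * (n C L) ≤ n * (n C L)
    cap = case L ≤? n of λ
      { (yes l) → *-monoˡ-≤ (n C L) l
      ; (no ≰) → ≤-trans (≤-reflexive (trans (cong (L *_) (k>n⇒nCk≡0 (≰⇒> ≰))) (*-zeroʳ L))) z≤n }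

  -- The J B levels from `b₀` up to `L` are at least as large as level `L`, so C(n,L) ≤ 2^n / (J B).
  -- With J B ≥ 128 e t this averaging suffices and no exponential tail estimate is involved.
  tail-term : 32 * e * (α * D.tail) ≤ 4 ^ n
  tail-term = *-cancelʳ-≤ _ _ (J * B) {{m*n≢0 J B}} (begin
    32 * e * (α * D.tail) * (J * B) ≤⟨ *-monoˡ-≤ (J * B) (*-monoʳ-≤ (32 * e) (*-monoʳ-≤ α tail-bound)) ⟩
    32 * e * (α * (n * (n C L))) * (J * B) ≡⟨ lem₁ e α n (n C L) (J * B) ⟩
    32 * e * α * n * (J * B * (n C L)) ≤⟨ *-mono-≤ (*-monoʳ-≤ (32 * e * α) n≤4t²) spread ⟩
    32 * e * α * (4 * (t * t)) * 2 ^ n ≡⟨ lem₂ e α t (2 ^ n) ⟩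
    128 * e * t * (α * t * 2 ^ n) ≤⟨ *-monoʳ-≤ (128 * e * t) (*-monoˡ-≤ (2 ^ n) αt≤) ⟩
    128 * e * t * (2 ^ n * 2 ^ n) ≡⟨ cong (128 * e * t *_) (four-power n) ⟨
    128 * e * t * 4 ^ n ≤⟨ *-monoˡ-≤ (4 ^ n) long ⟩
    J * B * 4 ^ n ≡⟨ *-comm (J * B) (4 ^ n) ⟩
    4 ^ n * (J * B) ∎)
    where
    lem₁ : ∀ e a n c j → 32 * e * (a * (n * c)) * j ≡ 32 * e * a * n * (j * c)
    lem₁ = solve-∀
    lem₂ : ∀ e a t p → 32 * e * a * (4 * (t * t)) * p ≡ 128 * e * t * (a * t * p)
    lem₂ = solve-∀
    lem₃ : ∀ e E c → 128 * e * (4 * E * c) ≡ 256 * e * E * (2 * c)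
    lem₃ = solve-∀
    long : 128 * e * t ≤ J * B
    long = begin
      128 * e * t ≤⟨ *-monoʳ-≤ (128 * e) c-high ⟩
      128 * e * (4 * E * c) ≡⟨ lem₃ e E c ⟩
      256 * e * E * (2 * c) ≤⟨ *-mono-≤ J-large (≤-reflexive (sym B≡)) ⟩
      J * B ∎
    spread : J * B * (n C L) ≤ 2 ^ n
    spread = begin
      J * B * (n C L) ≡⟨ ∑<-const (J * B) (n C L) ⟨
      ∑< (J * B) (λ _ → n C L) ≤⟨ ∑<-mono (J * B) (λ i i< → binomial-antitone n (past-centre n h-mid (≤-trans (m≤m+n h q) (m≤m+n b₀ i))) (+-monoʳ-≤ b₀ (<⇒≤ i<))) ⟩
      ∑< (J * B) (λ i → n C (b₀ + i)) ≤⟨ ∑-binomials-≤ n b₀ (J * B) ⟩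
      2 ^ n ∎

  -- The budget: 2 (2e+1) from the good chains, 1 from the bad ones and 1 from the tail make 4
  -- (e+1).
  pairs-term : 4 * e * (α * pairs) ≤ suc e * 4 ^ n
  pairs-term = *-cancelˡ-≤ 4 (begin
    4 * (4 * e * (α * pairs)) ≤⟨ *-monoʳ-≤ 4 (*-monoʳ-≤ (4 * e) (*-monoʳ-≤ α D.pairs-bound)) ⟩
    4 * (4 * e * (α * (α * (D.g * D.g) + bad-count * (D.G * D.G) + 2 * D.tail))) ≡⟨ lem₁ e α (α * (D.g * D.g)) (bad-count * (D.G * D.G)) D.tail ⟩
    2 * (8 * e * (α * (α * (D.g * D.g)))) + 16 * e * (α * (bad-count * (D.G * D.G))) + 32 * e * (α * D.tail)
      ≤⟨ +-mono-≤ (+-mono-≤ (*-monoʳ-≤ 2 main-term) bad-term) tail-term ⟩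
    2 * (suc (2 * e) * 4 ^ n) + 4 ^ n + 4 ^ n ≡⟨ lem₂ e (4 ^ n) ⟩
    4 * (suc e * 4 ^ n) ∎)
    where
    lem₁ : ∀ e a x y z → 4 * (4 * e * (a * (x + y + 2 * z))) ≡ 2 * (8 * e * (a * x)) + 16 * e * (a * y) + 32 * e * (a * z)
    lem₁ = solve-∀
    lem₂ : ∀ e p → 2 * (suc (2 * e) * p) + p + p ≡ 4 * (suc e * p)
    lem₂ = solve-∀

-- At most (1 + 1/e) 4^n / (2α) edges, the leading term of the Turán bound up to the factor.
SparseGraph : ℕ → ℕ → Set
SparseGraph e n = Σ (SpanningSubgraphBn n) λ H → Admissible H × 2 * e * ((n C (n / 2)) * edgeCount H) ≤ suc e * 4 ^ n

sparse-from-sizes : ∀ {e E J₁ Z Λ q n' c t} → Sizes e E J₁ Z Λ q n' c t → SparseGraph e (q + n')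
sparse-from-sizes {e} {q = q} {n'} sizes = graph , admissible , bound
  where
  n = q + n'
  module X = Half sizes (n / 2) (half-central n)
  module Y = Half sizes (n ∸ n / 2) (other-half-central n)
  open ChainGraph n X.H.system Y.H.system
  open ≤-Reasoning
  lem₁ : ∀ e a x y → 2 * (2 * e * (a * (x + y))) ≡ 4 * e * (a * x) + 4 * e * (a * y)
  lem₁ = solve-∀
  bound : 2 * e * ((n C (n / 2)) * edgeCount graph) ≤ suc e * 4 ^ n
  bound = *-cancelˡ-≤ 2 (begin
    2 * (2 * e * ((n C (n / 2)) * edgeCount graph)) ≤⟨ *-monoʳ-≤ 2 (*-monoʳ-≤ (2 * e) (*-monoʳ-≤ (n C (n / 2)) edges-bound)) ⟩
    2 * (2 * e * ((n C (n / 2)) * (A.pairs + B.pairs))) ≡⟨ lem₁ e (n C (n / 2)) A.pairs B.pairs ⟩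
    4 * e * ((n C (n / 2)) * A.pairs) + 4 * e * ((n C (n / 2)) * B.pairs) ≤⟨ +-mono-≤ X.pairs-term (≤-trans
        (≤-reflexive (cong (λ a → 4 * e * (a * B.pairs)) (binomial-central n (half-central n) (other-half-central n)))) Y.pairs-term) ⟩
    suc e * 4 ^ n + suc e * 4 ^ n ≡⟨ cong (suc e * 4 ^ n +_) (+-identityʳ _) ⟨
    2 * (suc e * 4 ^ n) ∎)

-- No rank has more sets than the middle level, so a bounded number of ranks becomes negligible in
-- 2^q.
early-count : ∀ q P → ∑S {q} (λ x → ⟦ does (pos x <? P) ⟧) ≤ P * (q C (q / 2))
early-count q P = begin
  ∑S {q} (λ x → ⟦ does (pos x <? P) ⟧) ≤⟨ ∑-mono (allSubsets q) split ⟩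
  ∑S {q} (λ x → ∑< P (λ i → ⟦ at i x ⟧)) ≡⟨ ∑-swap (allSubsets q) (range P) _ ⟩
  ∑< P (λ i → ∑S {q} (λ x → ⟦ at i x ⟧)) ≤⟨ ∑-mono (range P) (λ i → ≤-trans (≤-reflexive (pos-count q i)) (binomial-max q (half-central q) ⌈ q + i /2⌉)) ⟩
  ∑< P (λ _ → q C (q / 2)) ≡⟨ ∑<-const P (q C (q / 2)) ⟩
  P * (q C (q / 2)) ∎
  where
  open ≤-Reasoning
  split : ∀ x → ⟦ does (pos x <? P) ⟧ ≤ ∑< P (λ i → ⟦ at i x ⟧)
  split x = case pos x <? P of λ
    { (yes l) → ≤-trans (⟦⟧≤1 (does (pos x <? P))) (≤-reflexive (sym (trans (∑-cong (range P) λ i → sym (*-identityʳ ⟦ at i x ⟧)) (∑<-δ P (pos x) (λ _ → 1) l))))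
    ; (no ≮) → ≤-trans (≤-reflexive (cong ⟦_⟧ (dec-false (pos x <? P) ≮))) z≤n }

root≤ : ∀ {t n T} → n < suc t * suc t → T * T ≤ n → T ≤ t
root≤ {t} {n} {T} hi lo = ≮⇒≥ λ t<T → <⇒≱ hi (≤-trans (*-mono-≤ t<T t<T) lo)

-- For q = Γ² each rank has at most 2^q / Γ sets, and Γ is the constant that `q-large` has to beat.
-- The threshold `N` gathers the conditions that hold once n is large for this q.
eventually-sparse : ∀ {e E J₁ Z Λ Γ q} → 0 < e → E ≡ 100 * e → 256 * e * E ≤ suc J₁ → Z ≡ 128 * (E * E) →
  Λ ≡ suc J₁ * suc J₁ * suc Z → Γ ≡ 128 * e * (suc J₁ * suc J₁) * (suc Z * suc Λ !) → q ≡ Γ * Γ → 0 < q →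
  ∃ λ N → ∀ n → N ≤ n → SparseGraph e n
eventually-sparse {e} {E} {J₁} {Z} {Λ} {Γ} {q} e>0 E-def J-large Z-def Λ-def Γ-def q-def q>0 = N , λ n N≤n →
  subst (SparseGraph e) (m+[n∸m]≡n (q≤ n N≤n)) (sparse-from-sizes (sizes n N≤n))
  where
  T X N : ℕ
  T = E * suc q + 2 * E
  X = suc E * (suc (2 * q) * suc (2 * suc (2 * q)))
  N = T * T + (q + (q + X * 2))
  E>0 : 0 < E
  E>0 = subst (0 <_) (sym E-def) (≤-trans e>0 (m≤n*m e 100))
  q-large : 128 * e * (suc J₁ * suc J₁) * ∑S {q} (λ x → ⟦ does (pos x <? suc Z * suc Λ !) ⟧) ≤ 2 ^ q
  q-large = begin
    128 * e * (suc J₁ * suc J₁) * ∑S {q} (λ x → ⟦ does (pos x <? P) ⟧) ≤⟨ *-monoʳ-≤ (128 * e * (suc J₁ * suc J₁)) (early-count q P) ⟩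
    128 * e * (suc J₁ * suc J₁) * (P * μ) ≡⟨ trans (sym (*-assoc (128 * e * (suc J₁ * suc J₁)) P μ)) (trans (cong (_* μ) (sym Γ-def)) (*-comm Γ μ)) ⟩
    μ * Γ ≤⟨ square-≤-^ μ q Γ q (≤-reflexive (sym q-def)) (central-bound q (q / 2)) ⟩
    2 ^ q ∎
    where
    open ≤-Reasoning
    P = suc Z * suc Λ !
    μ = q C (q / 2)
  q≤ : ∀ n → N ≤ n → q ≤ n
  q≤ n N≤n = ≤-trans (≤-trans (m≤m+n q _) (m≤n+m _ (T * T))) N≤n
  module _ (n : ℕ) (N≤n : N ≤ n) where
    t = proj₁ (isqrt n)
    n' = n ∸ q
    n≡ : q + n' ≡ n
    n≡ = m+[n∸m]≡n (q≤ n N≤n)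
    lo = proj₁ (proj₂ (isqrt n))
    hi = proj₂ (proj₂ (isqrt n))
    T≤t : T ≤ t
    T≤t = root≤ hi (≤-trans (m≤m+n (T * T) _) N≤n)
    instance
      2E-nonZero : NonZero (2 * E)
      2E-nonZero = >-nonZero (≤-trans E>0 (m≤m+n E _))
    c = t / (2 * E)
    2E≤t : 2 * E ≤ t
    2E≤t = ≤-trans (m≤n+m (2 * E) (E * suc q)) T≤t
    c>0 : 0 < c
    c>0 = m≥n⇒m/n>0 2E≤t
      where open import Data.Nat.DivMod using (m≥n⇒m/n>0)
    lem₁ : ∀ c E → 2 * c * E ≡ c * (2 * E)
    lem₁ = solve-∀
    lem₂ : ∀ c E → c * (2 * E) + c * (2 * E) ≡ 4 * E * c
    lem₂ = solve-∀
    rest : q + X * 2 ≤ n'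
    rest = m+n≤o⇒m≤o∸n (q + X * 2) (≤-trans (≤-reflexive (+-comm (q + X * 2) q)) (≤-trans (m≤n+m _ (T * T)) N≤n))
    sizes : Sizes e E J₁ Z Λ q n' c t
    sizes = record
      { e>0 = e>0 ; q>0 = q>0 ; E-def = E-def ; J-large = J-large ; Z-def = Z-def ; Λ-def = Λ-def ; q-large = q-large
      ; t-low = ≤-trans lo (≤-reflexive (sym n≡))
      ; t-high = subst (_< suc t * suc t) (sym n≡) hi
      ; c>0 = c>0
      ; c-low = ≤-trans (≤-reflexive (lem₁ c E)) (m/n*n≤m t (2 * E))
      ; c-high = ≤-trans (≤-reflexive (m≡m%n+[m/n]*n t (2 * E))) (≤-trans (+-monoˡ-≤ (c * (2 * E)) (≤-trans (<⇒≤ (m%n<n t (2 * E))) (m≤n*m (2 * E) c {{>-nonZero c>0}}))) (≤-reflexive (lem₂ c E)))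
      ; t-large = ≤-trans (m≤m+n (E * suc q) (2 * E)) T≤t
      ; n'-large = ≤-trans (m≤m+n q _) rest
      ; centre-large = m≤n⇒m≤1+n (≤-trans (≤-reflexive (sym (m*n/n≡m X 2))) (/-monoˡ-≤ 2 (≤-trans (m≤n+m (X * 2) q) rest))) }

abstract
  sparse-graphs : ∀ e → 0 < e → ∃ λ N → ∀ n → N ≤ n → SparseGraph e n
  sparse-graphs e e>0 = eventually-sparse {J₁ = 256 * e * (100 * e)} e>0 refl (n≤1+n _) refl refl refl refl (*-mono-≤ Γ>0 Γ>0)
    where
    positive : ∀ {a b} → 0 < a → 0 < b → 0 < a * b
    positive {a} {b} p q = *-mono-≤ {1} {a} {1} {b} p q
    J₁ Z Λ : ℕ
    J₁ = 256 * e * (100 * e)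
    Z = 128 * (100 * e * (100 * e))
    Λ = suc J₁ * suc J₁ * suc Z
    Γ>0 : 0 < 128 * e * (suc J₁ * suc J₁) * (suc Z * suc Λ !)
    Γ>0 = positive (positive (positive {128} (s≤s z≤n) e>0) (positive {suc J₁} {suc J₁} (s≤s z≤n) (s≤s z≤n))) (positive {suc Z} (s≤s z≤n) (n≢0⇒n>0 (≢-nonZero⁻¹ _ {{suc Λ !≢0}})))

-- The Turán bound

argmin : ∀ {n} (P : Subset n → Bool) (f : Subset n → ℕ) v → P v ≡ true → ∃ λ w → P w ≡ true × (∀ x → P x ≡ true → f w ≤ f x)
argmin {n} P f v pv = go (f v) v pv ≤-refl
  where
  go : ∀ fuel v → P v ≡ true → f v ≤ fuel → ∃ λ w → P w ≡ true × (∀ x → P x ≡ true → f w ≤ f x)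
  go fuel v pv bound with anySubset? (λ x → (P x Data.Bool.≟ true) ×-dec (f x <? f v))
  ... | no least = v , pv , λ x px → ≮⇒≥ λ l → least (x , px , l)
  go zero v pv bound | yes (x , px , l) = ⊥-elim (n≮0 (≤-trans l bound))
  go (suc fuel) v pv bound | yes (x , px , l) = go fuel x px (≤-pred (≤-trans l bound))

-- Cauchy-Schwarz with one block added at a time: a block of m vertices contributes weight at least
-- m², and the cross term is bounded by the arithmetic-geometric mean inequality.
cauchy-step : ∀ Q i A m → Q * Q ≤ i * A → (Q + m) * (Q + m) ≤ suc i * (A + m * m)
cauchy-step Q i A m h = begin
  (Q + m) * (Q + m) ≡⟨ lem₁ Q m ⟩
  Q * Q + m * m + 2 * (Q * m) ≤⟨ +-mono-≤ (+-monoˡ-≤ (m * m) h) cross ⟩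
  i * A + m * m + (A + i * (m * m)) ≡⟨ lem₂ i A (m * m) ⟩
  suc i * (A + m * m) ∎
  where
  open ≤-Reasoning
  lem₁ : ∀ Q m → (Q + m) * (Q + m) ≡ Q * Q + m * m + 2 * (Q * m)
  lem₁ = solve-∀
  lem₂ : ∀ i A m → i * A + m + (A + i * m) ≡ suc i * (A + m)
  lem₂ = solve-∀
  lem₃ : ∀ Q m → 2 * (Q * m) * (2 * (Q * m)) ≡ 4 * (m * m) * (Q * Q)
  lem₃ = solve-∀
  lem₄ : ∀ i A m → 4 * m * (i * A) ≡ 2 * (A * (i * m)) + 2 * (A * (i * m))
  lem₄ = solve-∀
  lem₅ : ∀ x y → x * x + y * y + 2 * (x * y) ≡ (x + y) * (x + y)
  lem₅ = solve-∀
  cross : 2 * (Q * m) ≤ A + i * (m * m)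
  cross = square-cancel (begin
    2 * (Q * m) * (2 * (Q * m)) ≡⟨ lem₃ Q m ⟩
    4 * (m * m) * (Q * Q) ≤⟨ *-monoʳ-≤ (4 * (m * m)) h ⟩
    4 * (m * m) * (i * A) ≡⟨ lem₄ i A (m * m) ⟩
    2 * (A * (i * (m * m))) + 2 * (A * (i * (m * m))) ≤⟨ +-monoˡ-≤ _ (2*-≤-squares A (i * (m * m))) ⟩
    A * A + i * (m * m) * (i * (m * m)) + 2 * (A * (i * (m * m))) ≡⟨ lem₅ A (i * (m * m)) ⟩
    (A + i * (m * m)) * (A + i * (m * m)) ∎)

module Greedy {n : ℕ} (G : SpanningSubgraphBn n) where
  open ≤-Reasoning

  loopless : ∀ x → edge G x x ≡ false
  loopless x = ¬true⇒false λ e → case edge-sub G x x e of λ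
    { (inj₁ (_ , _ , a , b)) → b a ; (inj₂ (_ , _ , a , b)) → b a }

  degree+1 : Subset n → ℕ
  degree+1 x = suc (∑S (λ y → ⟦ edge G x y ⟧))

  ∣_∣ᵇ : (Subset n → Bool) → ℕ
  ∣ P ∣ᵇ = ∑S (⟦_⟧ ∘ P)

  weight : (Subset n → Bool) → ℕ
  weight P = ∑S (λ x → ⟦ P x ⟧ * degree+1 x)

  -- The quadratic form of the invariant yields a bound by the average degree instead of the maximal
  -- one, and it survives the deletion of a closed neighbourhood.
  Greedily : (Subset n → Bool) → Set
  Greedily P = Σ (Subset n → Bool) λ I → IsIndependent G I × (∀ x → I x ≡ true → P x ≡ true) × ∣ P ∣ᵇ * ∣ P ∣ᵇ ≤ ∣ I ∣ᵇ * weight P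

  partition : ∀ (P C : Subset n → Bool) (f : Subset n → ℕ) →
    ∑S (λ x → ⟦ P x ⟧ * f x) ≡ ∑S (λ x → ⟦ P x ∧ not (C x) ⟧ * f x) + ∑S (λ x → ⟦ P x ∧ C x ⟧ * f x)
  partition P C f = trans (∑-cong (allSubsets n) λ x → split (P x) (C x) (f x)) (∑-+ (allSubsets n) _ _)
    where
    split : ∀ p c m → ⟦ p ⟧ * m ≡ ⟦ p ∧ not c ⟧ * m + ⟦ p ∧ c ⟧ * m
    split false c m = refl
    split true true m = refl
    split true false m = sym (+-identityʳ (m + 0))

  count-1 : ∀ (P : Subset n → Bool) → ∣ P ∣ᵇ ≡ ∑S (λ x → ⟦ P x ⟧ * 1)
  count-1 P = ∑-cong (allSubsets n) λ x → sym (*-identityʳ ⟦ P x ⟧)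

  greedy : ∀ fuel P → ∣ P ∣ᵇ ≤ fuel → Greedily P
  greedy fuel P bound with anySubset? (λ x → P x Data.Bool.≟ true)
  ... | no none = (λ _ → false) , (λ _ _ ()) , (λ _ ()) , ≤-trans (≤-reflexive (cong (λ m → m * m) zeroP)) z≤n
    where
    zeroP : ∣ P ∣ᵇ ≡ 0
    zeroP = trans (∑-cong (allSubsets n) λ x → cong ⟦_⟧ (¬true⇒false λ h → none (x , h))) (∑-0 (allSubsets n))
  greedy zero P bound | yes (u , pu) = ⊥-elim (<⇒≱ (s≤s z≤n) (≤-trans (≤-trans (≤-reflexive (cong ⟦_⟧ (sym pu))) (∑S-pos (⟦_⟧ ∘ P) u)) bound))
  greedy (suc fuel) P bound | yes (u , pu) = I , independent , inside , final
    where
    inner : Subset n → ℕ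
    inner x = ∑S (λ y → ⟦ P y ∧ edge G x y ⟧)
    least = argmin P inner u pu
    -- With v of least degree inside P, every deleted vertex has degree at least m - 1, so the m
    -- deleted vertices carry weight at least m².
    v = proj₁ least
    pv = proj₁ (proj₂ least)
    minimal = proj₂ (proj₂ least)
    near Q : Subset n → Bool
    near x = does (v ≡S? x) ∨ edge G v x
    Q x = P x ∧ not (near x)
    m = ∑S (λ x → ⟦ P x ∧ near x ⟧)
    m≡ : m ≡ suc (inner v)
    m≡ = trans (∑-cong (allSubsets n) per) (trans (∑-+ (allSubsets n) _ _) (cong (_+ inner v) (∑S-δ1 v)))
      where
      per : ∀ x → ⟦ P x ∧ near x ⟧ ≡ ⟦ does (v ≡S? x) ⟧ + ⟦ P x ∧ edge G v x ⟧
      per x with v ≡S? x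
      ... | no _ = refl
      ... | yes refl rewrite pv | loopless v = refl
    sizes : ∣ P ∣ᵇ ≡ ∣ Q ∣ᵇ + m
    sizes = trans (count-1 P) (trans (partition P near (λ _ → 1)) (cong₂ _+_ (sym (count-1 Q)) (sym (count-1 (λ x → P x ∧ near x)))))
    smaller : ∣ Q ∣ᵇ ≤ fuel
    smaller = ≤-pred (≤-trans (≤-trans (≤-reflexive (+-comm 1 ∣ Q ∣ᵇ)) (+-monoʳ-≤ ∣ Q ∣ᵇ (≤-trans (s≤s z≤n) (≤-reflexive (sym m≡))))) (≤-trans (≤-reflexive (sym sizes)) bound))
    rec = greedy fuel Q smaller
    I' = proj₁ rec
    independent' = proj₁ (proj₂ rec)
    inside' = proj₁ (proj₂ (proj₂ rec))
    bound' = proj₂ (proj₂ (proj₂ rec))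
    I : Subset n → Bool
    I x = does (v ≡S? x) ∨ I' x
    far-from-v : ∀ x → I' x ≡ true → near x ≡ false
    far-from-v x h = not-true (proj₂ (∧-elim {P x} (inside' x h)))
      where
      not-true : ∀ {b} → not b ≡ true → b ≡ false
      not-true {false} _ = refl
    no-edge : ∀ x → I' x ≡ true → edge G v x ≡ false
    no-edge x h = ¬true⇒false λ e → true≢false (∨-introʳ {does (v ≡S? x)} e) (far-from-v x h)
    independent : IsIndependent G I
    independent x y ix iy with ∨-elim {does (v ≡S? x)} ix | ∨-elim {does (v ≡S? y)} iy
    ... | inj₂ a | inj₂ b = independent' x y a b
    ... | inj₁ a | inj₂ b = subst (λ w → edge G w y ≡ false) (does⁻ (v ≡S? x) a) (no-edge y b)
    ... | inj₂ a | inj₁ b = trans (edge-sym G x y) (subst (λ w → edge G w x ≡ false) (does⁻ (v ≡S? y) b) (no-edge x a))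
    ... | inj₁ a | inj₁ b = subst₂ (λ s t → edge G s t ≡ false) (does⁻ (v ≡S? x) a) (does⁻ (v ≡S? y) b) (loopless v)
    inside : ∀ x → I x ≡ true → P x ≡ true
    inside x h with ∨-elim {does (v ≡S? x)} h
    ... | inj₁ a = subst (λ w → P w ≡ true) (does⁻ (v ≡S? x) a) pv
    ... | inj₂ a = proj₁ (∧-elim (inside' x a))
    bigger : suc ∣ I' ∣ᵇ ≤ ∣ I ∣ᵇ
    bigger = ≤-trans (≤-reflexive (trans (cong (_+ ∣ I' ∣ᵇ) (sym (∑S-δ1 v))) (sym (∑-+ (allSubsets n) _ _)))) (∑-mono (allSubsets n) per)
      where
      per : ∀ x → ⟦ does (v ≡S? x) ⟧ + ⟦ I' x ⟧ ≤ ⟦ I x ⟧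
      per x with v ≡S? x
      ... | no _ = ≤-refl
      ... | yes refl with I' v in iv
      ...   | false = ≤-refl
      ...   | true = ⊥-elim (true≢false (∨-introˡ (does⁺ (v ≡S? v) refl)) (far-from-v v iv))
    heavy : weight Q + m * m ≤ weight P
    heavy = begin
      weight Q + m * m ≡⟨ cong (weight Q +_) (∑-*ʳ (allSubsets n) m _) ⟨
      weight Q + ∑S (λ x → ⟦ P x ∧ near x ⟧ * m) ≤⟨ +-monoʳ-≤ (weight Q) (∑-mono (allSubsets n) per) ⟩
      weight Q + ∑S (λ x → ⟦ P x ∧ near x ⟧ * degree+1 x) ≡⟨ partition P near degree+1 ⟨
      weight P ∎
      where
      per : ∀ x → ⟦ P x ∧ near x ⟧ * m ≤ ⟦ P x ∧ near x ⟧ * degree+1 x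
      per x with P x in px
      ... | false = z≤n
      ... | true = *-monoʳ-≤ ⟦ near x ⟧ (≤-trans (≤-reflexive m≡) (s≤s (≤-trans (minimal x px)
            (∑-mono (allSubsets n) λ y → ⟦⟧-mono λ h → proj₂ (∧-elim {P y} h)))))
    final : ∣ P ∣ᵇ * ∣ P ∣ᵇ ≤ ∣ I ∣ᵇ * weight P
    final = begin
      ∣ P ∣ᵇ * ∣ P ∣ᵇ ≡⟨ cong (λ s → s * s) sizes ⟩
      (∣ Q ∣ᵇ + m) * (∣ Q ∣ᵇ + m) ≤⟨ cauchy-step ∣ Q ∣ᵇ ∣ I' ∣ᵇ (weight Q) m bound' ⟩
      suc ∣ I' ∣ᵇ * (weight Q + m * m) ≤⟨ *-mono-≤ bigger heavy ⟩
      ∣ I ∣ᵇ * weight P ∎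

-- The greedy set starting from all vertices has at most α elements; the `suc` covers the remainder
-- of the halving in `edgeCount`.
turán : ∀ {n} (G : SpanningSubgraphBn n) → Admissible G → 4 ^ n ≤ (n C (n / 2)) * (suc (2 * edgeCount G) + 2 ^ n)
turán {n} G adm = begin
  4 ^ n ≡⟨ four-power n ⟩
  2 ^ n * 2 ^ n ≡⟨ cong (λ s → s * s) (∑S-1 n) ⟨
  ∣ all ∣ᵇ * ∣ all ∣ᵇ ≤⟨ bound ⟩
  ∣ I ∣ᵇ * weight all ≤⟨ *-mono-≤ (≤-trans (≤-reflexive (sym (length-filter I (allSubsets n)))) (adm I independent)) (≤-reflexive total) ⟩
  (n C (n / 2)) * (E + 2 ^ n) ≤⟨ *-monoʳ-≤ (n C (n / 2)) (+-monoˡ-≤ (2 ^ n) halves) ⟩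
  (n C (n / 2)) * (suc (2 * edgeCount G) + 2 ^ n) ∎
  where
  open ≤-Reasoning
  open Greedy G
  all : Subset n → Bool
  all _ = true
  run = greedy ∣ all ∣ᵇ all ≤-refl
  I = proj₁ run
  independent = proj₁ (proj₂ run)
  bound = proj₂ (proj₂ (proj₂ run))
  E = ∑S (λ x → ∑S (λ y → ⟦ edge G x y ⟧))
  total : weight all ≡ E + 2 ^ n
  total = trans (∑-cong (allSubsets n) λ x → trans (*-identityˡ (degree+1 x)) (+-comm 1 _)) (trans (∑-+ (allSubsets n) _ _) (cong (E +_) (∑S-1 n)))
  halves : E ≤ suc (2 * edgeCount G)
  halves = begin
    E ≡⟨ m≡m%n+[m/n]*n E 2 ⟩
    E % 2 + E / 2 * 2 ≤⟨ +-monoˡ-≤ (E / 2 * 2) (≤-pred (m%n<n E 2)) ⟩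
    suc (E / 2 * 2) ≡⟨ cong suc (trans (*-comm (E / 2) 2) (cong (2 *_) (sym (edgeCount-∑ G)))) ⟩
    suc (2 * edgeCount G) ∎

-- The Wallis integral and the Leibniz series

ℚ-ring : ACR.AlmostCommutativeRing _ _
ℚ-ring = ACR.fromCommutativeRing ℚP.+-*-commutativeRing (λ p → decToMaybe (0ℚ ℚP.≟ p))
  where open import Relation.Nullary.Decidable using () renaming (dec⇒maybe to decToMaybe)

fromℚᵘ-+ : ∀ p q → ℚ.fromℚᵘ p +ℚ ℚ.fromℚᵘ q ≡ ℚ.fromℚᵘ (p ℚᵘ.+ q)
fromℚᵘ-+ p q = ℚP.toℚᵘ-injective (ℚᵘP.≃-trans (ℚP.toℚᵘ-homo-+ (ℚ.fromℚᵘ p) (ℚ.fromℚᵘ q))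
  (ℚᵘP.≃-trans (ℚᵘP.+-cong (ℚP.toℚᵘ-fromℚᵘ p) (ℚP.toℚᵘ-fromℚᵘ q)) (ℚᵘP.≃-sym (ℚP.toℚᵘ-fromℚᵘ (p ℚᵘ.+ q)))))

fromℚᵘ-* : ∀ p q → ℚ.fromℚᵘ p *ℚ ℚ.fromℚᵘ q ≡ ℚ.fromℚᵘ (p ℚᵘ.* q)
fromℚᵘ-* p q = ℚP.toℚᵘ-injective (ℚᵘP.≃-trans (ℚP.toℚᵘ-homo-* (ℚ.fromℚᵘ p) (ℚ.fromℚᵘ q))
  (ℚᵘP.≃-trans (ℚᵘP.*-cong (ℚP.toℚᵘ-fromℚᵘ p) (ℚP.toℚᵘ-fromℚᵘ q)) (ℚᵘP.≃-sym (ℚP.toℚᵘ-fromℚᵘ (p ℚᵘ.* q)))))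

fromℚᵘ-≤ : ∀ {p q} → p ℚᵘ.≤ q → ℚ.fromℚᵘ p ≤ℚ ℚ.fromℚᵘ q
fromℚᵘ-≤ {p} {q} h = ℚP.toℚᵘ-cancel-≤ (ℚᵘP.≤-respˡ-≃ (ℚᵘP.≃-sym (ℚP.toℚᵘ-fromℚᵘ p)) (ℚᵘP.≤-respʳ-≃ (ℚᵘP.≃-sym (ℚP.toℚᵘ-fromℚᵘ q)) h))

fromℚᵘ-≤⁻ : ∀ {p q} → ℚ.fromℚᵘ p ≤ℚ ℚ.fromℚᵘ q → p ℚᵘ.≤ q
fromℚᵘ-≤⁻ {p} {q} h = ℚᵘP.≤-respˡ-≃ (ℚP.toℚᵘ-fromℚᵘ p) (ℚᵘP.≤-respʳ-≃ (ℚP.toℚᵘ-fromℚᵘ q) (ℚP.toℚᵘ-mono-≤ h))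

term-anti : ∀ k → leibnizTerm (suc k) ≤ℚ leibnizTerm k
term-anti k = fromℚᵘ-≤ {mkℚᵘ (ℤ.+ 4) (2 * suc k)} {mkℚᵘ (ℤ.+ 4) (2 * k)} (*≤* (ℤ.+≤+ (*-monoʳ-≤ 4 (s≤s (*-monoʳ-≤ 2 (n≤1+n k))))))

abstract
  ι : ℕ → ℚ
  ι = ℕ→ℚ

  ι-+ : ∀ a b → ι (a + b) ≡ ι a +ℚ ι b
  ι-+ a b = sym (trans (fromℚᵘ-+ (mkℚᵘ (ℤ.+ a) 0) (mkℚᵘ (ℤ.+ b) 0)) (ℚP.fromℚᵘ-cong {mkℚᵘ (ℤ.+ a) 0 ℚᵘ.+ mkℚᵘ (ℤ.+ b) 0} {mkℚᵘ (ℤ.+ (a + b)) 0} (*≡* (cong (ℤ._* ℤ.+ 1) (cong₂ ℤ._+_ (ℤP.*-identityʳ (ℤ.+ a)) (ℤP.*-identityʳ (ℤ.+ b)))))))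

  ι-* : ∀ a b → ι (a * b) ≡ ι a *ℚ ι b
  ι-* a b = sym (trans (fromℚᵘ-* (mkℚᵘ (ℤ.+ a) 0) (mkℚᵘ (ℤ.+ b) 0)) (ℚP.fromℚᵘ-cong {mkℚᵘ (ℤ.+ a) 0 ℚᵘ.* mkℚᵘ (ℤ.+ b) 0} {mkℚᵘ (ℤ.+ (a * b)) 0} (*≡* (cong (ℤ._* ℤ.+ 1) (sym (ℤP.pos-* a b))))))

  ι-≤ : ∀ {a b} → a ≤ b → ι a ≤ℚ ι b
  ι-≤ {a} {b} h = fromℚᵘ-≤ {mkℚᵘ (ℤ.+ a) 0} {mkℚᵘ (ℤ.+ b) 0} (*≤* (subst₂ ℤ._≤_ (sym (ℤP.*-identityʳ (ℤ.+ a))) (sym (ℤP.*-identityʳ (ℤ.+ b))) (ℤ.+≤+ h)))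

  ι-≤⁻ : ∀ {a b} → ι a ≤ℚ ι b → a ≤ b
  ι-≤⁻ {a} {b} h with fromℚᵘ-≤⁻ {mkℚᵘ (ℤ.+ a) 0} {mkℚᵘ (ℤ.+ b) 0} h
  ... | *≤* le = ℤP.drop‿+≤+ (subst₂ ℤ._≤_ (ℤP.*-identityʳ (ℤ.+ a)) (ℤP.*-identityʳ (ℤ.+ b)) le)

  ι-isNonNeg : ∀ a → ℚ.NonNegative (ι a)
  ι-isNonNeg a = ℚP.normalize-nonNeg a 1

  ι-isPos : ∀ a → 0 < a → ℚ.Positive (ι a)
  ι-isPos a 0<a = ℚP.normalize-pos a 1 {{_}} {{>-nonZero 0<a}}

  ι-def : ∀ a → ι a ≡ ℕ→ℚ a
  ι-def a = refl

  ι-1 : ι 1 ≡ 1ℚ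
  ι-1 = refl

  ι-0 : ι 0 ≡ 0ℚ
  ι-0 = refl

  term-unit : ∀ k → ι (suc (2 * k)) *ℚ leibnizTerm k ≡ ι 4
  term-unit k = trans (fromℚᵘ-* (mkℚᵘ (ℤ.+ suc (2 * k)) 0) (mkℚᵘ (ℤ.+ 4) (2 * k))) (ℚP.fromℚᵘ-cong {mkℚᵘ (ℤ.+ suc (2 * k)) 0 ℚᵘ.* mkℚᵘ (ℤ.+ 4) (2 * k)} {mkℚᵘ (ℤ.+ 4) 0} (*≡* (cong ℤ.+_ (lem (2 * k)))))
    where
    lem : ∀ j → suc j * 4 * 1 ≡ 4 * (suc j + 0)
    lem = solve-∀

  term≤4 : ∀ k → leibnizTerm k ≤ℚ ι 4
  term≤4 zero = ℚP.≤-refl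
  term≤4 (suc k) = ℚP.≤-trans (term-anti k) (term≤4 k)

instance
  ι-nonNeg : ∀ {a} → ℚ.NonNegative (ι a)
  ι-nonNeg {a} = ι-isNonNeg a

ι-mono : ∀ a {p q} → p ≤ℚ q → ι a *ℚ p ≤ℚ ι a *ℚ q
ι-mono a = ℚP.*-monoˡ-≤-nonNeg (ι a)

ι-cancel : ∀ a {p q} → 0 < a → ι a *ℚ p ≤ℚ ι a *ℚ q → p ≤ℚ q
ι-cancel a 0<a = ℚP.*-cancelˡ-≤-pos (ι a) {{ι-isPos a 0<a}}

-ℚ-anti : ∀ r p q → p ≤ℚ q → r -ℚ q ≤ℚ r -ℚ p
-ℚ-anti r p q h = ℚP.+-monoʳ-≤ r (ℚP.neg-antimono-≤ h)

term≥0 : ∀ k → 0ℚ ≤ℚ leibnizTerm k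
term≥0 k = ℚP.nonNegative⁻¹ (leibnizTerm k) {{ℚP.normalize-nonNeg 4 (suc (2 * k))}}

-- The N-term sum f 0 - f 1 + f 2 - ..., nested so that no signs have to be tracked.
alt : ℕ → (ℕ → ℚ) → ℚ
alt zero f = 0ℚ
alt (suc N) f = f 0 -ℚ alt N (f ∘ suc)

alt-cong : ∀ N {f g : ℕ → ℚ} → (∀ k → f k ≡ g k) → alt N f ≡ alt N g
alt-cong zero h = refl
alt-cong (suc N) h = cong₂ _-ℚ_ (h 0) (alt-cong N (h ∘ suc))

alt-+ : ∀ N (f g : ℕ → ℚ) → alt N (λ k → f k +ℚ g k) ≡ alt N f +ℚ alt N g
alt-+ zero f g = sym (ℚP.+-identityʳ 0ℚ)
alt-+ (suc N) f g = trans (cong ((f 0 +ℚ g 0) -ℚ_) (alt-+ N (f ∘ suc) (g ∘ suc))) (lem (f 0) (g 0) _ _)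
  where
  lem : ∀ a b c d → (a +ℚ b) -ℚ (c +ℚ d) ≡ (a -ℚ c) +ℚ (b -ℚ d)
  lem = RS.solve-∀ ℚ-ring

alt-* : ∀ N c (f : ℕ → ℚ) → alt N (λ k → c *ℚ f k) ≡ c *ℚ alt N f
alt-* zero c f = sym (ℚP.*-zeroʳ c)
alt-* (suc N) c f = trans (cong (c *ℚ f 0 -ℚ_) (alt-* N c (f ∘ suc))) (lem c (f 0) _)
  where
  lem : ∀ c a b → c *ℚ a -ℚ c *ℚ b ≡ c *ℚ (a -ℚ b)
  lem = RS.solve-∀ ℚ-ring

alt-telescope : ∀ N (f : ℕ → ℚ) → f N ≡ 0ℚ → alt N (λ k → f k +ℚ f (suc k)) ≡ f 0
alt-telescope zero f h = sym h
alt-telescope (suc N) f h = trans (cong ((f 0 +ℚ f 1) -ℚ_) (alt-telescope N (f ∘ suc) h)) (lem (f 0) (f 1))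
  where
  lem : ∀ a b → (a +ℚ b) -ℚ b ≡ a
  lem = RS.solve-∀ ℚ-ring

alternate : ℕ → ℚ → ℚ
alternate zero p = p
alternate (suc N) p = ⊝ alternate N p

alt-last : ∀ N f → alt (suc N) f ≡ alt N f +ℚ alternate N (f N)
alt-last zero f = lem (f 0)
  where
  lem : ∀ a → a -ℚ 0ℚ ≡ 0ℚ +ℚ a
  lem a = trans (ℚP.+-identityʳ a) (sym (ℚP.+-identityˡ a))
alt-last (suc N) f = trans (cong (f 0 -ℚ_) (alt-last N (f ∘ suc))) (lem (f 0) _ _)
  where
  lem : ∀ a b c → a -ℚ (b +ℚ c) ≡ (a -ℚ b) +ℚ (⊝ c)
  lem = RS.solve-∀ ℚ-ring

-- The parity test inside leibniz is local to its definition, so it is recovered here by unification.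
leibniz-step : Σ (ℕ → Bool) λ even → ∀ r → leibniz (suc (suc r)) ≡
  (if even r then leibniz (suc r) +ℚ leibnizTerm (suc (suc r)) else leibniz (suc r) -ℚ leibnizTerm (suc (suc r)))
leibniz-step = _ , λ r → refl

parity-sign : ∀ r x p → (if proj₁ leibniz-step r then x +ℚ p else x -ℚ p) ≡ x +ℚ alternate r p
parity-sign zero x p = refl
parity-sign (suc zero) x p = refl
parity-sign (suc (suc r)) x p = trans (parity-sign r x p) (cong (x +ℚ_) (sym (double-neg (alternate r p))))
  where
  double-neg : ∀ p → ⊝ (⊝ p) ≡ p
  double-neg = RS.solve-∀ ℚ-ring

leibniz-alt : ∀ r → leibniz r ≡ alt (suc r) leibnizTerm
leibniz-alt zero = sym (trans (alt-last 0 leibnizTerm) (ℚP.+-identityˡ _))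
leibniz-alt (suc zero) = sym (trans (alt-last 1 leibnizTerm) (cong (_-ℚ leibnizTerm 1) (sym (leibniz-alt 0))))
leibniz-alt (suc (suc r)) = begin
  leibniz (suc (suc r)) ≡⟨ proj₂ leibniz-step r ⟩
  (if proj₁ leibniz-step r then L +ℚ t else L -ℚ t) ≡⟨ parity-sign (suc (suc r)) L t ⟩
  L +ℚ alternate (suc (suc r)) t ≡⟨ cong (_+ℚ alternate (suc (suc r)) t) (leibniz-alt (suc r)) ⟩
  alt (suc (suc r)) leibnizTerm +ℚ alternate (suc (suc r)) t ≡⟨ alt-last (suc (suc r)) leibnizTerm ⟨
  alt (suc (suc (suc r))) leibnizTerm ∎
  where
  open ≡-Reasoning
  L = leibniz (suc r)
  t = leibnizTerm (suc (suc r))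

Decreasing : (ℕ → ℚ) → Set
Decreasing f = ∀ k → 0ℚ ≤ℚ f k × f (suc k) ≤ℚ f k

alt-bounds : ∀ N f → Decreasing f → 0ℚ ≤ℚ alt N f × alt N f ≤ℚ f 0
alt-bounds zero f d = ℚP.≤-refl , proj₁ (d 0)
alt-bounds (suc N) f d =
  let lo , hi = alt-bounds N (f ∘ suc) (d ∘ suc) in
  ℚP.≤-trans (ℚP.≤-reflexive (sym (ℚP.+-inverseʳ (f 0)))) (-ℚ-anti (f 0) (alt N (f ∘ suc)) (f 0) (ℚP.≤-trans hi (proj₂ (d 0)))) ,
  ℚP.≤-trans (-ℚ-anti (f 0) 0ℚ (alt N (f ∘ suc)) lo) (ℚP.≤-reflexive (ℚP.+-identityʳ (f 0)))

-- Doubling by constructors, so that `alt` unfolds a positive and a negative term together.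
double : ℕ → ℕ
double zero = zero
double (suc M) = suc (suc (double M))

double-≡ : ∀ M → double M ≡ 2 * M
double-≡ zero = refl
double-≡ (suc M) = trans (cong (2 +_) (double-≡ M)) (lem M)
  where
  lem : ∀ M → suc (suc (2 * M)) ≡ 2 * suc M
  lem = solve-∀

alt-even-≤ : ∀ M N f → Decreasing f → alt (double M) f ≤ℚ alt (double M + N) f
alt-even-≤ zero N f d = proj₁ (alt-bounds N f d)
alt-even-≤ (suc M) N f d = -ℚ-anti (f 0) (alt (suc (double M) + N) (f ∘ suc)) (alt (suc (double M)) (f ∘ suc))
  (-ℚ-anti (f 1) (alt (double M) (λ k → f (suc (suc k)))) (alt (double M + N) (λ k → f (suc (suc k)))) (alt-even-≤ M N (λ k → f (suc (suc k))) (λ k → d (suc (suc k)))))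

alt-odd-≥ : ∀ M N f → Decreasing f → alt (suc (double M + N)) f ≤ℚ alt (suc (double M)) f
alt-odd-≥ M N f d = -ℚ-anti (f 0) (alt (double M) (f ∘ suc)) (alt (double M + N) (f ∘ suc)) (alt-even-≤ M N (f ∘ suc) (d ∘ suc))

record Nearly (A B : ℚ) (D t : ℕ → ℚ) (k : ℕ) : Set where
  constructor nearly
  field
    D≤A : D k ≤ℚ A
    A≤D : A ≤ℚ D k +ℚ B
    t≥0 : 0ℚ ≤ℚ t k
    t≤4 : t k ≤ℚ ι 4

module _ (A B : ℚ) {{B≥0 : ℚ.NonNegative B}} where

  -- Since D k ≤ A, replacing D k by A helps in the negative terms. Only the M positive terms cost
  -- anything, at most 4 B each.
  perturbed-lower : ∀ M D t → (∀ k → k < double M → Nearly A B D t k) →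
    A *ℚ alt (double M) t ≤ℚ alt (double M) (λ k → D k *ℚ t k) +ℚ ι M *ℚ (B *ℚ ι 4)
  perturbed-lower zero D t h = ℚP.≤-reflexive (trans (ℚP.*-zeroʳ A) (sym (trans (ℚP.+-identityˡ (ι 0 *ℚ (B *ℚ ι 4))) (trans (cong (_*ℚ (B *ℚ ι 4)) ι-0) (ℚP.*-zeroˡ (B *ℚ ι 4))))))
  perturbed-lower (suc M) D t h = begin
    A *ℚ (t 0 -ℚ (t 1 -ℚ R)) ≡⟨ lem₁ A (t 0) (t 1) R ⟩
    A *ℚ t 0 +ℚ ((⊝ (A *ℚ t 1)) +ℚ A *ℚ R) ≤⟨ ℚP.+-mono-≤ first (ℚP.+-mono-≤ (ℚP.neg-antimono-≤ second) (perturbed-lower M (λ k → D (suc (suc k))) (λ k → t (suc (suc k))) (λ k k< → Nearly-shift (h (suc (suc k)) (s<s (s<s k<)))))) ⟩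
    (D 0 *ℚ t 0 +ℚ B *ℚ ι 4) +ℚ ((⊝ (D 1 *ℚ t 1)) +ℚ (S +ℚ ι M *ℚ (B *ℚ ι 4))) ≡⟨ lem₂ (D 0 *ℚ t 0) (B *ℚ ι 4) (D 1 *ℚ t 1) S (ι M) ⟩
    (D 0 *ℚ t 0 -ℚ (D 1 *ℚ t 1 -ℚ S)) +ℚ ((ι M *ℚ (B *ℚ ι 4)) +ℚ B *ℚ ι 4) ≡⟨ cong ((D 0 *ℚ t 0 -ℚ (D 1 *ℚ t 1 -ℚ S)) +ℚ_) (trans (lem₃ (ι M) (B *ℚ ι 4)) (cong (_*ℚ (B *ℚ ι 4)) (trans (cong (_+ℚ ι M) (sym ι-1)) (sym (ι-+ 1 M))))) ⟩
    (D 0 *ℚ t 0 -ℚ (D 1 *ℚ t 1 -ℚ S)) +ℚ ι (suc M) *ℚ (B *ℚ ι 4) ∎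
    where
    open ℚP.≤-Reasoning
    R = alt (double M) (λ k → t (suc (suc k)))
    S = alt (double M) (λ k → D (suc (suc k)) *ℚ t (suc (suc k)))
    lem₁ : ∀ A a b r → A *ℚ (a -ℚ (b -ℚ r)) ≡ A *ℚ a +ℚ ((⊝ (A *ℚ b)) +ℚ A *ℚ r)
    lem₁ = RS.solve-∀ ℚ-ring
    lem₂ : ∀ a b c s m → (a +ℚ b) +ℚ ((⊝ c) +ℚ (s +ℚ m *ℚ b)) ≡ (a -ℚ (c -ℚ s)) +ℚ ((m *ℚ b) +ℚ b)
    lem₂ = RS.solve-∀ ℚ-ring
    lem₃ : ∀ m b → m *ℚ b +ℚ b ≡ (1ℚ +ℚ m) *ℚ b
    lem₃ m b = trans (ℚP.+-comm (m *ℚ b) b) (trans (cong (_+ℚ m *ℚ b) (sym (ℚP.*-identityˡ b))) (sym (ℚP.*-distribʳ-+ b 1ℚ m)))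
    Nearly-shift : ∀ {k} → Nearly A B D t (suc (suc k)) → Nearly A B (λ k → D (suc (suc k))) (λ k → t (suc (suc k))) k
    Nearly-shift (nearly a b c d) = nearly a b c d
    n₀ = h 0 z<s
    n₁ = h 1 (s<s z<s)
    first : A *ℚ t 0 ≤ℚ D 0 *ℚ t 0 +ℚ B *ℚ ι 4
    first = begin
      A *ℚ t 0 ≤⟨ ℚP.*-monoʳ-≤-nonNeg (t 0) {{ℚ.nonNegative (Nearly.t≥0 n₀)}} (Nearly.A≤D n₀) ⟩
      (D 0 +ℚ B) *ℚ t 0 ≡⟨ ℚP.*-distribʳ-+ (t 0) (D 0) B ⟩
      D 0 *ℚ t 0 +ℚ B *ℚ t 0 ≤⟨ ℚP.+-monoʳ-≤ (D 0 *ℚ t 0) (ℚP.*-monoˡ-≤-nonNeg B (Nearly.t≤4 n₀)) ⟩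
      D 0 *ℚ t 0 +ℚ B *ℚ ι 4 ∎
    second : D 1 *ℚ t 1 ≤ℚ A *ℚ t 1
    second = ℚP.*-monoʳ-≤-nonNeg (t 1) {{ℚ.nonNegative (Nearly.t≥0 n₁)}} (Nearly.D≤A n₁)

  perturbed-upper : ∀ M D t → (∀ k → k < suc (double M) → Nearly A B D t k) →
    alt (suc (double M)) (λ k → D k *ℚ t k) ≤ℚ A *ℚ alt (suc (double M)) t +ℚ ι M *ℚ (B *ℚ ι 4)
  perturbed-upper M D t h = begin
    D 0 *ℚ t 0 -ℚ S ≤⟨ ℚP.+-monoˡ-≤ (⊝ S) (ℚP.*-monoʳ-≤-nonNeg (t 0) {{ℚ.nonNegative (Nearly.t≥0 n₀)}} (Nearly.D≤A n₀)) ⟩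
    A *ℚ t 0 -ℚ S ≡⟨ lem₁ (A *ℚ t 0) S E ⟩
    (A *ℚ t 0 -ℚ (S +ℚ E)) +ℚ E ≤⟨ ℚP.+-monoˡ-≤ E (-ℚ-anti (A *ℚ t 0) (A *ℚ R) (S +ℚ E) (perturbed-lower M (D ∘ suc) (t ∘ suc) (λ k k< → Nearly-shift (h (suc k) (s<s k<))))) ⟩
    (A *ℚ t 0 -ℚ A *ℚ R) +ℚ E ≡⟨ lem₂ A (t 0) R E ⟩
    A *ℚ (t 0 -ℚ R) +ℚ E ∎
    where
    open ℚP.≤-Reasoning
    n₀ = h 0 z<s
    S = alt (double M) (λ k → D (suc k) *ℚ t (suc k))
    R = alt (double M) (t ∘ suc)
    E = ι M *ℚ (B *ℚ ι 4)
    Nearly-shift : ∀ {k} → Nearly A B D t (suc k) → Nearly A B (D ∘ suc) (t ∘ suc) k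
    Nearly-shift (nearly a b c d) = nearly a b c d
    lem₁ : ∀ a s e → a -ℚ s ≡ (a -ℚ (s +ℚ e)) +ℚ e
    lem₁ = RS.solve-∀ ℚ-ring
    lem₂ : ∀ A a r e → (A *ℚ a -ℚ A *ℚ r) +ℚ e ≡ A *ℚ (a -ℚ r) +ℚ e
    lem₂ = RS.solve-∀ ℚ-ring

-- Odd powers of the cosine and Wallis' formula

-- For k ≥ 1 this is the coefficient of cos((2k-1)x) in 4^m cos^(2m+1)(x).
row : ℕ → ℕ → ℕ
row m k = suc (2 * m) C (m + k)

row-absorption : ∀ m k → suc (m + k) * row m (suc k) ≡ (suc m ∸ k) * row m k
row-absorption m k = trans (cong (λ v → suc (m + k) * (suc (2 * m) C v)) (+-suc m k)) (trans (absorption (suc (2 * m)) (m + k))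
  (cong (_* row m k) (trans (cong (_∸ (m + k)) (lem m)) ([m+n]∸[m+o]≡n∸o m (suc m) k))))
  where
  lem : ∀ m → suc (2 * m) ≡ m + suc m
  lem = solve-∀

row-vanishes : ∀ m k → suc m < k → row m k ≡ 0
row-vanishes m k l = k>n⇒nCk≡0 (≤-trans (≤-reflexive (lem m)) (+-monoʳ-≤ m l))
  where
  lem : ∀ m → suc (suc (2 * m)) ≡ m + suc (suc m)
  lem = solve-∀

row-pascal : ∀ m k → row (suc m) (suc k) ≡ row m k + row m (suc k) + (row m (suc k) + row m (suc (suc k)))
row-pascal m k = begin
  suc (2 * suc m) C (suc m + suc k) ≡⟨ cong₂ _C_ (lem m) (cong suc (+-suc m k)) ⟩
  suc (suc (suc (2 * m))) C suc (suc (m + k)) ≡⟨ nCk+nC[k+1]≡[n+1]C[k+1] (suc (suc (2 * m))) (suc (m + k)) ⟨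
  suc (suc (2 * m)) C suc (m + k) + suc (suc (2 * m)) C suc (suc (m + k)) ≡⟨ cong₂ _+_ (nCk+nC[k+1]≡[n+1]C[k+1] (suc (2 * m)) (m + k)) (nCk+nC[k+1]≡[n+1]C[k+1] (suc (2 * m)) (suc (m + k))) ⟨
  (r (m + k) + r (suc (m + k))) + (r (suc (m + k)) + r (suc (suc (m + k)))) ≡⟨ cong₂ (λ u v → (r (m + k) + r u) + (r u + r v)) (+-suc m k) (trans (+-suc m (suc k)) (cong suc (+-suc m k))) ⟨
  (r (m + k) + r (m + suc k)) + (r (m + suc k) + r (m + suc (suc k))) ∎
  where
  open ≡-Reasoning
  r : ℕ → ℕ
  r j = suc (2 * m) C j
  lem' : ∀ m → 2 * suc m ≡ suc (suc (2 * m))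
  lem' = solve-∀
  lem : ∀ m → suc (2 * suc m) ≡ suc (suc (suc (2 * m)))
  lem m = cong suc (lem' m)

-- The termwise form of integration by parts. Multiplied by 4/(2k+1), the terms with b + e and a + b
-- become sums of neighbours, whose alternating sums telescope to 4 `row m 1` and 4 `row m 0`; these
-- agree by `row-centre`.
row-recurrence : ∀ m k → let a = row m k ; b = row m (suc k) ; e = row m (suc (suc k)) in
  suc (2 * suc m) * row (suc m) (suc k) + suc (2 * k) * (b + e) ≡ 8 * suc m * b + suc (2 * k) * (a + b)
row-recurrence m k = trans (cong (λ v → suc (2 * suc m) * v + suc (2 * k) * (b + e)) (row-pascal m k)) (by-cases (<-cmp k (suc m)))
  where
  open import Relation.Binary.Definitions using (tri<; tri≈; tri>; Tri)
  open ≡-Reasoning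
  a = row m k
  b = row m (suc k)
  e = row m (suc (suc k))
  Goal : Set
  Goal = suc (2 * suc m) * (a + b + (b + e)) + suc (2 * k) * (b + e) ≡ 8 * suc m * b + suc (2 * k) * (a + b)
  lem₁ : ∀ k j a b e → suc (2 * suc (k + j)) * (a + b + (b + e)) + suc (2 * k) * (b + e) ≡
    suc (2 * k) * a + 2 * (suc j * a) + (4 * (k + j) + 2 * k + 7) * b + 2 * (suc (k + j + suc k) * e)
  lem₁ = solve-∀
  lem₂ : ∀ k j a b → suc (2 * k) * a + 2 * (suc (k + j + k) * b) + (4 * (k + j) + 2 * k + 7) * b + 2 * (j * b) ≡
    8 * suc (k + j) * b + suc (2 * k) * (a + b)
  lem₂ = solve-∀
  lem₃ : ∀ s a t → s * (a + 0 + (0 + 0)) + s * (0 + 0) ≡ t * 0 + s * (a + 0)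
  lem₃ = solve-∀
  lem₄ : ∀ s r t → s * (0 + 0 + (0 + 0)) + r * (0 + 0) ≡ t * 0 + r * (0 + 0)
  lem₄ = solve-∀
  inner : ∀ k j (a b e : ℕ) → suc (k + j + k) * b ≡ suc j * a → suc (k + j + suc k) * e ≡ j * b →
    suc (2 * suc (k + j)) * (a + b + (b + e)) + suc (2 * k) * (b + e) ≡ 8 * suc (k + j) * b + suc (2 * k) * (a + b)
  inner k j a b e h₁ h₂ = trans (lem₁ k j a b e) (trans (cong₂ (λ u v → suc (2 * k) * a + 2 * u + (4 * (k + j) + 2 * k + 7) * b + 2 * v) (sym h₁) h₂) (lem₂ k j a b))
  by-cases : Tri (k < suc m) (k ≡ suc m) (suc m < k) → Goal
  by-cases (tri< (s≤s k≤m) _ _) = subst (λ M → suc (2 * suc M) * (a + b + (b + e)) + suc (2 * k) * (b + e) ≡ 8 * suc M * b + suc (2 * k) * (a + b)) (m+[n∸m]≡n k≤m)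
    (inner k (m ∸ k) a b e
      (subst (λ M → suc (M + k) * b ≡ suc (m ∸ k) * a) (sym (m+[n∸m]≡n k≤m)) (trans (row-absorption m k) (cong (_* a) (+-∸-assoc 1 k≤m))))
      (subst (λ M → suc (M + suc k) * e ≡ (m ∸ k) * b) (sym (m+[n∸m]≡n k≤m)) (row-absorption m (suc k))))
  by-cases (tri≈ _ refl _) rewrite row-vanishes m (suc (suc m)) ≤-refl | row-vanishes m (suc (suc (suc m))) (n≤1+n _) = lem₃ (suc (2 * suc m)) a (8 * suc m)
  by-cases (tri> _ _ l) rewrite row-vanishes m k l | row-vanishes m (suc k) (m<n⇒m<1+n l) | row-vanishes m (suc (suc k)) (m<n⇒m<1+n (m<n⇒m<1+n l)) =
    lem₄ (suc (2 * suc m)) (suc (2 * k)) (8 * suc m)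

row-centre : ∀ m → row m 1 ≡ row m 0
row-centre m = trans (cong (suc (2 * m) C_) (+-comm m 1)) (trans (odd-symmetric m) (cong (suc (2 * m) C_) (sym (+-identityʳ m))))

-- For N > m this is 4^(m+1) times the integral of cos^(2m+1) from 0 to π/2.
wallisSum : ℕ → ℕ → ℚ
wallisSum N m = alt N (λ k → ι (row m (suc k)) *ℚ leibnizTerm k)

-- Expanding cos^(2m+1) into cosines and integrating gives the Wallis integral as an alternating sum;
-- this recurrence is the reduction formula for that integral.
wallisSum-recurrence : ∀ N m → suc m < N → ι (suc (2 * suc m)) *ℚ wallisSum N (suc m) ≡ ι (8 * suc m) *ℚ wallisSum N m
wallisSum-recurrence N m l = cancel _ _ (ι 4 *ℚ ι (row m 0)) (begin
  ι (suc (2 * suc m)) *ℚ wallisSum N (suc m) +ℚ ι 4 *ℚ ι (row m 0) ≡⟨ cong₂ _+ℚ_ (sym (alt-* N (ι (suc (2 * suc m))) (λ k → ι (row (suc m) (suc k)) *ℚ t k))) (trans (cong (λ v → ι 4 *ℚ ι v) (sym (row-centre m))) (trans (cong (ι 4 *ℚ_) (sym sum₁)) (sym (alt-* N (ι 4) _)))) ⟩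
  alt N (λ k → ι (suc (2 * suc m)) *ℚ (ι (row (suc m) (suc k)) *ℚ t k)) +ℚ alt N (λ k → ι 4 *ℚ (ι (row m (suc k)) +ℚ ι (row m (suc (suc k))))) ≡⟨ alt-+ N _ _ ⟨
  alt N (λ k → ι (suc (2 * suc m)) *ℚ (ι (row (suc m) (suc k)) *ℚ t k) +ℚ ι 4 *ℚ (ι (row m (suc k)) +ℚ ι (row m (suc (suc k))))) ≡⟨ alt-cong N termwise ⟩
  alt N (λ k → ι (8 * suc m) *ℚ (ι (row m (suc k)) *ℚ t k) +ℚ ι 4 *ℚ (ι (row m k) +ℚ ι (row m (suc k)))) ≡⟨ alt-+ N _ _ ⟩
  alt N (λ k → ι (8 * suc m) *ℚ (ι (row m (suc k)) *ℚ t k)) +ℚ alt N (λ k → ι 4 *ℚ (ι (row m k) +ℚ ι (row m (suc k)))) ≡⟨ cong₂ _+ℚ_ (alt-* N (ι (8 * suc m)) (λ k → ι (row m (suc k)) *ℚ t k)) (trans (alt-* N (ι 4) _) (cong (ι 4 *ℚ_) sum₀)) ⟩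
  ι (8 * suc m) *ℚ wallisSum N m +ℚ ι 4 *ℚ ι (row m 0) ∎)
  where
  open ≡-Reasoning
  t = leibnizTerm
  cancel : ∀ x y z → x +ℚ z ≡ y +ℚ z → x ≡ y
  cancel x y z h = trans (sym (lem x z)) (trans (cong (_-ℚ z) h) (lem y z))
    where
    lem : ∀ a b → (a +ℚ b) -ℚ b ≡ a
    lem = RS.solve-∀ ℚ-ring
  zero-at : ∀ k → suc m < k → ι (row m k) ≡ 0ℚ
  zero-at k h = trans (cong ι (row-vanishes m k h)) ι-0
  sum₀ : alt N (λ k → ι (row m k) +ℚ ι (row m (suc k))) ≡ ι (row m 0)
  sum₀ = alt-telescope N (λ k → ι (row m k)) (zero-at N l)
  sum₁ : alt N (λ k → ι (row m (suc k)) +ℚ ι (row m (suc (suc k)))) ≡ ι (row m 1)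
  sum₁ = alt-telescope N (λ k → ι (row m (suc k))) (zero-at (suc N) (m<n⇒m<1+n l))
  termwise : ∀ k → ι (suc (2 * suc m)) *ℚ (ι (row (suc m) (suc k)) *ℚ t k) +ℚ ι 4 *ℚ (ι (row m (suc k)) +ℚ ι (row m (suc (suc k))))
    ≡ ι (8 * suc m) *ℚ (ι (row m (suc k)) *ℚ t k) +ℚ ι 4 *ℚ (ι (row m k) +ℚ ι (row m (suc k)))
  termwise k = trans (gather (suc (2 * suc m)) (row (suc m) (suc k)) (row m (suc k)) (row m (suc (suc k))))
    (trans (cong (λ v → ι v *ℚ t k) (row-recurrence m k)) (sym (gather (8 * suc m) (row m (suc k)) (row m k) (row m (suc k)))))
    where
    lem : ∀ c r t u x y → c *ℚ (r *ℚ t) +ℚ (u *ℚ t) *ℚ (x +ℚ y) ≡ (c *ℚ r +ℚ u *ℚ (x +ℚ y)) *ℚ t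
    lem = RS.solve-∀ ℚ-ring
    gather : ∀ c r x y → ι c *ℚ (ι r *ℚ t k) +ℚ ι 4 *ℚ (ι x +ℚ ι y) ≡ ι (c * r + suc (2 * k) * (x + y)) *ℚ t k
    gather c r x y = trans (cong (λ v → ι c *ℚ (ι r *ℚ t k) +ℚ v *ℚ (ι x +ℚ ι y)) (sym (term-unit k)))
      (trans (lem (ι c) (ι r) (t k) (ι (suc (2 * k))) (ι x) (ι y))
      (cong (_*ℚ t k) (sym (trans (ι-+ (c * r) _) (cong₂ _+ℚ_ (ι-* c r) (trans (ι-* (suc (2 * k)) (x + y)) (cong (ι (suc (2 * k)) *ℚ_) (ι-+ x y))))))))

wallisFactor : ℕ → ℕ
wallisFactor m = suc (2 * m) * (2 * m C m)

-- Wallis' value 4^m / ((2m+1) C(2m,m)) of the integral, obtained by running the recurrence from m =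
-- 0.
wallis-product : ∀ N m → m < N → ι (wallisFactor m) *ℚ wallisSum N m ≡ ι (4 * 16 ^ m)
wallis-product (suc N) zero _ = begin
  ι 1 *ℚ (ι 1 *ℚ leibnizTerm 0 -ℚ alt N (λ k → ι (row 0 (suc (suc k))) *ℚ leibnizTerm (suc k)))
    ≡⟨ cong₂ (λ u v → u *ℚ (ι 1 *ℚ leibnizTerm 0 -ℚ v)) ι-1 (trans (alt-cong N (λ k → trans (cong (_*ℚ leibnizTerm (suc k)) (trans (cong ι (row-vanishes 0 (suc (suc k)) (s≤s (s≤s z≤n)))) ι-0)) (ℚP.*-zeroˡ (leibnizTerm (suc k))))) (alt-0 N)) ⟩
  1ℚ *ℚ (ι 1 *ℚ leibnizTerm 0 -ℚ 0ℚ) ≡⟨ trans (ℚP.*-identityˡ _) (ℚP.+-identityʳ _) ⟩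
  ι 1 *ℚ leibnizTerm 0 ≡⟨ term-unit 0 ⟩
  ι (4 * 16 ^ 0) ∎
  where
  open ≡-Reasoning
  alt-0 : ∀ N → alt N (λ _ → 0ℚ) ≡ 0ℚ
  alt-0 zero = refl
  alt-0 (suc N) = trans (cong (0ℚ -ℚ_) (alt-0 N)) (ℚP.+-inverseʳ 0ℚ)
wallis-product N (suc m) l = ℚP.≤-antisym (ι-cancel (suc m) z<s (ℚP.≤-reflexive both)) (ι-cancel (suc m) z<s (ℚP.≤-reflexive (sym both)))
  where
  open ≡-Reasoning
  K = wallisFactor m
  K' = wallisFactor (suc m)
  c' = 2 * suc m C suc m
  lem₁ : ∀ s k w → s *ℚ (k *ℚ w) ≡ (s *ℚ k) *ℚ w
  lem₁ = RS.solve-∀ ℚ-ring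
  lem₂ : ∀ k s w → (k *ℚ s) *ℚ w ≡ k *ℚ (s *ℚ w)
  lem₂ = RS.solve-∀ ℚ-ring
  lem₃ : ∀ k e w → k *ℚ (e *ℚ w) ≡ e *ℚ (k *ℚ w)
  lem₃ = RS.solve-∀ ℚ-ring
  factors : suc m * K' ≡ 2 * K * suc (2 * suc m)
  factors = trans (lem (suc m) (suc (2 * suc m)) c') (cong (_* suc (2 * suc m)) (trans (cong (suc m *_) (even-central m)) (trans (lem' (suc m) (suc (2 * m) C m)) (cong (2 *_) (odd-central m)))))
    where
    lem : ∀ a s c → a * (s * c) ≡ a * c * s
    lem = solve-∀
    lem' : ∀ a c → a * (2 * c) ≡ 2 * (a * c)
    lem' = solve-∀
  both : ι (suc m) *ℚ (ι K' *ℚ wallisSum N (suc m)) ≡ ι (suc m) *ℚ ι (4 * 16 ^ suc m)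
  both = begin
    ι (suc m) *ℚ (ι K' *ℚ wallisSum N (suc m)) ≡⟨ lem₁ (ι (suc m)) (ι K') _ ⟩
    (ι (suc m) *ℚ ι K') *ℚ wallisSum N (suc m) ≡⟨ cong (_*ℚ wallisSum N (suc m)) (trans (sym (ι-* (suc m) K')) (trans (cong ι factors) (ι-* (2 * K) (suc (2 * suc m))))) ⟩
    (ι (2 * K) *ℚ ι (suc (2 * suc m))) *ℚ wallisSum N (suc m) ≡⟨ trans (lem₂ (ι (2 * K)) (ι (suc (2 * suc m))) _) (cong (ι (2 * K) *ℚ_) (wallisSum-recurrence N m l)) ⟩
    ι (2 * K) *ℚ (ι (8 * suc m) *ℚ wallisSum N m) ≡⟨ cong (_*ℚ (ι (8 * suc m) *ℚ wallisSum N m)) (ι-* 2 K) ⟩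
    (ι 2 *ℚ ι K) *ℚ (ι (8 * suc m) *ℚ wallisSum N m) ≡⟨ trans (lem₂ (ι 2) (ι K) _) (cong (ι 2 *ℚ_) (trans (lem₃ (ι K) (ι (8 * suc m)) _) (cong (ι (8 * suc m) *ℚ_) (wallis-product N m (<-trans (n<1+n m) l))))) ⟩
    ι 2 *ℚ (ι (8 * suc m) *ℚ ι (4 * 16 ^ m)) ≡⟨ trans (cong (ι 2 *ℚ_) (sym (ι-* (8 * suc m) (4 * 16 ^ m)))) (trans (sym (ι-* 2 _)) (trans (cong ι (lem₄ m (16 ^ m))) (ι-* (suc m) _))) ⟩
    ι (suc m) *ℚ ι (4 * 16 ^ suc m) ∎
    where
    lem₄ : ∀ m p → 2 * (8 * suc m * (4 * p)) ≡ suc m * (4 * (16 * p))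
    lem₄ = solve-∀

abstract
  ι-denominator : ∀ k d-1 .(c : Coprime k (suc d-1)) → ι (suc d-1) *ℚ ℚ.mkℚ (ℤ.+ k) d-1 c ≡ ι k
  ι-denominator k d-1 c = trans (cong₂ _*ℚ_ (ι-def (suc d-1)) (sym (ℚP.fromℚᵘ-toℚᵘ (ℚ.mkℚ (ℤ.+ k) d-1 c)))) (trans (fromℚᵘ-* (mkℚᵘ (ℤ.+ suc d-1) 0) (mkℚᵘ (ℤ.+ k) d-1))
    (trans (ℚP.fromℚᵘ-cong {mkℚᵘ (ℤ.+ suc d-1) 0 ℚᵘ.* mkℚᵘ (ℤ.+ k) d-1} {mkℚᵘ (ℤ.+ k) 0} (*≡* (trans (cong (ℤ._* ℤ.+ 1) (sym (ℤP.pos-* (suc d-1) k))) (trans (sym (ℤP.pos-* (suc d-1 * k) 1)) (trans (cong ℤ.+_ (lem d-1 k)) (ℤP.pos-* k (suc d-1 + 0))))))) (sym (ι-def k))))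
    where
    lem : ∀ d k → suc d * k * 1 ≡ k * (suc d + 0)
    lem = solve-∀

-- The witness is the denominator of y - x: multiplied by it, the difference becomes a positive
-- integer.
archimedean : ∀ x y → x <ℚ y → ∃ λ s → 0 < s × ι s *ℚ x +ℚ ι 1 ≤ℚ ι s *ℚ y
archimedean x y x<y = go (y -ℚ x) refl (ℚ.positive (ℚP.≤-<-trans (ℚP.≤-reflexive (sym (ℚP.+-inverseʳ x))) (ℚP.+-monoˡ-< (⊝ x) x<y)))
  where
  go : ∀ r → r ≡ y -ℚ x → ℚ.Positive r → ∃ λ s → 0 < s × ι s *ℚ x +ℚ ι 1 ≤ℚ ι s *ℚ y
  go (ℚ.mkℚ (ℤ.+ suc k) d-1 c) e _ = suc d-1 , z<s , (begin
    ι (suc d-1) *ℚ x +ℚ ι 1 ≤⟨ ℚP.+-monoʳ-≤ (ι (suc d-1) *ℚ x) (ι-≤ (s≤s (z≤n {k}))) ⟩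
    ι (suc d-1) *ℚ x +ℚ ι (suc k) ≡⟨ cong (ι (suc d-1) *ℚ x +ℚ_) (trans (sym (ι-denominator (suc k) d-1 c)) (cong (ι (suc d-1) *ℚ_) e)) ⟩
    ι (suc d-1) *ℚ x +ℚ ι (suc d-1) *ℚ (y -ℚ x) ≡⟨ lem (ι (suc d-1)) x y ⟩
    ι (suc d-1) *ℚ y ∎)
    where
    open ℚP.≤-Reasoning
    lem : ∀ s x y → s *ℚ x +ℚ s *ℚ (y -ℚ x) ≡ s *ℚ y
    lem = RS.solve-∀ ℚ-ring

fraction : ∀ a → 0ℚ ≤ℚ a → ∃₂ λ p d → 0 < d × ι d *ℚ a ≡ ι p
fraction a 0≤a = go a (ℚ.nonNegative 0≤a)
  where
  go : ∀ a → ℚ.NonNegative a → ∃₂ λ p d → 0 < d × ι d *ℚ a ≡ ι p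
  go (ℚ.mkℚ (ℤ.+ k) d-1 c) _ = k , suc d-1 , z<s , ι-denominator k d-1 c

-- Comparison of the Wallis and Leibniz sums

-- The first S coefficients equal A up to the relative error z / x = S (2S+1) / (m+1), which
-- vanishes for fixed S. All later terms are handled by monotonicity and the alternating signs.
module WallisBounds (m S : ℕ) where
  open ℚP.≤-Reasoning
  n A x z : ℕ
  n = suc (2 * m)
  A = n C m
  x = suc m
  z = S * suc (2 * S)

  D : ℕ → ℕ
  D k = row m (suc k)

  D-anti : ∀ k → D (suc k) ≤ D k
  D-anti k = binomial-antitone n (past-centre n ≤-refl (m≤m+n m (suc k))) (+-monoʳ-≤ m (n≤1+n (suc k)))

  D≤A : ∀ k → D k ≤ A
  D≤A k = binomial-antitone n (past-centre n ≤-refl ≤-refl) (m≤m+n m (suc k))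

  A≤D : ∀ k → k < S → x * A ≤ x * D k + A * z
  A≤D k k<S = ≤-trans (≤-reflexive (*-comm x A)) (≤-trans (*-monoʳ-≤ A (m≤n+m∸n x (suc k * suc (2 * S)))) (≤-trans (≤-reflexive (trans (*-distribˡ-+ A (suc k * suc (2 * S)) _) (+-comm (A * (suc k * suc (2 * S))) _)))
    (+-mono-≤ (≤-trans (near-centre n m S (n≤1+n _) (suc k) k<S) (≤-reflexive (*-comm (D k) x))) (*-monoʳ-≤ A (*-monoˡ-≤ (suc (2 * S)) k<S)))))

  nearly-all : ∀ k → k < S → Nearly (ι (x * A)) (ι (A * z)) (λ k → ι (x * D k)) leibnizTerm k
  nearly-all k k<S = nearly (ι-≤ (*-monoʳ-≤ x (D≤A k))) (ℚP.≤-trans (ι-≤ (A≤D k k<S)) (ℚP.≤-reflexive (ι-+ (x * D k) (A * z)))) (term≥0 k) (term≤4 k)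

  decreasing : Decreasing (λ k → ι (x * D k) *ℚ leibnizTerm k)
  decreasing k = ℚP.nonNegative⁻¹ _ {{ℚP.nonNeg*nonNeg⇒nonNeg (ι (x * D k)) (leibnizTerm k) {{ℚ.nonNegative (term≥0 k)}}}} ,
    ℚP.≤-trans (ι-mono (x * D (suc k)) (term-anti k)) (ℚP.*-monoʳ-≤-nonNeg (leibnizTerm k) {{ℚ.nonNegative (term≥0 k)}} (ι-≤ (*-monoʳ-≤ x (D-anti k))))

  scaled : ∀ N → alt N (λ k → ι (x * D k) *ℚ leibnizTerm k) ≡ ι x *ℚ wallisSum N m
  scaled N = trans (alt-cong N (λ k → trans (cong (_*ℚ leibnizTerm k) (ι-* x (D k))) (ℚP.*-assoc (ι x) (ι (D k)) (leibnizTerm k)))) (alt-* N (ι x) _)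

  error : ∀ M → ι M *ℚ (ι (A * z) *ℚ ι 4) ≡ ι (M * (A * z * 4))
  error M = sym (trans (ι-* M _) (cong (ι M *ℚ_) (ι-* (A * z) 4)))

  lower-sum : ∀ M N → double M ≤ S → ι (x * A) *ℚ alt (double M) leibnizTerm ≤ℚ ι x *ℚ wallisSum (double M + N) m +ℚ ι (M * (A * z * 4))
  lower-sum M N M≤S = begin
    ι (x * A) *ℚ alt (double M) leibnizTerm ≤⟨ perturbed-lower (ι (x * A)) (ι (A * z)) M (λ k → ι (x * D k)) leibnizTerm (λ k k< → nearly-all k (<-≤-trans k< M≤S)) ⟩
    alt (double M) (λ k → ι (x * D k) *ℚ leibnizTerm k) +ℚ ι M *ℚ (ι (A * z) *ℚ ι 4) ≤⟨ ℚP.+-mono-≤ (alt-even-≤ M N _ decreasing) (ℚP.≤-reflexive (error M)) ⟩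
    alt (double M + N) (λ k → ι (x * D k) *ℚ leibnizTerm k) +ℚ ι (M * (A * z * 4)) ≡⟨ cong (_+ℚ ι (M * (A * z * 4))) (scaled (double M + N)) ⟩
    ι x *ℚ wallisSum (double M + N) m +ℚ ι (M * (A * z * 4)) ∎

  upper-sum : ∀ M N → suc (double M) ≤ S → ι x *ℚ wallisSum (suc (double M + N)) m ≤ℚ ι (x * A) *ℚ alt (suc (double M)) leibnizTerm +ℚ ι (M * (A * z * 4))
  upper-sum M N M≤S = begin
    ι x *ℚ wallisSum (suc (double M + N)) m ≡⟨ scaled (suc (double M + N)) ⟨
    alt (suc (double M + N)) (λ k → ι (x * D k) *ℚ leibnizTerm k) ≤⟨ alt-odd-≥ M N _ decreasing ⟩
    alt (suc (double M)) (λ k → ι (x * D k) *ℚ leibnizTerm k) ≤⟨ perturbed-upper (ι (x * A)) (ι (A * z)) M (λ k → ι (x * D k)) leibnizTerm (λ k k< → nearly-all k (<-≤-trans k< M≤S)) ⟩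
    ι (x * A) *ℚ alt (suc (double M)) leibnizTerm +ℚ ι M *ℚ (ι (A * z) *ℚ ι 4) ≡⟨ cong (ι (x * A) *ℚ alt (suc (double M)) leibnizTerm +ℚ_) (error M) ⟩
    ι (x * A) *ℚ alt (suc (double M)) leibnizTerm +ℚ ι (M * (A * z * 4)) ∎

  -- The rational gap between p/d and the Leibniz sum is worth one unit x A after scaling; `large`
  -- keeps the accumulated error below that unit.
  module _ (p d s M : ℕ) (s>0 : 0 < s) (large : s * d * (M * (z * 4)) ≤ x) where
    K = wallisFactor m

    small-error : ι (s * d) *ℚ ι (M * (A * z * 4)) ≤ℚ ι (x * A)
    small-error = ℚP.≤-trans (ℚP.≤-reflexive (sym (ι-* (s * d) _))) (ι-≤ (≤-trans (≤-reflexive (lem s d M A z)) (*-monoˡ-≤ A large)))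
      where
      lem : ∀ s d M A z → s * d * (M * (A * z * 4)) ≡ s * d * (M * (z * 4)) * A
      lem = solve-∀

    xs>0 : 0 < x * s
    xs>0 = *-mono-≤ {1} {x} {1} {s} (s≤s z≤n) s>0

    drop-error : ∀ u v → u +ℚ ι (x * A) ≤ℚ v +ℚ ι (x * A) → u ≤ℚ v
    drop-error u v h = ℚP.≤-trans (ℚP.≤-reflexive (sym (lem u (ι (x * A))))) (ℚP.≤-trans (ℚP.+-monoˡ-≤ (⊝ ι (x * A)) h) (ℚP.≤-reflexive (lem v (ι (x * A)))))
      where
      lem : ∀ a b → (a +ℚ b) -ℚ b ≡ a
      lem = RS.solve-∀ ℚ-ring

    finish-lower : ∀ N L → m < N → ι s *ℚ ι p +ℚ ι 1 ≤ℚ ι s *ℚ (L *ℚ ι d) →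
      ι (x * A) *ℚ L ≤ℚ ι x *ℚ wallisSum N m +ℚ ι (M * (A * z * 4)) → p * (A * K) ≤ d * (4 * 16 ^ m)
    finish-lower N L m<N gap bound = ι-≤⁻ (begin
      ι (p * (A * K)) ≡⟨ cong ι (lem₀ p A K) ⟩
      ι (K * (p * A)) ≡⟨ ι-* K (p * A) ⟩
      ι K *ℚ ι (p * A) ≤⟨ ι-mono K (ι-cancel (x * s) xs>0 (drop-error _ _ core)) ⟩
      ι K *ℚ (ι d *ℚ W) ≡⟨ lem₁ (ι K) (ι d) W ⟩
      ι d *ℚ (ι K *ℚ W) ≡⟨ trans (cong (ι d *ℚ_) (wallis-product N m m<N)) (sym (ι-* d _)) ⟩
      ι (d * (4 * 16 ^ m)) ∎)
      where
      W = wallisSum N m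
      lem₀ : ∀ p a k → p * (a * k) ≡ k * (p * a)
      lem₀ = solve-∀
      lem₁ : ∀ k d w → k *ℚ (d *ℚ w) ≡ d *ℚ (k *ℚ w)
      lem₁ = RS.solve-∀ ℚ-ring
      lem₂ : ∀ x s p a o → (x *ℚ s) *ℚ (p *ℚ a) +ℚ (x *ℚ a) *ℚ o ≡ (x *ℚ a) *ℚ (s *ℚ p +ℚ o)
      lem₂ = RS.solve-∀ ℚ-ring
      lem₃ : ∀ a s l d → a *ℚ (s *ℚ (l *ℚ d)) ≡ (s *ℚ d) *ℚ (a *ℚ l)
      lem₃ = RS.solve-∀ ℚ-ring
      lem₄ : ∀ s d x w e → (s *ℚ d) *ℚ (x *ℚ w +ℚ e) ≡ (x *ℚ s) *ℚ (d *ℚ w) +ℚ (s *ℚ d) *ℚ e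
      lem₄ = RS.solve-∀ ℚ-ring
      core : ι (x * s) *ℚ ι (p * A) +ℚ ι (x * A) ≤ℚ ι (x * s) *ℚ (ι d *ℚ W) +ℚ ι (x * A)
      core = begin
        ι (x * s) *ℚ ι (p * A) +ℚ ι (x * A) ≡⟨ cong₂ _+ℚ_ (cong₂ _*ℚ_ (ι-* x s) (ι-* p A)) (trans (ι-* x A) (sym (trans (cong ((ι x *ℚ ι A) *ℚ_) ι-1) (ℚP.*-identityʳ _)))) ⟩
        (ι x *ℚ ι s) *ℚ (ι p *ℚ ι A) +ℚ (ι x *ℚ ι A) *ℚ ι 1 ≡⟨ trans (lem₂ (ι x) (ι s) (ι p) (ι A) (ι 1)) (cong (_*ℚ (ι s *ℚ ι p +ℚ ι 1)) (sym (ι-* x A))) ⟩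
        ι (x * A) *ℚ (ι s *ℚ ι p +ℚ ι 1) ≤⟨ ι-mono (x * A) gap ⟩
        ι (x * A) *ℚ (ι s *ℚ (L *ℚ ι d)) ≡⟨ trans (lem₃ (ι (x * A)) (ι s) L (ι d)) (cong (_*ℚ (ι (x * A) *ℚ L)) (sym (ι-* s d))) ⟩
        ι (s * d) *ℚ (ι (x * A) *ℚ L) ≤⟨ ι-mono (s * d) bound ⟩
        ι (s * d) *ℚ (ι x *ℚ W +ℚ ι (M * (A * z * 4))) ≡⟨ trans (cong (_*ℚ (ι x *ℚ W +ℚ ι (M * (A * z * 4)))) (ι-* s d)) (trans (lem₄ (ι s) (ι d) (ι x) W _) (cong₂ _+ℚ_ (cong (_*ℚ (ι d *ℚ W)) (sym (ι-* x s))) (cong (_*ℚ ι (M * (A * z * 4))) (sym (ι-* s d))))) ⟩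
        ι (x * s) *ℚ (ι d *ℚ W) +ℚ ι (s * d) *ℚ ι (M * (A * z * 4)) ≤⟨ ℚP.+-monoʳ-≤ (ι (x * s) *ℚ (ι d *ℚ W)) small-error ⟩
        ι (x * s) *ℚ (ι d *ℚ W) +ℚ ι (x * A) ∎

    finish-upper : ∀ N L → m < N → ι s *ℚ (L *ℚ ι d) +ℚ ι 1 ≤ℚ ι s *ℚ ι p →
      ι x *ℚ wallisSum N m ≤ℚ ι (x * A) *ℚ L +ℚ ι (M * (A * z * 4)) → d * (4 * 16 ^ m) ≤ p * (A * K)
    finish-upper N L m<N gap bound = ι-≤⁻ (begin
      ι (d * (4 * 16 ^ m)) ≡⟨ trans (ι-* d _) (cong (ι d *ℚ_) (sym (wallis-product N m m<N))) ⟩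
      ι d *ℚ (ι K *ℚ W) ≡⟨ lem₁ (ι d) (ι K) W ⟩
      ι K *ℚ (ι d *ℚ W) ≤⟨ ι-mono K (ι-cancel (x * s) xs>0 core) ⟩
      ι K *ℚ ι (p * A) ≡⟨ trans (sym (ι-* K (p * A))) (cong ι (lem₀ p A K)) ⟩
      ι (p * (A * K)) ∎)
      where
      W = wallisSum N m
      lem₀ : ∀ p a k → k * (p * a) ≡ p * (a * k)
      lem₀ = solve-∀
      lem₁ : ∀ k d w → k *ℚ (d *ℚ w) ≡ d *ℚ (k *ℚ w)
      lem₁ = RS.solve-∀ ℚ-ring
      lem₂ : ∀ x s p a → (x *ℚ a) *ℚ (s *ℚ p) ≡ (x *ℚ s) *ℚ (p *ℚ a)
      lem₂ = RS.solve-∀ ℚ-ring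
      lem₃ : ∀ s d a l e → (s *ℚ d) *ℚ (a *ℚ l +ℚ e) ≡ a *ℚ (s *ℚ (l *ℚ d)) +ℚ (s *ℚ d) *ℚ e
      lem₃ = RS.solve-∀ ℚ-ring
      lem₄ : ∀ s d x w → (x *ℚ s) *ℚ (d *ℚ w) ≡ (s *ℚ d) *ℚ (x *ℚ w)
      lem₄ = RS.solve-∀ ℚ-ring
      core : ι (x * s) *ℚ (ι d *ℚ W) ≤ℚ ι (x * s) *ℚ ι (p * A)
      core = begin
        ι (x * s) *ℚ (ι d *ℚ W) ≡⟨ trans (cong (_*ℚ (ι d *ℚ W)) (ι-* x s)) (trans (lem₄ (ι s) (ι d) (ι x) W) (cong (_*ℚ (ι x *ℚ W)) (sym (ι-* s d)))) ⟩
        ι (s * d) *ℚ (ι x *ℚ W) ≤⟨ ι-mono (s * d) bound ⟩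
        ι (s * d) *ℚ (ι (x * A) *ℚ L +ℚ ι (M * (A * z * 4))) ≡⟨ trans (cong (_*ℚ (ι (x * A) *ℚ L +ℚ ι (M * (A * z * 4)))) (ι-* s d)) (trans (lem₃ (ι s) (ι d) (ι (x * A)) L _) (cong (ι (x * A) *ℚ (ι s *ℚ (L *ℚ ι d)) +ℚ_) (cong (_*ℚ ι (M * (A * z * 4))) (sym (ι-* s d))))) ⟩
        ι (x * A) *ℚ (ι s *ℚ (L *ℚ ι d)) +ℚ ι (s * d) *ℚ ι (M * (A * z * 4)) ≤⟨ ℚP.+-monoʳ-≤ (ι (x * A) *ℚ (ι s *ℚ (L *ℚ ι d))) small-error ⟩
        ι (x * A) *ℚ (ι s *ℚ (L *ℚ ι d)) +ℚ ι (x * A) ≡⟨ sym (trans (ℚP.*-distribˡ-+ (ι (x * A)) (ι s *ℚ (L *ℚ ι d)) (ι 1)) (cong (ι (x * A) *ℚ (ι s *ℚ (L *ℚ ι d)) +ℚ_) (trans (cong (ι (x * A) *ℚ_) ι-1) (ℚP.*-identityʳ _)))) ⟩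
        ι (x * A) *ℚ (ι s *ℚ (L *ℚ ι d) +ℚ ι 1) ≤⟨ ι-mono (x * A) gap ⟩
        ι (x * A) *ℚ (ι s *ℚ ι p) ≡⟨ trans (cong (_*ℚ (ι s *ℚ ι p)) (ι-* x A)) (trans (lem₂ (ι x) (ι s) (ι p) (ι A)) (sym (cong₂ _*ℚ_ (ι-* x s) (ι-* p A)))) ⟩
        ι (x * s) *ℚ ι (p * A) ∎

wallis-lower : ∀ p d μ → ι p <ℚ leibniz (suc (2 * μ)) *ℚ ι d →
  ∃ λ m₀ → ∀ m → m₀ ≤ m → p * ((suc (2 * m) C m) * wallisFactor m) ≤ d * (4 * 16 ^ m)
wallis-lower p d μ h = m₀ , λ m m₀≤m → finish-lower m S p d s M s>0 (m≤n⇒m≤1+n m₀≤m) (double M + suc m) L (m≤n+m (suc m) (double M)) gap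
        (subst (λ l → ι (suc m * (suc (2 * m) C m)) *ℚ l ≤ℚ ι (suc m) *ℚ wallisSum (double M + suc m) m +ℚ ι (M * ((suc (2 * m) C m) * z * 4))) (sym L≡) (lower-sum m S M (suc m) ≤-refl))
  where
  open WallisBounds using (lower-sum; finish-lower)
  separation = archimedean (ι p) (leibniz (suc (2 * μ)) *ℚ ι d) h
  s = proj₁ separation
  s>0 = proj₁ (proj₂ separation)
  gap = proj₂ (proj₂ separation)
  M S z m₀ : ℕ
  M = suc μ
  S = double M
  z = S * suc (2 * S)
  m₀ = s * d * (M * (z * 4))
  L = leibniz (suc (2 * μ))
  L≡ : L ≡ alt (double M) leibnizTerm
  L≡ = trans (leibniz-alt (suc (2 * μ))) (cong (λ r → alt (suc (suc r)) leibnizTerm) (sym (double-≡ μ)))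

wallis-upper : ∀ p d μ → leibniz (2 * μ) *ℚ ι d <ℚ ι p →
  ∃ λ m₀ → ∀ m → m₀ ≤ m → d * (4 * 16 ^ m) ≤ p * ((suc (2 * m) C m) * wallisFactor m)
wallis-upper p d μ h = m₀ , λ m m₀≤m → finish-upper m S p d s μ s>0 (m≤n⇒m≤1+n m₀≤m) (suc (double μ + suc m)) L (s≤s (≤-trans (n≤1+n m) (m≤n+m (suc m) (double μ)))) gap
        (subst (λ l → ι (suc m) *ℚ wallisSum (suc (double μ + suc m)) m ≤ℚ ι (suc m * (suc (2 * m) C m)) *ℚ l +ℚ ι (μ * ((suc (2 * m) C m) * z * 4))) (sym L≡) (upper-sum m S μ (suc m) ≤-refl))
  where
  open WallisBounds using (upper-sum; finish-upper)
  separation = archimedean (leibniz (2 * μ) *ℚ ι d) (ι p) h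
  s = proj₁ separation
  s>0 = proj₁ (proj₂ separation)
  gap = proj₂ (proj₂ separation)
  S z m₀ : ℕ
  S = suc (double μ)
  z = S * suc (2 * S)
  m₀ = s * d * (μ * (z * 4))
  L = leibniz (2 * μ)
  L≡ : L ≡ alt (suc (double μ)) leibnizTerm
  L≡ = trans (leibniz-alt (2 * μ)) (cong (λ r → alt (suc r) leibnizTerm) (sym (double-≡ μ)))

-- Bounds on the central binomial coefficient by approximations of π

α : ℕ → ℕ
α n = n C (n / 2)

half-even : ∀ m → 2 * m / 2 ≡ m
half-even m = trans (cong (_/ 2) (*-comm 2 m)) (m*n/n≡m m 2)

α-even : ∀ m → α (2 * m) ≡ 2 * m C m
α-even m = cong (2 * m C_) (half-even m)

α-odd : ∀ m → α (suc (2 * m)) ≡ suc (2 * m) C m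
α-odd m = binomial-central (suc (2 * m)) {suc (2 * m) / 2} {m} (half-central (suc (2 * m))) (central ≤-refl (≤-trans (n≤1+n _) (n≤1+n _)))

power-even : ∀ m → 4 ^ (2 * m) ≡ 16 ^ m
power-even m = sym (^-*-assoc 4 2 m)

even-wallis : ∀ m → suc m * ((suc (2 * m) C m) * wallisFactor m) ≡ suc (2 * m) * suc (2 * m) * (α (2 * m) * α (2 * m))
even-wallis m = begin
  suc m * (A * (suc (2 * m) * c)) ≡⟨ *-assoc (suc m) A _ ⟨
  suc m * A * (suc (2 * m) * c) ≡⟨ cong (_* (suc (2 * m) * c)) (odd-central m) ⟩
  suc (2 * m) * c * (suc (2 * m) * c) ≡⟨ lem (suc (2 * m)) c ⟩
  suc (2 * m) * suc (2 * m) * (c * c) ≡⟨ cong (λ a → suc (2 * m) * suc (2 * m) * (a * a)) (α-even m) ⟨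
  suc (2 * m) * suc (2 * m) * (α (2 * m) * α (2 * m)) ∎
  where
  open ≡-Reasoning
  A = suc (2 * m) C m
  c = 2 * m C m
  lem : ∀ s c → s * c * (s * c) ≡ s * s * (c * c)
  lem = solve-∀

odd-wallis : ∀ m → (suc (2 * m) C m) * wallisFactor m ≡ suc m * (α (suc (2 * m)) * α (suc (2 * m)))
odd-wallis m = trans (cong ((suc (2 * m) C m) *_) (sym (odd-central m))) (trans (lem (suc (2 * m) C m) (suc m)) (cong (λ a → suc m * (a * a)) (sym (α-odd m))))
  where
  lem : ∀ a s → a * (s * a) ≡ s * (a * a)
  lem = solve-∀

half-≤ : ∀ {a b} → suc (2 * a) ≤ suc (2 * b) → a ≤ b
half-≤ h = *-cancelˡ-≤ 2 (≤-pred h)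

-- The corrections for both parities have the favourable sign: 4m(m+1) ≤ (2m+1)² for even n and 2m+1
-- ≤ 2(m+1) for odd n.
below-from-wallis : ∀ p d m₀ → (∀ m → m₀ ≤ m → p * ((suc (2 * m) C m) * wallisFactor m) ≤ d * (4 * 16 ^ m)) →
  ∀ n → suc (2 * m₀) ≤ n → p * (n * (α n * α n)) ≤ d * (2 * 4 ^ n)
below-from-wallis p d m₀ bound n N≤n = by-parity n N≤n (even-or-odd n)
  where
  open ≤-Reasoning
  by-parity : ∀ n → suc (2 * m₀) ≤ n → (∃ λ m → n ≡ 2 * m ⊎ n ≡ suc (2 * m)) → p * (n * (α n * α n)) ≤ d * (2 * 4 ^ n)
  by-parity _ N≤n (m , inj₁ refl) = *-cancelˡ-≤ (2 * suc m) {{m*n≢0 2 (suc m)}} (begin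
    2 * suc m * (p * (2 * m * aa)) ≡⟨ lem₁ m p aa ⟩
    p * ((4 * m * suc m) * aa) ≤⟨ *-monoʳ-≤ p (*-monoˡ-≤ aa (≤-trans (n≤1+n _) (≤-reflexive (lem₂ m)))) ⟩
    p * (suc (2 * m) * suc (2 * m) * aa) ≡⟨ cong (p *_) (even-wallis m) ⟨
    p * (suc m * (A * wallisFactor m)) ≡⟨ lem₃ p (suc m) (A * wallisFactor m) ⟩
    suc m * (p * (A * wallisFactor m)) ≤⟨ *-monoʳ-≤ (suc m) (bound m (half-≤ (≤-trans N≤n (n≤1+n _)))) ⟩
    suc m * (d * (4 * 16 ^ m)) ≡⟨ lem₄ (suc m) d (16 ^ m) ⟩
    2 * suc m * (d * (2 * 16 ^ m)) ≡⟨ cong (λ u → 2 * suc m * (d * (2 * u))) (power-even m) ⟨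
    2 * suc m * (d * (2 * 4 ^ (2 * m))) ∎)
    where
    aa = α (2 * m) * α (2 * m)
    A = suc (2 * m) C m
    lem₁ : ∀ m p a → 2 * suc m * (p * (2 * m * a)) ≡ p * ((4 * m * suc m) * a)
    lem₁ = solve-∀
    lem₂ : ∀ m → suc (4 * m * suc m) ≡ suc (2 * m) * suc (2 * m)
    lem₂ = solve-∀
    lem₃ : ∀ p s x → p * (s * x) ≡ s * (p * x)
    lem₃ = solve-∀
    lem₄ : ∀ s d x → s * (d * (4 * x)) ≡ 2 * s * (d * (2 * x))
    lem₄ = solve-∀
  by-parity _ N≤n (m , inj₂ refl) = begin
    p * (suc (2 * m) * aa) ≤⟨ *-monoʳ-≤ p (*-monoˡ-≤ aa (≤-trans (n≤1+n _) (≤-reflexive (lem₁ m)))) ⟩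
    p * (2 * suc m * aa) ≡⟨ lem₂ p (suc m) aa ⟩
    2 * (p * (suc m * aa)) ≡⟨ cong (λ u → 2 * (p * u)) (odd-wallis m) ⟨
    2 * (p * ((suc (2 * m) C m) * wallisFactor m)) ≤⟨ *-monoʳ-≤ 2 (bound m (half-≤ N≤n)) ⟩
    2 * (d * (4 * 16 ^ m)) ≡⟨ trans (lem₃ d (16 ^ m)) (cong (λ u → d * (2 * (4 * u))) (sym (power-even m))) ⟩
    d * (2 * (4 * 4 ^ (2 * m))) ∎
    where
    aa = α (suc (2 * m)) * α (suc (2 * m))
    lem₁ : ∀ m → suc (suc (2 * m)) ≡ 2 * suc m
    lem₁ = solve-∀
    lem₂ : ∀ p s a → p * (2 * s * a) ≡ 2 * (p * (s * a))
    lem₂ = solve-∀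
    lem₃ : ∀ d x → 2 * (d * (4 * x)) ≡ d * (2 * (4 * x))
    lem₃ = solve-∀

eventually-below-π : ∀ p d μ → ι p <ℚ leibniz (suc (2 * μ)) *ℚ ι d → ∃ λ N → ∀ n → N ≤ n → p * (n * (α n * α n)) ≤ d * (2 * 4 ^ n)
eventually-below-π p d μ h = suc (2 * proj₁ w) , below-from-wallis p d (proj₁ w) (proj₂ w)
  where w = wallis-lower p d μ h

leibniz≥0 : ∀ r → 0ℚ ≤ℚ leibniz r
leibniz≥0 r = ℚP.≤-trans (proj₁ (alt-bounds (suc r) leibnizTerm (λ k → term≥0 k , term-anti k))) (ℚP.≤-reflexive (sym (leibniz-alt r)))

leibniz≤4 : ∀ r → leibniz r ≤ℚ ι 4
leibniz≤4 r = ℚP.≤-trans (ℚP.≤-reflexive (leibniz-alt r)) (ℚP.≤-trans (proj₂ (alt-bounds (suc r) leibnizTerm (λ k → term≥0 k , term-anti k))) (term≤4 0))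

<-from-+1 : ∀ {x y} → x +ℚ ι 1 ≤ℚ y → x <ℚ y
<-from-+1 {x} {y} h = ℚP.<-≤-trans (ℚP.≤-<-trans (ℚP.≤-reflexive (sym (ℚP.+-identityʳ x))) (ℚP.+-monoʳ-< x (ℚP.positive⁻¹ (ι 1) {{ι-isPos 1 z<s}}))) h

-- Here the parity corrections go the wrong way. With s p = r + 1 the fraction p/d is lowered to
-- (2r+1) / (2 s d), which the gap still keeps above the Leibniz sum; the factor 1 - 1/(2r+2)
-- absorbs the corrections once m > r.
above-from-gap : ∀ p d μ → (∃ λ s → 0 < s × ι s *ℚ (leibniz (2 * μ) *ℚ ι d) +ℚ ι 1 ≤ℚ ι s *ℚ ι p) →
  ∃ λ N → ∀ n → N ≤ n → d * (2 * 4 ^ n) ≤ p * (n * (α n * α n))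
above-from-gap p d μ (s , s>0 , gap) = from (s * p) refl
  where
  open ≤-Reasoning
  L = leibniz (2 * μ)
  from : ∀ r → r ≡ s * p → ∃ λ N → ∀ n → N ≤ n → d * (2 * 4 ^ n) ≤ p * (n * (α n * α n))
  from zero e = ⊥-elim (<⇒≱ z<s (ι-≤⁻ (ℚP.≤-trans (ℚP.≤-trans (ℚP.≤-reflexive (sym (ℚP.+-identityˡ (ι 1)))) (ℚP.+-monoˡ-≤ (ι 1) positive))
      (ℚP.≤-trans gap (ℚP.≤-reflexive (trans (sym (ι-* s p)) (cong ι (sym e))))))))
    where
    positive : 0ℚ ≤ℚ ι s *ℚ (L *ℚ ι d)
    positive = ℚP.≤-trans (ℚP.≤-reflexive (sym (trans (cong (ι s *ℚ_) (ℚP.*-zeroˡ (ι d))) (ℚP.*-zeroʳ (ι s)))))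
      (ι-mono s (ℚP.*-monoʳ-≤-nonNeg (ι d) (leibniz≥0 (2 * μ))))
  from (suc r) e = finish (wallis-upper p' d' μ (<-from-+1 slack))
    where
    p' d' : ℕ
    p' = suc (2 * r)
    d' = 2 * (s * d)
    slack : L *ℚ ι d' +ℚ ι 1 ≤ℚ ι p'
    slack = ℚP.≤-trans (ℚP.≤-reflexive (sym (lem₂ (L *ℚ ι d' +ℚ ι 1) (ι 1)))) (ℚP.≤-trans (ℚP.+-monoˡ-≤ (⊝ ι 1) doubled) (ℚP.≤-reflexive (lem₂ (ι p') (ι 1))))
      where
      lem₂ : ∀ x o → (x +ℚ o) -ℚ o ≡ x
      lem₂ = RS.solve-∀ ℚ-ring
      lem₃ : ∀ t s l d o → t *ℚ (s *ℚ (l *ℚ d) +ℚ o) ≡ l *ℚ (t *ℚ (s *ℚ d)) +ℚ t *ℚ o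
      lem₃ = RS.solve-∀ ℚ-ring
      lem₄ : ∀ r → 2 * suc r ≡ suc (2 * r) + 1
      lem₄ = solve-∀
      doubled : (L *ℚ ι d' +ℚ ι 1) +ℚ ι 1 ≤ℚ ι p' +ℚ ι 1
      doubled = ℚP.≤-trans (ℚP.≤-reflexive (trans (ℚP.+-assoc (L *ℚ ι d') (ι 1) (ι 1)) (sym (trans (lem₃ (ι 2) (ι s) L (ι d) (ι 1))
          (cong₂ (λ u v → L *ℚ u +ℚ v) (sym (trans (ι-* 2 (s * d)) (cong (ι 2 *ℚ_) (ι-* s d)))) (trans (sym (ι-* 2 1)) (ι-+ 1 1)))))))
        (ℚP.≤-trans (ι-mono 2 gap) (ℚP.≤-reflexive (trans (cong (ι 2 *ℚ_) (trans (sym (ι-* s p)) (cong ι (sym e)))) (trans (sym (ι-* 2 (suc r))) (trans (cong ι (lem₄ r)) (ι-+ p' 1))))))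
    finish : (∃ λ m₀ → ∀ m → m₀ ≤ m → d' * (4 * 16 ^ m) ≤ p' * ((suc (2 * m) C m) * wallisFactor m)) → ∃ λ N → ∀ n → N ≤ n → d * (2 * 4 ^ n) ≤ p * (n * (α n * α n))
    finish (m₀ , bound) = suc (2 * (m₀ + suc r)) , λ n N≤n → by-parity n N≤n (even-or-odd n)
      where
      by-parity : ∀ n → suc (2 * (m₀ + suc r)) ≤ n → (∃ λ m → n ≡ 2 * m ⊎ n ≡ suc (2 * m)) → d * (2 * 4 ^ n) ≤ p * (n * (α n * α n))
      by-parity _ N≤n (m , inj₁ refl) = *-cancelˡ-≤ (4 * suc m * s) {{m*n≢0 (4 * suc m) s {{m*n≢0 4 (suc m)}} {{>-nonZero s>0}}}} (begin
        4 * suc m * s * (d * (2 * 4 ^ (2 * m))) ≡⟨ trans (cong (λ u → 4 * suc m * s * (d * (2 * u))) (power-even m)) (lem₁ (suc m) s d (16 ^ m)) ⟩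
        suc m * (d' * (4 * 16 ^ m)) ≤⟨ *-monoʳ-≤ (suc m) (bound m (≤-trans (m≤m+n m₀ (suc r)) m≥)) ⟩
        suc m * (p' * (A * wallisFactor m)) ≡⟨ trans (lem₃ (suc m) p' (A * wallisFactor m)) (cong (p' *_) (even-wallis m)) ⟩
        p' * (suc (2 * m) * suc (2 * m) * aa) ≤⟨ margin ⟩
        suc r * (8 * m * suc m * aa) ≡⟨ cong (_* (8 * m * suc m * aa)) e ⟩
        s * p * (8 * m * suc m * aa) ≡⟨ lem₂ s p m aa ⟩
        4 * suc m * s * (p * (2 * m * aa)) ∎)
        where
        aa = α (2 * m) * α (2 * m)
        A = suc (2 * m) C m
        m≥ : m₀ + suc r ≤ m
        m≥ = half-≤ (≤-trans N≤n (n≤1+n _))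
        lem₁ : ∀ m s d x → 4 * m * s * (d * (2 * x)) ≡ m * (2 * (s * d) * (4 * x))
        lem₁ = solve-∀
        lem₂ : ∀ s p m a → s * p * (8 * m * suc m * a) ≡ 4 * suc m * s * (p * (2 * m * a))
        lem₂ = solve-∀
        lem₃ : ∀ m p x → m * (p * x) ≡ p * (m * x)
        lem₃ = solve-∀
        lem₄ : ∀ m r a → suc (2 * r) * (suc (2 * m) * suc (2 * m) * a) ≡ suc (2 * r) * (4 * m * suc m * a) + (r + suc r) * a
        lem₄ = solve-∀
        lem₅ : ∀ m r a → suc (2 * r) * (4 * m * suc m * a) + (m + m) * a + (4 * m * m + 2 * m) * a ≡ suc r * (8 * m * suc m * a)
        lem₅ = solve-∀
        r≤m : suc r ≤ m
        r≤m = ≤-trans (m≤n+m (suc r) m₀) m≥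
        margin : suc (2 * r) * (suc (2 * m) * suc (2 * m) * aa) ≤ suc r * (8 * m * suc m * aa)
        margin = begin
          suc (2 * r) * (suc (2 * m) * suc (2 * m) * aa) ≡⟨ lem₄ m r aa ⟩
          suc (2 * r) * (4 * m * suc m * aa) + (r + suc r) * aa ≤⟨ +-monoʳ-≤ (suc (2 * r) * (4 * m * suc m * aa)) (*-monoˡ-≤ aa (+-mono-≤ (≤-trans (n≤1+n r) r≤m) r≤m)) ⟩
          suc (2 * r) * (4 * m * suc m * aa) + (m + m) * aa ≤⟨ m≤m+n _ _ ⟩
          suc (2 * r) * (4 * m * suc m * aa) + (m + m) * aa + (4 * m * m + 2 * m) * aa ≡⟨ lem₅ m r aa ⟩
          suc r * (8 * m * suc m * aa) ∎
      by-parity _ N≤n (m , inj₂ refl) = *-cancelˡ-≤ s {{>-nonZero s>0}} (begin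
        s * (d * (2 * (4 * 4 ^ (2 * m)))) ≡⟨ trans (cong (λ u → s * (d * (2 * (4 * u)))) (power-even m)) (lem₁ s d (16 ^ m)) ⟩
        d' * (4 * 16 ^ m) ≤⟨ bound m (≤-trans (m≤m+n m₀ (suc r)) (half-≤ N≤n)) ⟩
        p' * ((suc (2 * m) C m) * wallisFactor m) ≡⟨ cong (p' *_) (odd-wallis m) ⟩
        p' * (suc m * aa) ≤⟨ margin ⟩
        suc r * (suc (2 * m) * aa) ≡⟨ trans (cong (_* (suc (2 * m) * aa)) e) (*-assoc s p _) ⟩
        s * (p * (suc (2 * m) * aa)) ∎)
        where
        aa = α (suc (2 * m)) * α (suc (2 * m))
        lem₁ : ∀ s d x → s * (d * (2 * (4 * x))) ≡ 2 * (s * d) * (4 * x)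
        lem₁ = solve-∀
        lem₂ : ∀ m r a → suc (2 * r) * (suc m * a) ≡ (2 * r * m + m + r) * a + suc r * a
        lem₂ = solve-∀
        lem₃ : ∀ m r a → (2 * r * m + m + r) * a + suc m * a ≡ suc r * (suc (2 * m) * a)
        lem₃ = solve-∀
        margin : suc (2 * r) * (suc m * aa) ≤ suc r * (suc (2 * m) * aa)
        margin = begin
          suc (2 * r) * (suc m * aa) ≡⟨ lem₂ m r aa ⟩
          (2 * r * m + m + r) * aa + suc r * aa ≤⟨ +-monoʳ-≤ ((2 * r * m + m + r) * aa) (*-monoˡ-≤ aa (≤-trans (≤-trans (m≤n+m (suc r) m₀) (half-≤ N≤n)) (n≤1+n m))) ⟩
          (2 * r * m + m + r) * aa + suc m * aa ≡⟨ lem₃ m r aa ⟩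
          suc r * (suc (2 * m) * aa) ∎

eventually-above-π : ∀ p d μ → leibniz (2 * μ) *ℚ ι d <ℚ ι p → ∃ λ N → ∀ n → N ≤ n → d * (2 * 4 ^ n) ≤ p * (n * (α n * α n))
eventually-above-π p d μ h = above-from-gap p d μ (archimedean (leibniz (2 * μ) *ℚ ι d) (ι p) h)

-- The Turán bound turns 4 p² s n α² ≤ d₀ 4ⁿ into p² 4ⁿ n ≤ d² E², with d² s = d₀ + 1 absorbing the lower order terms.
lower-final : ∀ (p d s d₀ n a E : ℕ) → 0 < s → 0 < a → d * d * s ≡ suc d₀ → 8 * (p * p) * s * (n * (a * a)) ≤ d₀ * (2 * 4 ^ n) →
  (8 * d₀ + 3) * a ≤ 2 ^ n → 4 ^ n ≤ a * (suc (2 * E) + 2 ^ n) → p * p * (4 ^ n * n) ≤ d * d * (E * E)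
lower-final p d s d₀ n a E s>0 a>0 d₀-def wallis large turan = *-cancelˡ-≤ (s * (4 * (a * a))) {{m*n≢0 s (4 * (a * a)) {{>-nonZero s>0}} {{m*n≢0 4 (a * a) {{_}} {{m*n≢0 a a {{>-nonZero a>0}} {{>-nonZero a>0}}}}}}}} (begin
  s * (4 * (a * a)) * (p * p * (4 ^ n * n)) ≡⟨ lem₁ s a p (4 ^ n) n ⟩
  4 ^ n * (4 * (p * p) * s * (n * (a * a))) ≤⟨ *-monoʳ-≤ (4 ^ n) (*-cancelˡ-≤ 2 (≤-trans (≤-reflexive (lem₂ (p * p) s (n * (a * a)))) (≤-trans wallis (≤-reflexive (lem₃ d₀ (4 ^ n)))))) ⟩
  4 ^ n * (d₀ * 4 ^ n) ≡⟨ cong (λ q → q * (d₀ * q)) (four-power n) ⟩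
  P * P * (d₀ * (P * P)) ≤⟨ *-monoʳ-≤ (P * P) absorb ⟩
  P * P * (suc d₀ * (u * u)) ≡⟨ lem₄ P (suc d₀) u ⟩
  suc d₀ * (P * u * (P * u)) ≤⟨ *-monoʳ-≤ (suc d₀) (*-mono-≤ edges edges) ⟩
  suc d₀ * (2 * (a * E) * (2 * (a * E))) ≡⟨ cong (_* (2 * (a * E) * (2 * (a * E)))) d₀-def ⟨
  d * d * s * (2 * (a * E) * (2 * (a * E))) ≡⟨ lem₅ (d * d) s a E ⟩
  s * (4 * (a * a)) * (d * d * (E * E)) ∎)
  where
  open ≤-Reasoning
  P u : ℕ
  P = 2 ^ n
  -- Bounding the lower order terms 1 and 2^n of the Turán inequality both by 2^n leaves 2^n u ≤ 2 a
  -- E.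
  u = P ∸ 2 * a
  lem₁ : ∀ s a p q n → s * (4 * (a * a)) * (p * p * (q * n)) ≡ q * (4 * (p * p) * s * (n * (a * a)))
  lem₁ = solve-∀
  lem₂ : ∀ p s x → 2 * (4 * p * s * x) ≡ 8 * p * s * x
  lem₂ = solve-∀
  lem₃ : ∀ d q → d * (2 * q) ≡ 2 * (d * q)
  lem₃ = solve-∀
  lem₄ : ∀ P d u → P * P * (d * (u * u)) ≡ d * (P * u * (P * u))
  lem₄ = solve-∀
  lem₅ : ∀ d s a E → d * s * (2 * (a * E) * (2 * (a * E))) ≡ s * (4 * (a * a)) * (d * (E * E))
  lem₅ = solve-∀
  2a≤P : 2 * a ≤ P
  2a≤P = ≤-trans (*-monoˡ-≤ a (≤-trans (n≤1+n 2) (m≤n+m 3 (8 * d₀)))) large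
  P≡ : 2 * a + u ≡ P
  P≡ = m+[n∸m]≡n 2a≤P
  u-large : (8 * d₀ + 1) * a ≤ u
  u-large = m+n≤o⇒m≤o∸n ((8 * d₀ + 1) * a) (≤-trans (≤-reflexive (lem d₀ a)) large)
    where
    lem : ∀ d a → (8 * d + 1) * a + 2 * a ≡ (8 * d + 3) * a
    lem = solve-∀
  absorb : d₀ * (P * P) ≤ suc d₀ * (u * u)
  absorb = begin
    d₀ * (P * P) ≡⟨ cong (λ q → d₀ * (q * q)) P≡ ⟨
    d₀ * ((2 * a + u) * (2 * a + u)) ≡⟨ lem₆ d₀ a u ⟩
    d₀ * (u * u) + (4 * d₀ * a * a + 4 * d₀ * a * u) ≤⟨ +-monoʳ-≤ (d₀ * (u * u)) (+-monoˡ-≤ (4 * d₀ * a * u) (*-monoʳ-≤ (4 * d₀ * a) (≤-trans (m≤n*m a (8 * d₀ + 1) {{>-nonZero (m≤n+m 1 (8 * d₀))}}) u-large))) ⟩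
    d₀ * (u * u) + (4 * d₀ * a * u + 4 * d₀ * a * u) ≡⟨ cong (d₀ * (u * u) +_) (lem₇ d₀ a u) ⟩
    d₀ * (u * u) + 8 * d₀ * a * u ≤⟨ +-monoʳ-≤ (d₀ * (u * u)) (*-monoˡ-≤ u (≤-trans (*-monoˡ-≤ a (m≤m+n (8 * d₀) 1)) u-large)) ⟩
    d₀ * (u * u) + u * u ≡⟨ +-comm (d₀ * (u * u)) (u * u) ⟩
    suc d₀ * (u * u) ∎
    where
    lem₆ : ∀ d a u → d * ((2 * a + u) * (2 * a + u)) ≡ d * (u * u) + (4 * d * a * a + 4 * d * a * u)
    lem₆ = solve-∀
    lem₇ : ∀ d a u → 4 * d * a * u + 4 * d * a * u ≡ 8 * d * a * u
    lem₇ = solve-∀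
  edges : P * u ≤ 2 * (a * E)
  edges = +-cancelʳ-≤ (2 * a * P) _ _ (begin
    P * u + 2 * a * P ≡⟨ lem₈ P u a ⟩
    P * (2 * a + u) ≡⟨ cong (P *_) P≡ ⟩
    P * P ≡⟨ four-power n ⟨
    4 ^ n ≤⟨ turan ⟩
    a * (suc (2 * E) + P) ≤⟨ *-monoʳ-≤ a (+-monoˡ-≤ P (+-monoˡ-≤ (2 * E) (m^n>0 2 n))) ⟩
    a * (P + 2 * E + P) ≡⟨ lem₉ a E P ⟩
    2 * (a * E) + 2 * a * P ∎)
    where
    lem₈ : ∀ P u a → P * u + 2 * a * P ≡ P * (2 * a + u)
    lem₈ = solve-∀
    lem₉ : ∀ a E P → a * (P + 2 * E + P) ≡ 2 * (a * E) + 2 * a * P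
    lem₉ = solve-∀

-- With D = d² s and e = 3D one has D (1 + 1/e)² = D + 2/3 + 1/(9D) ≤ D + 1, so the surplus 1 in the
-- Wallis bound covers the precision of the sparse graph.
upper-final : ∀ (p d s e n a E : ℕ) → 0 < s → 0 < a → 0 < d → e ≡ 3 * (d * d * s) → (d * d * s + 1) * (2 * 4 ^ n) ≤ 8 * (p * p) * s * (n * (a * a)) →
  2 * e * (a * E) ≤ suc e * 4 ^ n → d * d * (E * E) ≤ p * p * (4 ^ n * n)
upper-final p d s e n a E s>0 a>0 d>0 e-def wallis sparse = *-cancelˡ-≤ (s * (4 * (e * e) * (a * a))) {{>-nonZero positive}} (begin
  s * (4 * (e * e) * (a * a)) * (d * d * (E * E)) ≡⟨ lem₁ s e a (d * d) E ⟩
  D * (2 * e * (a * E) * (2 * e * (a * E))) ≤⟨ *-monoʳ-≤ D (*-mono-≤ sparse sparse) ⟩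
  D * (suc e * q * (suc e * q)) ≡⟨ lem₂ D (suc e) q ⟩
  q * (D * (suc e * suc e) * q) ≤⟨ *-monoʳ-≤ q (*-monoˡ-≤ q margin) ⟩
  q * (e * e * (D + 1) * q) ≤⟨ *-monoʳ-≤ q (≤-trans (≤-reflexive (*-assoc (e * e) (D + 1) q)) (*-monoʳ-≤ (e * e) (*-cancelˡ-≤ 2 (≤-trans (≤-reflexive (lem₃ (D + 1) q)) (≤-trans wallis (≤-reflexive (lem₄ (p * p) s (n * (a * a))))))))) ⟩
  q * (e * e * (4 * (p * p) * s * (n * (a * a)))) ≡⟨ lem₅ q (e * e) (p * p) s n (a * a) ⟩
  s * (4 * (e * e) * (a * a)) * (p * p * (q * n)) ∎)
  where
  open ≤-Reasoning
  D q : ℕ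
  D = d * d * s
  q = 4 ^ n
  D>0 : 0 < D
  D>0 = *-mono-≤ {1} {d * d} {1} {s} (*-mono-≤ {1} {d} {1} {d} d>0 d>0) s>0
  e>0 : 0 < e
  e>0 = subst (0 <_) (sym e-def) (≤-trans D>0 (m≤n*m D 3))
  positive : 0 < s * (4 * (e * e) * (a * a))
  positive = *-mono-≤ {1} {s} {1} {4 * (e * e) * (a * a)} s>0 (*-mono-≤ {1} {4 * (e * e)} {1} {a * a} (≤-trans (*-mono-≤ {1} {e} {1} {e} e>0 e>0) (m≤n*m (e * e) 4)) (*-mono-≤ {1} {a} {1} {a} a>0 a>0))
  lem₁ : ∀ s e a d E → s * (4 * (e * e) * (a * a)) * (d * (E * E)) ≡ d * s * (2 * e * (a * E) * (2 * e * (a * E)))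
  lem₁ = solve-∀
  lem₂ : ∀ D e q → D * (e * q * (e * q)) ≡ q * (D * (e * e) * q)
  lem₂ = solve-∀
  lem₃ : ∀ d q → 2 * (d * q) ≡ d * (2 * q)
  lem₃ = solve-∀
  lem₄ : ∀ p s x → 8 * p * s * x ≡ 2 * (4 * p * s * x)
  lem₄ = solve-∀
  lem₅ : ∀ q e p s n a → q * (e * (4 * p * s * (n * a))) ≡ s * (4 * e * a) * (p * (q * n))
  lem₅ = solve-∀
  margin : D * (suc e * suc e) ≤ e * e * (D + 1)
  margin = subst (λ e → D * (suc e * suc e) ≤ e * e * (D + 1)) (sym e-def) (begin
    D * (suc (3 * D) * suc (3 * D)) ≡⟨ lem₆ D ⟩
    9 * D * D * D + 6 * D * D + 1 * D ≤⟨ +-monoʳ-≤ (9 * D * D * D + 6 * D * D) (≤-trans (*-monoˡ-≤ D {1} {3} (s≤s z≤n)) (*-monoʳ-≤ 3 (m≤m*n D D {{>-nonZero D>0}}))) ⟩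
    9 * D * D * D + 6 * D * D + 3 * (D * D) ≡⟨ lem₇ D ⟩
    3 * D * (3 * D) * (D + 1) ∎)
    where
    lem₆ : ∀ D → D * (suc (3 * D) * suc (3 * D)) ≡ 9 * D * D * D + 6 * D * D + 1 * D
    lem₆ = solve-∀
    lem₇ : ∀ D → 9 * D * D * D + 6 * D * D + 3 * (D * D) ≡ 3 * D * (3 * D) * (D + 1)
    lem₇ = solve-∀

-- Both bounds for rational constants

α>0 : ∀ n → 0 < α n
α>0 n = binomial-max n (half-central n) 0

α-small : ∀ n c → c * c ≤ n → c * α n ≤ 2 ^ n
α-small n c c²≤n = ≤-trans (≤-reflexive (*-comm c (α n))) (square-≤-^ (α n) n c n c²≤n (central-bound n (n / 2)))

-- From ι d · a = ι p, an inequality of squares of rationals becomes one of naturals.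
scale-square : ∀ {a p d} → ι d *ℚ a ≡ ι p → ∀ X → ι (d * d) *ℚ (a *ℚ a *ℚ ι X) ≡ ι (p * p * X)
scale-square {a} {p} {d} e X = trans (cong (_*ℚ (a *ℚ a *ℚ ι X)) (ι-* d d)) (trans (lem (ι d) a (ι X)) (trans (cong (λ u → u *ℚ u *ℚ ι X) e)
  (sym (trans (ι-* (p * p) X) (cong (_*ℚ ι X) (ι-* p p))))))
  where
  lem : ∀ d a x → (d *ℚ d) *ℚ (a *ℚ a *ℚ x) ≡ (d *ℚ a) *ℚ (d *ℚ a) *ℚ x
  lem = RS.solve-∀ ℚ-ring

scale-eight : ∀ {a p d} → ι d *ℚ a ≡ ι p → ι (d * d) *ℚ (ℕ→ℚ 8 *ℚ a *ℚ a) ≡ ι (8 * (p * p))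
scale-eight {a} {p} {d} e = trans (cong (λ v → ι (d * d) *ℚ (v *ℚ a *ℚ a)) (sym (ι-def 8))) (trans (cong (ι (d * d) *ℚ_) (lem (ι 8) a)) (trans (scale-square e 8) (cong ι (*-comm (p * p) 8))))
  where
  lem : ∀ e a → e *ℚ a *ℚ a ≡ a *ℚ a *ℚ e
  lem = RS.solve-∀ ℚ-ring

LowerBound : ℚ → Set
LowerBound a = ∃ λ N → ∀ n → N ≤ n → (G : SpanningSubgraphBn n) → Admissible G →
  a *ℚ a *ℚ ℕ→ℚ (4 ^ n * n) ≤ℚ ℕ→ℚ (edgeCount G * edgeCount G)

UpperBound : ℚ → Set
UpperBound b = ∃ λ N → ∀ n → N ≤ n → (G : SpanningSubgraphBn n) → IsMinimalAdmissible G →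
  ℕ→ℚ (edgeCount G * edgeCount G) ≤ℚ b *ℚ b *ℚ ℕ→ℚ (4 ^ n * n)

lower-bound-at : ∀ a μ → (∃₂ λ p d → 0 < d × ι d *ℚ a ≡ ι p) →
  (∃ λ s → 0 < s × ι s *ℚ (ℕ→ℚ 8 *ℚ a *ℚ a) +ℚ ι 1 ≤ℚ ι s *ℚ leibniz (suc (2 * μ))) → LowerBound a
lower-bound-at a μ (p , d , d>0 , da≡p) (s , s>0 , gap) = conclude (d * d * s') refl
  where
  L = leibniz (suc (2 * μ))
  s' : ℕ
  -- The factor 5 enlarges the gap: 4 units pay for lowering d² s' by one, as Leibniz sums are at
  -- most 4, and one unit keeps the inequality strict.
  s' = 5 * s
  s'>0 : 0 < s'
  s'>0 = ≤-trans s>0 (m≤n*m s 5)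
  dd>0 : 0 < d * d
  dd>0 = *-mono-≤ {1} {d} {1} {d} d>0 d>0
  conclude : ∀ r → r ≡ d * d * s' → LowerBound a
  conclude zero e = ⊥-elim (<⇒≱ (*-mono-≤ {1} {d * d} {1} {s'} dd>0 s'>0) (≤-reflexive (sym e)))
  conclude (suc d₀) e = proj₁ wallis + c * c , λ n N≤n G adm →
      ι-cancel (d * d) dd>0 (ℚP.≤-trans (ℚP.≤-reflexive (trans (cong (λ v → ι (d * d) *ℚ (a *ℚ a *ℚ v)) (sym (ι-def (4 ^ n * n)))) (scale-square da≡p (4 ^ n * n))))
        (ℚP.≤-trans (ι-≤ (lower-final p d s' d₀ n (α n) (edgeCount G) s'>0 (α>0 n) (sym e) (proj₂ wallis n (≤-trans (m≤m+n _ _) N≤n))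
           (α-small n c (≤-trans (m≤n+m _ (proj₁ wallis)) N≤n)) (turán G adm)))
         (ℚP.≤-reflexive (trans (ι-* (d * d) (edgeCount G * edgeCount G)) (cong (ι (d * d) *ℚ_) (ι-def (edgeCount G * edgeCount G)))))))
    where
    open ℚP.≤-Reasoning
    c : ℕ
    c = 8 * d₀ + 3
    q = ι (8 * (p * p) * s')
    lem₁ : ∀ f D s x o → (f *ℚ D) *ℚ (s *ℚ x +ℚ o) ≡ (D *ℚ x) *ℚ (f *ℚ s) +ℚ (f *ℚ D) *ℚ o
    lem₁ = RS.solve-∀ ℚ-ring
    lem₂ : ∀ f D s l → (f *ℚ D) *ℚ (s *ℚ l) ≡ l *ℚ (D *ℚ (f *ℚ s))
    lem₂ = RS.solve-∀ ℚ-ring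
    lem₃ : ∀ x o → (x +ℚ o) -ℚ o ≡ x
    lem₃ = RS.solve-∀ ℚ-ring
    spread : q +ℚ ι 5 ≤ℚ L *ℚ ι (suc d₀)
    spread = begin
      q +ℚ ι 5 ≤⟨ ℚP.+-monoʳ-≤ q (ι-≤ (m≤m*n 5 (d * d) {{>-nonZero dd>0}})) ⟩
      q +ℚ ι (5 * (d * d)) ≡⟨ cong₂ _+ℚ_ (trans (ι-* (8 * (p * p)) s') (cong₂ _*ℚ_ (sym (scale-eight {a} {p} {d} da≡p)) (ι-* 5 s))) (trans (ι-* 5 (d * d)) (sym (trans (cong ((ι 5 *ℚ ι (d * d)) *ℚ_) ι-1) (ℚP.*-identityʳ _)))) ⟩
      (ι (d * d) *ℚ (ℕ→ℚ 8 *ℚ a *ℚ a)) *ℚ (ι 5 *ℚ ι s) +ℚ (ι 5 *ℚ ι (d * d)) *ℚ ι 1 ≡⟨ lem₁ (ι 5) (ι (d * d)) (ι s) (ℕ→ℚ 8 *ℚ a *ℚ a) (ι 1) ⟨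
      (ι 5 *ℚ ι (d * d)) *ℚ (ι s *ℚ (ℕ→ℚ 8 *ℚ a *ℚ a) +ℚ ι 1) ≡⟨ cong (_*ℚ (ι s *ℚ (ℕ→ℚ 8 *ℚ a *ℚ a) +ℚ ι 1)) (ι-* 5 (d * d)) ⟨
      ι (5 * (d * d)) *ℚ (ι s *ℚ (ℕ→ℚ 8 *ℚ a *ℚ a) +ℚ ι 1) ≤⟨ ι-mono (5 * (d * d)) gap ⟩
      ι (5 * (d * d)) *ℚ (ι s *ℚ L) ≡⟨ trans (cong (_*ℚ (ι s *ℚ L)) (ι-* 5 (d * d))) (lem₂ (ι 5) (ι (d * d)) (ι s) L) ⟩
      L *ℚ (ι (d * d) *ℚ (ι 5 *ℚ ι s)) ≡⟨ cong (L *ℚ_) (trans (cong (ι (d * d) *ℚ_) (sym (ι-* 5 s))) (trans (sym (ι-* (d * d) s')) (cong ι (sym e)))) ⟩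
      L *ℚ ι (suc d₀) ∎
    slack : q +ℚ ι 1 ≤ℚ L *ℚ ι d₀
    slack = begin
      q +ℚ ι 1 ≡⟨ lem₃ (q +ℚ ι 1) (ι 4) ⟨
      ((q +ℚ ι 1) +ℚ ι 4) -ℚ ι 4 ≡⟨ cong (_-ℚ ι 4) (trans (ℚP.+-assoc q (ι 1) (ι 4)) (cong (q +ℚ_) (sym (ι-+ 1 4)))) ⟩
      (q +ℚ ι 5) -ℚ ι 4 ≤⟨ ℚP.+-monoˡ-≤ (⊝ ι 4) spread ⟩
      L *ℚ ι (suc d₀) -ℚ ι 4 ≡⟨ cong (λ v → L *ℚ v -ℚ ι 4) (trans (cong ι (+-comm 1 d₀)) (ι-+ d₀ 1)) ⟩
      L *ℚ (ι d₀ +ℚ ι 1) -ℚ ι 4 ≡⟨ cong (_-ℚ ι 4) (trans (ℚP.*-distribˡ-+ L (ι d₀) (ι 1)) (cong (L *ℚ ι d₀ +ℚ_) (trans (cong (L *ℚ_) ι-1) (ℚP.*-identityʳ L)))) ⟩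
      (L *ℚ ι d₀ +ℚ L) -ℚ ι 4 ≤⟨ ℚP.+-monoˡ-≤ (⊝ ι 4) (ℚP.+-monoʳ-≤ (L *ℚ ι d₀) (leibniz≤4 (suc (2 * μ)))) ⟩
      (L *ℚ ι d₀ +ℚ ι 4) -ℚ ι 4 ≡⟨ lem₃ (L *ℚ ι d₀) (ι 4) ⟩
      L *ℚ ι d₀ ∎
    wallis = eventually-below-π (8 * (p * p) * s') d₀ μ (<-from-+1 slack)

lower-bound : ∀ a → 0ℚ ≤ℚ a → (ℕ→ℚ 8 *ℚ a *ℚ a) <π → LowerBound a
lower-bound a 0≤a (μ , below) = lower-bound-at a μ (fraction a 0≤a) (archimedean (ℕ→ℚ 8 *ℚ a *ℚ a) (leibniz (suc (2 * μ))) below)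

upper-bound-at : ∀ b μ → (∃₂ λ p d → 0 < d × ι d *ℚ b ≡ ι p) →
  (∃ λ s → 0 < s × ι s *ℚ leibniz (2 * μ) +ℚ ι 1 ≤ℚ ι s *ℚ (ℕ→ℚ 8 *ℚ b *ℚ b)) → UpperBound b
upper-bound-at b μ (p , d , d>0 , db≡p) (s , s>0 , gap) = proj₁ wallis + proj₁ sparse , λ n N≤n G minimal →
      let H , adm , bound = proj₂ sparse n (≤-trans (m≤n+m _ (proj₁ wallis)) N≤n)
          E≤ = proj₂ minimal H adm
      in ι-cancel (d * d) dd>0 (ℚP.≤-trans (ℚP.≤-reflexive (sym (trans (ι-* (d * d) (edgeCount G * edgeCount G)) (cong (ι (d * d) *ℚ_) (ι-def (edgeCount G * edgeCount G))))))
        (ℚP.≤-trans (ι-≤ (upper-final p d s' e n (α n) (edgeCount G) s'>0 (α>0 n) d>0 refl (proj₂ wallis n (≤-trans (m≤m+n _ _) N≤n))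
           (≤-trans (*-monoʳ-≤ (2 * e) (*-monoʳ-≤ (α n) E≤)) bound)))
         (ℚP.≤-reflexive (sym (trans (cong (λ v → ι (d * d) *ℚ (b *ℚ b *ℚ v)) (sym (ι-def (4 ^ n * n)))) (scale-square db≡p (4 ^ n * n)))))))
  where
  open ℚP.≤-Reasoning
  L = leibniz (2 * μ)
  s' e : ℕ
  -- Again a gap of five units: at most 4 are spent on raising d² s' by one, and one remains for
  -- strictness.
  s' = 5 * s
  e = 3 * (d * d * s')
  s'>0 : 0 < s'
  s'>0 = ≤-trans s>0 (m≤n*m s 5)
  dd>0 : 0 < d * d
  dd>0 = *-mono-≤ {1} {d} {1} {d} d>0 d>0
  lem₁ : ∀ f D s l o → (f *ℚ D) *ℚ (s *ℚ l +ℚ o) ≡ l *ℚ (D *ℚ (f *ℚ s)) +ℚ (f *ℚ D) *ℚ o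
  lem₁ = RS.solve-∀ ℚ-ring
  lem₂ : ∀ f D s x → (f *ℚ D) *ℚ (s *ℚ x) ≡ (D *ℚ x) *ℚ (f *ℚ s)
  lem₂ = RS.solve-∀ ℚ-ring
  slack : L *ℚ ι (d * d * s' + 1) +ℚ ι 1 ≤ℚ ι (8 * (p * p) * s')
  slack = begin
    L *ℚ ι (d * d * s' + 1) +ℚ ι 1 ≡⟨ cong (_+ℚ ι 1) (trans (cong (L *ℚ_) (ι-+ (d * d * s') 1)) (trans (ℚP.*-distribˡ-+ L (ι (d * d * s')) (ι 1)) (cong (L *ℚ ι (d * d * s') +ℚ_) (trans (cong (L *ℚ_) ι-1) (ℚP.*-identityʳ L))))) ⟩
    (L *ℚ ι (d * d * s') +ℚ L) +ℚ ι 1 ≤⟨ ℚP.+-monoˡ-≤ (ι 1) (ℚP.+-monoʳ-≤ (L *ℚ ι (d * d * s')) (leibniz≤4 (2 * μ))) ⟩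
    (L *ℚ ι (d * d * s') +ℚ ι 4) +ℚ ι 1 ≡⟨ trans (ℚP.+-assoc (L *ℚ ι (d * d * s')) (ι 4) (ι 1)) (cong (L *ℚ ι (d * d * s') +ℚ_) (sym (ι-+ 4 1))) ⟩
    L *ℚ ι (d * d * s') +ℚ ι 5 ≤⟨ ℚP.+-monoʳ-≤ (L *ℚ ι (d * d * s')) (ι-≤ (m≤m*n 5 (d * d) {{>-nonZero dd>0}})) ⟩
    L *ℚ ι (d * d * s') +ℚ ι (5 * (d * d)) ≡⟨ cong₂ _+ℚ_ (cong (L *ℚ_) (trans (ι-* (d * d) s') (cong (ι (d * d) *ℚ_) (ι-* 5 s)))) (trans (ι-* 5 (d * d)) (sym (trans (cong ((ι 5 *ℚ ι (d * d)) *ℚ_) ι-1) (ℚP.*-identityʳ _)))) ⟩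
    L *ℚ (ι (d * d) *ℚ (ι 5 *ℚ ι s)) +ℚ (ι 5 *ℚ ι (d * d)) *ℚ ι 1 ≡⟨ lem₁ (ι 5) (ι (d * d)) (ι s) L (ι 1) ⟨
    (ι 5 *ℚ ι (d * d)) *ℚ (ι s *ℚ L +ℚ ι 1) ≡⟨ cong (_*ℚ (ι s *ℚ L +ℚ ι 1)) (ι-* 5 (d * d)) ⟨
    ι (5 * (d * d)) *ℚ (ι s *ℚ L +ℚ ι 1) ≤⟨ ι-mono (5 * (d * d)) gap ⟩
    ι (5 * (d * d)) *ℚ (ι s *ℚ (ℕ→ℚ 8 *ℚ b *ℚ b)) ≡⟨ trans (cong (_*ℚ (ι s *ℚ (ℕ→ℚ 8 *ℚ b *ℚ b))) (ι-* 5 (d * d))) (lem₂ (ι 5) (ι (d * d)) (ι s) (ℕ→ℚ 8 *ℚ b *ℚ b)) ⟩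
    (ι (d * d) *ℚ (ℕ→ℚ 8 *ℚ b *ℚ b)) *ℚ (ι 5 *ℚ ι s) ≡⟨ trans (cong₂ _*ℚ_ (scale-eight {b} {p} {d} db≡p) (sym (ι-* 5 s))) (sym (ι-* (8 * (p * p)) s')) ⟩
    ι (8 * (p * p) * s') ∎
  wallis = eventually-above-π (8 * (p * p) * s') (d * d * s' + 1) μ (<-from-+1 slack)
  sparse = sparse-graphs e (≤-trans (*-mono-≤ {1} {d * d} {1} {s'} dd>0 s'>0) (m≤n*m (d * d * s') 3))

upper-bound : ∀ b → 0ℚ ≤ℚ b → π< (ℕ→ℚ 8 *ℚ b *ℚ b) → UpperBound b
upper-bound b 0≤b (μ , above) = upper-bound-at b μ (fraction b 0≤b) (archimedean (leibniz (2 * μ)) (ℕ→ℚ 8 *ℚ b *ℚ b) above)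

theorem1p4 : ∀ (a b : ℚ) → 0ℚ ≤ℚ a → 0ℚ ≤ℚ b →
    (ℕ→ℚ 8 *ℚ a *ℚ a) <π → π< (ℕ→ℚ 8 *ℚ b *ℚ b) →
    ∃ λ N → ∀ (n : ℕ) → n ≥ N → (G : SpanningSubgraphBn n) → IsMinimalAdmissible G →
      (a *ℚ a *ℚ ℕ→ℚ (4 ^ n ℕ.* n) ≤ℚ ℕ→ℚ (edgeCount G ℕ.* edgeCount G))
      × (ℕ→ℚ (edgeCount G ℕ.* edgeCount G) ≤ℚ b *ℚ b *ℚ ℕ→ℚ (4 ^ n ℕ.* n))
theorem1p4 a b 0≤a 0≤b below above =
  let N₁ , low = lower-bound a 0≤a below
      N₂ , high = upper-bound b 0≤b above
  in N₁ + N₂ , λ n N≤n G minimal →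
    low n (≤-trans (m≤m+n N₁ N₂) N≤n) G (proj₁ minimal) , high n (≤-trans (m≤n+m N₂ N₁) N≤n) G minimal
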